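{- Let $\mathcal{S}$ be a semiring and $\tau=\{R_1,\dots,R_j\}$ a finite relational vocabulary. The weighted logic $\mathrm{wLFP}[\mathcal{S}]$ captures $\mathsf{FP}[\mathcal{S}]$ over finite ordered $\tau$-structures; that is: (1) for every $\mathrm{wLFP}[\mathcal{S}]$-formula $\varphi$ there is $P\in\mathsf{FP}[\mathcal{S}]$ with $P(\mathrm{enc}(\mathfrak{A}))=\|\varphi\|(\mathfrak{A})$ for every finite ordered $\tau$-structure $\mathfrak{A}$; and (2) for every $P\in\mathsf{FP}[\mathcal{S}]$ there is a $\mathrm{wLFP}[\mathcal{S}]$-formula $\varphi$ with $P(\mathrm{enc}(\mathfrak{A}))=\|\varphi\|(\mathfrak{A})$ for every finite ordered $\tau$-structure $\mathfrak{A}$.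
   Context: A semiring $\mathcal{S}=\langle S,+,\cdot,\mathbb{0},\mathbb{1}\rangle$: $\langle S,+,\mathbb{0}\rangle$ commutative monoid, $\langle S,\cdot,\mathbb{1}\rangle$ monoid, distributivity, $\mathbb{0}$ absorbing. Term words. For $G\subseteq S$, $T(G)$ is the smallest set of finite words with $G\subseteq T(G)$ and $(t_1+t_2),(t_1\cdot t_2)\in T(G)$ for $t_1,t_2\in T(G)$; each such word has an obvious value in $\mathcal{S}$. $\mathsf{FP}[\mathcal{S}]$ is the union, over finite $G$ with $\{\mathbb{0},\mathbb{1}\}\subseteq G\subseteq S$ and finite alphabets $\Sigma$, of the sets of series $\sigma:\Sigma^*\to\langle G\rangle$ ($\langle G\rangle$ the subsemiring generated by $G$) for which there are a constant $k\in\mathbb{N}$ and a deterministic polynomial-time Turing machine that outputs on each $w\in\Sigma^*$ a word of $T(G)$ of the form $\sum_{i_1=1}^{m_1}\prod_{j_1=1}^{n_1}\cdots\sum_{i_k=1}^{m_k}\prod_{j_k=1}^{n_k}s_{i_1j_1\cdots i_kj_k}$ (with $s_{\dots}\in G$) whose value in $\mathcal{S}$ is $\sigma(w)$. Structures and encodings. An ordered $\tau$-structure is a finite $\tau\cup\{<\}$-structure with $<$ a linear order. With universe identified with $\{0,\dots,n-1\}$ via $<$, $\mathrm{enc}(\mathfrak{A})=\mathrm{enc}(R_1^{\mathfrak{A}})\cdots\mathrm{enc}(R_j^{\mathfrak{A}})$, where for $l$-ary $R_i$ the string $\mathrm{enc}(R_i^{\mathfrak{A}})\in\{0,1\}^{n^l}$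 has $1$ at position $m$ iff the $m$-th tuple of $A^l$ in lexicographic order belongs to $R_i^{\mathfrak{A}}$. Weighted least fixed-point logic $\mathrm{wLFP}[\mathcal{S}]$. Boolean formulas $\beta$ are the formulas of least fixed-point logic $\mathrm{LFP}$ over $\tau\cup\{<\}$: first-order logic ($\mathtt{false}$, atomic $R(\bar x)$, $\neg$, $\lor$, $\exists x$) closed under $[\mathbf{lfp}\,R\bar x.\psi](\bar t)$ and $[\mathbf{gfp}\,R\bar x.\psi](\bar t)$ for $\psi$ in which the new relation variable $R$ occurs only positively, interpreted as membership of $\bar t$ in the least (resp. greatest) fixed point of the monotone operator $R\mapsto\{\bar a\mid(\mathfrak{A},R)\models\psi(R,\bar a)\}$. Weighted formulas: $\varphi::=\beta\mid s\ (s\in S)\mid\varphi\oplus\varphi\mid\varphi\otimes\varphi\mid\bigoplus x.\varphi\mid\bigotimes x.\varphi$. Semantics: $\|\beta\|=\mathbb{1}$ if $\beta$ holds and $\mathbb{0}$ otherwise; $\|s\|=s$; $\oplus,\otimes$ are $+,\cdot$; $\bigoplus x$ is the sum over all $a\in A$ of the value with $x\mapsto a$; $\bigotimes x$ is the product $\prod_{i=1}^{k}$ over the elements $a_1<\dots<a_k$ of $A$ taken in the order $<$. $\|\varphi\|(\mathfrak{A})$ denotes evaluation under the empty assignment.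
   Formalization: Some relation symbol of the vocabulary is assumed to have positive arity (universes are nonempty): otherwise the encoding does not determine the universe size and part (1) fails, e.g. for the empty vocabulary over the natural numbers the sum over x of 1 has value |A|. -}

module Defs where

open import Level using (Level; _⊔_)
open import Data.Bool using (Bool; true; false; if_then_else_; not; _∨_; _∧_)
open import Data.Nat using (ℕ; zero; suc; _+_; _*_; _^_; _<?_)
open import Data.Fin using (Fin; zero; suc)
open import Data.Fin.Properties using () renaming (_≟_ to _≟F_)
open import Data.List using (List; []; _∷_; _++_; map; concatMap; allFin; length; foldr)
open import Data.Vec using (Vec; []; _∷_; lookup)
import Data.Vec as Vec
open import Data.Vec.Properties using (≡-dec)
open import Data.Maybe using (Maybe; just; nothing)
open import Data.Product using (Σ; _×_; _,_; ∃)
open import Relation.Nullary using (does)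
open import Relation.Binary.PropositionalEquality using (_≡_)
open import Algebra.Bundles using (Semiring)

all any : ∀ {A : Set} → (A → Bool) → List A → Bool
all p []       = true
all p (x ∷ xs) = p x ∧ all p xs
any p []       = false
any p (x ∷ xs) = p x ∨ any p xs

-- A finite relational vocabulary τ = {R_1,…,R_j} is given by the vector
-- of arities of its relation symbols.
Vocab : ℕ → Set
Vocab j = Vec ℕ j

-- A finite ordered τ-structure, with universe identified via < with
-- {0,…,n-1} = Fin n (n = suc m ≥ 1, universes are nonempty); the linear
-- order < is the natural order of Fin n.
record Struct {j : ℕ} (ar : Vocab j) : Set where
  field
    m    : ℕ
    rels : (i : Fin j) → Vec (Fin (suc m)) (lookup ar i) → Bool

open Struct public

size : ∀ {j} {ar : Vocab j} → Struct ar → ℕ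
size 𝔄 = suc (m 𝔄)

tuples : (n l : ℕ) → List (Vec (Fin n) l)
tuples n zero    = [] ∷ []
tuples n (suc l) = concatMap (λ a → map (a ∷_) (tuples n l)) (allFin n)

-- letters of a finite alphabet Fin (2 + a) containing the bits 0 and 1
bit : ∀ {a} → Bool → Fin (suc (suc a))
bit false = zero
bit true  = suc zero

encRels : ∀ {j n a} (ar : Vocab j) →
          ((i : Fin j) → Vec (Fin n) (lookup ar i) → Bool) → List (Fin (suc (suc a)))
encRels {zero}  {n} []       R = []
encRels {suc j} {n} (l ∷ ar) R =
  map (λ t → bit (R zero t)) (tuples n l) ++ encRels ar (λ i → R (suc i))

enc : ∀ {j a} {ar : Vocab j} → Struct ar → List (Fin (suc (suc a)))
enc {ar = ar} 𝔄 = encRels ar (rels 𝔄)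

-- LFP (Boolean formulas), well-scoped (de Bruijn) syntax
-- Formula ar v Δ : formulas with first-order variables Fin v and
-- relation variables of arities listed in Δ.

data Formula {j : ℕ} (ar : Vocab j) : ℕ → {k : ℕ} → Vec ℕ k → Set where
  ff   : ∀ {v k} {Δ : Vec ℕ k} → Formula ar v Δ
  rel  : ∀ {v k} {Δ : Vec ℕ k} (i : Fin j) → Vec (Fin v) (lookup ar i) → Formula ar v Δ
  lt   : ∀ {v k} {Δ : Vec ℕ k} → Fin v → Fin v → Formula ar v Δ
  rvar : ∀ {v k} {Δ : Vec ℕ k} (i : Fin k) → Vec (Fin v) (lookup Δ i) → Formula ar v Δ
  neg  : ∀ {v k} {Δ : Vec ℕ k} → Formula ar v Δ → Formula ar v Δ
  or   : ∀ {v k} {Δ : Vec ℕ k} → Formula ar v Δ → Formula ar v Δ → Formula ar v Δ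
  ex   : ∀ {v k} {Δ : Vec ℕ k} → Formula ar (suc v) Δ → Formula ar v Δ
  -- [lfp R x̄. ψ](t̄): x̄ are the variables 0,…,l-1 of ψ, R is relation var 0
  lfp  : ∀ {v k} {Δ : Vec ℕ k} (l : ℕ) → Formula ar (l + v) (l ∷ Δ) → Vec (Fin v) l → Formula ar v Δ
  gfp  : ∀ {v k} {Δ : Vec ℕ k} (l : ℕ) → Formula ar (l + v) (l ∷ Δ) → Vec (Fin v) l → Formula ar v Δ

Pos Neg : ∀ {j} {ar : Vocab j} {v k} {Δ : Vec ℕ k} → Fin k → Formula ar v Δ → Set
Pos x ff           = ⊤'
  where open import Data.Unit using () renaming (⊤ to ⊤')
Pos x (rel i ts)   = ⊤'
  where open import Data.Unit using () renaming (⊤ to ⊤')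
Pos x (lt _ _)     = ⊤'
  where open import Data.Unit using () renaming (⊤ to ⊤')
Pos x (rvar i ts)  = ⊤'
  where open import Data.Unit using () renaming (⊤ to ⊤')
Pos x (neg φ)      = Neg x φ
Pos x (or φ ψ)     = Pos x φ × Pos x ψ
Pos x (ex φ)       = Pos x φ
Pos x (lfp l ψ ts) = Pos (suc x) ψ
Pos x (gfp l ψ ts) = Pos (suc x) ψ
Neg x ff           = ⊤'
  where open import Data.Unit using () renaming (⊤ to ⊤')
Neg x (rel i ts)   = ⊤'
  where open import Data.Unit using () renaming (⊤ to ⊤')
Neg x (lt _ _)     = ⊤'
  where open import Data.Unit using () renaming (⊤ to ⊤')
Neg x (rvar i ts)  = i ≡ x → ⊥'
  where open import Data.Empty using () renaming (⊥ to ⊥')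
Neg x (neg φ)      = Pos x φ
Neg x (or φ ψ)     = Neg x φ × Neg x ψ
Neg x (ex φ)       = Neg x φ
Neg x (lfp l ψ ts) = Neg (suc x) ψ
Neg x (gfp l ψ ts) = Neg (suc x) ψ

WF : ∀ {j} {ar : Vocab j} {v k} {Δ : Vec ℕ k} → Formula ar v Δ → Set
WF ff           = ⊤'
  where open import Data.Unit using () renaming (⊤ to ⊤')
WF (rel i ts)   = ⊤'
  where open import Data.Unit using () renaming (⊤ to ⊤')
WF (lt _ _)     = ⊤'
  where open import Data.Unit using () renaming (⊤ to ⊤')
WF (rvar i ts)  = ⊤'
  where open import Data.Unit using () renaming (⊤ to ⊤')
WF (neg φ)      = WF φ
WF (or φ ψ)     = WF φ × WF ψ
WF (ex φ)       = WF φ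
WF (lfp l ψ ts) = Pos zero ψ × WF ψ
WF (gfp l ψ ts) = Pos zero ψ × WF ψ

RelEnv : ℕ → ∀ {k} → Vec ℕ k → Set
RelEnv n {k} Δ = (i : Fin k) → Vec (Fin n) (lookup Δ i) → Bool

extR : ∀ {n l k} {Δ : Vec ℕ k} → (Vec (Fin n) l → Bool) → RelEnv n Δ → RelEnv n (l ∷ Δ)
extR R ρ zero    = R
extR R ρ (suc i) = ρ i

subsets : ∀ {A : Set} → List A → List (List A)
subsets []       = [] ∷ []
subsets (x ∷ xs) = let ss = subsets xs in ss ++ map (x ∷_) ss

memb : ∀ {n l} → List (Vec (Fin n) l) → Vec (Fin n) l → Bool
memb S t = any (λ u → does (≡-dec _≟F_ u t)) S

allRels : (n l : ℕ) → List (Vec (Fin n) l → Bool)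
allRels n l = map memb (subsets (tuples n l))

-- Boolean semantics.  The least fixed point of the (monotone) operator
-- F(R) = {ā | ψ(R,ā)} is the intersection of all R with F(R) ⊆ R, the
-- greatest fixed point the union of all R with R ⊆ F(R) (Knaster–Tarski).
evalB : ∀ {j} {ar : Vocab j} (𝔄 : Struct ar) {v k} {Δ : Vec ℕ k} →
        Formula ar v Δ → Vec (Fin (size 𝔄)) v → RelEnv (size 𝔄) Δ → Bool
evalB 𝔄 ff           η ρ = false
evalB 𝔄 (rel i ts)   η ρ = rels 𝔄 i (Vec.map (lookup η) ts)
evalB 𝔄 (lt x y)     η ρ = does (Data.Fin._<?_ (lookup η x) (lookup η y))
  where import Data.Fin
evalB 𝔄 (rvar i ts)  η ρ = ρ i (Vec.map (lookup η) ts)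
evalB 𝔄 (neg φ)      η ρ = not (evalB 𝔄 φ η ρ)
evalB 𝔄 (or φ ψ)     η ρ = evalB 𝔄 φ η ρ ∨ evalB 𝔄 ψ η ρ
evalB 𝔄 (ex φ)       η ρ = any (λ a → evalB 𝔄 φ (a ∷ η) ρ) (allFin (size 𝔄))
evalB 𝔄 (lfp l ψ ts) η ρ =
  all (λ R → not (all (λ b → not (evalB 𝔄 ψ (b Vec.++ η) (extR R ρ)) ∨ R b)
                      (tuples (size 𝔄) l))
             ∨ R (Vec.map (lookup η) ts))
      (allRels (size 𝔄) l)
evalB 𝔄 (gfp l ψ ts) η ρ =
  any (λ R → all (λ b → not (R b) ∨ evalB 𝔄 ψ (b Vec.++ η) (extR R ρ))
                 (tuples (size 𝔄) l)
             ∧ R (Vec.map (lookup η) ts))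
      (allRels (size 𝔄) l)

noRels : ∀ {n} → RelEnv n []
noRels ()

module Weighted {c ℓ : Level} (S : Semiring c ℓ) where
  open Semiring S using (Carrier; 0#; 1#) renaming (_+_ to _+S_; _*_ to _*S_)

  data WFormula {j : ℕ} (ar : Vocab j) : ℕ → Set c where
    bool  : ∀ {v} (β : Formula ar v []) → WF β → WFormula ar v
    const : ∀ {v} → Carrier → WFormula ar v
    _⊕_   : ∀ {v} → WFormula ar v → WFormula ar v → WFormula ar v
    _⊗_   : ∀ {v} → WFormula ar v → WFormula ar v → WFormula ar v
    ⨁    : ∀ {v} → WFormula ar (suc v) → WFormula ar v
    ⨂    : ∀ {v} → WFormula ar (suc v) → WFormula ar v

  evalW : ∀ {j} {ar : Vocab j} (𝔄 : Struct ar) {v} →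
          WFormula ar v → Vec (Fin (size 𝔄)) v → Carrier
  evalW 𝔄 (bool β _) η = if evalB 𝔄 β η noRels then 1# else 0#
  evalW 𝔄 (const s)  η = s
  evalW 𝔄 (φ ⊕ ψ)    η = evalW 𝔄 φ η +S evalW 𝔄 ψ η
  evalW 𝔄 (φ ⊗ ψ)    η = evalW 𝔄 φ η *S evalW 𝔄 ψ η
  evalW 𝔄 (⨁ φ)      η = foldr _+S_ 0# (map (λ a → evalW 𝔄 φ (a ∷ η)) (allFin (size 𝔄)))
  -- product over a₁ < ⋯ < a_n in the order <
  evalW 𝔄 (⨂ φ)      η = foldr _*S_ 1# (map (λ a → evalW 𝔄 φ (a ∷ η)) (allFin (size 𝔄)))

  ⟦_⟧ : ∀ {j} {ar : Vocab j} → WFormula ar 0 → Struct ar → Carrier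
  ⟦ φ ⟧ 𝔄 = evalW 𝔄 φ []

data Move : Set where
  left right stay : Move

record TM (I O : Set) : Set where
  field
    nQ nΓ : ℕ
    δ     : Fin nQ → Fin nΓ → Maybe (Fin nQ × Fin nΓ × Move)  -- nothing = halt
    start : Fin nQ
    blank : Fin nΓ
    inp   : I → Fin nΓ
    out   : Fin nΓ → Maybe O

record Config {I O : Set} (M : TM I O) : Set where
  constructor cfg
  field
    state : Fin (TM.nQ M)
    head  : ℕ
    tape  : ℕ → Fin (TM.nΓ M)

module _ {I O : Set} (M : TM I O) where
  open TM M

  nth : List I → ℕ → Maybe I
  nth []       _       = nothing
  nth (x ∷ xs) zero    = just x
  nth (x ∷ xs) (suc i) = nth xs i

  initCfg : List I → Config M
  initCfg w = cfg start 0 (λ i → maybeIn (nth w i))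
    where
      maybeIn : Maybe I → Fin nΓ
      maybeIn (just a) = inp a
      maybeIn nothing  = blank

  write : (ℕ → Fin nΓ) → ℕ → Fin nΓ → ℕ → Fin nΓ
  write t p s i with does (Data.Nat._≟_ i p)
    where import Data.Nat
  ... | true  = s
  ... | false = t i

  move : Move → ℕ → ℕ
  move left  zero    = zero
  move left  (suc p) = p
  move right p       = suc p
  move stay  p       = p

  step : Config M → Maybe (Config M)
  step (cfg q p t) with δ q (t p)
  ... | nothing          = nothing
  ... | just (q' , s , d) = just (cfg q' (move d p) (write t p s))

  run : ℕ → Config M → Config M
  run zero    c = c
  run (suc n) c with step c
  ... | nothing = c
  ... | just c' = run n c'

  Halted : Config M → Set
  Halted (cfg q p t) = δ q (t p) ≡ nothing

  TapeOut : (ℕ → Fin nΓ) → ℕ → List O → Set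
  TapeOut t i []       = out (t i) ≡ nothing
  TapeOut t i (o ∷ u)  = (out (t i) ≡ just o) × TapeOut t (suc i) u

  ComputesWithin : List I → ℕ → List O → Set
  ComputesWithin w T u = Halted (run T (initCfg w)) × TapeOut (Config.tape (run T (initCfg w))) 0 u

-- G = {g 0, …, g (r-1)}; symbols of term words
data TSym (r : ℕ) : Set where
  sym   : Fin r → TSym r
  lpar rpar plus dot : TSym r

data Term (r : ℕ) : Set where
  gen       : Fin r → Term r
  _[+]_ _[·]_ : Term r → Term r → Term r

render : ∀ {r} → Term r → List (TSym r)
render (gen i)    = sym i ∷ []
render (t [+] u)  = lpar ∷ render t ++ plus ∷ render u ++ rpar ∷ []
render (t [·] u)  = lpar ∷ render t ++ dot ∷ render u ++ rpar ∷ []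

bigSum bigProd : ∀ {r} m → (Fin (suc m) → Term r) → Term r
bigSum zero    f = f zero
bigSum (suc m) f = f zero [+] bigSum m (λ i → f (suc i))
bigProd zero    f = f zero
bigProd (suc m) f = f zero [·] bigProd m (λ i → f (suc i))

-- index tuples (i₁,j₁,…,i_k,j_k) for bounds (m₁,n₁),…,(m_k,n_k) (stored as
-- predecessors, all bounds are ≥ 1)
Idx : ∀ {k} → Vec (ℕ × ℕ) k → Set
Idx []             = Data.Unit.⊤
  where import Data.Unit
Idx ((m , n) ∷ sh) = Fin (suc m) × Fin (suc n) × Idx sh

nested : ∀ {r k} (sh : Vec (ℕ × ℕ) k) → (Idx sh → Fin r) → Term r
nested []             s = gen (s _)
nested ((m , n) ∷ sh) s =
  bigSum m (λ i → bigProd n (λ j → nested sh (λ ix → s (i , j , ix))))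

module FP {c ℓ : Level} (S : Semiring c ℓ) where
  open Semiring S using (Carrier; _≈_; 0#; 1#) renaming (_+_ to _+S_; _*_ to _*S_)

  value : ∀ {r} → (Fin r → Carrier) → Term r → Carrier
  value g (gen i)   = g i
  value g (t [+] u) = value g t +S value g u
  value g (t [·] u) = value g t *S value g u

  InFP : (I : Set) → (List I → Carrier) → Set (c ⊔ ℓ)
  InFP I σ =
    Σ ℕ λ r → Σ (Fin r → Carrier) λ g →
    (∃ λ i → g i ≈ 0#) × (∃ λ i → g i ≈ 1#) ×
    Σ ℕ λ k → Σ (TM I (TSym r)) λ M →
    Σ ℕ λ a → Σ ℕ λ d →
    ∀ (w : List I) →
      Σ (Vec (ℕ × ℕ) k) λ sh → Σ (Idx sh → Fin r) λ s →
        ComputesWithin M w (a * length w ^ d + a) (render (nested sh s))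
        × value g (nested sh s) ≈ σ w

{-# OPTIONS --safe #-}
-- From formulas to machines.  A weighted formula becomes k alternating sums and
-- products whose indices run through the universe and one extra value, with a
-- generator at each leaf chosen by LFP tests.  LFP formulas are evaluated by
-- programs whose nested loops run through the universe; a fixed point of arity l
-- is reached after n ^ l sweeps.  Program variables are unary marks and relations
-- are bit tracks on a one-tape machine, so an instruction costs one pass over the
-- visited part of the tape, and the depth of the loops bounds the number of
-- instructions by a polynomial.
--
-- From machines to formulas.  If n ≥ 2, K-tuples of elements are numbers below
-- n ^ K, which exceeds the running time, and the history of the computation is a
-- least fixed point.  Further fixed points parse its output: which positions
-- start and end a subterm, and where the maximal summands (factors) of a sum
-- (product) start.  Hence k quantifier pairs ⨁⨂ over positions evaluate the
-- output.  Over a one-element universe there are only finitely many structures.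
module Submission where

open import Defs renaming (sym to tsym)
open import Level using (Level)
open import Algebra.Bundles using (Semiring; Monoid)
open import Data.Bool using (Bool; true; false; not; _∨_; _∧_; if_then_else_)
open import Data.Nat using (ℕ; zero; suc; _+_; _*_; _^_; _<_; _≤_; z≤n; s≤s; _≡ᵇ_; _<ᵇ_; _⊔_; _<?_)
open import Data.Fin using (Fin; zero; suc; toℕ; fromℕ<; _↑ˡ_; _↑ʳ_)
open import Data.List using ([]; _∷_; _++_; allFin; List; length)
open import Data.Vec using (Vec; []; _∷_; lookup; _[_]≔_)
open import Data.Maybe using (Maybe; just; nothing; is-nothing)
open import Data.Product using (_×_; _,_; ∃; proj₁; proj₂; Σ)
open import Data.Sum using (_⊎_; inj₁; inj₂)
open import Data.Unit using (⊤; tt)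
open import Data.Empty using (⊥-elim; ⊥)
open import Function using (_∘_; id)
open import Data.List.Membership.Propositional using (_∈_; _∉_)
open import Data.List.Relation.Unary.Any using (here; there)
open import Relation.Binary.PropositionalEquality using (_≡_; cong; cong₂; subst; _≗_; _≢_)
open import Relation.Binary.Definitions using (tri<; tri≈; tri>)
open import Relation.Nullary using (¬_)
import Data.Nat.Properties as ℕ
import Data.Fin.Properties as Fin
import Data.Vec as Vec
import Data.Vec.Properties as Vec
import Data.List.Properties as List
import Data.Sum as Sum

-- A term of the prescribed shape must be printed for every word, also for words that encode no
-- structure. Decoding is therefore total: a size is guessed from the length of the word alone, and
-- whatever bits are found serve as relations. The length of an encoding determines the size because
-- some relation has positive arity. The extra index value lets one rectangular shape serve all
-- connectives, even over one element: for a binary sum (product) the first element carries the left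
-- operand, the extra value the right one, and the other elements 0 (1). Conversely, the bounds of a
-- printed term cannot be read off it, for a sum of one summand prints like that summand. The term
-- is read greedily along right spines instead; `plus-inv` and `dot-inv` show that k levels still
-- suffice. Multiplication need not commute, so items are met in the order of their positions. The
-- relation of a fixed point may occur only positively. Halting, blank cells and the end of the
-- output are negative information; it is taken from the transition table, from the input or from
-- fixed points that are already complete.

module FixedPoints where
  open import Data.Nat.DivMod using (_/_; m%n<n; m≡m%n+[m/n]*n; m<n*o⇒m/o<n)
  open import Data.List using (map; filterᵇ)
  open import Data.List.Membership.Propositional.Properties
    using (∈-allFin; ∈-map⁺; ∈-concat⁺′; ∈-++⁺ˡ; ∈-++⁺ʳ)
  open import Data.Sum using (map₁)
  open import Relation.Nullary using (does; yes; no)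
  open import Relation.Binary.PropositionalEquality using (refl; sym; trans)
  open import Data.Vec.Properties as Vec using (≡-dec)

  -- Boolean implication and finite quantification.

  infix 4 _⇒ᵇ_
  _⇒ᵇ_ : Bool → Bool → Set
  a ⇒ᵇ b = a ≡ true → b ≡ true

  ⇒ᵇ-antisym : ∀ {a b} → a ⇒ᵇ b → b ⇒ᵇ a → a ≡ b
  ⇒ᵇ-antisym {false} {false} f g = refl
  ⇒ᵇ-antisym {false} {true}  f g = g refl
  ⇒ᵇ-antisym {true}  {b}     f g = sym (f refl)

  ≡⇒⇒ᵇ : ∀ {a b} → a ≡ b → a ⇒ᵇ b
  ≡⇒⇒ᵇ refl p = p

  not-⇒ᵇ : ∀ {a b} → a ⇒ᵇ b → not b ⇒ᵇ not a
  not-⇒ᵇ {false} f p = refl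
  not-⇒ᵇ {true} {false} f p = f refl
  not-⇒ᵇ {true} {true} f p = p

  ∨-elimᵇ : ∀ {a b} {C : Set} → (a ≡ true → C) → (b ≡ true → C) → a ∨ b ≡ true → C
  ∨-elimᵇ {true}  f g p = f refl
  ∨-elimᵇ {false} f g p = g p

  ∨-introˡ : ∀ {a b} → a ⇒ᵇ a ∨ b
  ∨-introˡ refl = refl

  ∨-introʳ : ∀ {a b} → b ⇒ᵇ a ∨ b
  ∨-introʳ {true}  p = refl
  ∨-introʳ {false} p = p

  ∧-elimᵇ : ∀ {a b} → a ∧ b ≡ true → a ≡ true × b ≡ true
  ∧-elimᵇ {true} p = refl , p

  ∧-introᵇ : ∀ {a b} → a ≡ true → b ≡ true → a ∧ b ≡ true
  ∧-introᵇ refl refl = refl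

  imp-introᵇ : ∀ {a b} → a ⇒ᵇ b → not a ∨ b ≡ true
  imp-introᵇ {false} f = refl
  imp-introᵇ {true}  f = f refl

  imp-elimᵇ : ∀ {a b} → not a ∨ b ≡ true → a ⇒ᵇ b
  imp-elimᵇ p refl = p

  all-sound : ∀ {A : Set} {p : A → Bool} {xs x} → all p xs ≡ true → x ∈ xs → p x ≡ true
  all-sound q (here refl) = proj₁ (∧-elimᵇ q)
  all-sound {p = p} {y ∷ _} q (there m) = all-sound (proj₂ (∧-elimᵇ {p y} q)) m

  all-complete : ∀ {A : Set} {p : A → Bool} xs → (∀ x → x ∈ xs → p x ≡ true) → all p xs ≡ true
  all-complete []       f = refl
  all-complete (x ∷ xs) f = ∧-introᵇ (f x (here refl)) (all-complete xs (λ y m → f y (there m)))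

  any-sound : ∀ {A : Set} {p : A → Bool} xs → any p xs ≡ true → ∃ λ x → x ∈ xs × p x ≡ true
  any-sound (x ∷ xs) = ∨-elimᵇ (λ q → x , here refl , q)
    (λ q → let (y , m , r) = any-sound xs q in y , there m , r)

  any-complete : ∀ {A : Set} {p : A → Bool} {xs x} → x ∈ xs → p x ≡ true → any p xs ≡ true
  any-complete (here refl) q = ∨-introˡ q
  any-complete {p = p} {y ∷ _} (there m) q = ∨-introʳ {p y} (any-complete m q)

  ∈-tuples : ∀ {n l} (t : Vec (Fin n) l) → t ∈ tuples n l
  ∈-tuples []      = here refl
  ∈-tuples (a ∷ t) = ∈-concat⁺′ (∈-map⁺ (a ∷_) (∈-tuples t)) (∈-map⁺ _ (∈-allFin a))

  filter∈subsets : ∀ {A : Set} (p : A → Bool) xs → filterᵇ p xs ∈ subsets xs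
  filter∈subsets p []       = here refl
  filter∈subsets p (x ∷ xs) with p x
  ... | true  = ∈-++⁺ʳ (subsets xs) (∈-map⁺ (x ∷_) (filter∈subsets p xs))
  ... | false = ∈-++⁺ˡ (filter∈subsets p xs)

  memb-filter : ∀ {n l} (R : Vec (Fin n) l → Bool) t → memb (filterᵇ R (tuples n l)) t ≡ R t
  memb-filter {n} {l} R t = ⇒ᵇ-antisym (sound (tuples n l)) (complete (tuples n l) (∈-tuples t))
    where
    sound : ∀ xs → memb (filterᵇ R xs) t ⇒ᵇ R t
    sound (x ∷ xs) q with R x in eq
    ... | false = sound xs q
    ... | true with ≡-dec Fin._≟_ x t
    ...   | yes refl = eq
    ...   | no _     = sound xs q
    complete : ∀ xs → t ∈ xs → R t ⇒ᵇ memb (filterᵇ R xs) t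
    complete (x ∷ xs) (here refl) q rewrite q with ≡-dec Fin._≟_ x x
    ... | yes _ = refl
    ... | no x≢ = ⊥-elim (x≢ refl)
    complete (x ∷ xs) (there m) q with R x
    ... | false = complete xs m q
    ... | true  = ∨-introʳ {does (≡-dec Fin._≟_ x t)} (complete xs m q)

  -- The semantics quantifies over a list of functions, and without function extensionality R itself
  -- need not be in it. Only a pointwise equal copy is, which is why operators have to be
  -- `Extensional` below.
  allRels-complete : ∀ {n l} (R : Vec (Fin n) l → Bool) → ∃ λ R' → R' ∈ allRels n l × (∀ t → R' t ≡ R t)
  allRels-complete {n} {l} R =
    memb (filterᵇ R (tuples n l)) , ∈-map⁺ memb (filter∈subsets R (tuples n l)) , memb-filter R

  -- Least and greatest fixed points among Boolean relations.

  Operator : ℕ → ℕ → Set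
  Operator n l = (Vec (Fin n) l → Bool) → Vec (Fin n) l → Bool

  Extensional : ∀ {n l} → Operator n l → Set
  Extensional F = ∀ R R' → (∀ t → R t ≡ R' t) → ∀ t → F R t ⇒ᵇ F R' t

  Closed Dense : ∀ {n l} → Operator n l → (Vec (Fin n) l → Bool) → Set
  Closed F R = ∀ t → F R t ⇒ᵇ R t
  Dense F R  = ∀ t → R t ⇒ᵇ F R t

  -- By computation these are the `lfp` and `gfp` clauses of `evalB` with the operator abstracted,
  -- so the rules below apply to formulas without rewriting.
  lfpᵇ gfpᵇ : ∀ {n l} → Operator n l → Vec (Fin n) l → Bool
  lfpᵇ {n} {l} F t = all (λ R → not (all (λ b → not (F R b) ∨ R b) (tuples n l)) ∨ R t) (allRels n l)
  gfpᵇ {n} {l} F t = any (λ R → all (λ b → not (R b) ∨ F R b) (tuples n l) ∧ R t) (allRels n l)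

  lfp-elim : ∀ {n l} (F : Operator n l) → Extensional F →
    ∀ {t} → lfpᵇ F t ≡ true → ∀ R → Closed F R → R t ≡ true
  lfp-elim {n} {l} F ext {t} q R c with allRels-complete R
  ... | R' , m , e = trans (sym (e t)) (imp-elimᵇ (all-sound q m)
    (all-complete (tuples n l) (λ b _ → imp-introᵇ (λ r → trans (e b) (c b (ext R' R e b r))))))

  lfp-intro : ∀ {n l} (F : Operator n l) → ∀ {t} → (∀ R → Closed F R → R t ≡ true) → lfpᵇ F t ≡ true
  lfp-intro {n} {l} F f = all-complete (allRels n l)
    (λ R _ → imp-introᵇ (λ q → f R (λ b → imp-elimᵇ (all-sound q (∈-tuples b)))))

  gfp-elim : ∀ {n l} (F : Operator n l) → ∀ {t} → gfpᵇ F t ≡ true → ∃ λ R → Dense F R × R t ≡ true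
  gfp-elim {n} {l} F q =
    let (R , _ , r) = any-sound (allRels n l) q
        (c , d) = ∧-elimᵇ {all _ (tuples n l)} r
    in R , (λ b → imp-elimᵇ (all-sound c (∈-tuples b))) , d

  gfp-intro : ∀ {n l} (F : Operator n l) → Extensional F →
    ∀ {t} R → Dense F R → R t ≡ true → gfpᵇ F t ≡ true
  gfp-intro {n} {l} F ext {t} R c r with allRels-complete R
  ... | R' , m , e = any-complete m (∧-introᵇ
    (all-complete (tuples n l) (λ b _ → imp-introᵇ
      (λ q → ext R R' (λ u → sym (e u)) b (c b (trans (sym (e b)) q)))))
    (trans (e t) r))

  record Below {n k : ℕ} (Δ : Vec ℕ k) (P : Fin k → Set) (ρ ρ' : RelEnv n Δ) : Set where
    constructor below
    field at : ∀ i → P i ⊎ (∀ t → ρ i t ⇒ᵇ ρ' i t)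

  Below-extR : ∀ {n k l} {Δ : Vec ℕ k} {P : Fin (suc k) → Set} {ρ ρ' : RelEnv n Δ} {R R' : Vec (Fin n) l → Bool} →
    P zero ⊎ (∀ t → R t ⇒ᵇ R' t) → Below Δ (λ i → P (suc i)) ρ ρ' → Below (l ∷ Δ) P (extR R ρ) (extR R' ρ')
  Below-extR h (below b) = below λ { zero → h ; (suc i) → b i }

  Below-refl : ∀ {n k} {Δ : Vec ℕ k} {P : Fin k → Set} (ρ : RelEnv n Δ) → Below Δ P ρ ρ
  Below-refl ρ = below λ i → inj₂ (λ t q → q)

  Below-proj : ∀ {n k} {Δ : Vec ℕ k} {P Q : Fin k → Set} {ρ ρ' : RelEnv n Δ} →
    (∀ i → P i → Q i) → Below Δ P ρ ρ' → Below Δ Q ρ ρ'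
  Below-proj f (below b) = below λ i → map₁ (f i) (b i)

  structure : ∀ {j} {ar : Vocab j} (m₀ : ℕ) → ((i : Fin j) → Vec (Fin (suc m₀)) (lookup ar i) → Bool) → Struct ar
  structure m₀ r = record { m = m₀ ; rels = r }

  operator : ∀ {j} {ar : Vocab j} (𝔄 : Struct ar) {l v k} {Δ : Vec ℕ k} →
    Formula ar (l + v) (l ∷ Δ) → Vec (Fin (size 𝔄)) v → RelEnv (size 𝔄) Δ → Operator (size 𝔄) l
  operator 𝔄 ψ η ρ R b = evalB 𝔄 ψ (b Vec.++ η) (extR R ρ)

  -- A relation variable is exempt from the comparison of the environments in
  -- the direction in which it does not occur.
  evalB-mono : ∀ {j} {ar : Vocab j} (m₀ : ℕ) r₁ r₂ → (∀ i t → r₁ i t ≡ r₂ i t) →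
    ∀ {v k} {Δ : Vec ℕ k} (φ : Formula ar v Δ) (η : Vec (Fin (suc m₀)) v) (ρ ρ' : RelEnv (suc m₀) Δ) →
    Below Δ (λ i → Neg i φ) ρ ρ' → Below Δ (λ i → Pos i φ) ρ' ρ →
    evalB (structure m₀ r₁) φ η ρ ⇒ᵇ evalB (structure m₀ r₂) φ η ρ'

  -- Mutual with `evalB-mono`: the rules for a fixed point need its operator to be extensional,
  -- which is monotonicity of the smaller formula ψ under environments that are included in each
  -- other.
  operator-ext : ∀ {j} {ar : Vocab j} (𝔄 : Struct ar) {l v k} {Δ : Vec ℕ k} (ψ : Formula ar (l + v) (l ∷ Δ)) η ρ →
    Extensional (operator 𝔄 ψ η ρ)

  evalB-mono m₀ r₁ r₂ e (rel i ts) η ρ ρ' up dn q = trans (sym (e i _)) q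
  evalB-mono m₀ r₁ r₂ e (lt x y) η ρ ρ' up dn q = q
  evalB-mono m₀ r₁ r₂ e (rvar i ts) η ρ ρ' (below up) dn q with up i
  ... | inj₁ n = ⊥-elim (n refl)
  ... | inj₂ h = h _ q
  evalB-mono m₀ r₁ r₂ e (neg φ) η ρ ρ' up dn =
    not-⇒ᵇ (evalB-mono m₀ r₂ r₁ (λ i t → sym (e i t)) φ η ρ' ρ dn up)
  evalB-mono m₀ r₁ r₂ e (or φ ψ) η ρ ρ' up dn =
    ∨-elimᵇ (λ q → ∨-introˡ (evalB-mono m₀ r₁ r₂ e φ η ρ ρ' (Below-proj (λ _ → proj₁) up) (Below-proj (λ _ → proj₁) dn) q))
            (λ q → ∨-introʳ {evalB (structure m₀ r₂) φ η ρ'}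
              (evalB-mono m₀ r₁ r₂ e ψ η ρ ρ' (Below-proj (λ _ → proj₂) up) (Below-proj (λ _ → proj₂) dn) q))
  evalB-mono m₀ r₁ r₂ e (ex φ) η ρ ρ' up dn q =
    let (a , m , p) = any-sound (allFin (suc m₀)) q
    in any-complete m (evalB-mono m₀ r₁ r₂ e φ (a ∷ η) ρ ρ' up dn p)
  evalB-mono m₀ r₁ r₂ e (lfp l ψ ts) η ρ ρ' up dn q =
    lfp-intro (operator (structure m₀ r₂) ψ η ρ') (λ R c →
      lfp-elim (operator (structure m₀ r₁) ψ η ρ) (operator-ext (structure m₀ r₁) ψ η ρ) q R (λ b p →
        c b (evalB-mono m₀ r₁ r₂ e ψ (b Vec.++ η) (extR R ρ) (extR R ρ')
          (Below-extR (inj₂ λ _ r → r) up) (Below-extR (inj₂ λ _ r → r) dn) p)))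
  evalB-mono m₀ r₁ r₂ e (gfp l ψ ts) η ρ ρ' up dn q =
    let (R , d , r) = gfp-elim (operator (structure m₀ r₁) ψ η ρ) q
    in gfp-intro (operator (structure m₀ r₂) ψ η ρ') (operator-ext (structure m₀ r₂) ψ η ρ') R
      (λ b p → evalB-mono m₀ r₁ r₂ e ψ (b Vec.++ η) (extR R ρ) (extR R ρ')
          (Below-extR (inj₂ λ _ r → r) up) (Below-extR (inj₂ λ _ r → r) dn) (d b p)) r

  operator-ext 𝔄 ψ η ρ R R' e b = evalB-mono (m 𝔄) (rels 𝔄) (rels 𝔄) (λ _ _ → refl) ψ (b Vec.++ η) (extR R ρ) (extR R' ρ)
    (Below-extR (inj₂ λ t → ≡⇒⇒ᵇ (e t)) (Below-refl ρ))
    (Below-extR (inj₂ λ t → ≡⇒⇒ᵇ (sym (e t))) (Below-refl ρ))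

  -- `Pos zero ψ` exempts the fixed-point variable from the comparison in the opposite direction, so
  -- the inclusion of R in R' suffices.
  operator-mono : ∀ {j} {ar : Vocab j} (𝔄 : Struct ar) {l v k} {Δ : Vec ℕ k} (ψ : Formula ar (l + v) (l ∷ Δ)) → Pos zero ψ →
    ∀ η ρ R R' → (∀ t → R t ⇒ᵇ R' t) → ∀ b → operator 𝔄 ψ η ρ R b ⇒ᵇ operator 𝔄 ψ η ρ R' b
  operator-mono 𝔄 ψ pos η ρ R R' h b = evalB-mono (m 𝔄) (rels 𝔄) (rels 𝔄) (λ _ _ → refl) ψ (b Vec.++ η) (extR R ρ) (extR R' ρ)
    (Below-extR (inj₂ h) (Below-refl ρ)) (Below-extR (inj₁ pos) (Below-refl ρ))

  evalB-cong : ∀ {j} {ar : Vocab j} (m₀ : ℕ) r₁ r₂ → (∀ i t → r₁ i t ≡ r₂ i t) →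
    ∀ {v k} {Δ : Vec ℕ k} (φ : Formula ar v Δ) (η : Vec (Fin (suc m₀)) v) (ρ : RelEnv (suc m₀) Δ) →
    evalB (structure m₀ r₁) φ η ρ ≡ evalB (structure m₀ r₂) φ η ρ
  evalB-cong m₀ r₁ r₂ e φ η ρ = ⇒ᵇ-antisym
    (evalB-mono m₀ r₁ r₂ e φ η ρ ρ (Below-refl ρ) (Below-refl ρ))
    (evalB-mono m₀ r₂ r₁ (λ i t → sym (e i t)) φ η ρ ρ (Below-refl ρ) (Below-refl ρ))

  -- Base n with the least significant digit at the head. In de Bruijn notation the head is the
  -- innermost variable, so nested loops and nested quantifiers run through tuples in this order.
  numR : ∀ {n l} → Vec (Fin n) l → ℕ
  numR []                = 0
  numR {n} (a ∷ t) = toℕ a + numR t * n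

  numR-bound : ∀ {n l} (t : Vec (Fin n) l) → numR t < n ^ l
  numR-bound []                    = s≤s z≤n
  numR-bound {n} {suc l} (a ∷ t) = begin-strict
    toℕ a + numR t * n  <⟨ ℕ.+-monoˡ-< _ (Fin.toℕ<n a) ⟩
    n + numR t * n      ≤⟨ ℕ.*-monoˡ-≤ n (numR-bound t) ⟩
    n ^ l * n           ≡⟨ ℕ.*-comm (n ^ l) n ⟩
    n * n ^ l           ∎
    where open ℕ.≤-Reasoning

  mixed-radix-unique : ∀ {n} (a b : Fin n) x y → toℕ a + x * n ≡ toℕ b + y * n → a ≡ b × x ≡ y
  mixed-radix-unique a b zero zero e =
    Fin.toℕ-injective (trans (sym (ℕ.+-identityʳ _)) (trans e (ℕ.+-identityʳ _))) , refl
  mixed-radix-unique {n} a b zero (suc y) e = ⊥-elim (ℕ.<⇒≱ (Fin.toℕ<n a)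
    (subst (n ≤_) (trans (sym e) (ℕ.+-identityʳ _)) (ℕ.≤-trans (ℕ.m≤m+n n (y * n)) (ℕ.m≤n+m _ (toℕ b)))))
  mixed-radix-unique {n} a b (suc x) zero e = ⊥-elim (ℕ.<⇒≱ (Fin.toℕ<n b)
    (subst (n ≤_) (trans e (ℕ.+-identityʳ _)) (ℕ.≤-trans (ℕ.m≤m+n n (x * n)) (ℕ.m≤n+m _ (toℕ a)))))
  mixed-radix-unique {n} a b (suc x) (suc y) e =
    let (p , q) = mixed-radix-unique a b x y (ℕ.+-cancelˡ-≡ n _ _ (trans (swap a x) (trans e (sym (swap b y)))))
    in p , cong suc q
    where
    swap : ∀ c z → n + (toℕ c + z * n) ≡ toℕ c + (n + z * n)
    swap c z = trans (sym (ℕ.+-assoc n (toℕ c) _)) (trans (cong (_+ z * n) (ℕ.+-comm n (toℕ c))) (ℕ.+-assoc (toℕ c) n _))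

  numR-injective : ∀ {n l} (s t : Vec (Fin n) l) → numR s ≡ numR t → s ≡ t
  numR-injective []      []      e = refl
  numR-injective (a ∷ s) (b ∷ t) e =
    let (p , q) = mixed-radix-unique a b (numR s) (numR t) e in cong₂ _∷_ p (numR-injective s t q)

  numR-surjective : ∀ {m₀} l p → p < suc m₀ ^ l → ∃ λ (t : Vec (Fin (suc m₀)) l) → numR t ≡ p
  numR-surjective zero    zero    h = [] , refl
  numR-surjective zero    (suc p) (s≤s ())
  numR-surjective {m₀} (suc l) p h =
    let n = suc m₀
        (t , e) = numR-surjective l (p / n) (m<n*o⇒m/o<n {p} {suc m₀ ^ l} {n} (subst (p <_) (ℕ.*-comm n (n ^ l)) h))
    in fromℕ< (m%n<n p n) ∷ t ,
       trans (cong₂ (λ x y → x + y * n) (Fin.toℕ-fromℕ< (m%n<n p n)) e) (sym (m≡m%n+[m/n]*n p n))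

  firstVars : ∀ l {v} → Vec (Fin (l + v)) l
  firstVars l {v} = Vec.tabulate (_↑ˡ v)

  lookup-firstVars : ∀ {A : Set} {l v} (b : Vec A l) (η : Vec A v) → Vec.map (lookup (b Vec.++ η)) (firstVars l) ≡ b
  lookup-firstVars b η = trans (sym (Vec.tabulate-∘ (lookup (b Vec.++ η)) _))
    (trans (Vec.tabulate-cong (Vec.lookup-++ˡ b η)) (Vec.tabulate∘lookup b))

  lookup-shift : ∀ {A : Set} {l v k} (b : Vec A l) (η : Vec A v) (xs : Vec (Fin v) k) →
    Vec.map (lookup (b Vec.++ η)) (Vec.map (l ↑ʳ_) xs) ≡ Vec.map (lookup η) xs
  lookup-shift b η xs = trans (sym (Vec.map-∘ _ _ xs)) (Vec.map-cong (Vec.lookup-++ʳ b η) xs)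

  map-lookup-map : ∀ {A : Set} {u v k} (η : Vec A v) (τ : Vec (Fin v) u) (ts : Vec (Fin u) k) →
    Vec.map (lookup η) (Vec.map (lookup τ) ts) ≡ Vec.map (lookup (Vec.map (lookup η) τ)) ts
  map-lookup-map η τ ts = trans (sym (Vec.map-∘ _ _ ts)) (Vec.map-cong (λ i → sym (Vec.lookup-map i (lookup η) τ)) ts)

-- Composable machine fragments and their conversion to Turing machines.

module Machines where
  open import Data.Fin using (splitAt; join; combine; remQuot)
  open import Data.Maybe using (maybe′)
  open import Data.Product using (map₁)
  open import Relation.Binary.PropositionalEquality using (refl; sym; trans)

  record Finite (A : Set) : Set where
    field
      card    : ℕ
      to      : A → Fin card
      from    : Fin card → A
      from-to : ∀ a → from (to a) ≡ a
  open Finite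

  fin-retract : ∀ {A B : Set} (f : A → B) (g : B → A) → (∀ a → g (f a) ≡ a) → Finite B → Finite A
  fin-retract f g gf B = record
    { card = card B ; to = to B ∘ f ; from = g ∘ from B
    ; from-to = λ a → trans (cong g (from-to B (f a))) (gf a) }

  fin-Fin : ∀ n → Finite (Fin n)
  fin-Fin n = record { card = n ; to = id ; from = id ; from-to = λ _ → refl }

  fin-⊤ : Finite ⊤
  fin-⊤ = fin-retract (λ _ → zero) (λ _ → tt) (λ _ → refl) (fin-Fin 1)

  fin-⊎ : ∀ {A B : Set} → Finite A → Finite B → Finite (A ⊎ B)
  fin-⊎ A B = record
    { card = card A + card B
    ; to = λ x → join (card A) (card B) (Sum.map (to A) (to B) x)
    ; from = λ i → Sum.map (from A) (from B) (splitAt (card A) i)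
    ; from-to = λ x → trans (cong (Sum.map (from A) (from B)) (Fin.splitAt-join (card A) (card B) (Sum.map (to A) (to B) x))) (inverse x) }
    where
    inverse : ∀ x → Sum.map (from A) (from B) (Sum.map (to A) (to B) x) ≡ x
    inverse (inj₁ a) = cong inj₁ (from-to A a)
    inverse (inj₂ b) = cong inj₂ (from-to B b)

  fin-× : ∀ {A B : Set} → Finite A → Finite B → Finite (A × B)
  fin-× A B = record
    { card = card A * card B
    ; to = λ (a , b) → combine (to A a) (to B b)
    ; from = λ i → let (x , y) = remQuot (card B) i in from A x , from B y
    ; from-to = λ (a , b) → trans (cong (λ (x , y) → from A x , from B y) (Fin.remQuot-combine (to A a) (to B b)))
                                  (cong₂ _,_ (from-to A a) (from-to B b)) }

  fin-Bool : Finite Bool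
  fin-Bool = fin-retract (λ { true → zero ; false → suc zero }) (λ { zero → true ; (suc _) → false })
    (λ { true → refl ; false → refl }) (fin-Fin 2)

  fin-Maybe : ∀ {A : Set} → Finite A → Finite (Maybe A)
  fin-Maybe A = fin-retract (maybe′ inj₂ (inj₁ tt)) (Sum.[ (λ _ → nothing) , just ])
    (λ { (just _) → refl ; nothing → refl }) (fin-⊎ fin-⊤ A)

  fin-Vec : ∀ {A : Set} → Finite A → ∀ n → Finite (Vec A n)
  fin-Vec A zero    = fin-retract (λ _ → tt) (λ _ → []) (λ { [] → refl }) fin-⊤
  fin-Vec A (suc n) = fin-retract (λ { (x ∷ xs) → x , xs }) (λ (x , xs) → x ∷ xs) (λ { (_ ∷ _) → refl })
    (fin-× A (fin-Vec A n))

  fin-ΣBool : ∀ {P : Bool → Set} → (∀ b → Finite (P b)) → Finite (Σ Bool P)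
  fin-ΣBool P = fin-retract (λ { (true , p) → inj₁ p ; (false , p) → inj₂ p })
    Sum.[ true ,_ , false ,_ ] (λ { (true , _) → refl ; (false , _) → refl }) (fin-⊎ (P true) (P false))

  fin-TSym : ∀ r → Finite (TSym r)
  fin-TSym r = fin-retract f g gf (fin-⊎ (fin-Fin r) (fin-Fin 4))
    where
    f : TSym r → Fin r ⊎ Fin 4
    f (tsym i) = inj₁ i
    f lpar     = inj₂ zero
    f rpar     = inj₂ (suc zero)
    f plus     = inj₂ (suc (suc zero))
    f dot      = inj₂ (suc (suc (suc zero)))
    g : Fin r ⊎ Fin 4 → TSym r
    g (inj₁ i)                   = tsym i
    g (inj₂ zero)                = lpar
    g (inj₂ (suc zero))          = rpar
    g (inj₂ (suc (suc zero)))    = plus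
    g (inj₂ (suc (suc (suc _)))) = dot
    gf : ∀ a → g (f a) ≡ a
    gf (tsym i) = refl
    gf lpar     = refl
    gf rpar     = refl
    gf plus     = refl
    gf dot      = refl

  ≡ᵇ-sound : ∀ i j → (i ≡ᵇ j) ≡ true → i ≡ j
  ≡ᵇ-sound zero    zero    q = refl
  ≡ᵇ-sound (suc i) (suc j) q = cong suc (≡ᵇ-sound i j q)

  ≡ᵇ-refl : ∀ i → (i ≡ᵇ i) ≡ true
  ≡ᵇ-refl zero    = refl
  ≡ᵇ-refl (suc i) = ≡ᵇ-refl i

  ≡ᵇ-< : ∀ {i j} → i < j → (i ≡ᵇ j) ≡ false
  ≡ᵇ-< {zero}  (s≤s _) = refl
  ≡ᵇ-< {suc i} (s≤s h) = ≡ᵇ-< h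

  ≡ᵇ-sym : ∀ i j → (i ≡ᵇ j) ≡ (j ≡ᵇ i)
  ≡ᵇ-sym zero    zero    = refl
  ≡ᵇ-sym zero    (suc j) = refl
  ≡ᵇ-sym (suc i) zero    = refl
  ≡ᵇ-sym (suc i) (suc j) = ≡ᵇ-sym i j

  module _ {Γ : Set} where

    Tape : Set
    Tape = ℕ → Γ

    upd : Tape → ℕ → Γ → Tape
    upd t p γ i = if i ≡ᵇ p then γ else t i

    modify : Tape → ℕ → (Γ → Γ) → Tape
    modify t p f i = if i ≡ᵇ p then f (t i) else t i

    upd-modify : ∀ t p f → modify t p f ≗ upd t p (f (t p))
    upd-modify t p f i with i ≡ᵇ p in eq
    ... | true  = cong (f ∘ t) (≡ᵇ-sound i p eq)
    ... | false = refl

    upd-id : ∀ t p → t ≗ upd t p (t p)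
    upd-id t p i = trans (lemma (i ≡ᵇ p)) (upd-modify t p id i)
      where
      lemma : ∀ b → t i ≡ (if b then t i else t i)
      lemma true  = refl
      lemma false = refl

  moveH : Move → ℕ → ℕ
  moveH left  zero    = zero
  moveH left  (suc p) = p
  moveH right p       = suc p
  moveH stay  p       = p

  -- A machine whose last transition delivers an exit value instead of halting, so that fragments
  -- are composed by redirecting exits.
  record Frag (Γ E : Set) : Set₁ where
    field
      Q     : Set
      fin   : Finite Q
      start : Q
      δ     : Q → Γ → (E ⊎ Q) × Γ × Move
  open Frag

  -- Tapes are functions and can only be compared pointwise; each step may therefore replace the
  -- written tape by a pointwise equal one.
  data Run {Γ E : Set} (F : Frag Γ E) : Q F → ℕ → (ℕ → Γ) → ℕ → E → ℕ → (ℕ → Γ) → Set where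
    exit : ∀ {q p t e γ d t'} → δ F q (t p) ≡ (inj₁ e , γ , d) → t' ≗ upd t p γ →
           Run F q p t 1 e (moveH d p) t'
    next : ∀ {q p t q₁ γ d} t₁ {k e p' t'} → δ F q (t p) ≡ (inj₂ q₁ , γ , d) → t₁ ≗ upd t p γ →
           Run F q₁ (moveH d p) t₁ k e p' t' → Run F q p t (suc k) e p' t'

  module _ {Γ : Set} where

    retR : ∀ {E : Set} → E → Frag Γ E
    retR e = record { Q = ⊤ ; fin = fin-⊤ ; start = tt ; δ = λ _ γ → inj₁ e , γ , stay }

    run-ret : ∀ {E : Set} {e : E} {p t} → Run (retR e) tt p t 1 e p t
    run-ret {p = p} {t} = exit refl (upd-id t p)

    module _ {E : Set} (F : Frag Γ Bool) (G : Bool → Frag Γ E) where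
      private
        BQ = Q F ⊎ Σ Bool (λ b → Q (G b))
        out₁ : Bool ⊎ Q F → E ⊎ BQ
        out₁ (inj₁ b) = inj₂ (inj₂ (b , start (G b)))
        out₁ (inj₂ q) = inj₂ (inj₁ q)
        out₂ : ∀ b → E ⊎ Q (G b) → E ⊎ BQ
        out₂ b (inj₁ e) = inj₁ e
        out₂ b (inj₂ q) = inj₂ (inj₂ (b , q))
        δ' : BQ → Γ → (E ⊎ BQ) × Γ × Move
        δ' (inj₁ q)       γ = map₁ out₁ (δ F q γ)
        δ' (inj₂ (b , q)) γ = map₁ (out₂ b) (δ (G b) q γ)

      -- The exit transition of F itself becomes the jump into `G b`, so running times add up
      -- without overhead.
      bindR : Frag Γ E
      bindR = record { Q = BQ ; fin = fin-⊎ (fin F) (fin-ΣBool (λ b → fin (G b))) ; start = inj₁ (start F) ; δ = δ' }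

      private
        run-bind₂ : ∀ {b q p t k e p' t'} → Run (G b) q p t k e p' t' → Run bindR (inj₂ (b , q)) p t k e p' t'
        run-bind₂ {b} (exit eq u)      = exit (cong (map₁ (out₂ b)) eq) u
        run-bind₂ {b} (next t₁ eq u r) = next t₁ (cong (map₁ (out₂ b)) eq) u (run-bind₂ r)

      run-bind : ∀ {q p t k b p' t' k' e p'' t''} → Run F q p t k b p' t' →
        Run (G b) (start (G b)) p' t' k' e p'' t'' → Run bindR (inj₁ q) p t (k + k') e p'' t''
      run-bind (exit {t' = t'} eq u) s = next t' (cong (map₁ out₁) eq) u (run-bind₂ s)
      run-bind (next t₁ eq u r)      s = next t₁ (cong (map₁ out₁) eq) u (run-bind r s)

    module _ {E : Set} (F : Frag Γ (Maybe E)) where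
      private
        out : Maybe E ⊎ Q F → E ⊎ Q F
        out (inj₁ nothing)  = inj₂ (start F)
        out (inj₁ (just e)) = inj₁ e
        out (inj₂ q)        = inj₂ q

      iterR : Frag Γ E
      iterR = record { Q = Q F ; fin = fin F ; start = start F ; δ = λ q γ → map₁ out (δ F q γ) }

      run-done : ∀ {q p t k e p' t'} → Run F q p t k (just e) p' t' → Run iterR q p t k e p' t'
      run-done (exit eq u)      = exit (cong (map₁ out) eq) u
      run-done (next t₁ eq u r) = next t₁ (cong (map₁ out) eq) u (run-done r)

      run-again : ∀ {q p t k p' t' k' e p'' t''} → Run F q p t k nothing p' t' →
        Run iterR (start F) p' t' k' e p'' t'' → Run iterR q p t (k + k') e p'' t''
      run-again (exit {t' = t'} eq u) s = next t' (cong (map₁ out) eq) u s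
      run-again (next t₁ eq u r)      s = next t₁ (cong (map₁ out) eq) u (run-again r s)

    data PrimQ : Set where
      seek       : PrimQ
      put rewind : Bool → PrimQ

    fin-PrimQ : Finite PrimQ
    fin-PrimQ = fin-retract {B = ⊤ ⊎ (Bool ⊎ Bool)}
      (λ { seek → inj₁ tt ; (put b) → inj₂ (inj₁ b) ; (rewind b) → inj₂ (inj₂ b) })
      (λ { (inj₁ _) → seek ; (inj₂ (inj₁ b)) → put b ; (inj₂ (inj₂ b)) → rewind b })
      (λ { seek → refl ; (put _) → refl ; (rewind _) → refl })
      (fin-⊎ fin-⊤ (fin-⊎ fin-Bool fin-Bool))

    -- Starts and ends at cell 0: f₁ is applied to the first cell satisfying h,
    -- f₂ to its right neighbour, and f₃ to cell 0 on return.
    module _ (lft h test : Γ → Bool) (f₁ f₂ f₃ : Γ → Γ) where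
      private
        δ₁ : Bool → Γ → (Bool ⊎ PrimQ) × Γ × Move
        δ₁ true  γ = inj₂ (put (test γ)) , f₁ γ , right
        δ₁ false γ = inj₂ seek , γ , right
        δ₂ : Bool → Bool → Γ → (Bool ⊎ PrimQ) × Γ × Move
        δ₂ b true  γ = inj₁ b , f₃ γ , stay
        δ₂ b false γ = inj₂ (rewind b) , γ , left
        δ' : PrimQ → Γ → (Bool ⊎ PrimQ) × Γ × Move
        δ' seek       γ = δ₁ (h γ) γ
        δ' (put b)    γ = inj₂ (rewind b) , f₂ γ , left
        δ' (rewind b) γ = δ₂ b (lft γ) γ

      primR : Frag Γ Bool
      primR = record { Q = PrimQ ; fin = fin-PrimQ ; start = seek ; δ = δ' }

      private
        run-rewind : ∀ b t i → (∀ j → lft (t j) ≡ (j ≡ᵇ 0)) → Run primR (rewind b) i t (suc i) b 0 (modify t 0 f₃)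
        run-rewind b t zero    l = exit (cong (λ x → δ₂ b x (t 0)) (l 0)) (upd-modify t 0 f₃)
        run-rewind b t (suc i) l = next t (cong (λ x → δ₂ b x (t (suc i))) (l (suc i))) (upd-id t (suc i)) (run-rewind b t i l)

        run-seek : ∀ t m i p {k b p' t'} → m + i ≡ p → (∀ j → j < p → h (t j) ≡ false) →
          Run primR seek p t k b p' t' → Run primR seek i t (m + k) b p' t'
        run-seek t zero    i p refl l r = r
        run-seek t (suc m) i p e    l r =
          next t (cong (λ x → δ₁ x (t i)) (l i (subst (i <_) e (s≤s (ℕ.m≤n+m i m))))) (upd-id t i)
            (run-seek t m (suc i) p (trans (ℕ.+-suc m i) e) l r)

      -- There are p steps of seeking, one at the cell found, one at its neighbour and p + 1 for the
      -- way back. The left-end mark must survive f₁ and f₂, as `rewind` stops at it.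
      run-prim : ∀ t p → h (t p) ≡ true → (∀ j → j < p → h (t j) ≡ false) → (∀ j → lft (t j) ≡ (j ≡ᵇ 0)) →
        (∀ γ → lft (f₁ γ) ≡ lft γ) → (∀ γ → lft (f₂ γ) ≡ lft γ) →
        Run primR seek 0 t (p + suc (suc (suc p))) (test (t p)) 0 (modify (modify (modify t p f₁) (suc p) f₂) 0 f₃)
      run-prim t p hp hj l l₁ l₂ = run-seek t p 0 p (ℕ.+-identityʳ p) hj
        (next (modify t p f₁) (cong (λ x → δ₁ x (t p)) hp) (upd-modify t p f₁)
        (next (modify (modify t p f₁) (suc p) f₂) refl (upd-modify _ (suc p) f₂)
        (run-rewind _ _ p (λ j → trans (lft-modify (modify t p f₁) (suc p) f₂ l₂ j) (trans (lft-modify t p f₁ l₁ j) (l j))))))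
        where
        lft-modify : ∀ t q f → (∀ γ → lft (f γ) ≡ lft γ) → ∀ j → lft (modify t q f j) ≡ lft (t j)
        lft-modify t q f g j with j ≡ᵇ q
        ... | true  = g (t j)
        ... | false = refl

  -- Without opacity every comparison of composed machines unfolds them.
  module _ {Γ : Set} where
    opaque
      retF : ∀ {E : Set} → E → Frag Γ E
      retF = retR

      run-retF : ∀ {E : Set} {e : E} {p t} → Run (retF e) (start (retF e)) p t 1 e p t
      run-retF = run-ret

      bindF : ∀ {E : Set} → Frag Γ Bool → (Bool → Frag Γ E) → Frag Γ E
      bindF = bindR

      run-bindF : ∀ {E : Set} (F : Frag Γ Bool) (G : Bool → Frag Γ E) {p t k b p' t' k' e p'' t''} → Run F (start F) p t k b p' t' →
        Run (G b) (start (G b)) p' t' k' e p'' t'' → Run (bindF F G) (start (bindF F G)) p t (k + k') e p'' t''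
      run-bindF = λ F G → run-bind F G

      iterF : ∀ {E : Set} → Frag Γ (Maybe E) → Frag Γ E
      iterF = iterR

      run-doneF : ∀ {E : Set} (F : Frag Γ (Maybe E)) {p t k e p' t'} → Run F (start F) p t k (just e) p' t' →
        Run (iterF F) (start (iterF F)) p t k e p' t'
      run-doneF = λ F → run-done F

      run-againF : ∀ {E : Set} (F : Frag Γ (Maybe E)) {p t k p' t' k' e p'' t''} → Run F (start F) p t k nothing p' t' →
        Run (iterF F) (start (iterF F)) p' t' k' e p'' t'' → Run (iterF F) (start (iterF F)) p t (k + k') e p'' t''
      run-againF = λ F → run-again F

      primF : (lft h test : Γ → Bool) (f₁ f₂ f₃ : Γ → Γ) → Frag Γ Bool
      primF = primR

      run-primF : ∀ (lft h test : Γ → Bool) (f₁ f₂ f₃ : Γ → Γ) t p → h (t p) ≡ true → (∀ j → j < p → h (t j) ≡ false) →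
        (∀ j → lft (t j) ≡ (j ≡ᵇ 0)) → (∀ γ → lft (f₁ γ) ≡ lft γ) → (∀ γ → lft (f₂ γ) ≡ lft γ) →
        let F = primF lft h test f₁ f₂ f₃ in
        Run F (start F) 0 t (p + suc (suc (suc p))) (test (t p)) 0 (modify (modify (modify t p f₁) (suc p) f₂) 0 f₃)
      run-primF = run-prim

  nthᵐ : ∀ {A : Set} → List A → ℕ → Maybe A
  nthᵐ []       _       = nothing
  nthᵐ (x ∷ xs) zero    = just x
  nthᵐ (x ∷ xs) (suc i) = nthᵐ xs i

  module _ {Γ I O E : Set} (finΓ : Finite Γ) (F : Frag Γ E) (blank : Γ) (inp : I → Γ) (out : Γ → Maybe O) where
    private
      finQ : Finite (Q F ⊎ ⊤)
      finQ = fin-⊎ (fin F) fin-⊤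

      MStep : Set
      MStep = Maybe (Fin (card finQ) × Fin (card finΓ) × Move)

      goto : E ⊎ Q F → Fin (card finQ)
      goto (inj₁ e) = to finQ (inj₂ tt)
      goto (inj₂ q) = to finQ (inj₁ q)

      δ₀ : Q F ⊎ ⊤ → Γ → MStep
      δ₀ (inj₂ tt) γ = nothing
      δ₀ (inj₁ q)  γ = let (x , γ' , d) = δ F q γ in just (goto x , to finΓ γ' , d)

    -- The additional state `inj₂ tt` has no transition; exiting the fragment means entering it,
    -- whatever the exit value.
    toTM : TM I O
    toTM = record
      { nQ = card finQ ; nΓ = card finΓ
      ; δ = λ q γ → δ₀ (from finQ q) (from finΓ γ)
      ; start = to finQ (inj₁ (start F)) ; blank = to finΓ blank
      ; inp = to finΓ ∘ inp ; out = out ∘ from finΓ }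

    private
      moveH-move : ∀ d p → move toTM d p ≡ moveH d p
      moveH-move left  zero    = refl
      moveH-move left  (suc p) = refl
      moveH-move right p       = refl
      moveH-move stay  p       = refl

      write-upd : ∀ t p γ tc → tc ≗ to finΓ ∘ t → write toTM tc p (to finΓ γ) ≗ to finΓ ∘ upd t p γ
      write-upd t p γ tc e i with i ≡ᵇ p
      ... | true  = refl
      ... | false = e i

      step-eq : ∀ {q p t x γ d} → δ F q (t p) ≡ (x , γ , d) → ∀ tc → tc ≗ to finΓ ∘ t →
        step toTM (cfg (to finQ (inj₁ q)) p tc) ≡ just (cfg (goto x) (moveH d p) (write toTM tc p (to finΓ γ)))
      step-eq {q} {p} {t} {x} {γ} {d} eq tc e
        rewrite from-to finQ (inj₁ q) | e p | from-to finΓ (t p) | eq | moveH-move d p = refl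

      run-step : ∀ k {c c'} → step toTM c ≡ just c' → run toTM (suc k) c ≡ run toTM k c'
      run-step k eq rewrite eq = refl

    halted : ∀ p tc → Halted toTM (cfg (to finQ (inj₂ tt)) p tc)
    halted p tc rewrite from-to finQ (inj₂ tt) = refl

    run-halted : ∀ n c → Halted toTM c → run toTM n c ≡ c
    run-halted zero    c h = refl
    run-halted (suc n) (cfg q p t) h rewrite h = refl

    run-toTM : ∀ {q p t k e p' t'} n → Run F q p t k e p' t' → k ≤ n → ∀ tc → tc ≗ to finΓ ∘ t →
      ∃ λ tc' → run toTM n (cfg (to finQ (inj₁ q)) p tc) ≡ cfg (to finQ (inj₂ tt)) p' tc' × tc' ≗ to finΓ ∘ t'
    run-toTM (suc n) (exit {p = p} {t = t} {γ = γ} {d = d} eq u) k≤n tc e =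
      _ , trans (run-step n (step-eq eq tc e)) (run-halted n _ (halted (moveH d p) (write toTM tc p (to finΓ γ))))
        , λ i → trans (write-upd t p γ tc e i) (cong (to finΓ) (sym (u i)))
    run-toTM (suc n) (next {p = p} {t = t} {γ = γ} t₁ eq u r) (s≤s k≤n) tc e =
      let (tc' , r' , e') = run-toTM n r k≤n (write toTM tc p (to finΓ γ))
                              (λ i → trans (write-upd t p γ tc e i) (cong (to finΓ) (sym (u i))))
      in tc' , trans (run-step n (step-eq eq tc e)) r' , e'

    private
      nth-nthᵐ : ∀ w i → nth toTM w i ≡ nthᵐ w i
      nth-nthᵐ []      i       = refl
      nth-nthᵐ (x ∷ w) zero    = refl
      nth-nthᵐ (x ∷ w) (suc i) = nth-nthᵐ w i

      initial : ∀ w i → Config.tape (initCfg toTM w) i ≡ to finΓ (maybe′ inp blank (nthᵐ w i))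
      initial w i rewrite sym (nth-nthᵐ w i) with nth toTM w i
      ... | just a  = refl
      ... | nothing = refl

      tapeOut : ∀ tc k u → (∀ i → TM.out toTM (tc (k + i)) ≡ nthᵐ u i) → TapeOut toTM tc k u
      tapeOut tc k []      h = trans (cong (TM.out toTM ∘ tc) (sym (ℕ.+-identityʳ k))) (h 0)
      tapeOut tc k (o ∷ u) h = trans (cong (TM.out toTM ∘ tc) (sym (ℕ.+-identityʳ k))) (h 0) ,
        tapeOut tc (suc k) u (λ i → trans (cong (TM.out toTM ∘ tc) (sym (ℕ.+-suc k i))) (h (suc i)))

    computes : ∀ {w k e p' t' u} n → Run F (start F) 0 (λ i → maybe′ inp blank (nthᵐ w i)) k e p' t' → k ≤ n →
      (∀ i → out (t' i) ≡ nthᵐ u i) → ComputesWithin toTM w n u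
    computes {w} {p' = p'} {t'} {u} n r k≤n h
      with run-toTM n r k≤n (Config.tape (initCfg toTM w)) (initial w)
    ... | tc' , eq , e' rewrite eq = halted p' tc' ,
      tapeOut tc' 0 u (λ i → trans (cong (TM.out toTM) (e' i)) (trans (cong out (from-to finΓ (t' i))) (h i)))

-- Loop programs and their compilation to a one-tape machine.

module Programs where
  open Machines
  open import Data.Bool.Properties using (∨-zeroʳ)
  open import Data.Fin using (splitAt)
  open import Relation.Nullary using (does; yes; no)
  open import Relation.Binary.PropositionalEquality using (refl; sym; trans)

  -- The v loop variables in scope (de Bruijn) are changed by the loops only;
  -- A is the address at which the input and the bit arrays are accessed.
  data Prim (r v : ℕ) : Set where
    ltv                    : Fin v → Fin v → Prim r v
    resetA incA incN endA readA : Prim r v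
    getA                   : ℕ → Prim r v
    setA                   : ℕ → Bool → Prim r v
    emit                   : TSym r → Prim r v

  data Cmd (r : ℕ) : ℕ → Set where
    prim : ∀ {v} → Prim r v → Cmd r v
    ret  : ∀ {v} → Bool → Cmd r v
    ite  : ∀ {v} → Cmd r v → Cmd r v → Cmd r v → Cmd r v
    -- The variable runs through the input positions, with the flag only through
    -- those below N; the loop stops with true as soon as the body returns true.
    loop : ∀ {v} → Bool → Cmd r (suc v) → Cmd r v

  -- N is the size of the universe as computed by the program itself, and `arr d i` is bit i of
  -- array d. Everything is kept in unary or as bits, so that one cell of tape serves one number.
  record St (r : ℕ) : Set where
    constructor st
    field
      N A : ℕ
      arr : ℕ → ℕ → Bool
      out : List (TSym r)
  open St public

  isOne : Maybe (Fin 2) → Bool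
  isOne (just (suc zero)) = true
  isOne _                 = false

  loopS : ∀ {r} → (ℕ → St r → Bool × St r) → Bool → ℕ → ℕ → St r → Bool × St r
  loopS f flag zero       i s = false , s
  loopS f flag (suc fuel) i s =
    if flag ∧ (i ≡ᵇ N s) then (false , s)
    else (if proj₁ (f i s) then (true , proj₂ (f i s)) else loopS f flag fuel (suc i) (proj₂ (f i s)))

  semP : ∀ {r v} → List (Fin 2) → Prim r v → Vec ℕ v → St r → Bool × St r
  semP w (ltv x y)  η s = (lookup η x <ᵇ lookup η y) , s
  semP w resetA     η s = false , record s { A = 0 }
  semP w incA       η s = false , record s { A = suc (A s) }
  semP w incN       η s = false , record s { N = suc (N s) }
  semP w endA       η s = is-nothing (nthᵐ w (A s)) , s
  semP w readA      η s = isOne (nthᵐ w (A s)) , s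
  semP w (getA d)   η s = arr s d (A s) , s
  semP w (setA d b) η s = false , record s { arr = λ e i → if (e ≡ᵇ d) ∧ (i ≡ᵇ A s) then b else arr s e i }
  semP w (emit o)   η s = false , record s { out = out s ++ o ∷ [] }

  sem : ∀ {r v} → List (Fin 2) → Cmd r v → Vec ℕ v → St r → Bool × St r
  sem w (prim p)    η s = semP w p η s
  sem w (ret b)     η s = b , s
  sem w (ite c d e) η s = if proj₁ (sem w c η s) then sem w d η (proj₂ (sem w c η s)) else sem w e η (proj₂ (sem w c η s))
  sem w (loop b c)  η s = loopS (λ i → sem w c (i ∷ η)) b (length w) 0 s

  -- Bounds both the number of passes over the tape and the growth of the counters. A primitive
  -- counts 2 because `emit` takes two passes; the 3 per iteration pays for the test, the move of
  -- the loop mark and the return.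
  prims : ∀ {r v} → ℕ → Cmd r v → ℕ
  prims L (prim _)    = 2
  prims L (ret _)     = 1
  prims L (ite c d e) = prims L c + (prims L d + prims L e)
  prims L (loop _ c)  = suc L * (3 + prims L c)

  -- The numbers of variable tracks and of array tracks that the tape must provide.
  needL needA : ∀ {r v} → Cmd r v → ℕ
  needL {v = v} (prim _)   = v
  needL (ret _)            = 0
  needL (ite c d e)        = needL c ⊔ (needL d ⊔ needL e)
  needL {v = v} (loop _ c) = suc v ⊔ needL c
  needA (prim (getA d))   = suc d
  needA (prim (setA d _)) = suc d
  needA (prim _)          = 0
  needA (ret _)           = 0
  needA (ite c d e)       = needA c ⊔ (needA d ⊔ needA e)
  needA (loop _ c)        = needA c

  -- A variable is kept as a mark on the track given by its level; a variable
  -- out of scope is parked at position 0.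
  level : ∀ {v} → Fin v → ℕ
  level {suc v} zero    = v
  level {suc v} (suc x) = level x

  level< : ∀ {v} (x : Fin v) → level x < v
  level< {suc v} zero    = ℕ.≤-refl
  level< {suc v} (suc x) = ℕ.m≤n⇒m≤1+n (level< x)

  lev : ∀ {v} → Vec ℕ v → ℕ → ℕ
  lev []              x = 0
  lev (_∷_ {v} i η)   x = if x ≡ᵇ v then i else lev η x

  lev-level : ∀ {v} (η : Vec ℕ v) x → lev η (level x) ≡ lookup η x
  lev-level (_∷_ {v} i η) zero    rewrite ≡ᵇ-refl v = refl
  lev-level (_∷_ {v} i η) (suc x) rewrite ≡ᵇ-< (level< x) = lev-level η x

  lev-out : ∀ {v} (η : Vec ℕ v) x → v ≤ x → lev η x ≡ 0
  lev-out []            x h = refl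
  lev-out (_∷_ {v} i η) x h rewrite trans (≡ᵇ-sym x v) (≡ᵇ-< h) = lev-out η x (ℕ.<⇒≤ h)

  -- On the tape a variable with value 0 looks like one out of scope. Hence a loop is entered
  -- without any action and left by resetting its mark.
  lev-0∷ : ∀ {v} (η : Vec ℕ v) → lev (0 ∷ η) ≗ lev η
  lev-0∷ {v} η x with x ≡ᵇ v in eq
  ... | true  = sym (lev-out η x (ℕ.≤-reflexive (sym (≡ᵇ-sound x v eq))))
  ... | false = refl

  nthᵐ-length : ∀ {A : Set} (w : List A) i → length w ≤ i → nthᵐ w i ≡ nothing
  nthᵐ-length []      i       h       = refl
  nthᵐ-length (x ∷ w) (suc i) (s≤s h) = nthᵐ-length w i h

  nthᵐ-< : ∀ {A : Set} (w : List A) i → i < length w → is-nothing (nthᵐ w i) ≡ false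
  nthᵐ-< (x ∷ w) zero    h       = refl
  nthᵐ-< (x ∷ w) (suc i) (s≤s h) = nthᵐ-< w i h

  nthᵐ-∷ʳ : ∀ {A : Set} (u : List A) o i → nthᵐ (u ++ o ∷ []) i ≡ (if i ≡ᵇ length u then just o else nthᵐ u i)
  nthᵐ-∷ʳ []      o zero    = refl
  nthᵐ-∷ʳ []      o (suc i) = refl
  nthᵐ-∷ʳ (x ∷ u) o zero    = refl
  nthᵐ-∷ʳ (x ∷ u) o (suc i) = nthᵐ-∷ʳ u o i

  <ᵇ-true : ∀ {a b} → a < b → (a <ᵇ b) ≡ true
  <ᵇ-true {zero}  (s≤s h) = refl
  <ᵇ-true {suc a} (s≤s h) = <ᵇ-true h

  <ᵇ-false : ∀ {a b} → b ≤ a → (a <ᵇ b) ≡ false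
  <ᵇ-false {a}     z≤n     = refl
  <ᵇ-false {suc a} (s≤s h) = <ᵇ-false h

  record Cell (r nb : ℕ) : Set where
    constructor cell
    field
      inp  : Maybe (Fin 2)
      osym : Maybe (TSym r)
      bits : Vec Bool nb

  fin-Cell : ∀ r nb → Finite (Cell r nb)
  fin-Cell r nb = fin-retract (λ (cell i o b) → i , o , b) (λ (i , o , b) → cell i o b) (λ _ → refl)
    (fin-× (fin-Maybe (fin-Fin 2)) (fin-× (fin-Maybe (fin-TSym r)) (fin-Vec fin-Bool nb)))

  module Compile (r np nt : ℕ) where

    nb : ℕ
    nb = 4 + (np + nt)

    Γ : Set
    Γ = Cell r nb

    -- Tracks for the left end of the tape, the counters N and A, and the length of the output.
    LEFT NN AA OO : Fin nb
    LEFT = zero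
    NN   = suc zero
    AA   = suc (suc zero)
    OO   = suc (suc (suc zero))

    rest : Fin (np + nt) → Fin nb
    rest y = suc (suc (suc (suc y)))

    mark : Fin nb → Γ → Bool
    mark x γ = lookup (Cell.bits γ) x

    setb : Fin nb → Bool → Γ → Γ
    setb x b γ = record γ { bits = Cell.bits γ [ x ]≔ b }

    sets : TSym r → Γ → Γ
    sets o γ = record γ { osym = just o }

    opF : (h test : Γ → Bool) (f₁ f₂ f₃ : Γ → Γ) → Frag Γ Bool
    opF = primF (mark LEFT)

    incF resetF : Fin nb → Frag Γ Bool
    incF x   = opF (mark x) (λ _ → false) (setb x false) (setb x true) id
    resetF x = opF (mark x) (λ _ → false) (setb x false) id (setb x true)

    testF : Fin nb → (Γ → Bool) → Frag Γ Bool
    testF x test = opF (mark x) test id id id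

    loopName : ∀ {x} → x < np → Fin nb
    loopName h = rest (fromℕ< h ↑ˡ nt)

    arrName : ∀ {d} → d < nt → Fin nb
    arrName h = rest (np ↑ʳ fromℕ< h)

    emitK : TSym r → Bool → Frag Γ Bool
    emitK o _ = incF OO

    compileP : ∀ {v} (p : Prim r v) → v ≤ np → needA (prim p) ≤ nt → Frag Γ Bool
    -- The pass stops at the first of the two marks; x is smaller exactly if X stands there and Y
    -- does not.
    compileP (ltv x y)  hv hd = opF (λ γ → mark X γ ∨ mark Y γ) (λ γ → mark X γ ∧ not (mark Y γ)) id id id
      where X = loopName (ℕ.<-≤-trans (level< x) hv)
            Y = loopName (ℕ.<-≤-trans (level< y) hv)
    compileP resetA     hv hd = resetF AA
    compileP incA       hv hd = incF AA
    compileP incN       hv hd = incF NN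
    compileP endA       hv hd = testF AA (λ γ → is-nothing (Cell.inp γ))
    compileP readA      hv hd = testF AA (λ γ → isOne (Cell.inp γ))
    compileP (getA d)   hv hd = testF AA (mark (arrName hd))
    compileP (setA d b) hv hd = opF (mark AA) (λ _ → false) (setb (arrName hd) b) id id
    compileP (emit o)   hv hd = bindF (opF (mark OO) (λ _ → false) (sets o) id id) (emitK o)

    thenR : Maybe Bool → Bool → Frag Γ (Maybe Bool)
    thenR e _ = retF e

    loopEnd : Fin nb → Bool → Frag Γ (Maybe Bool)
    loopEnd x b = bindF (resetF x) (thenR (just b))

    afterBody : Fin nb → Bool → Frag Γ (Maybe Bool)
    afterBody x true  = loopEnd x true
    afterBody x false = bindF (incF x) (thenR nothing)

    afterTest : Fin nb → Frag Γ Bool → Bool → Frag Γ (Maybe Bool)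
    afterTest x F true  = loopEnd x false
    afterTest x F false = bindF F (afterBody x)

    loopF : Fin nb → Bool → Frag Γ Bool → Frag Γ Bool
    -- The loop ends when the mark of its variable has run past the input or, with the flag, has
    -- reached the mark of N.
    loopF x flag F = iterF (bindF (testF x (λ γ → is-nothing (Cell.inp γ) ∨ (flag ∧ mark NN γ))) (afterTest x F))

    branch : Frag Γ Bool → Frag Γ Bool → Bool → Frag Γ Bool
    branch F G true  = F
    branch F G false = G

    compile : ∀ {v} (c : Cmd r v) → needL c ≤ np → needA c ≤ nt → Frag Γ Bool
    compile (prim p)    hl ha = compileP p hl ha
    compile (ret b)     hl ha = retF b
    compile (ite c d e) hl ha = bindF (compile c (ℕ.m⊔n≤o⇒m≤o _ _ hl) (ℕ.m⊔n≤o⇒m≤o _ _ ha))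
      (branch (compile d (ℕ.m⊔n≤o⇒m≤o _ _ (ℕ.m⊔n≤o⇒n≤o (needL c) _ hl)) (ℕ.m⊔n≤o⇒m≤o _ _ (ℕ.m⊔n≤o⇒n≤o (needA c) _ ha)))
              (compile e (ℕ.m⊔n≤o⇒n≤o (needL d) _ (ℕ.m⊔n≤o⇒n≤o (needL c) _ hl))
                         (ℕ.m⊔n≤o⇒n≤o (needA d) _ (ℕ.m⊔n≤o⇒n≤o (needA c) _ ha))))
    compile {v} (loop b c)  hl ha =
      loopF (loopName (ℕ.m⊔n≤o⇒m≤o (suc v) (needL c) hl)) b (compile c (ℕ.m⊔n≤o⇒n≤o (suc v) (needL c) hl) ha)

    module _ (w : List (Fin 2)) where

      track : (ℕ → ℕ) → St r → Fin nb → ℕ → Bool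
      trackR : (ℕ → ℕ) → St r → Fin np ⊎ Fin nt → ℕ → Bool
      track ηf s zero                   i = i ≡ᵇ 0
      track ηf s (suc zero)             i = i ≡ᵇ N s
      track ηf s (suc (suc zero))       i = i ≡ᵇ A s
      track ηf s (suc (suc (suc zero))) i = i ≡ᵇ length (out s)
      track ηf s (suc (suc (suc (suc y)))) i = trackR ηf s (splitAt np y) i
      trackR ηf s (inj₁ x) i = i ≡ᵇ ηf (toℕ x)
      trackR ηf s (inj₂ d) i = arr s (toℕ d) i

      track-loop : ∀ ηf s {x} (h : x < np) i → track ηf s (loopName h) i ≡ (i ≡ᵇ ηf x)
      track-loop ηf s h i rewrite Fin.splitAt-↑ˡ np (fromℕ< h) nt | Fin.toℕ-fromℕ< h = refl

      track-arr : ∀ ηf s {d} (h : d < nt) i → track ηf s (arrName h) i ≡ arr s d i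
      track-arr ηf s h i rewrite Fin.splitAt-↑ʳ np nt (fromℕ< h) | Fin.toℕ-fromℕ< h = refl

      -- The output track and the bit tracks. Assertions are about these and not about program
      -- states, because the tape between the two passes of `emit` represents no state.
      Desc : Set
      Desc = (ℕ → Maybe (TSym r)) × (Fin nb → ℕ → Bool)

      record RepD (D : Desc) (t : ℕ → Γ) : Set where
        constructor rep
        field
          inp-eq : ∀ i → Cell.inp (t i) ≡ nthᵐ w i
          sym-eq : ∀ i → Cell.osym (t i) ≡ proj₁ D i
          bit-eq : ∀ x i → mark x (t i) ≡ proj₂ D x i
      open RepD

      desc : (ℕ → ℕ) → St r → Desc
      desc ηf s = nthᵐ (out s) , track ηf s

      infix 4 _≈D_
      _≈D_ : Desc → Desc → Set
      (sy , bt) ≈D (sy' , bt') = sy ≗ sy' × (∀ x i → bt x i ≡ bt' x i)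

      RepD-ext : ∀ {D D' t} → D ≈D D' → RepD D t → RepD D' t
      RepD-ext (f , g) (rep a b c) = rep a (λ i → trans (b i) (f i)) (λ x i → trans (c x i) (g x i))

      write-bit : (Fin nb → ℕ → Bool) → ℕ → Fin nb → Bool → Fin nb → ℕ → Bool
      write-bit bt p x b y i = if does (y Fin.≟ x) ∧ (i ≡ᵇ p) then b else bt y i

      rep-id : ∀ {D t} p → RepD D t → RepD D (modify t p id)
      rep-id {t = t} p (rep a b c) = rep
        (λ i → trans (cong Cell.inp (sym (same i))) (a i)) (λ i → trans (cong Cell.osym (sym (same i))) (b i))
        (λ x i → trans (cong (mark x) (sym (same i))) (c x i))
        where
        same : ∀ i → t i ≡ modify t p id i
        same i with i ≡ᵇ p
        ... | true  = refl
        ... | false = refl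

      rep-setb : ∀ {sy bt t} p x b → RepD (sy , bt) t → RepD (sy , write-bit bt p x b) (modify t p (setb x b))
      rep-setb {sy} {bt} {t} p x b (rep f g h) = rep (λ i → trans (f' i) (f i)) (λ i → trans (g' i) (g i)) h'
        where
        f' : ∀ i → Cell.inp (modify t p (setb x b) i) ≡ Cell.inp (t i)
        f' i with i ≡ᵇ p
        ... | true  = refl
        ... | false = refl
        g' : ∀ i → Cell.osym (modify t p (setb x b) i) ≡ Cell.osym (t i)
        g' i with i ≡ᵇ p
        ... | true  = refl
        ... | false = refl
        h' : ∀ y i → mark y (modify t p (setb x b) i) ≡ write-bit bt p x b y i
        h' y i with i ≡ᵇ p | y Fin.≟ x
        ... | true  | yes refl = Vec.lookup∘update x (Cell.bits (t i)) b
        ... | true  | no y≢x   = trans (Vec.lookup∘update′ y≢x (Cell.bits (t i)) b) (h y i)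
        ... | false | yes _    = h y i
        ... | false | no _     = h y i

      rep-sets : ∀ {sy bt t} p o → RepD (sy , bt) t → RepD ((λ i → if i ≡ᵇ p then just o else sy i) , bt) (modify t p (sets o))
      rep-sets {sy} {bt} {t} p o (rep f g h) = rep (λ i → trans (f' i) (f i)) g' (λ x i → trans (h' x i) (h x i))
        where
        f' : ∀ i → Cell.inp (modify t p (sets o) i) ≡ Cell.inp (t i)
        f' i with i ≡ᵇ p
        ... | true  = refl
        ... | false = refl
        g' : ∀ i → Cell.osym (modify t p (sets o) i) ≡ (if i ≡ᵇ p then just o else sy i)
        g' i with i ≡ᵇ p
        ... | true  = refl
        ... | false = g i
        h' : ∀ y i → mark y (modify t p (sets o) i) ≡ mark y (t i)
        h' y i with i ≡ᵇ p
        ... | true  = refl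
        ... | false = refl

      -- The mark is set after it has been cleared, so p and q may coincide, as they do when a
      -- counter at 0 is reset.
      move-mark : ∀ {bt bt' : Fin nb → ℕ → Bool} x p q → (∀ i → bt x i ≡ (i ≡ᵇ p)) → (∀ i → bt' x i ≡ (i ≡ᵇ q)) →
        (∀ y → y ≢ x → ∀ i → bt y i ≡ bt' y i) → ∀ y i → write-bit (write-bit bt p x false) q x true y i ≡ bt' y i
      move-mark x p q bx bx' by y i with y Fin.≟ x
      ... | no y≢x = by y y≢x i
      ... | yes refl with i ≡ᵇ q in eq | i ≡ᵇ p in eq'
      ...   | true  | _     = sym (trans (bx' i) eq)
      ...   | false | true  = sym (trans (bx' i) eq)
      ...   | false | false = trans (trans (bx i) eq') (sym (trans (bx' i) eq))

      -- A Hoare triple with a time bound; every run starts and ends with the head on cell 0, which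
      -- makes runs composable.
      record Exec {E : Set} (F : Frag Γ E) (D : Desc) (e : E) (D' : Desc) (cost : ℕ) : Set where
        constructor exec
        field go : ∀ t → RepD D t → ∃ λ t' → ∃ λ k → Run F (Frag.start F) 0 t k e 0 t' × RepD D' t' × k ≤ cost

      exec-cost : ∀ {E : Set} {F : Frag Γ E} {D e D' k k'} → k ≤ k' → Exec F D e D' k → Exec F D e D' k'
      exec-cost h (exec f) = exec λ t x → let (t' , k , run , y , l) = f t x in t' , k , run , y , ℕ.≤-trans l h

      exec-bind : ∀ {E : Set} {F : Frag Γ Bool} {G : Bool → Frag Γ E} {D b D₁ e D₂ k₁ k₂} →
        Exec F D b D₁ k₁ → Exec (G b) D₁ e D₂ k₂ → Exec (bindF F G) D e D₂ (k₁ + k₂)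
      exec-bind {F = F} {G} {k₁ = c₁} {c₂} (exec f) (exec g) = exec λ t x →
        let (t₁ , k₁ , run₁ , x₁ , l₁) = f t x
            (t₂ , k₂ , run₂ , x₂ , l₂) = g t₁ x₁
        in t₂ , k₁ + k₂ , run-bindF F G run₁ run₂ , x₂ , ℕ.+-mono-≤ l₁ l₂

      exec-ret : ∀ {E : Set} {e : E} {D} → Exec (retF e) D e D 1
      exec-ret = exec λ t x → t , 1 , run-retF , x , ℕ.≤-refl

      exec-ext : ∀ {E : Set} {F : Frag Γ E} {D₁ D₂ D₃ D₄ e k} → D₁ ≈D D₂ → D₃ ≈D D₄ → Exec F D₂ e D₃ k → Exec F D₁ e D₄ k
      exec-ext f g (exec h) = exec λ t x →
        let (t' , k , run , y , l) = h t (RepD-ext f x) in t' , k , run , RepD-ext g y , l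

      ≈D-refl : ∀ {D} → D ≈D D
      ≈D-refl = (λ _ → refl) , λ _ _ → refl

      ≈D-env : ∀ {ηf ηf'} s → ηf ≗ ηf' → desc ηf s ≈D desc ηf' s
      ≈D-env {ηf} {ηf'} s e = (λ _ → refl) , tr
        where
        tr : ∀ y i → track ηf s y i ≡ track ηf' s y i
        tr zero                   i = refl
        tr (suc zero)             i = refl
        tr (suc (suc zero))       i = refl
        tr (suc (suc (suc zero))) i = refl
        tr (suc (suc (suc (suc y)))) i with splitAt np y
        ... | inj₁ x = cong (i ≡ᵇ_) (e (toℕ x))
        ... | inj₂ _ = refl

      module _ (B : ℕ) where

        unit : ℕ
        unit = B + suc (suc (suc B))

        exec-op : ∀ {h test f₁ f₂ f₃ D D' b} p → p ≤ B →
          (∀ i → proj₂ D LEFT i ≡ (i ≡ᵇ 0)) →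
          (∀ t → RepD D t → h (t p) ≡ true × (∀ j → j < p → h (t j) ≡ false) × test (t p) ≡ b) →
          (∀ γ → mark LEFT (f₁ γ) ≡ mark LEFT γ) → (∀ γ → mark LEFT (f₂ γ) ≡ mark LEFT γ) →
          (∀ t → RepD D t → RepD D' (modify (modify (modify t p f₁) (suc p) f₂) 0 f₃)) →
          Exec (opF h test f₁ f₂ f₃) D b D' unit
        exec-op {h} {test} {f₁} {f₂} {f₃} p p≤B L found l₁ l₂ R = exec λ t x →
          let (a , b , c) = found t x in
          _ , _ , subst (λ b → Run (opF h test f₁ f₂ f₃) (Frag.start (opF h test f₁ f₂ f₃)) 0 t _ b 0 _) c
                    (run-primF (mark LEFT) h test f₁ f₂ f₃ t p a b (λ j → trans (bit-eq x LEFT j) (L j)) l₁ l₂)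
          , R t x , ℕ.+-mono-≤ p≤B (s≤s (s≤s (s≤s p≤B)))

        found-mark : ∀ {D} (test : Γ → Bool) (b : Bool) x p → (∀ i → proj₂ D x i ≡ (i ≡ᵇ p)) →
          (∀ t → RepD D t → test (t p) ≡ b) →
          ∀ t → RepD D t → mark x (t p) ≡ true × (∀ j → j < p → mark x (t j) ≡ false) × test (t p) ≡ b
        found-mark test b x p e c t y = trans (bit-eq y x p) (trans (e p) (≡ᵇ-refl p)) ,
          (λ j h → trans (bit-eq y x j) (trans (e j) (≡ᵇ-< h))) , c t y

        setb-LEFT : ∀ x b → x ≢ LEFT → ∀ γ → mark LEFT (setb x b γ) ≡ mark LEFT γ
        setb-LEFT x b ne γ = Vec.lookup∘update′ (λ e → ne (sym e)) (Cell.bits γ) b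

        exec-inc : ∀ {sy bt sy' bt'} x p → p ≤ B → x ≢ LEFT → (∀ i → bt LEFT i ≡ (i ≡ᵇ 0)) → sy ≗ sy' →
          (∀ i → bt x i ≡ (i ≡ᵇ p)) →
          (∀ i → bt' x i ≡ (i ≡ᵇ suc p)) → (∀ y → y ≢ x → ∀ i → bt y i ≡ bt' y i) →
          Exec (incF x) (sy , bt) false (sy' , bt') unit
        exec-inc x p p≤B ne L o e e' f = exec-op p p≤B L (found-mark (λ _ → false) false x p e (λ _ _ → refl))
          (setb-LEFT x false ne) (setb-LEFT x true ne)
          (λ t y → rep-id 0 (RepD-ext (o , move-mark x p (suc p) e e' f)
            (rep-setb (suc p) x true (rep-setb p x false y))))

        exec-reset : ∀ {sy bt sy' bt'} x p → p ≤ B → x ≢ LEFT → (∀ i → bt LEFT i ≡ (i ≡ᵇ 0)) → sy ≗ sy' →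
          (∀ i → bt x i ≡ (i ≡ᵇ p)) →
          (∀ i → bt' x i ≡ (i ≡ᵇ 0)) → (∀ y → y ≢ x → ∀ i → bt y i ≡ bt' y i) →
          Exec (resetF x) (sy , bt) false (sy' , bt') unit
        exec-reset x p p≤B ne L o e e' f = exec-op p p≤B L (found-mark (λ _ → false) false x p e (λ _ _ → refl))
          (setb-LEFT x false ne) (λ _ → refl)
          (λ t y → RepD-ext (o , move-mark x p 0 e e' f)
            (rep-setb 0 x true (rep-id (suc p) (rep-setb p x false y))))

        exec-test : ∀ {D} test b x p → p ≤ B → (∀ i → proj₂ D LEFT i ≡ (i ≡ᵇ 0)) → (∀ i → proj₂ D x i ≡ (i ≡ᵇ p)) →
          (∀ t → RepD D t → test (t p) ≡ b) → Exec (testF x test) D b D unit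
        exec-test test b x p p≤B L e c = exec-op p p≤B L (found-mark test b x p e c) (λ _ → refl) (λ _ → refl)
          (λ t y → rep-id 0 (rep-id (suc p) (rep-id p y)))

        exec-lt : ∀ {D} X Y a b → a ≤ B → b ≤ B → (∀ i → proj₂ D LEFT i ≡ (i ≡ᵇ 0)) →
          (∀ i → proj₂ D X i ≡ (i ≡ᵇ a)) → (∀ i → proj₂ D Y i ≡ (i ≡ᵇ b)) →
          Exec (opF (λ γ → mark X γ ∨ mark Y γ) (λ γ → mark X γ ∧ not (mark Y γ)) id id id) D (a <ᵇ b) D unit
        exec-lt {D} X Y a b ha hb L eX eY with ℕ.<-cmp a b
        ... | tri< a<b _ _ = exec-op a ha L (λ t y →
                let X= : ∀ i → mark X (t i) ≡ (i ≡ᵇ a)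
                    X= i = trans (bit-eq y X i) (eX i)
                    Y= : ∀ i → mark Y (t i) ≡ (i ≡ᵇ b)
                    Y= i = trans (bit-eq y Y i) (eY i)
                in cong (_∨ mark Y (t a)) (trans (X= a) (≡ᵇ-refl a)) ,
                   (λ i h → cong₂ _∨_ (trans (X= i) (≡ᵇ-< h)) (trans (Y= i) (≡ᵇ-< (ℕ.<-trans h a<b)))) ,
                   trans (cong₂ (λ p q → p ∧ not q) (trans (X= a) (≡ᵇ-refl a)) (trans (Y= a) (≡ᵇ-< a<b))) (sym (<ᵇ-true a<b)))
                (λ _ → refl) (λ _ → refl) (λ t y → rep-id 0 (rep-id (suc a) (rep-id a y)))
        ... | tri≈ _ refl _ = exec-op a ha L (λ t y →
                let X= : ∀ i → mark X (t i) ≡ (i ≡ᵇ a)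
                    X= i = trans (bit-eq y X i) (eX i)
                    Y= : ∀ i → mark Y (t i) ≡ (i ≡ᵇ b)
                    Y= i = trans (bit-eq y Y i) (eY i)
                in cong (_∨ mark Y (t a)) (trans (X= a) (≡ᵇ-refl a)) ,
                   (λ i h → cong₂ _∨_ (trans (X= i) (≡ᵇ-< h)) (trans (Y= i) (≡ᵇ-< h))) ,
                   trans (cong₂ (λ p q → p ∧ not q) (trans (X= a) (≡ᵇ-refl a)) (trans (Y= a) (≡ᵇ-refl a)))
                     (sym (<ᵇ-false (ℕ.≤-refl {a}))))
                (λ _ → refl) (λ _ → refl) (λ t y → rep-id 0 (rep-id (suc a) (rep-id a y)))
        ... | tri> _ _ b<a = exec-op b hb L (λ t y →
                let X= : ∀ i → mark X (t i) ≡ (i ≡ᵇ a)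
                    X= i = trans (bit-eq y X i) (eX i)
                    Y= : ∀ i → mark Y (t i) ≡ (i ≡ᵇ b)
                    Y= i = trans (bit-eq y Y i) (eY i)
                in trans (cong (mark X (t b) ∨_) (trans (Y= b) (≡ᵇ-refl b))) (∨-zeroʳ _) ,
                   (λ i h → cong₂ _∨_ (trans (X= i) (≡ᵇ-< (ℕ.<-trans h b<a))) (trans (Y= i) (≡ᵇ-< h))) ,
                   trans (cong (_∧ not (mark Y (t b))) (trans (X= b) (≡ᵇ-< b<a))) (sym (<ᵇ-false (ℕ.<⇒≤ b<a))))
                (λ _ → refl) (λ _ → refl) (λ t y → rep-id 0 (rep-id (suc b) (rep-id b y)))

        two-units : ∀ {F : Frag Γ Bool} {D e D'} → Exec F D e D' unit → Exec F D e D' (2 * unit)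
        two-units = exec-cost (ℕ.m≤m+n unit (unit + 0))

        track-A : ∀ ηf s a y → y ≢ AA → ∀ i → track ηf s y i ≡ track ηf (record s { A = a }) y i
        track-A ηf s a zero                   ne i = refl
        track-A ηf s a (suc zero)             ne i = refl
        track-A ηf s a (suc (suc zero))       ne i = ⊥-elim (ne refl)
        track-A ηf s a (suc (suc (suc zero))) ne i = refl
        track-A ηf s a (suc (suc (suc (suc y)))) ne i with splitAt np y
        ... | inj₁ _ = refl
        ... | inj₂ _ = refl

        exec-prim : ∀ {v} (p : Prim r v) hv hd (η : Vec ℕ v) s →
          (∀ x → lookup η x ≤ B) → N s ≤ B → A s ≤ B → length (out s) ≤ B →
          Exec (compileP p hv hd) (desc (lev η) s) (proj₁ (semP w p η s)) (desc (lev η) (proj₂ (semP w p η s))) (2 * unit)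
        exec-prim (ltv x y) hv hd η s hη hN hA hO = two-units (exec-lt _ _ (lookup η x) (lookup η y) (hη x) (hη y) (λ _ → refl)
          (λ i → trans (track-loop (lev η) s (ℕ.<-≤-trans (level< x) hv) i) (cong (i ≡ᵇ_) (lev-level η x)))
          (λ i → trans (track-loop (lev η) s (ℕ.<-≤-trans (level< y) hv) i) (cong (i ≡ᵇ_) (lev-level η y))))
        exec-prim resetA hv hd η s hη hN hA hO = two-units (exec-reset AA (A s) hA (λ ()) (λ _ → refl) (λ _ → refl) (λ _ → refl) (λ _ → refl)
          (track-A (lev η) s 0))
        exec-prim incA hv hd η s hη hN hA hO = two-units (exec-inc AA (A s) hA (λ ()) (λ _ → refl) (λ _ → refl) (λ _ → refl) (λ _ → refl)
          (track-A (lev η) s (suc (A s))))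
        exec-prim incN hv hd η s hη hN hA hO = two-units (exec-inc NN (N s) hN (λ ()) (λ _ → refl) (λ _ → refl) (λ _ → refl) (λ _ → refl) tr)
          where
          tr : ∀ y → y ≢ NN → ∀ i → track (lev η) s y i ≡ track (lev η) (record s { N = suc (N s) }) y i
          tr zero                   ne i = refl
          tr (suc zero)             ne i = ⊥-elim (ne refl)
          tr (suc (suc zero))       ne i = refl
          tr (suc (suc (suc zero))) ne i = refl
          tr (suc (suc (suc (suc y)))) ne i with splitAt np y
          ... | inj₁ _ = refl
          ... | inj₂ _ = refl
        exec-prim endA hv hd η s hη hN hA hO = two-units (exec-test _ _ AA (A s) hA (λ _ → refl) (λ _ → refl)
          (λ t y → cong is-nothing (inp-eq y (A s))))
        exec-prim readA hv hd η s hη hN hA hO = two-units (exec-test _ _ AA (A s) hA (λ _ → refl) (λ _ → refl)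
          (λ t y → cong isOne (inp-eq y (A s))))
        exec-prim (getA d) hv hd η s hη hN hA hO = two-units (exec-test _ _ AA (A s) hA (λ _ → refl) (λ _ → refl)
          (λ t y → trans (bit-eq y (arrName hd) (A s)) (track-arr (lev η) s hd (A s))))
        exec-prim (setA d b) hv hd η s hη hN hA hO = two-units (exec-op (A s) hA (λ _ → refl)
          (found-mark (λ _ → false) false AA (A s) (λ _ → refl) (λ _ _ → refl))
          (setb-LEFT (arrName hd) b (λ ())) (λ _ → refl)
          (λ t y → rep-id 0 (rep-id (suc (A s)) (RepD-ext ((λ _ → refl) , tr) (rep-setb (A s) (arrName hd) b y)))))
          where
          s' = proj₂ (semP w (setA d b) η s)
          tr : ∀ y i → write-bit (track (lev η) s) (A s) (arrName hd) b y i ≡ track (lev η) s' y i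
          tr zero                   i = refl
          tr (suc zero)             i = refl
          tr (suc (suc zero))       i = refl
          tr (suc (suc (suc zero))) i = refl
          tr (suc (suc (suc (suc y)))) i with y Fin.≟ (np ↑ʳ fromℕ< hd)
          ... | yes refl rewrite Fin.splitAt-↑ʳ np nt (fromℕ< hd) | Fin.toℕ-fromℕ< hd | ≡ᵇ-refl d = refl
          ... | no ne with splitAt np y in eq
          ...   | inj₁ _ = refl
          ...   | inj₂ d' with toℕ d' ≡ᵇ d in eq'
          ...     | false = refl
          ...     | true  = ⊥-elim (ne (trans (sym (Fin.splitAt⁻¹-↑ʳ eq)) (cong (np ↑ʳ_)
                      (Fin.toℕ-injective (trans (≡ᵇ-sound (toℕ d') d eq') (sym (Fin.toℕ-fromℕ< hd)))))))
        exec-prim (emit o) hv hd η s hη hN hA hO = exec-cost (ℕ.≤-reflexive (cong (unit +_) (sym (ℕ.+-identityʳ unit))))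
          (exec-bind {D₁ = (λ i → if i ≡ᵇ length (out s) then just o else nthᵐ (out s) i) , track (lev η) s}
            (exec-op (length (out s)) hO (λ _ → refl)
              (found-mark (λ _ → false) false OO (length (out s)) (λ _ → refl) (λ _ _ → refl))
              (λ _ → refl) (λ _ → refl)
              (λ t y → rep-id 0 (rep-id (suc (length (out s))) (rep-sets (length (out s)) o y))))
            (exec-inc OO (length (out s)) hO (λ ()) (λ _ → refl) (λ i → sym (nthᵐ-∷ʳ (out s) o i)) (λ _ → refl)
              (λ i → cong (i ≡ᵇ_) (trans (List.length-++ (out s)) (ℕ.+-comm _ 1))) tr))
          where
          tr : ∀ y → y ≢ OO → ∀ i → track (lev η) s y i ≡ track (lev η) (record s { out = out s ++ o ∷ [] }) y i
          tr zero                   ne i = refl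
          tr (suc zero)             ne i = refl
          tr (suc (suc zero))       ne i = refl
          tr (suc (suc (suc zero))) ne i = ⊥-elim (ne refl)
          tr (suc (suc (suc (suc y)))) ne i with splitAt np y
          ... | inj₁ _ = refl
          ... | inj₂ _ = refl

        -- A potential that grows by at most 2 with each primitive. It keeps all counters within B,
        -- and only then does a pass cost at most `unit`; so time and potential are bounded in one
        -- induction.
        pot : St r → ℕ
        pot s = N s + (A s + length (out s))

        pot-prim : ∀ {v} (p : Prim r v) η s → pot (proj₂ (semP w p η s)) ≤ pot s + 2
        pot-prim (ltv x y)  η s = ℕ.m≤m+n (pot s) 2
        pot-prim resetA     η s = ℕ.≤-trans (ℕ.+-monoʳ-≤ (N s) (ℕ.m≤n+m _ (A s))) (ℕ.m≤m+n (pot s) 2)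
        pot-prim incA       η s = ℕ.≤-trans (ℕ.≤-reflexive (trans (ℕ.+-suc (N s) _) (ℕ.+-comm 1 (pot s)))) (ℕ.+-monoʳ-≤ (pot s) (s≤s z≤n))
        pot-prim incN       η s = ℕ.≤-trans (ℕ.≤-reflexive (ℕ.+-comm 1 (pot s))) (ℕ.+-monoʳ-≤ (pot s) (s≤s z≤n))
        pot-prim endA       η s = ℕ.m≤m+n (pot s) 2
        pot-prim readA      η s = ℕ.m≤m+n (pot s) 2
        pot-prim (getA d)   η s = ℕ.m≤m+n (pot s) 2
        pot-prim (setA d b) η s = ℕ.m≤m+n (pot s) 2
        pot-prim (emit o)   η s = ℕ.≤-trans (ℕ.≤-reflexive (trans
          (cong (λ x → N s + (A s + x)) (List.length-++ (out s)))
          (trans (cong (N s +_) (sym (ℕ.+-assoc (A s) (length (out s)) 1))) (sym (ℕ.+-assoc (N s) _ 1)))))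
          (ℕ.+-monoʳ-≤ (pot s) (s≤s z≤n))

        exec-done : ∀ {E : Set} {F : Frag Γ (Maybe E)} {D e D' k} → Exec F D (just e) D' k → Exec (iterF F) D e D' k
        exec-done {F = F} (exec f) = exec λ t x →
          let (t' , k , run , y , l) = f t x in t' , k , run-doneF F run , y , l

        exec-again : ∀ {E : Set} {F : Frag Γ (Maybe E)} {D e D₁ D₂ k k'} →
          Exec F D nothing D₁ k → Exec (iterF F) D₁ e D₂ k' → Exec (iterF F) D e D₂ (k + k')
        exec-again {F = F} (exec f) (exec g) = exec λ t x →
          let (t₁ , k₁ , run₁ , x₁ , l₁) = f t x
              (t₂ , k₂ , run₂ , x₂ , l₂) = g t₁ x₁
          in t₂ , k₁ + k₂ , run-againF F run₁ run₂ , x₂ , ℕ.+-mono-≤ l₁ l₂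

        track-other : ∀ {v} (η : Vec ℕ v) (h : v < np) a b s y → y ≢ loopName h → ∀ i →
          track (lev (a ∷ η)) s y i ≡ track (lev (b ∷ η)) s y i
        track-other η h a b s zero                   ne i = refl
        track-other η h a b s (suc zero)             ne i = refl
        track-other η h a b s (suc (suc zero))       ne i = refl
        track-other η h a b s (suc (suc (suc zero))) ne i = refl
        track-other {v} η h a b s (suc (suc (suc (suc y)))) ne i with splitAt np y in eq
        ... | inj₂ _ = refl
        ... | inj₁ x with toℕ x ≡ᵇ v in eq'
        ...   | false = refl
        ...   | true  = ⊥-elim (ne (cong rest (trans (sym (Fin.splitAt⁻¹-↑ˡ eq)) (cong (_↑ˡ nt)
                  (Fin.toℕ-injective (trans (≡ᵇ-sound (toℕ x) v eq') (sym (Fin.toℕ-fromℕ< h))))))))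

        track-self : ∀ {v} (η : Vec ℕ v) (h : v < np) a s i → track (lev (a ∷ η)) s (loopName h) i ≡ (i ≡ᵇ a)
        track-self {v} η h a s i = trans (track-loop (lev (a ∷ η)) s h i) (cong (i ≡ᵇ_) self)
          where
          self : lev (a ∷ η) v ≡ a
          self rewrite ≡ᵇ-refl v = refl

        private
          L = length w

        exec-cmd : L ≤ B → ∀ {v} (c : Cmd r v) hl ha (η : Vec ℕ v) s → (∀ x → lookup η x ≤ B) → pot s + prims L c ≤ B →
          Exec (compile c hl ha) (desc (lev η) s) (proj₁ (sem w c η s)) (desc (lev η) (proj₂ (sem w c η s))) (prims L c * unit)
          × pot (proj₂ (sem w c η s)) ≤ pot s + prims L c

        exec-loop : L ≤ B → ∀ {v} flag (c : Cmd r (suc v)) (h : v < np) hl ha (η : Vec ℕ v) → (∀ x → lookup η x ≤ B) →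
          ∀ fuel i s → fuel + i ≡ L → pot s + suc fuel * (3 + prims L c) ≤ B →
          let res = loopS (λ i → sem w c (i ∷ η)) flag fuel i s in
          Exec (loopF (loopName h) flag (compile c hl ha)) (desc (lev (i ∷ η)) s) (proj₁ res) (desc (lev η) (proj₂ res))
            (suc fuel * (3 + prims L c) * unit)
          × pot (proj₂ res) ≤ pot s + suc fuel * (3 + prims L c)

        exec-cmd lB (prim p) hl ha η s hη hs =
          exec-prim p hl ha η s hη
            (ℕ.≤-trans (ℕ.m≤m+n (N s) _) hs')
            (ℕ.≤-trans (ℕ.≤-trans (ℕ.m≤m+n (A s) _) (ℕ.m≤n+m _ (N s))) hs')
            (ℕ.≤-trans (ℕ.≤-trans (ℕ.m≤n+m _ (A s)) (ℕ.m≤n+m _ (N s))) hs') ,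
          pot-prim p η s
          where hs' = ℕ.≤-trans (ℕ.m≤m+n (pot s) _) hs
        exec-cmd lB (ret b) hl ha η s hη hs = exec-cost (ℕ.≤-trans (ℕ.≤-trans (s≤s z≤n) (ℕ.m≤n+m _ B)) (ℕ.m≤m+n unit 0)) exec-ret , ℕ.m≤m+n (pot s) 1
        exec-cmd lB (ite c d e) hl ha η s hη hs
          with sem w c η s | exec-cmd lB c (ℕ.m⊔n≤o⇒m≤o _ _ hl) (ℕ.m⊔n≤o⇒m≤o _ _ ha) η s hη
                               (ℕ.≤-trans (ℕ.+-monoʳ-≤ (pot s) (ℕ.m≤m+n _ _)) hs)
        ... | true , s₁ | E , p =
          let (E' , p') = exec-cmd lB d (ℕ.m⊔n≤o⇒m≤o _ _ (ℕ.m⊔n≤o⇒n≤o (needL c) _ hl))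
                (ℕ.m⊔n≤o⇒m≤o _ _ (ℕ.m⊔n≤o⇒n≤o (needA c) _ ha)) η s₁ hη
                (ℕ.≤-trans (ℕ.+-mono-≤ p (ℕ.m≤m+n _ (prims L e))) (ℕ.≤-trans (ℕ.≤-reflexive (ℕ.+-assoc (pot s) _ _)) hs))
          in exec-cost (ℕ.≤-trans (ℕ.+-monoʳ-≤ (prims L c * unit) (ℕ.*-monoˡ-≤ unit (ℕ.m≤m+n (prims L d) (prims L e))))
               (ℕ.≤-reflexive (sym (ℕ.*-distribʳ-+ unit (prims L c) _)))) (exec-bind E E') ,
             ℕ.≤-trans p' (ℕ.≤-trans (ℕ.+-mono-≤ p (ℕ.m≤m+n _ (prims L e))) (ℕ.≤-reflexive (ℕ.+-assoc (pot s) _ _)))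
        ... | false , s₁ | E , p =
          let (E' , p') = exec-cmd lB e (ℕ.m⊔n≤o⇒n≤o (needL d) _ (ℕ.m⊔n≤o⇒n≤o (needL c) _ hl))
                (ℕ.m⊔n≤o⇒n≤o (needA d) _ (ℕ.m⊔n≤o⇒n≤o (needA c) _ ha)) η s₁ hη
                (ℕ.≤-trans (ℕ.+-mono-≤ p (ℕ.m≤n+m _ (prims L d))) (ℕ.≤-trans (ℕ.≤-reflexive (ℕ.+-assoc (pot s) _ _)) hs))
          in exec-cost (ℕ.≤-trans (ℕ.+-monoʳ-≤ (prims L c * unit) (ℕ.*-monoˡ-≤ unit (ℕ.m≤n+m _ (prims L d))))
               (ℕ.≤-reflexive (sym (ℕ.*-distribʳ-+ unit (prims L c) _)))) (exec-bind E E') ,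
             ℕ.≤-trans p' (ℕ.≤-trans (ℕ.+-mono-≤ p (ℕ.m≤n+m _ (prims L d))) (ℕ.≤-reflexive (ℕ.+-assoc (pot s) _ _)))
        exec-cmd lB {v} (loop flag c) hl ha η s hη hs =
          let (E , p) = exec-loop lB flag c (ℕ.m⊔n≤o⇒m≤o (suc v) (needL c) hl) (ℕ.m⊔n≤o⇒n≤o (suc v) (needL c) hl) ha η hη
                          L 0 s (ℕ.+-identityʳ L) hs
          in exec-ext (≈D-env s (λ x → sym (lev-0∷ η x))) ≈D-refl E , p

        private
          iteration-cost : ∀ P → unit + (P * unit + (unit + 1)) ≤ (3 + P) * unit
          iteration-cost P = ℕ.+-monoʳ-≤ unit (ℕ.≤-trans
            (ℕ.+-monoʳ-≤ (P * unit) (ℕ.+-monoʳ-≤ unit (ℕ.≤-trans (s≤s z≤n) (ℕ.m≤n+m _ B))))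
            (ℕ.≤-reflexive (trans (ℕ.+-comm (P * unit) _) (ℕ.+-assoc unit unit _))))

          stop-cost : ∀ P → unit + (unit + 1) ≤ (3 + P) * unit
          stop-cost P = ℕ.≤-trans (ℕ.+-monoʳ-≤ unit (ℕ.m≤n+m _ (P * unit))) (iteration-cost P)

          first : ∀ f P → (3 + P) * unit ≤ suc f * (3 + P) * unit
          first f P = ℕ.*-monoˡ-≤ unit (ℕ.m≤m+n (3 + P) (f * (3 + P)))

        exec-loop lB {v} flag c h hl ha η hη fuel i s fi hs = go fuel fi hs
          where
          x = loopName h
          P = prims L c
          F = compile c hl ha

          i≤B : ∀ fuel → fuel + i ≡ L → i ≤ B
          i≤B fuel fi = ℕ.≤-trans (ℕ.≤-trans (ℕ.m≤n+m i fuel) (ℕ.≤-reflexive fi)) lB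

          test : ∀ fuel → fuel + i ≡ L → ∀ b → is-nothing (nthᵐ w i) ∨ (flag ∧ (i ≡ᵇ N s)) ≡ b →
            Exec (testF x (λ γ → is-nothing (Cell.inp γ) ∨ (flag ∧ mark NN γ))) (desc (lev (i ∷ η)) s) b (desc (lev (i ∷ η)) s) unit
          test fuel fi b e = exec-test _ b x i (i≤B fuel fi) (λ _ → refl) (track-self η h i s)
            (λ t y → trans (cong₂ (λ p q → is-nothing p ∨ (flag ∧ q)) (inp-eq y i) (bit-eq y NN i)) e)

          ending : ∀ fuel → fuel + i ≡ L → ∀ s' b → Exec (loopEnd x b) (desc (lev (i ∷ η)) s') (just b) (desc (lev η) s') (unit + 1)
          ending fuel fi s' b = exec-bind {G = thenR (just b)} (exec-ext ≈D-refl (≈D-env s' (lev-0∷ η))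
            (exec-reset x i (i≤B fuel fi) (λ ()) (λ _ → refl) (λ _ → refl) (track-self η h i s') (track-self η h 0 s')
              (track-other η h i 0 s'))) exec-ret

          stop : ∀ fuel → fuel + i ≡ L → is-nothing (nthᵐ w i) ∨ (flag ∧ (i ≡ᵇ N s)) ≡ true →
            Exec (loopF x flag F) (desc (lev (i ∷ η)) s) false (desc (lev η) s) (suc fuel * (3 + P) * unit)
          stop fuel fi e = exec-cost (ℕ.≤-trans (stop-cost P) (first fuel P))
            (exec-done (exec-bind (test fuel fi true e) (ending fuel fi s false)))

          go : ∀ fuel → fuel + i ≡ L → pot s + suc fuel * (3 + P) ≤ B →
            let res = loopS (λ i → sem w c (i ∷ η)) flag fuel i s in
            Exec (loopF x flag F) (desc (lev (i ∷ η)) s) (proj₁ res) (desc (lev η) (proj₂ res)) (suc fuel * (3 + P) * unit)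
            × pot (proj₂ res) ≤ pot s + suc fuel * (3 + P)
          -- Without fuel i is the length of the input, so the cell under the loop mark is empty and
          -- the test succeeds.
          go zero fi hs =
            stop zero fi (cong (_∨ (flag ∧ (i ≡ᵇ N s))) (cong is-nothing (nthᵐ-length w i (ℕ.≤-reflexive (sym fi))))) ,
            ℕ.m≤m+n (pot s) _
          go (suc fuel) fi hs with flag ∧ (i ≡ᵇ N s) in eq
          ... | true  = stop (suc fuel) fi (trans (cong (is-nothing (nthᵐ w i) ∨_) eq) (∨-zeroʳ _)) , ℕ.m≤m+n (pot s) _
          ... | false with sem w c (i ∷ η) s
                         | exec-cmd lB c hl ha (i ∷ η) s (λ { zero → i≤B (suc fuel) fi ; (suc y) → hη y })
                             (ℕ.≤-trans (ℕ.+-monoʳ-≤ (pot s) (ℕ.≤-trans (ℕ.m≤n+m P 3) (ℕ.m≤m+n _ (suc fuel * (3 + P))))) hs)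
          ...   | true , s₁ | E , p =
            exec-cost (ℕ.≤-trans (iteration-cost P) (first (suc fuel) P)) (exec-done (exec-bind
              (test (suc fuel) fi false continue) (exec-bind E (ending (suc fuel) fi s₁ true)))) ,
            ℕ.≤-trans p (ℕ.+-monoʳ-≤ (pot s) (ℕ.≤-trans (ℕ.m≤n+m P 3) (ℕ.m≤m+n _ (suc fuel * (3 + P)))))
            where
            continue : is-nothing (nthᵐ w i) ∨ (flag ∧ (i ≡ᵇ N s)) ≡ false
            continue rewrite nthᵐ-< w i (subst (i <_) fi (s≤s (ℕ.m≤n+m i fuel))) = eq
          ...   | false , s₁ | E , p =
            let bound = ℕ.≤-trans (ℕ.+-mono-≤ p (ℕ.≤-refl {suc fuel * (3 + P)}))
                  (ℕ.≤-trans (ℕ.≤-reflexive (ℕ.+-assoc (pot s) P _))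
                    (ℕ.+-monoʳ-≤ (pot s) (ℕ.+-monoˡ-≤ (suc fuel * (3 + P)) (ℕ.m≤n+m P 3))))
                (E' , p') = exec-loop lB flag c h hl ha η hη fuel (suc i) s₁ (trans (ℕ.+-suc fuel i) fi)
                              (ℕ.≤-trans bound hs)
            in exec-cost (ℕ.≤-trans (ℕ.+-monoˡ-≤ _ (iteration-cost P)) (ℕ.≤-reflexive (sym (ℕ.*-distribʳ-+ unit (3 + P) (suc fuel * (3 + P))))))
                 (exec-again (exec-bind (test (suc fuel) fi false continue) (exec-bind E (exec-bind {G = thenR nothing}
                   (exec-inc x i (i≤B (suc fuel) fi) (λ ()) (λ _ → refl) (λ _ → refl) (track-self η h i s₁) (track-self η h (suc i) s₁)
                     (track-other η h i (suc i) s₁)) exec-ret))) E') ,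
               ℕ.≤-trans p' bound
            where
            continue : is-nothing (nthᵐ w i) ∨ (flag ∧ (i ≡ᵇ N s)) ≡ false
            continue rewrite nthᵐ-< w i (subst (i <_) fi (s≤s (ℕ.m≤n+m i fuel))) = eq

-- Polynomial bounds and the machine of a program.

module PolynomialTime where
  open Machines
  open Programs
  open import Data.Fin using (splitAt)
  open import Data.Vec using (tabulate; replicate)
  open import Data.Maybe using (maybe′)
  open import Relation.Binary.PropositionalEquality using (refl; sym; trans)

  -- The base L + 1 is never 0, so powers grow with the exponent and the form is closed under sums
  -- and products.
  Poly : (ℕ → ℕ) → Set
  Poly f = Σ ℕ λ a → Σ ℕ λ d → ∀ L → f L ≤ a * suc L ^ d

  poly-const : ∀ k → Poly (λ _ → k)
  poly-const k = k , 0 , λ L → ℕ.≤-reflexive (sym (ℕ.*-identityʳ k))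

  poly-suc : Poly suc
  poly-suc = 1 , 1 , λ L → ℕ.≤-reflexive (sym (trans (ℕ.*-identityˡ _) (ℕ.*-identityʳ _)))

  poly-* : ∀ {f g} → Poly f → Poly g → Poly (λ L → f L * g L)
  poly-* (a , d , p) (b , e , q) = a * b , d + e , λ L → ℕ.≤-trans (ℕ.*-mono-≤ (p L) (q L))
    (ℕ.≤-reflexive (trans (ℕ.[m*n]*[o*p]≡[m*o]*[n*p] a (suc L ^ d) b (suc L ^ e))
      (cong (a * b *_) (sym (ℕ.^-distribˡ-+-* (suc L) d e)))))

  poly-+ : ∀ {f g} → Poly f → Poly g → Poly (λ L → f L + g L)
  poly-+ (a , d , p) (b , e , q) = a + b , d + e , λ L → ℕ.≤-trans
    (ℕ.+-mono-≤ (ℕ.≤-trans (p L) (ℕ.*-monoʳ-≤ a (ℕ.^-monoʳ-≤ (suc L) (ℕ.m≤m+n d e))))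
                (ℕ.≤-trans (q L) (ℕ.*-monoʳ-≤ b (ℕ.^-monoʳ-≤ (suc L) (ℕ.m≤n+m e d)))))
    (ℕ.≤-reflexive (sym (ℕ.*-distribʳ-+ (suc L ^ (d + e)) a b)))

  ^-distrib-* : ∀ m n d → (m * n) ^ d ≡ m ^ d * n ^ d
  ^-distrib-* m n zero    = refl
  ^-distrib-* m n (suc d) = trans (cong (m * n *_) (^-distrib-* m n d)) (ℕ.[m*n]*[o*p]≡[m*o]*[n*p] m n (m ^ d) (n ^ d))

  -- For positive L the base L + 1 is at most 2 L, which yields the factor 2 ^ d; for L = 0 the
  -- additive constant suffices.
  poly-bound : ∀ {f} → Poly f → Σ ℕ λ a → Σ ℕ λ d → ∀ L → f L ≤ a * L ^ d + a
  poly-bound (a , d , p) = a * 2 ^ d , d , λ L → ℕ.≤-trans (p L) (bound L)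
    where
    bound : ∀ L → a * suc L ^ d ≤ a * 2 ^ d * L ^ d + a * 2 ^ d
    bound zero    = ℕ.≤-trans (ℕ.*-monoʳ-≤ a (ℕ.^-monoˡ-≤ d {1} {2} (s≤s z≤n))) (ℕ.m≤n+m _ _)
    bound (suc L) = ℕ.≤-trans (ℕ.*-monoʳ-≤ a (ℕ.≤-trans
      (ℕ.^-monoˡ-≤ d (s≤s (ℕ.≤-trans (ℕ.m≤n+m (suc L) L) (ℕ.+-monoʳ-≤ L (ℕ.≤-reflexive (sym (ℕ.+-identityʳ (suc L))))))))
      (ℕ.≤-reflexive (^-distrib-* 2 (suc L) d))))
      (ℕ.≤-trans (ℕ.≤-reflexive (sym (ℕ.*-assoc a (2 ^ d) _))) (ℕ.m≤m+n _ _))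

  poly-prims : ∀ {r v} (c : Cmd r v) → Poly (λ L → prims L c)
  poly-prims (prim p)    = poly-const 2
  poly-prims (ret b)     = poly-const 1
  poly-prims (ite c d e) = poly-+ (poly-prims c) (poly-+ (poly-prims d) (poly-prims e))
  poly-prims (loop b c)  = poly-* poly-suc (poly-+ (poly-const 3) (poly-prims c))

  initial-state : ∀ {r} → St r
  initial-state = st 0 0 (λ _ _ → false) []

  module _ {r : ℕ} (c : Cmd r 0) where
    private
      open Compile r (needL c) (needA c)

      main : Frag Γ Bool
      main = compile c ℕ.≤-refl ℕ.≤-refl

      -- Initially all marks stand on cell 0 and all arrays are empty, so a single step at cell 0
      -- prepares the tape.
      initCell : Γ → Γ
      initCell γ = record γ { bits = tabulate (λ x → track [] (λ _ → 0) initial-state x 0) }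

      whole : Frag Γ Bool
      whole = bindF (record { Q = ⊤ ; fin = fin-⊤ ; start = tt ; δ = λ _ γ → inj₁ true , initCell γ , stay }) (λ _ → main)

      blank : Γ
      blank = cell nothing nothing (replicate nb false)

      inpCell : Fin 2 → Γ
      inpCell b = cell (just b) nothing (replicate nb false)

      start-tape : List (Fin 2) → ℕ → Γ
      start-tape w i = maybe′ inpCell blank (nthᵐ w i)

      B : ℕ → ℕ
      B L = suc L + prims L c

    private
      init-rep : ∀ w → RepD w (desc w (λ _ → 0) initial-state) (modify (start-tape w) 0 initCell)
      init-rep w = rep i-eq s-eq b-eq
        where
        i-eq : ∀ i → Cell.inp (modify (start-tape w) 0 initCell i) ≡ nthᵐ w i
        i-eq zero with nthᵐ w 0
        ... | just _  = refl
        ... | nothing = refl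
        i-eq (suc i) with nthᵐ w (suc i)
        ... | just _  = refl
        ... | nothing = refl
        s-eq : ∀ i → Cell.osym (modify (start-tape w) 0 initCell i) ≡ nothing
        s-eq zero with nthᵐ w 0
        ... | just _  = refl
        ... | nothing = refl
        s-eq (suc i) with nthᵐ w (suc i)
        ... | just _  = refl
        ... | nothing = refl
        off : ∀ x i → false ≡ track w (λ _ → 0) initial-state x (suc i)
        off zero                   i = refl
        off (suc zero)             i = refl
        off (suc (suc zero))       i = refl
        off (suc (suc (suc zero))) i = refl
        off (suc (suc (suc (suc y)))) i with splitAt (needL c) y
        ... | inj₁ _ = refl
        ... | inj₂ _ = refl
        same : ∀ x → track [] (λ _ → 0) initial-state x 0 ≡ track w (λ _ → 0) initial-state x 0
        same zero                   = refl
        same (suc zero)             = refl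
        same (suc (suc zero))       = refl
        same (suc (suc (suc zero))) = refl
        same (suc (suc (suc (suc y)))) with splitAt (needL c) y
        ... | inj₁ _ = refl
        ... | inj₂ _ = refl
        b-eq : ∀ x i → mark x (modify (start-tape w) 0 initCell i) ≡ track w (λ _ → 0) initial-state x i
        b-eq x zero    = trans (Vec.lookup∘tabulate (λ x → track [] (λ _ → 0) initial-state x 0) x) (same x)
        b-eq x (suc i) with nthᵐ w (suc i)
        ... | just _  = trans (Vec.lookup-replicate x false) (off x i)
        ... | nothing = trans (Vec.lookup-replicate x false) (off x i)

      time : ℕ → ℕ
      time L = suc (prims L c * (B L + suc (suc (suc (B L)))))

      poly-time : Poly time
      poly-time = poly-+ (poly-const 1) (poly-* pc (poly-+ pB (poly-+ (poly-const 3) pB)))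
        where
        pc = poly-prims c
        pB = poly-+ poly-suc pc

    -- Unfolding the machine makes type checking infeasible.
    abstract
      machine : TM (Fin 2) (TSym r)
      machine = toTM (fin-Cell r nb) whole blank inpCell Cell.osym

      computes-in-time : ∀ w n → time (length w) ≤ n → ComputesWithin machine w n (out (proj₂ (sem w c [] initial-state)))
      computes-in-time w n h =
        let L = length w
            (exec go , _) = exec-cmd w (B L) (ℕ.≤-trans (ℕ.n≤1+n L) (ℕ.m≤m+n (suc L) _)) c ℕ.≤-refl ℕ.≤-refl [] initial-state (λ ())
                              (ℕ.m≤n+m (prims L c) (suc L))
            (t' , k , run , rep i s b , k≤) = go (modify (start-tape w) 0 initCell) (init-rep w)
            run' : Run whole (Frag.start whole) 0 (start-tape w) (suc k) (proj₁ (sem w c [] initial-state)) 0 t'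
            run' = run-bindF _ (λ _ → main) (exit refl (upd-modify (start-tape w) 0 initCell)) run
        in computes (fin-Cell r nb) whole blank inpCell Cell.osym {w = w} n run' (ℕ.≤-trans (s≤s k≤) h) s

      polynomial-machine : Σ ℕ λ a → Σ ℕ λ d → ∀ w →
        ComputesWithin machine w (a * length w ^ d + a) (out (proj₂ (sem w c [] initial-state)))
      polynomial-machine =
        let (a , d , p) = poly-bound poly-time
        in a , d , λ w → computes-in-time w _ (p (length w))

-- Positions of tuples in the encoding of a structure.

module Encodings where
  open FixedPoints
  open Machines
  open import Data.List using (map; concat; tabulate)
  open import Relation.Binary.PropositionalEquality using (refl; sym; trans; module ≡-Reasoning)

  nth-++ˡ : ∀ {A : Set} (u v : List A) {i} → i < length u → nthᵐ (u ++ v) i ≡ nthᵐ u i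
  nth-++ˡ (x ∷ u) v {zero}  h       = refl
  nth-++ˡ (x ∷ u) v {suc i} (s≤s h) = nth-++ˡ u v h

  nth-++ʳ : ∀ {A : Set} (u v : List A) i → nthᵐ (u ++ v) (length u + i) ≡ nthᵐ v i
  nth-++ʳ []      v i = refl
  nth-++ʳ (x ∷ u) v i = nth-++ʳ u v i

  nth-< : ∀ {A : Set} (u : List A) i → i < length u → ∃ λ x → nthᵐ u i ≡ just x
  nth-< (x ∷ u) zero    h       = x , refl
  nth-< (x ∷ u) (suc i) (s≤s h) = nth-< u i h

  nth-just : ∀ {A : Set} (u : List A) i {x} → nthᵐ u i ≡ just x → i < length u
  nth-just (x ∷ u) zero    e = s≤s z≤n
  nth-just (x ∷ u) (suc i) e = s≤s (nth-just u i e)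

  nth-++-just : ∀ {A : Set} (u v : List A) i {x} → nthᵐ u i ≡ just x → nthᵐ (u ++ v) i ≡ just x
  nth-++-just u v i e = trans (nth-++ˡ u v (nth-just u i e)) e

  -- The head is the most significant digit.
  lex : ∀ {n l} → Vec (Fin n) l → ℕ
  lex []                     = 0
  lex {n} {suc l} (a ∷ t) = toℕ a * n ^ l + lex t

  lex-bound : ∀ {n l} (t : Vec (Fin n) l) → lex t < n ^ l
  lex-bound []                    = s≤s z≤n
  lex-bound {n} {suc l} (a ∷ t) = ℕ.<-≤-trans (ℕ.+-monoʳ-< _ (lex-bound t))
    (ℕ.≤-trans (ℕ.≤-reflexive (ℕ.+-comm (toℕ a * n ^ l) (n ^ l))) (ℕ.*-monoˡ-≤ (n ^ l) (Fin.toℕ<n a)))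

  numR-∷ʳ : ∀ {n l} (t : Vec (Fin n) l) a → numR (t Vec.∷ʳ a) ≡ toℕ a * n ^ l + numR t
  numR-∷ʳ []      a = cong (_+ 0) (trans (sym (ℕ.*-identityʳ _)) refl)
  numR-∷ʳ {n} {suc l} (b ∷ t) a = trans (cong (λ x → toℕ b + x * n) (numR-∷ʳ t a)) (begin
    toℕ b + (toℕ a * n ^ l + numR t) * n        ≡⟨ cong (toℕ b +_) (ℕ.*-distribʳ-+ n (toℕ a * n ^ l) (numR t)) ⟩
    toℕ b + (toℕ a * n ^ l * n + numR t * n)    ≡⟨ ℕ.+-assoc (toℕ b) _ _ ⟨
    toℕ b + toℕ a * n ^ l * n + numR t * n      ≡⟨ cong (_+ numR t * n) (ℕ.+-comm (toℕ b) _) ⟩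
    toℕ a * n ^ l * n + toℕ b + numR t * n      ≡⟨ ℕ.+-assoc (toℕ a * n ^ l * n) (toℕ b) _ ⟩
    toℕ a * n ^ l * n + (toℕ b + numR t * n)    ≡⟨ cong (_+ (toℕ b + numR t * n)) (trans (ℕ.*-assoc (toℕ a) _ n) (cong (toℕ a *_) (ℕ.*-comm (n ^ l) n))) ⟩
    toℕ a * (n * n ^ l) + (toℕ b + numR t * n)  ∎)
    where open ≡-Reasoning

  -- The encoding puts the most significant digit first, loops put it last; reversing the tuple
  -- mediates between them.
  numR-reverse : ∀ {n l} (t : Vec (Fin n) l) → numR (Vec.reverse t) ≡ lex t
  numR-reverse []      = refl
  numR-reverse {n} {suc l} (a ∷ t) = trans (cong numR (Vec.reverse-∷ a t))
    (trans (numR-∷ʳ (Vec.reverse t) a) (cong (toℕ a * n ^ l +_) (numR-reverse t)))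

  length-blocks : ∀ {A B : Set} {m} K (h : B → List A) (f : Fin m → B) → (∀ b → length (h b) ≡ K) →
    length (concat (map h (tabulate f))) ≡ m * K
  length-blocks {m = zero}  K h f e = refl
  length-blocks {m = suc m} K h f e =
    trans (List.length-++ (h (f zero))) (cong₂ _+_ (e (f zero)) (length-blocks K h (f ∘ suc) e))

  nth-blocks : ∀ {A B : Set} {m} K (h : B → List A) (f : Fin m → B) → (∀ b → length (h b) ≡ K) → ∀ rest a q → q < K →
    nthᵐ (concat (map h (tabulate f)) ++ rest) (toℕ a * K + q) ≡ nthᵐ (h (f a)) q
  nth-blocks K h f e rest zero q q<K = trans (cong (λ z → nthᵐ z q) (List.++-assoc (h (f zero)) _ rest))
    (nth-++ˡ (h (f zero)) _ (subst (q <_) (sym (e (f zero))) q<K))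
  nth-blocks K h f e rest (suc a) q q<K = trans
    (cong₂ nthᵐ (List.++-assoc (h (f zero)) _ rest) (trans (ℕ.+-assoc K _ q) (cong (_+ (toℕ a * K + q)) (sym (e (f zero))))))
    (trans (nth-++ʳ (h (f zero)) _ (toℕ a * K + q)) (nth-blocks K h (f ∘ suc) e rest a q q<K))

  map-tuples : ∀ {A : Set} n l (f : Vec (Fin n) (suc l) → A) →
    map f (tuples n (suc l)) ≡ concat (map (λ a → map (λ t → f (a ∷ t)) (tuples n l)) (allFin n))
  map-tuples n l f = trans (List.map-concatMap f (λ a → map (a ∷_) (tuples n l)) (allFin n))
    (cong concat (List.map-cong (λ a → sym (List.map-∘ (tuples n l))) (allFin n)))

  length-tuples : ∀ {A : Set} n l (f : Vec (Fin n) l → A) → length (map f (tuples n l)) ≡ n ^ l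
  length-tuples n zero    f = refl
  length-tuples n (suc l) f = trans (cong length (map-tuples n l f))
    (length-blocks (n ^ l) _ id (λ a → length-tuples n l (λ t → f (a ∷ t))))

  nth-tuples : ∀ {A : Set} {n l} (f : Vec (Fin n) l → A) t rest → nthᵐ (map f (tuples n l) ++ rest) (lex t) ≡ just (f t)
  nth-tuples f [] rest = refl
  nth-tuples {n = n} {suc l} f (a ∷ t) rest = trans (cong (λ z → nthᵐ (z ++ rest) (lex (a ∷ t))) (map-tuples n l f))
    (trans (nth-blocks (n ^ l) _ id (λ b → length-tuples n l (λ u → f (b ∷ u))) rest a (lex t) (lex-bound t))
    (trans (cong (λ z → nthᵐ z (lex t)) (sym (List.++-identityʳ (map (λ u → f (a ∷ u)) (tuples n l))))) (nth-tuples (λ u → f (a ∷ u)) t [])))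

  position : ∀ n {j} (ar : Vec ℕ j) (i : Fin j) → Vec (Fin n) (lookup ar i) → ℕ
  position n (l ∷ ar) zero    t = numR (Vec.reverse t)
  position n (l ∷ ar) (suc i) t = n ^ l + position n ar i t

  total : ∀ {j} → Vec ℕ j → ℕ → ℕ
  total []       n = 0
  total (l ∷ ar) n = n ^ l + total ar n

  length-encRels : ∀ {j n a} (ar : Vec ℕ j) (R : (i : Fin j) → Vec (Fin n) (lookup ar i) → Bool) →
    length (encRels {a = a} ar R) ≡ total ar n
  length-encRels []       R = refl
  length-encRels {n = n} (l ∷ ar) R = trans (List.length-++ (map (λ t → bit (R zero t)) (tuples n l)))
    (cong₂ _+_ (length-tuples n l _) (length-encRels ar (λ i → R (suc i))))

  nth-encRels : ∀ {j n a} (ar : Vec ℕ j) (R : (i : Fin j) → Vec (Fin n) (lookup ar i) → Bool) i t →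
    nthᵐ (encRels {a = a} ar R) (position n ar i t) ≡ just (bit (R i t))
  nth-encRels (l ∷ ar) R zero t = trans (cong (nthᵐ (encRels (l ∷ ar) R)) (numR-reverse t))
    (nth-tuples (λ u → bit (R zero u)) t (encRels ar (λ i → R (suc i))))
  nth-encRels {n = n} (l ∷ ar) R (suc i) t = trans
    (cong (λ z → nthᵐ (encRels (l ∷ ar) R) (z + position n ar i t)) (sym (length-tuples n l (λ u → bit (R zero u)))))
    (trans (nth-++ʳ (map (λ u → bit (R zero u)) (tuples n l)) (encRels ar (λ i → R (suc i))) (position n ar i t))
           (nth-encRels ar (λ i → R (suc i)) i t))

  total-mono : ∀ {j} (ar : Vec ℕ j) {n n'} → n ≤ n' → total ar n ≤ total ar n'
  total-mono []       h = z≤n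
  total-mono (l ∷ ar) h = ℕ.+-mono-≤ (ℕ.^-monoˡ-≤ l h) (total-mono ar h)

  ^-strict : ∀ l {n n'} → n < n' → n ^ suc l < n' ^ suc l
  ^-strict zero    {n} {n'} h = subst (λ x → n * 1 < x) refl (ℕ.*-monoˡ-< 1 h)
  ^-strict (suc l) {n} {n'} h = ℕ.*-mono-< h (^-strict l h)

  -- This is where a relation of positive arity is needed: with 0-ary relations alone, encodings of
  -- all sizes have the same length.
  total-strict : ∀ {j} (ar : Vec ℕ j) → (∃ λ i → lookup ar i ≢ 0) → ∀ {n n'} → n < n' → total ar n < total ar n'
  total-strict (zero  ∷ ar) (zero , ne)  h = ⊥-elim (ne refl)
  total-strict (suc l ∷ ar) (zero , ne)  h = ℕ.+-mono-<-≤ (^-strict l h) (total-mono ar (ℕ.<⇒≤ h))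
  total-strict (l ∷ ar)     (suc i , ne) h = ℕ.+-mono-≤-< (ℕ.^-monoˡ-≤ l (ℕ.<⇒≤ h)) (total-strict ar (i , ne) h)

  -- Loop variables range over input positions, so the universe has to fit into the input.
  total-≥ : ∀ {j} (ar : Vec ℕ j) → (∃ λ i → lookup ar i ≢ 0) → ∀ n → n ≤ total ar n
  total-≥ ar ne zero    = z≤n
  total-≥ ar ne (suc n) = ℕ.≤-trans (s≤s (total-≥ ar ne n)) (total-strict ar ne ℕ.≤-refl)

-- Evaluation of fixed-point formulas by loop programs.

module Evaluation where
  open FixedPoints
  open Machines
  open Programs
  open Encodings
  open import Data.Bool using (_xor_)
  open import Data.Bool.Properties using (not-involutive)
  open import Data.List.Membership.Propositional.Properties using (∈-allFin)
  open import Relation.Nullary using (Reflects; ofʸ; ofⁿ)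
  open import Relation.Binary.PropositionalEquality using (refl; sym; trans)

  seq : ∀ {r v} → Cmd r v → Cmd r v → Cmd r v
  seq c d = ite c d d

  loops : ∀ {r} l {v} → Cmd r (l + v) → Cmd r v
  loops zero    c = c
  loops (suc l) c = loops l (loop true c)

  xorC : ∀ {r v} → Bool → Cmd r v → Cmd r v
  xorC false c = c
  xorC true  c = ite c (ret false) (ret true)

  eqv : ∀ {r v} → Fin v → Fin v → Cmd r v
  eqv x y = ite (prim (ltv x y)) (ret false) (ite (prim (ltv y x)) (ret false) (ret true))

  eqAll : ∀ {r v l} → Vec (Fin v) l → Vec (Fin v) l → Cmd r v
  eqAll []       []       = ret true
  eqAll (x ∷ xs) (y ∷ ys) = ite (eqv x y) (eqAll xs ys) (ret false)

  -- Advances the address by the number of the tuple xs: all tuples are enumerated, and the address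
  -- is incremented for each one until xs is met.
  locate : ∀ {r v l} → Vec (Fin v) l → Cmd r v
  locate {v = v} {l} xs = loops l (ite (eqAll (firstVars l) (Vec.map (l ↑ʳ_) xs)) (ret true) (prim incA))

  skip : ∀ {r v} → ℕ → Cmd r v
  skip l = loops l (prim incA)

  clear : ∀ {r v} → ℕ → ℕ → Cmd r v
  clear k l = seq (prim resetA) (loops l (seq (prim (setA k false)) (prim incA)))

  walk : ∀ {r v j} (ar : Vec ℕ j) (i : Fin j) → Vec (Fin v) (lookup ar i) → Cmd r v
  walk (l ∷ ar) zero    ts = seq (locate (Vec.reverse ts)) (prim readA)
  walk (l ∷ ar) (suc i) ts = seq (skip l) (walk ar i ts)

  fetch : ∀ {r v l} → ℕ × Bool → Vec (Fin v) l → Cmd r v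
  fetch (d , pol) xs = seq (prim resetA) (seq (locate xs) (xorC pol (prim (getA d))))

  -- The body of a fixed point runs inside two groups of l loops. The inner group is the tuple under
  -- test; the outer group merely counts sweeps and is skipped over.
  innerVars : ∀ l {v v'} → Vec (Fin v') v → Vec (Fin (l + (l + v'))) (l + v)
  innerVars l τ = firstVars l Vec.++ Vec.map (l ↑ʳ_) (Vec.map (l ↑ʳ_) τ)

  -- n ^ l sweeps over all tuples suffice: a sweep that adds nothing to array k
  -- has found a closed set, and every other one enlarges it.
  fixpoint : ∀ {r v} → Bool → ℕ → (l : ℕ) → Cmd r (l + (l + v)) → Vec (Fin v) l → Cmd r v
  fixpoint pol k l body xs =
    seq (clear k l)
    (seq (loops l (loops l (ite (xorC pol body)
           (seq (prim resetA) (seq (locate (firstVars l)) (prim (setA k true)))) (ret false))))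
    (fetch (k , pol) xs))

  -- The last argument gives for each relation variable its array and whether that array holds the complement.
  evalP : ∀ {r j} {ar : Vocab j} {v v' k} {Δ : Vec ℕ k} → Formula ar v Δ → Vec (Fin v') v → Vec (ℕ × Bool) k → Cmd r v'
  evalP ff         τ as = ret false
  evalP {ar = ar} (rel i ts) τ as = seq (prim resetA) (walk ar i (Vec.map (lookup τ) ts))
  evalP (lt x y)   τ as = prim (ltv (lookup τ x) (lookup τ y))
  evalP (rvar i ts) τ as = fetch (lookup as i) (Vec.map (lookup τ) ts)
  evalP (neg φ)    τ as = xorC true (evalP φ τ as)
  evalP (or φ ψ)   τ as = ite (evalP φ τ as) (ret true) (evalP ψ τ as)
  evalP (ex φ)     τ as = loop true (evalP φ (zero ∷ Vec.map suc τ) as)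
  evalP {k = k} (lfp l ψ ts) τ as =
    fixpoint false k l (evalP ψ (innerVars l τ) ((k , false) ∷ as)) (Vec.map (lookup τ) ts)
  evalP {k = k} (gfp l ψ ts) τ as =
    fixpoint true k l (evalP ψ (innerVars l τ) ((k , true) ∷ as)) (Vec.map (lookup τ) ts)

  module Logic {r : ℕ} (w : List (Fin 2)) where

    record WP {v} (c : Cmd r v) (η : Vec ℕ v) (s : St r) (Q : Bool → St r → Set) : Set where
      constructor wp
      field un : Q (proj₁ (sem w c η s)) (proj₂ (sem w c η s))
    open WP

    wp-mono : ∀ {v} {c : Cmd r v} {η s P Q} → (∀ b s' → P b s' → Q b s') → WP c η s P → WP c η s Q
    wp-mono f (wp p) = wp (f _ _ p)

    wp-ite : ∀ {v} {c d e : Cmd r v} {η s} (P : Bool → St r → Set) {Q} → WP c η s P →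
      (∀ s' → P true s' → WP d η s' Q) → (∀ s' → P false s' → WP e η s' Q) → WP (ite c d e) η s Q
    wp-ite {c = c} {d} {e} {η} {s} P {Q} (wp p) f g = wp (choose (sem w c η s) p)
      where
      choose : ∀ res → P (proj₁ res) (proj₂ res) →
        let res' = if proj₁ res then sem w d η (proj₂ res) else sem w e η (proj₂ res) in Q (proj₁ res') (proj₂ res')
      choose (true , s')  p = un (f s' p)
      choose (false , s') p = un (g s' p)

    wp-seq : ∀ {v} {c d : Cmd r v} {η s} (P : Bool → St r → Set) {Q} → WP c η s P →
      (∀ b s' → P b s' → WP d η s' Q) → WP (seq c d) η s Q
    wp-seq P p f = wp-ite P p (f true) (f false)

    -- Q is the assertion at an early exit, I the one with which the loop goes on or runs out.
    Branch : (Q I : St r → Set) → Bool → St r → Set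
    Branch Q I true  = Q
    Branch Q I false = I

    -- The invariant has to fix N, because the variable is compared with the current value of N in
    -- each round.
    wp-loop : ∀ {n} → n ≤ length w → ∀ {v} {c : Cmd r (suc v)} {η} (I : ℕ → St r → Set) (Q : St r → Set) →
      (∀ {i s} → I i s → N s ≡ n) → (∀ i s → i < n → I i s → WP c (i ∷ η) s (Branch Q (I (suc i)))) →
      ∀ {s} → I 0 s → WP (loop true c) η s (Branch Q (I n))
    wp-loop {n} n≤L {c = c} {η} I Q hN body {s} h = wp (go (length w) 0 s (ℕ.+-identityʳ _) z≤n h)
      where
      go : ∀ fuel i s → fuel + i ≡ length w → i ≤ n → I i s →
        let res = loopS (λ i → sem w c (i ∷ η)) true fuel i s in Branch Q (I n) (proj₁ res) (proj₂ res)
      go zero i s e le h = subst (λ x → I x s) (ℕ.≤-antisym le (ℕ.≤-trans n≤L (ℕ.≤-reflexive (sym e)))) h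
      go (suc fuel) i s e le h with i ≡ᵇ N s in eq
      ... | true  = subst (λ x → I x s) (trans (≡ᵇ-sound i (N s) eq) (hN h)) h
      ... | false with ℕ.m≤n⇒m<n∨m≡n le
      ...   | inj₂ refl = ⊥-elim (false≢true (trans (sym eq) (trans (cong (i ≡ᵇ_) (hN h)) (≡ᵇ-refl i))))
        where false≢true : false ≢ true
              false≢true ()
      ...   | inj₁ i<n with sem w c (i ∷ η) s | un (body i s i<n h)
      ...     | true  , s' | q = q
      ...     | false , s' | q = go fuel (suc i) s' (trans (ℕ.+-suc fuel i) e) i<n q

    toℕs : ∀ {n l} → Vec (Fin n) l → Vec ℕ l
    toℕs = Vec.map toℕ

    -- Nested loops meet tuples in the order of `numR` and thus behave like a single loop of n ^ l
    -- rounds.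
    wp-loops : ∀ {n} → n ≤ length w → ∀ l {v} {c : Cmd r (l + v)} {η} (I : ℕ → St r → Set) (Q : St r → Set) →
      (∀ {i s} → I i s → N s ≡ n) →
      (∀ (b : Vec (Fin n) l) s → I (numR b) s → WP c (toℕs b Vec.++ η) s (Branch Q (I (suc (numR b))))) →
      ∀ {s} → I 0 s → WP (loops l c) η s (Branch Q (I (n ^ l)))
    wp-loops n≤L zero    I Q hN body h = body [] _ h
    wp-loops {n} n≤L (suc l) {c = c} I Q hN body h =
      wp-mono (λ { true s' q → q ; false s' i → subst (λ x → I x s') (ℕ.*-comm (n ^ l) n) i })
        (wp-loops n≤L l {c = loop true c} (λ k s → I (k * n) s) Q hN
          (λ b s h' → wp-loop n≤L {c = c} (λ i s → I (i + numR b * n) s) Q hN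
            (λ i s i<n h'' → inner b i i<n s h'') h') h)
      where
      inner : ∀ (b : Vec (Fin n) l) i → i < n → ∀ s → I (i + numR b * n) s →
        WP c (i ∷ toℕs b Vec.++ _) s (Branch Q (I (suc i + numR b * n)))
      inner b i i<n s h'' with Data.Fin.fromℕ< i<n | Fin.toℕ-fromℕ< i<n
      ... | a | refl = body (a ∷ b) s h''

    -- A fixed point stores its stages in the array numbered by its nesting depth. Evaluation under
    -- k enclosing fixed points must therefore leave the arrays below k alone.
    record Keep (k : ℕ) (s s' : St r) : Set where
      constructor keep
      field
        keepN   : N s' ≡ N s
        keepOut : out s' ≡ out s
        keepArr : ∀ d → d < k → ∀ i → arr s' d i ≡ arr s d i
    open Keep public

    keep-refl : ∀ {k s} → Keep k s s
    keep-refl = keep refl refl (λ _ _ _ → refl)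

    keep-trans : ∀ {k s s' s''} → Keep k s s' → Keep k s' s'' → Keep k s s''
    keep-trans (keep a b c) (keep a' b' c') = keep (trans a' a) (trans b' b) (λ d h i → trans (c' d h i) (c d h i))

    keep-weaken : ∀ {k k' s s'} → k ≤ k' → Keep k' s s' → Keep k s s'
    keep-weaken h (keep a b c) = keep a b (λ d h' → c d (ℕ.≤-trans h' h))

    wp-xor : ∀ {v} pol {c : Cmd r v} {η s Q} → WP c η s (λ b s' → Q (pol xor b) s') → WP (xorC pol c) η s Q
    wp-xor false p = p
    wp-xor true {Q = Q} p = wp-ite (λ b s' → Q (not b) s') p (λ s' q → wp q) (λ s' q → wp q)

    wp-eqv : ∀ {v} (x y : Fin v) η s → WP (eqv x y) η s (λ b s' → Reflects (lookup η x ≡ lookup η y) b × s' ≡ s)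
    wp-eqv x y η s with ℕ.<-cmp (lookup η x) (lookup η y)
    ... | tri< le ne _ = wp-ite (λ b s' → b ≡ true × s' ≡ s) (wp (<ᵇ-true le , refl))
      (λ { s' (_ , refl) → wp (ofⁿ ne , refl) }) (λ { s' (() , _) })
    ... | tri≈ _ eq _ = wp-ite (λ b s' → b ≡ false × s' ≡ s) (wp (<ᵇ-false (ℕ.≤-reflexive (sym eq)) , refl)) (λ { s' (() , _) })
      (λ { s' (_ , refl) → wp-ite (λ b s'' → b ≡ false × s'' ≡ s) (wp (<ᵇ-false (ℕ.≤-reflexive eq) , refl)) (λ { s' (() , _) })
        (λ { s' (_ , refl) → wp (ofʸ eq , refl) }) })
    ... | tri> nlt ne gt = wp-ite (λ b s' → b ≡ false × s' ≡ s) (wp (<ᵇ-false (ℕ.<⇒≤ gt) , refl)) (λ { s' (() , _) })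
      (λ { s' (_ , refl) → wp-ite (λ b s'' → b ≡ true × s'' ≡ s) (wp (<ᵇ-true gt , refl))
        (λ { s' (_ , refl) → wp (ofⁿ ne , refl) }) (λ { s' (() , _) }) })

    wp-eqAll : ∀ {v l} (xs ys : Vec (Fin v) l) η s →
      WP (eqAll xs ys) η s (λ b s' → Reflects (Vec.map (lookup η) xs ≡ Vec.map (lookup η) ys) b × s' ≡ s)
    wp-eqAll []       []       η s = wp (ofʸ refl , refl)
    wp-eqAll (x ∷ xs) (y ∷ ys) η s = wp-ite _ (wp-eqv x y η s)
      (λ { s' (ofʸ e , refl) → wp-mono (λ { b s'' (ofʸ e' , q) → ofʸ (cong₂ _∷_ e e') , q
                                          ; b s'' (ofⁿ ne , q) → ofⁿ (λ z → ne (Vec.∷-injectiveʳ z)) , q })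
                                        (wp-eqAll xs ys η s') })
      (λ { s' (ofⁿ ne , refl) → wp (ofⁿ (λ z → ne (Vec.∷-injectiveˡ z)) , refl) })

    toℕs-injective : ∀ {n l} (s t : Vec (Fin n) l) → toℕs s ≡ toℕs t → s ≡ t
    toℕs-injective []      []      e = refl
    toℕs-injective (a ∷ s) (b ∷ t) e =
      cong₂ _∷_ (Fin.toℕ-injective (Vec.∷-injectiveˡ e)) (toℕs-injective s t (Vec.∷-injectiveʳ e))

    module _ {n : ℕ} (n≤L : n ≤ length w) where

      wp-locate : ∀ {v l} (xs : Vec (Fin v) l) η (x : Vec (Fin n) l) → Vec.map (lookup η) xs ≡ toℕs x →
        ∀ {s} → N s ≡ n → WP (locate xs) η s (λ b s' → s' ≡ record s { A = A s + numR x })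
      wp-locate {v} {l} xs η x e {s} hN = wp-mono final (wp-loops n≤L l I Q (λ { (_ , refl) → hN }) body
          (z≤n , cong (λ a → record s { A = a }) (sym (ℕ.+-identityʳ (A s)))))
        where
        I : ℕ → St r → Set
        I k s' = k ≤ numR x × s' ≡ record s { A = A s + k }
        Q : St r → Set
        Q s' = s' ≡ record s { A = A s + numR x }
        final : ∀ b s' → Branch Q (I (n ^ l)) b s' → Q s'
        final true  s' q       = q
        final false s' (h , _) = ⊥-elim (ℕ.<⇒≱ (numR-bound x) h)
        body : ∀ (b : Vec (Fin n) l) s' → I (numR b) s' →
          WP (ite (eqAll (firstVars l) (Vec.map (l ↑ʳ_) xs)) (ret true) (prim incA)) (toℕs b Vec.++ η) s' (Branch Q (I (suc (numR b))))
        body b s' (h , refl) = wp-ite _ (wp-eqAll (firstVars l) (Vec.map (l ↑ʳ_) xs) (toℕs b Vec.++ η) s')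
          (λ { s'' (ofʸ eq , refl) → wp (cong (λ t → record s { A = A s + numR t }) (same eq)) })
          (λ { s'' (ofⁿ ne , refl) → wp (ℕ.≤∧≢⇒< h (λ eq → ne (different (numR-injective b x eq))) ,
                 cong (λ a → record s { A = a }) (sym (ℕ.+-suc (A s) (numR b)))) })
          where
          lhs : Vec.map (lookup (toℕs b Vec.++ η)) (firstVars l) ≡ toℕs b
          lhs = lookup-firstVars (toℕs b) η
          rhs : Vec.map (lookup (toℕs b Vec.++ η)) (Vec.map (l ↑ʳ_) xs) ≡ toℕs x
          rhs = trans (lookup-shift (toℕs b) η xs) e
          same : Vec.map (lookup (toℕs b Vec.++ η)) (firstVars l) ≡ Vec.map (lookup (toℕs b Vec.++ η)) (Vec.map (l ↑ʳ_) xs) → b ≡ x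
          same eq = toℕs-injective b x (trans (sym lhs) (trans eq rhs))
          different : b ≡ x → Vec.map (lookup (toℕs b Vec.++ η)) (firstVars l) ≡ Vec.map (lookup (toℕs b Vec.++ η)) (Vec.map (l ↑ʳ_) xs)
          different refl = trans lhs (sym rhs)

      wp-skip : ∀ {v} l (η : Vec ℕ v) {s} → N s ≡ n → WP (skip l) η s (λ b s' → s' ≡ record s { A = A s + n ^ l })
      wp-skip l η {s} hN = wp-mono (λ { true _ () ; false _ q → q })
        (wp-loops n≤L l (λ k s' → s' ≡ record s { A = A s + k }) (λ _ → ⊥) (λ { refl → hN })
          (λ { b s' refl → wp (cong (λ a → record s { A = a }) (sym (ℕ.+-suc (A s) (numR b)))) })
          (cong (λ a → record s { A = a }) (sym (ℕ.+-identityʳ (A s)))))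

      wp-walk : ∀ {v j} (ar : Vec ℕ j) i (ts : Vec (Fin v) (lookup ar i)) η t → Vec.map (lookup η) ts ≡ toℕs t →
        ∀ {s} → N s ≡ n → WP (walk ar i ts) η s (λ b s' → b ≡ isOne (nthᵐ w (A s + position n ar i t)) × Keep 0 s s' × arr s' ≡ arr s)
      wp-walk (l ∷ ar) zero ts η t e {s} hN =
        wp-seq _ (wp-locate (Vec.reverse ts) η (Vec.reverse t)
            (trans (Vec.map-reverse (lookup η) ts) (trans (cong Vec.reverse e) (sym (Vec.map-reverse toℕ t)))) hN)
          (λ { b s' refl → wp (refl , keep refl refl (λ _ _ _ → refl) , refl) })
      wp-walk (l ∷ ar) (suc i) ts η t e {s} hN =
        wp-seq _ (wp-skip l η hN)
          (λ { b s' refl → wp-mono (λ b s'' (p , q , q') → trans p (cong (λ a → isOne (nthᵐ w a)) (ℕ.+-assoc (A s) (n ^ l) _)) ,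
                                      keep (keepN q) (keepOut q) (λ _ ()) , q')
                                   (wp-walk ar i ts η t e hN) })

      wp-fetch : ∀ {v l} d pol (xs : Vec (Fin v) l) η (x : Vec (Fin n) l) → Vec.map (lookup η) xs ≡ toℕs x →
        ∀ {s} → N s ≡ n → WP (fetch (d , pol) xs) η s (λ b s' → b ≡ pol xor arr s d (numR x) × s' ≡ record s { A = numR x })
      wp-fetch d pol xs η x e {s} hN =
        wp-seq (λ b s' → s' ≡ record s { A = 0 }) (wp refl) (λ { b s' refl →
          wp-seq _ (wp-locate xs η x e hN) (λ { b s' refl → wp-xor pol (wp (refl , refl)) }) })

      wp-clear : ∀ {v} k l (η : Vec ℕ v) {s} → N s ≡ n →
        WP (clear k l) η s (λ b s' → Keep k s s' × (∀ i → i < n ^ l → arr s' k i ≡ false))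
      wp-clear k l η {s} hN =
        wp-seq (λ b s' → s' ≡ record s { A = 0 }) (wp refl) (λ { b s' refl →
          wp-mono (λ { true _ () ; false s' (_ , q , h) → q , h })
            (wp-loops n≤L l I (λ _ → ⊥) (λ (_ , q , _) → trans (keepN q) hN) body (refl , keep refl refl (λ _ _ _ → refl) , λ _ ())) })
        where
        I : ℕ → St r → Set
        I m s' = A s' ≡ m × Keep k s s' × (∀ i → i < m → arr s' k i ≡ false)
        body : ∀ (b : Vec (Fin n) l) s' → I (numR b) s' →
          WP (seq (prim (setA k false)) (prim incA)) (toℕs b Vec.++ η) s' (Branch (λ _ → ⊥) (I (suc (numR b))))
        body b s' (refl , q , h) = wp (refl , keep-trans q (keep refl refl other) , new)
          where
          other : ∀ d → d < k → ∀ i → (if (d ≡ᵇ k) ∧ (i ≡ᵇ A s') then false else arr s' d i) ≡ arr s' d i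
          other d h i rewrite ≡ᵇ-< h = refl
          new : ∀ i → i < suc (A s') → (if (k ≡ᵇ k) ∧ (i ≡ᵇ A s') then false else arr s' k i) ≡ false
          new i h' rewrite ≡ᵇ-refl k with i ≡ᵇ A s' in eq
          ... | true  = refl
          ... | false = h i (ℕ.≤∧≢⇒< (ℕ.≤-pred h') (λ { refl → absurd (trans (sym eq) (≡ᵇ-refl i)) }))
            where absurd : false ≢ true
                  absurd ()

  count : ℕ → (ℕ → Bool) → ℕ
  count zero    f = 0
  count (suc m) f = (if f m then 1 else 0) + count m f

  count-≤ : ∀ m f → count m f ≤ m
  count-≤ zero    f = z≤n
  count-≤ (suc m) f with f m
  ... | true  = s≤s (count-≤ m f)
  ... | false = ℕ.m≤n⇒m≤1+n (count-≤ m f)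

  count-mono : ∀ m f g → (∀ p → p < m → f p ⇒ᵇ g p) → count m f ≤ count m g
  count-mono zero    f g h = z≤n
  count-mono (suc m) f g h with f m | g m | h m ℕ.≤-refl
  ... | true  | true  | _ = s≤s (count-mono m f g (λ p q → h p (ℕ.m≤n⇒m≤1+n q)))
  ... | true  | false | e = ⊥-elim (absurd (e refl))
    where absurd : false ≢ true
          absurd ()
  ... | false | true  | _ = ℕ.m≤n⇒m≤1+n (count-mono m f g (λ p q → h p (ℕ.m≤n⇒m≤1+n q)))
  ... | false | false | _ = count-mono m f g (λ p q → h p (ℕ.m≤n⇒m≤1+n q))

  -- The dichotomy behind the bound on the number of sweeps, since a count can grow at most m times.
  count-step : ∀ m f g → (∀ p → p < m → f p ⇒ᵇ g p) → (∀ p → p < m → g p ⇒ᵇ f p) ⊎ count m f < count m g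
  count-step zero    f g h = inj₁ (λ _ ())
  count-step (suc m) f g h with f m in ef | g m in eg | h m ℕ.≤-refl | count-step m f g (λ p q → h p (ℕ.m≤n⇒m≤1+n q))
  ... | true  | true  | _ | inj₂ c = inj₂ (s≤s c)
  ... | false | false | _ | inj₂ c = inj₂ c
  ... | false | true  | _ | _      = inj₂ (s≤s (count-mono m f g (λ p q → h p (ℕ.m≤n⇒m≤1+n q))))
  ... | true  | false | e | _      = ⊥-elim (absurd (e refl))
    where absurd : false ≢ true
          absurd ()
  ... | true  | true  | _ | inj₁ k = inj₁ below-suc
    where
    below-suc : ∀ p → p < suc m → g p ⇒ᵇ f p
    below-suc p q e with ℕ.m≤n⇒m<n∨m≡n (ℕ.≤-pred q)
    ... | inj₁ p<m  = k p p<m e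
    ... | inj₂ refl = ef
  ... | false | false | _ | inj₁ k = inj₁ below-suc
    where
    below-suc : ∀ p → p < suc m → g p ⇒ᵇ f p
    below-suc p q e with ℕ.m≤n⇒m<n∨m≡n (ℕ.≤-pred q)
    ... | inj₁ p<m  = k p p<m e
    ... | inj₂ refl = trans ef (trans (sym eg) e)

  count-full : ∀ m f → m ≤ count m f → ∀ p → p < m → f p ≡ true
  count-full (suc m) f h p q with f m in eq
  ... | false = ⊥-elim (ℕ.<⇒≱ h (count-≤ m f))
  ... | true with ℕ.m≤n⇒m<n∨m≡n (ℕ.≤-pred q)
  ...   | inj₁ p<m  = count-full m f (ℕ.≤-pred h) p p<m
  ...   | inj₂ refl = eq

  module Sweep {r : ℕ} (w : List (Fin 2)) {m₀ : ℕ} (n≤L : suc m₀ ≤ length w) {l : ℕ} (G : Operator (suc m₀) l)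
      (G-mono : ∀ R R' → (∀ t → R t ⇒ᵇ R' t) → ∀ t → G R t ⇒ᵇ G R' t) (k : ℕ) where
    open Logic {r} w

    private
      n = suc m₀

    content : St r → Vec (Fin n) l → Bool
    content s t = arr s k (numR t)

    -- Being included in all closed relations survives the addition of any element that G yields, by
    -- monotonicity; the order of additions is irrelevant.
    record Sound (s₀ s : St r) : Set where
      constructor sound
      field
        kept  : Keep k s₀ s
        least : ∀ R → Closed G R → ∀ t → content s t ⇒ᵇ R t

    record Computed (s₀ s : St r) : Set where
      constructor computed
      field
        valid  : Sound s₀ s
        closed : Closed G (content s)

    module _ {v : ℕ} (body : Cmd r (l + (l + v))) (η : Vec ℕ v) (pol : Bool) {s₀ : St r} (hN : N s₀ ≡ n)
      (wp-body : ∀ (b c : Vec (Fin n) l) s → Sound s₀ s →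
        WP (xorC pol body) (toℕs b Vec.++ (toℕs c Vec.++ η)) s (λ t s' → t ≡ G (content s) b × Keep (suc k) s s')) where

      private
        sweepBody : Cmd r (l + (l + v))
        sweepBody = ite (xorC pol body) (seq (prim resetA) (seq (locate (firstVars l)) (prim (setA k true)))) (ret false)

        -- The array is updated in place, so later tests of a sweep already see new elements.
        -- Comparison with the content at the start of the sweep is enough: by monotonicity the
        -- sweep adds at least what G yields on that content.
        Grown : St r → ℕ → St r → Set
        Grown s₁ m s = Sound s₀ s × (∀ t → content s₁ t ⇒ᵇ content s t) × (∀ t → numR t < m → G (content s₁) t ⇒ᵇ content s t)

        add : St r → ℕ → St r
        add s p = record s { A = p ; arr = λ e i → if (e ≡ᵇ k) ∧ (i ≡ᵇ p) then true else arr s e i }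

        add-new : ∀ s p → arr (add s p) k p ≡ true
        add-new s p rewrite ≡ᵇ-refl k | ≡ᵇ-refl p = refl

        add-old : ∀ s p i → arr s k i ⇒ᵇ arr (add s p) k i
        add-old s p i q rewrite ≡ᵇ-refl k with i ≡ᵇ p
        ... | true  = refl
        ... | false = q

        add-only : ∀ s p i → arr (add s p) k i ≡ true → i ≡ p ⊎ arr s k i ≡ true
        add-only s p i q rewrite ≡ᵇ-refl k with i ≡ᵇ p in eq
        ... | true  = inj₁ (≡ᵇ-sound i p eq)
        ... | false = inj₂ q

        add-keep : ∀ s p → Keep k s (add s p)
        add-keep s p = keep refl refl other
          where
          other : ∀ d → d < k → ∀ i → (if (d ≡ᵇ k) ∧ (i ≡ᵇ p) then true else arr s d i) ≡ arr s d i
          other d h i rewrite ≡ᵇ-< h = refl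

        same-content : ∀ {s s'} → Keep (suc k) s s' → ∀ t → content s' t ≡ content s t
        same-content q t = keepArr q k ℕ.≤-refl (numR t)

        sound-keep : ∀ {s s'} → Sound s₀ s → Keep (suc k) s s' → Sound s₀ s'
        sound-keep (sound q b) q' = sound (keep-trans q (keep-weaken (ℕ.n≤1+n k) q'))
          (λ R c t e → b R c t (trans (sym (same-content q' t)) e))

        wp-sweepBody : ∀ s₁ (b c : Vec (Fin n) l) s → Grown s₁ (numR b) s →
          WP sweepBody (toℕs b Vec.++ (toℕs c Vec.++ η)) s (Branch (λ _ → ⊥) (Grown s₁ (suc (numR b))))
        wp-sweepBody s₁ b c s (snd , grow , done) = wp-ite _ (wp-body b c s snd) yes-case no-case
          where
          η' = toℕs b Vec.++ (toℕs c Vec.++ η)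
          yes-case : ∀ s' → true ≡ G (content s) b × Keep (suc k) s s' →
            WP (seq (prim resetA) (seq (locate (firstVars l)) (prim (setA k true)))) η' s' (Branch (λ _ → ⊥) (Grown s₁ (suc (numR b))))
          yes-case s' (e , q) =
            wp-seq (λ _ s'' → s'' ≡ record s' { A = 0 }) (wp refl) (λ { _ _ refl →
            wp-seq _ (wp-locate n≤L (firstVars l) η' b (lookup-firstVars (toℕs b) _) {record s' { A = 0 }}
                       (trans (keepN (Sound.kept (sound-keep snd q))) hN)) (λ { _ _ refl →
              wp (sound (keep-trans (Sound.kept (sound-keep snd q)) (add-keep s' (numR b))) ok ,
                  (λ t h → add-old s' (numR b) (numR t) (trans (same-content q t) (grow t h))) , new) }) })
            where
            ok : ∀ R → Closed G R → ∀ t → content (add s' (numR b)) t ⇒ᵇ R t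
            ok R cl t h with add-only s' (numR b) (numR t) h
            ... | inj₂ h' = Sound.least (sound-keep snd q) R cl t h'
            ... | inj₁ h' with numR-injective t b h'
            ...   | refl = cl b (G-mono (content s) R (Sound.least snd R cl) b (sym e))
            new : ∀ t → numR t < suc (numR b) → G (content s₁) t ⇒ᵇ content (add s' (numR b)) t
            new t h g with ℕ.m≤n⇒m<n∨m≡n (ℕ.≤-pred h)
            ... | inj₁ lt' = add-old s' (numR b) (numR t) (trans (same-content q t) (done t lt' g))
            ... | inj₂ eq with numR-injective t b eq
            ...   | refl = add-new s' (numR b)
          no-case : ∀ s' → false ≡ G (content s) b × Keep (suc k) s s' → WP (ret false) η' s' (Branch (λ _ → ⊥) (Grown s₁ (suc (numR b))))
          no-case s' (e , q) = wp (sound-keep snd q , (λ t h → trans (same-content q t) (grow t h)) , new)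
            where
            new : ∀ t → numR t < suc (numR b) → G (content s₁) t ⇒ᵇ content s' t
            new t h g with ℕ.m≤n⇒m<n∨m≡n (ℕ.≤-pred h)
            ... | inj₁ lt' = trans (same-content q t) (done t lt' g)
            ... | inj₂ eq with numR-injective t b eq
            ...   | refl = ⊥-elim (absurd (trans e (G-mono (content s₁) (content s) grow b g)))
              where absurd : false ≢ true
                    absurd ()

        -- A sweep that finds no closed set has added an element, so after i of them there are at
        -- least i elements.
        Progress : ℕ → St r → Set
        Progress i s = Sound s₀ s × (Closed G (content s) ⊎ i ≤ count (n ^ l) (arr s k))

        progress : ∀ i s₁ s → Progress i s₁ → Grown s₁ (n ^ l) s → Progress (suc i) s
        progress i s₁ s (snd₁ , p) (snd , grow , done) = snd , conclude (count-step (n ^ l) (arr s₁ k) (arr s k) grow') p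
          where
          grow' : ∀ p → p < n ^ l → arr s₁ k p ⇒ᵇ arr s k p
          grow' p h with numR-surjective l p h
          ... | t , refl = grow t
          unchanged : (∀ p → p < n ^ l → arr s k p ⇒ᵇ arr s₁ k p) → Closed G (content s)
          unchanged h t g = done t (numR-bound t) (G-mono (content s) (content s₁) (λ u → h (numR u) (numR-bound u)) t g)
          conclude : (∀ p → p < n ^ l → arr s k p ⇒ᵇ arr s₁ k p) ⊎ count (n ^ l) (arr s₁ k) < count (n ^ l) (arr s k) →
            Closed G (content s₁) ⊎ i ≤ count (n ^ l) (arr s₁ k) → Closed G (content s) ⊎ suc i ≤ count (n ^ l) (arr s k)
          conclude (inj₁ h) _         = inj₁ (unchanged h)
          conclude (inj₂ c) (inj₂ le) = inj₂ (ℕ.≤-trans (s≤s le) c)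
          -- A closed content contains every sound one, so the sweep cannot have added anything.
          conclude (inj₂ c) (inj₁ cl) = inj₁ (unchanged back)
            where
            back : ∀ p → p < n ^ l → arr s k p ⇒ᵇ arr s₁ k p
            back p h with numR-surjective l p h
            ... | t , refl = Sound.least snd (content s₁) cl t

      wp-fixpoint : ∀ (xs : Vec (Fin v) l) x → Vec.map (lookup η) xs ≡ toℕs x →
        WP (fixpoint pol k l body xs) η s₀ (λ b s' → ∃ λ s → b ≡ pol xor content s x × Computed s₀ s × Keep k s₀ s')
      wp-fixpoint xs x e =
        wp-seq _ (wp-clear n≤L k l η hN) (λ { _ s (q , empty) →
        wp-seq (λ _ s' → Computed s₀ s') (wp-mono (λ { true _ () ; false s' p → finished s' p })
          (wp-loops n≤L l Progress (λ _ → ⊥) (λ (snd , _) → trans (keepN (Sound.kept snd)) hN)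
            (λ c s₁ p → wp-mono (λ { true _ () ; false s' g → progress (numR c) s₁ s' p g })
              (wp-loops n≤L l (Grown s₁) (λ _ → ⊥) (λ (snd , _) → trans (keepN (Sound.kept snd)) hN)
                (λ b s h → wp-sweepBody s₁ b c s h) (proj₁ p , (λ _ h → h) , λ _ ())))
            (sound q (λ R cl t h → ⊥-elim (absurd (trans (sym (empty (numR t) (numR-bound t))) h))) , inj₂ z≤n)))
        (λ _ s' C → wp-mono (λ { b s'' (p , refl) → s' , p , C , keep-trans (Sound.kept (Computed.valid C)) (keep refl refl (λ _ _ _ → refl)) })
          (wp-fetch n≤L k pol xs η x e (trans (keepN (Sound.kept (Computed.valid C))) hN))) })
        where
        absurd : false ≢ true
        absurd ()
        finished : ∀ s' → Progress (n ^ l) s' → Computed s₀ s'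
        finished s' (snd , inj₁ cl)   = computed snd cl
        -- After n ^ l productive sweeps the array is full, and the full relation is closed.
        finished s' (snd , inj₂ full) = computed snd (λ t _ → count-full (n ^ l) (arr s' k) full (numR t) (numR-bound t))

  module Correct {r j : ℕ} {ar : Vocab j} (w : List (Fin 2)) (𝔄 : Struct ar) (n≤L : size 𝔄 ≤ length w)
      (reads : ∀ i t → isOne (nthᵐ w (position (size 𝔄) ar i t)) ≡ rels 𝔄 i t) where
    open Logic {r} w

    private
      n = size 𝔄

    record Holds {k} (Δ : Vec ℕ k) (as : Vec (ℕ × Bool) k) (ρ : RelEnv n Δ) (s : St r) : Set where
      constructor holds
      field
        low   : ∀ i → proj₁ (lookup as i) < k
        value : ∀ i t → proj₂ (lookup as i) xor arr s (proj₁ (lookup as i)) (numR t) ≡ ρ i t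

    holds-keep : ∀ {k} {Δ : Vec ℕ k} {as} {ρ : RelEnv n Δ} {s s'} → Keep k s s' → Holds Δ as ρ s → Holds Δ as ρ s'
    holds-keep {as = as} q (holds lo val) = holds lo (λ i t →
      trans (cong (proj₂ (lookup as i) xor_) (keepArr q _ (lo i) (numR t))) (val i t))

    holds-extR : ∀ {k l} {Δ : Vec ℕ k} {as} {ρ : RelEnv n Δ} {s} pol → Holds Δ as ρ s →
      Holds (l ∷ Δ) ((k , pol) ∷ as) (extR {l = l} (λ t → pol xor arr s k (numR t)) ρ) s
    holds-extR pol (holds lo val) = holds (λ { zero → ℕ.≤-refl ; (suc i) → ℕ.m≤n⇒m≤1+n (lo i) })
      (λ { zero t → refl ; (suc i) t → val i t })

    -- With pol set this is the De Morgan dual of F, whose least fixed point is the complement of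
    -- the greatest fixed point of F. So a single program computes both kinds.
    dualise : ∀ {l} → Bool → Operator n l → Operator n l
    dualise pol F R b = pol xor F (λ t → pol xor R t) b

    agree : ∀ {u v l} {η : Vec (Fin n) v} {η' : Vec ℕ u} (τ : Vec (Fin u) v) → Vec.map (lookup η') τ ≡ toℕs η →
      ∀ (ts : Vec (Fin v) l) → Vec.map (lookup η') (Vec.map (lookup τ) ts) ≡ toℕs (Vec.map (lookup η) ts)
    agree {η = η} {η'} τ e ts = trans (map-lookup-map η' τ ts) (trans (cong (λ z → Vec.map (lookup z) ts) e)
      (trans (Vec.map-cong (λ i → Vec.lookup-map i toℕ η) ts) (Vec.map-∘ toℕ (lookup η) ts)))

    agree₁ : ∀ {u v} {η : Vec (Fin n) v} {η' : Vec ℕ u} (τ : Vec (Fin u) v) → Vec.map (lookup η') τ ≡ toℕs η →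
      ∀ x → lookup η' (lookup τ x) ≡ toℕ (lookup η x)
    agree₁ {η' = η'} τ e x = Vec.∷-injectiveˡ (agree {η' = η'} τ e (x ∷ []))

    agree-inner : ∀ {u v l} {η : Vec (Fin n) v} {η' : Vec ℕ u} (τ : Vec (Fin u) v) → Vec.map (lookup η') τ ≡ toℕs η →
      ∀ (b c : Vec (Fin n) l) → Vec.map (lookup (toℕs b Vec.++ (toℕs c Vec.++ η'))) (innerVars l τ) ≡ toℕs (b Vec.++ η)
    agree-inner {l = l} {η} {η'} τ e b c = trans (Vec.map-++ (lookup env) (firstVars l) _)
      (trans (cong₂ Vec._++_ (lookup-firstVars (toℕs b) _)
        (trans (lookup-shift (toℕs b) _ (Vec.map (l ↑ʳ_) τ)) (trans (lookup-shift (toℕs c) η' τ) e)))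
        (sym (Vec.map-++ toℕ b η)))
      where env = toℕs b Vec.++ (toℕs c Vec.++ η')

    wp-formula : ∀ {v v' k} {Δ : Vec ℕ k} (φ : Formula ar v Δ) → WF φ → ∀ (τ : Vec (Fin v') v) as (η : Vec (Fin n) v) (ρ : RelEnv n Δ) η' s →
      Vec.map (lookup η') τ ≡ toℕs η → N s ≡ n → Holds Δ as ρ s →
      WP (evalP φ τ as) η' s (λ b s' → b ≡ evalB 𝔄 φ η ρ × Keep k s s')

    wp-body : ∀ {v v' k} {Δ : Vec ℕ k} l (ψ : Formula ar (l + v) (l ∷ Δ)) → Pos zero ψ × WF ψ → ∀ pol (τ : Vec (Fin v') v) as
      (η : Vec (Fin n) v) (ρ : RelEnv n Δ) η' s₀ → Vec.map (lookup η') τ ≡ toℕs η → N s₀ ≡ n → Holds Δ as ρ s₀ →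
      let G = dualise pol (operator 𝔄 ψ η ρ) in
      (G-mono : ∀ R R' → (∀ t → R t ⇒ᵇ R' t) → ∀ t → G R t ⇒ᵇ G R' t) →
      ∀ (b c : Vec (Fin n) l) s → Sweep.Sound w n≤L G G-mono k s₀ s →
      WP (xorC pol (evalP ψ (innerVars l τ) ((k , pol) ∷ as))) (toℕs b Vec.++ (toℕs c Vec.++ η')) s
        (λ t s' → t ≡ G (λ t → arr s k (numR t)) b × Keep (suc k) s s')
    wp-body {k = k} l ψ (pos , wf) pol τ as η ρ η' s₀ e hN hold G-mono b c s (Sweep.sound q _) =
      wp-xor pol (wp-mono (λ t s' (p , q') → cong (pol xor_) p , q')
        (wp-formula ψ wf (innerVars l τ) ((k , pol) ∷ as) (b Vec.++ η) (extR (λ t → pol xor arr s k (numR t)) ρ) _ s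
          (agree-inner τ e b c) (trans (keepN q) hN) (holds-extR pol (holds-keep q hold))))

    dualise-mono : ∀ {v k} {Δ : Vec ℕ k} {l} (ψ : Formula ar (l + v) (l ∷ Δ)) → Pos zero ψ → ∀ pol η ρ R R' →
      (∀ t → R t ⇒ᵇ R' t) → ∀ t → dualise pol (operator 𝔄 ψ η ρ) R t ⇒ᵇ dualise pol (operator 𝔄 ψ η ρ) R' t
    dualise-mono ψ pos false η ρ R R' h t = operator-mono 𝔄 ψ pos η ρ R R' h t
    dualise-mono ψ pos true  η ρ R R' h t = not-⇒ᵇ (operator-mono 𝔄 ψ pos η ρ _ _ (λ u → not-⇒ᵇ (h u)) t)

    wp-formula ff wf τ as η ρ η' s e hN h = wp (refl , keep-refl)
    wp-formula (rel i ts) wf τ as η ρ η' s e hN h =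
      wp-seq (λ _ s' → s' ≡ record s { A = 0 }) (wp refl) (λ { _ _ refl →
        wp-mono (λ b s' (p , q , a) → trans p (reads i _) , keep (keepN q) (keepOut q) (λ d _ i → cong (λ f → f d i) a))
          (wp-walk n≤L ar i _ η' _ (agree {η' = η'} τ e ts) hN) })
    wp-formula (lt x y) wf τ as η ρ η' s e hN h =
      wp (cong₂ _<ᵇ_ (agree₁ {η' = η'} τ e x) (agree₁ {η' = η'} τ e y) , keep-refl)
    wp-formula (rvar i ts) wf τ as η ρ η' s e hN h =
      wp-mono (λ { b s' (p , refl) → trans p (Holds.value h i _) , keep refl refl (λ _ _ _ → refl) })
        (wp-fetch n≤L _ _ _ η' _ (agree {η' = η'} τ e ts) hN)
    wp-formula (neg φ) wf τ as η ρ η' s e hN h =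
      wp-xor true (wp-mono (λ b s' (p , q) → cong not p , q) (wp-formula φ wf τ as η ρ η' s e hN h))
    wp-formula (or φ ψ) (wf₁ , wf₂) τ as η ρ η' s e hN h =
      wp-ite _ (wp-formula φ wf₁ τ as η ρ η' s e hN h)
        (λ s' (p , q) → wp (cong (_∨ evalB 𝔄 ψ η ρ) p , q))
        (λ s' (p , q) → wp-mono (λ b s'' (p' , q') → trans p' (cong (_∨ evalB 𝔄 ψ η ρ) p) , keep-trans q q')
          (wp-formula ψ wf₂ τ as η ρ η' s' e (trans (keepN q) hN) (holds-keep q h)))
    wp-formula {k = k} (ex φ) wf τ as η ρ η' s e hN h =
      wp-mono final (wp-loop n≤L I (λ s' → evalB 𝔄 (ex φ) η ρ ≡ true × Keep k s s')
        (λ (q , _) → trans (keepN q) hN) body (keep-refl , λ _ ()))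
      where
      I : ℕ → St r → Set
      I m s' = Keep k s s' × (∀ a → toℕ a < m → evalB 𝔄 φ (a ∷ η) ρ ≡ false)
      absurd : ∀ {A : Set} {b} → b ≡ true → b ≡ false → A
      absurd refl ()
      final : ∀ b s' → Branch _ (I n) b s' → b ≡ evalB 𝔄 (ex φ) η ρ × Keep k s s'
      final true  s' (p , q) = sym p , q
      final false s' (q , p) = ⇒ᵇ-antisym (λ ()) (λ x → let (a , _ , y) = any-sound {p = λ c → evalB 𝔄 φ (c ∷ η) ρ} (Data.List.allFin n) x in absurd y (p a (Fin.toℕ<n a))) , q
      body : ∀ i s' → i < n → I i s' → WP (evalP φ (zero ∷ Vec.map suc τ) as) (i ∷ η') s' (Branch _ (I (suc i)))
      body i s' i<n (q , p) with Data.Fin.fromℕ< i<n | Fin.toℕ-fromℕ< i<n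
      ... | a | refl = wp-mono (λ { true s'' (x , q') → any-complete {p = λ c → evalB 𝔄 φ (c ∷ η) ρ} {xs = Data.List.allFin n} (∈-allFin a) (sym x) , keep-trans q q'
                                  ; false s'' (x , q') → keep-trans q q' , more x })
          (wp-formula φ wf (zero ∷ Vec.map suc τ) as (a ∷ η) ρ (toℕ a ∷ η') s'
            (cong (toℕ a ∷_) (trans (lookup-shift (toℕ a ∷ []) η' τ) e)) (trans (keepN q) hN) (holds-keep q h))
        where
        more : false ≡ evalB 𝔄 φ (a ∷ η) ρ → ∀ c → toℕ c < suc (toℕ a) → evalB 𝔄 φ (c ∷ η) ρ ≡ false
        more x c l with ℕ.m≤n⇒m<n∨m≡n (ℕ.≤-pred l)
        ... | inj₁ c<a = p c c<a
        ... | inj₂ eq with Fin.toℕ-injective eq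
        ...   | refl = sym x
    wp-formula {k = k} (lfp l ψ ts) wf τ as η ρ η' s e hN h =
      wp-mono (λ { b s' (s₁ , p , computed (sound _ bel) cl , q) →
          -- The array is included in every closed relation and is itself closed, which makes it the
          -- least fixed point.
          trans p (⇒ᵇ-antisym (λ x → lfp-intro F (λ R c → bel R c _ x)) (λ x → lfp-elim F (operator-ext 𝔄 ψ η ρ) x (content s₁) cl)) , q })
        (wp-fixpoint _ η' false hN (wp-body l ψ wf false τ as η ρ η' s e hN h (dualise-mono ψ (proj₁ wf) false η ρ))
          _ _ (agree {η' = η'} τ e ts))
      where
      F = operator 𝔄 ψ η ρ
      open Sweep {r} w n≤L (dualise false F) (dualise-mono ψ (proj₁ wf) false η ρ) k
    wp-formula {k = k} (gfp l ψ ts) wf τ as η ρ η' s e hN h =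
      wp-mono (λ { b s' (s₁ , p , computed (sound _ bel) cl , q) → trans p (⇒ᵇ-antisym
          (gfp-intro F (operator-ext 𝔄 ψ η ρ) (λ t → not (content s₁ t)) (λ t → dense (cl t)))
          (λ x → let (R , d , y) = gfp-elim F x in outside (bel (λ t → not (R t)) (closed-not R d) _) y)) , q })
        (wp-fixpoint _ η' true hN (wp-body l ψ wf true τ as η ρ η' s e hN h (dualise-mono ψ (proj₁ wf) true η ρ))
          _ _ (agree {η' = η'} τ e ts))
      where
      F = operator 𝔄 ψ η ρ
      open Sweep {r} w n≤L (dualise true F) (dualise-mono ψ (proj₁ wf) true η ρ) k
      dense : ∀ {a b} → (not a ⇒ᵇ b) → not b ⇒ᵇ a
      dense {true}          f x = refl
      dense {false} {true}  f ()
      dense {false} {false} f x = f refl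
      outside : ∀ {a b} → (a ⇒ᵇ not b) → b ≡ true → not a ≡ true
      outside {true}  f refl = f refl
      outside {false} f x = refl
      closed-not : ∀ R → Dense F R → Closed (dualise true F) (λ t → not (R t))
      closed-not R d t = not-⇒ᵇ (λ x → operator-ext 𝔄 ψ η ρ R (λ u → not (not (R u))) (λ u → sym (not-involutive (R u))) t (d t x))

-- Recovering the size of the universe and printing terms of rectangular shape.

module Printing where
  open Machines
  open Programs
  open Encodings
  open Evaluation
  open PolynomialTime
  open import Data.List using (map; replicate)
  open import Relation.Binary.PropositionalEquality using (refl; sym; trans)

  sizes : ∀ {r v j} → Vec ℕ j → Cmd r v
  sizes []       = ret false
  sizes (l ∷ ar) = seq (skip l) (sizes ar)

  -- The least N ≥ 1 for which an encoding of a structure of size N is at least as long as the input.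
  computeN : ∀ {r j} → Vec ℕ j → Cmd r 0
  computeN ar = seq (prim incN)
    (loop false (seq (prim resetA) (seq (sizes ar) (ite (prim endA) (ret false) (prim incN)))))

  module _ {r : ℕ} (w : List (Fin 2)) where
    open Logic {r} w

    private
      L = length w

    wp-sizes : ∀ {n} → n ≤ L → ∀ {v j} (ar : Vec ℕ j) (η : Vec ℕ v) {s} → N s ≡ n →
      WP (sizes ar) η s (λ b s' → s' ≡ record s { A = A s + total ar n })
    wp-sizes n≤L []       η {s} hN = wp (cong (λ a → record s { A = a }) (sym (ℕ.+-identityʳ (A s))))
    wp-sizes {n} n≤L (l ∷ ar) η {s} hN = wp-seq _ (wp-skip n≤L l η hN) (λ { _ _ refl →
      wp-mono (λ { _ _ refl → cong (λ a → record s { A = a }) (ℕ.+-assoc (A s) (n ^ l) _) }) (wp-sizes n≤L ar η hN) })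

    wp-loopAll : ∀ {v} {c : Cmd r (suc v)} {η} (I : ℕ → St r → Set) →
      (∀ i s → I i s → WP c (i ∷ η) s (λ b s' → b ≡ false × I (suc i) s')) →
      ∀ {s} → I 0 s → WP (loop false c) η s (λ b s' → I L s')
    wp-loopAll {c = c} {η} I body {s} h = wp (go L 0 s (ℕ.+-identityʳ _) h)
      where
      go : ∀ fuel i s → fuel + i ≡ L → I i s → I L (proj₂ (loopS (λ i → sem w c (i ∷ η)) false fuel i s))
      go zero       i s e h = subst (λ x → I x s) e h
      go (suc fuel) i s e h with sem w c (i ∷ η) s | WP.un (body i s h)
      ... | false , s' | _ , h' = go fuel (suc i) s' (trans (ℕ.+-suc fuel i) e) h'

    module _ {j : ℕ} (ar : Vec ℕ j) (ne : ∃ λ i → lookup ar i ≢ 0) (L≥1 : 1 ≤ L) where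

      private
        -- Each round either has already reached a size n₀ that fits the length or increases N.
        -- After L rounds the second alternative of `close` would put N above L, so N is n₀.
        record I (i : ℕ) (s : St r) : Set where
          constructor inv
          field
            N≥1   : 1 ≤ N s
            N≤L   : N s ≤ L
            empty : out s ≡ []
            close : ∀ n₀ → 1 ≤ n₀ → total ar n₀ ≡ L → N s ≤ n₀ × (N s ≡ n₀ ⊎ suc i ≤ N s)

        body : ∀ i s → I i s → WP (seq (prim resetA) (seq (sizes ar) (ite (prim endA) (ret false) (prim incN)))) (i ∷ []) s
          (λ b s' → b ≡ false × I (suc i) s')
        body i s (inv a b c d) =
          wp-seq (λ _ s' → s' ≡ record s { A = 0 }) (wp refl) (λ { _ _ refl →
          wp-seq _ (wp-sizes b ar (i ∷ []) refl) (λ { _ _ refl →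
          wp-ite (λ t s' → is-nothing (nthᵐ w (total ar (N s))) ≡ t × s' ≡ record s { A = total ar (N s) }) (wp (refl , refl))
            (λ { s' (e , refl) → wp (refl , inv a b c (λ n₀ h₁ h₂ →
                let N≤ = proj₁ (d n₀ h₁ h₂) in N≤ , inj₁ (ℕ.≤-antisym N≤ (ℕ.≮⇒≥ (λ N<n₀ → stuck e
                  (subst (total ar (N s) <_) h₂ (total-strict ar ne N<n₀))))))) })
            -- Here an encoding of size N is shorter than the input and at least as long as N, hence
            -- N + 1 is still at most L.
            (λ { s' (e , refl) → wp (refl , (let N<L = ℕ.≰⇒> (λ L≤ → stuck' e L≤) in
              inv (s≤s z≤n) (ℕ.≤-trans (s≤s (total-≥ ar ne (N s))) N<L) c (λ n₀ h₁ h₂ →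
                let N<n₀ = ℕ.≰⇒> (λ n₀≤N → ℕ.<⇒≱ N<L (subst (_≤ total ar (N s)) h₂ (total-mono ar n₀≤N)))
                in N<n₀ , inj₂ (s≤s (Sum.[ (λ e → ⊥-elim (ℕ.<⇒≢ N<n₀ e)) , id ] (proj₂ (d n₀ h₁ h₂))))))) }) }) })
          where
          stuck : is-nothing (nthᵐ w (total ar (N s))) ≡ true → total ar (N s) < L → ⊥
          stuck e h rewrite nthᵐ-< w _ h with e
          ... | ()
          stuck' : is-nothing (nthᵐ w (total ar (N s))) ≡ false → L ≤ total ar (N s) → ⊥
          stuck' e h rewrite nthᵐ-length w _ h with e
          ... | ()

      wp-computeN : WP (computeN ar) [] initial-state (λ _ s → 1 ≤ N s × N s ≤ L × out s ≡ [] ×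
        (∀ n₀ → 1 ≤ n₀ → total ar n₀ ≡ L → N s ≡ n₀))
      wp-computeN = wp-seq (λ _ s' → s' ≡ record initial-state { N = 1 }) (wp refl) (λ { _ _ refl →
        wp-mono (λ _ s (inv a b c d) → a , b , c , λ n₀ h₁ h₂ →
            Sum.[ id , (λ h → ⊥-elim (ℕ.<⇒≱ h b)) ] (proj₂ (d n₀ h₁ h₂)))
          (wp-loopAll I body (inv ℕ.≤-refl L≥1 refl (λ n₀ h₁ h₂ → h₁ , inj₂ ℕ.≤-refl))) })

  data Tree (r : ℕ) {j} (ar : Vocab j) (v : ℕ) : Set where
    leaf : Fin r → Tree r ar v
    test : ∀ {u} (β : Formula ar u []) → WF β → Vec (Fin v) u → Tree r ar v → Tree r ar v → Tree r ar v

  -- k alternations of sum and product; each index runs through the n elements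
  -- of the universe and one further value "end".  The four parts treat the
  -- cases for the two outermost indices: both "end", only the sum index "end",
  -- only the product index "end", none.
  data NF (r : ℕ) {j} (ar : Vocab j) (v : ℕ) : ℕ → Set where
    tree : Tree r ar v → NF r ar v 0
    node : ∀ {k} → NF r ar v k → NF r ar (suc v) k → NF r ar (suc v) k → NF r ar (suc (suc v)) k → NF r ar v (suc k)

  treeIdx : ∀ {r j} {ar : Vocab j} (𝔄 : Struct ar) {v} → Tree r ar v → Vec (Fin (size 𝔄)) v → Fin r
  treeIdx 𝔄 (leaf s) η = s
  treeIdx 𝔄 (test β wf τ a b) η = if evalB 𝔄 β (Vec.map (lookup η) τ) noRels then treeIdx 𝔄 a η else treeIdx 𝔄 b η

  -- The extra value comes last. In a binary product the left operand sits at an element and the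
  -- right one at the extra value, so this order is the order of the factors.
  ext : ∀ {A : Set} {n} → (Fin n → A) → A → Fin (suc n) → A
  ext {n = zero}  f l _       = l
  ext {n = suc n} f l zero    = f zero
  ext {n = suc n} f l (suc i) = ext (f ∘ suc) l i

  ext-natural : ∀ {A B : Set} {n} (h : A → B) (f : Fin n → A) l i → h (ext f l i) ≡ ext (h ∘ f) (h l) i
  ext-natural {n = zero}  h f l i       = refl
  ext-natural {n = suc n} h f l zero    = refl
  ext-natural {n = suc n} h f l (suc i) = ext-natural h (f ∘ suc) l i

  ext-cong : ∀ {A : Set} {n} {f f' : Fin n → A} {l l'} → (∀ i → f i ≡ f' i) → l ≡ l' → ∀ i → ext f l i ≡ ext f' l' i
  ext-cong {n = zero}  e e' i       = e'
  ext-cong {n = suc n} e e' zero    = e zero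
  ext-cong {n = suc n} e e' (suc i) = ext-cong (e ∘ suc) e' i

  bigOp : ∀ {r} → Bool → ∀ m → (Fin (suc m) → Term r) → Term r
  bigOp true  = bigSum
  bigOp false = bigProd

  bigOp-cong : ∀ {r} o m {f f' : Fin (suc m) → Term r} → (∀ i → f i ≡ f' i) → bigOp o m f ≡ bigOp o m f'
  bigOp-cong true  zero    e = e zero
  bigOp-cong true  (suc m) e = cong₂ _[+]_ (e zero) (bigOp-cong true m (e ∘ suc))
  bigOp-cong false zero    e = e zero
  bigOp-cong false (suc m) e = cong₂ _[·]_ (e zero) (bigOp-cong false m (e ∘ suc))

  module _ {r j : ℕ} {ar : Vocab j} (𝔄 : Struct ar) where
    private
      n = size 𝔄

    term : ∀ {v k} → NF r ar v k → Vec (Fin n) v → Term r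
    term (tree t) η = gen (treeIdx 𝔄 t η)
    term (node ee ev ve vv) η = bigOp true n (ext
      (λ x → bigOp false n (ext (λ y → term vv (y ∷ x ∷ η)) (term ve (x ∷ η))))
      (bigOp false n (ext (λ y → term ev (y ∷ η)) (term ee η))))

    -- Bounds are stored as predecessors, so n stands for the n elements and the extra value.
    shape : ∀ k → Vec (ℕ × ℕ) k
    shape k = Vec.replicate k (n , n)

    leaves : ∀ {v k} → NF r ar v k → Vec (Fin n) v → Idx (shape k) → Fin r
    leaves (tree t) η _ = treeIdx 𝔄 t η
    leaves (node ee ev ve vv) η (x , y , ix) = ext
      (λ x' → ext (λ y' → leaves vv (y' ∷ x' ∷ η) ix) (leaves ve (x' ∷ η) ix) y)
      (ext (λ y' → leaves ev (y' ∷ η) ix) (leaves ee η ix) y) x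

    private
      nested-cong : ∀ {k} (sh : Vec (ℕ × ℕ) k) {s s' : Idx sh → Fin r} → (∀ ix → s ix ≡ s' ix) → nested sh s ≡ nested sh s'
      nested-cong []             e = cong gen (e tt)
      nested-cong ((m₁ , m₂) ∷ sh) e =
        bigOp-cong true m₁ (λ x → bigOp-cong false m₂ (λ y → nested-cong sh (λ ix → e (x , y , ix))))

    -- The printer follows `term`, while the definition of the class demands `nested`. As `ext`
    -- commutes with every function, the case distinctions at all levels can be moved into the
    -- leaves.
    term-nested : ∀ {v k} (nf : NF r ar v k) η → term nf η ≡ nested (shape k) (leaves nf η)
    term-nested (tree t) η = refl
    term-nested {v} {k = suc k} (node ee ev ve vv) η = bigOp-cong true n (λ x → trans
      (ext-cong (λ x' → inner (λ y' → vv , y' ∷ x' ∷ η) (ve , x' ∷ η)) (inner (λ y' → ev , y' ∷ η) (ee , η)) x)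
      (trans (sym (ext-natural (λ q → bigOp false n (λ y → nested (shape k) (q y))) F L x))
        (bigOp-cong false n (λ y → nested-cong (shape k) (λ ix → ext-natural (λ q → q y ix) F L x)))))
      where
      row : ∀ {v₁ v₂} → (Fin n → NF r ar v₁ k × Vec (Fin n) v₁) → NF r ar v₂ k × Vec (Fin n) v₂ →
        Fin (suc n) → Idx (shape k) → Fin r
      row f (nf , η') y ix = ext (λ y' → leaves (proj₁ (f y')) (proj₂ (f y')) ix) (leaves nf η' ix) y
      F : Fin n → Fin (suc n) → Idx (shape k) → Fin r
      F x' = row (λ y' → vv , y' ∷ x' ∷ η) (ve , x' ∷ η)
      L : Fin (suc n) → Idx (shape k) → Fin r
      L = row (λ y' → ev , y' ∷ η) (ee , η)
      inner : ∀ {v₁ v₂} (f : Fin n → NF r ar v₁ k × Vec (Fin n) v₁) (l : NF r ar v₂ k × Vec (Fin n) v₂) →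
        bigOp false n (ext (λ y → term (proj₁ (f y)) (proj₂ (f y))) (term (proj₁ l) (proj₂ l)))
        ≡ bigOp false n (λ y → nested (shape k) (row f l y))
      inner f (nf , η') = bigOp-cong false n (λ y → trans
        (ext-cong (λ y' → term-nested (proj₁ (f y')) (proj₂ (f y'))) (term-nested nf η') y)
        (trans (sym (ext-natural (nested (shape k)) g (leaves nf η') y))
          (nested-cong (shape k) (λ ix → ext-natural (λ q → q ix) g (leaves nf η') y))))
        where
        g : Fin n → Idx (shape k) → Fin r
        g y' = leaves (proj₁ (f y')) (proj₂ (f y'))

  opSym : ∀ {r} → Bool → TSym r
  opSym true  = plus
  opSym false = dot

  -- Sums and products are nested to the right, so their closing parentheses stand together at the
  -- end and a second loop prints them.
  chainC : ∀ {r v} → Bool → Cmd r (suc v) → Cmd r v → Cmd r v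
  chainC o body last = seq (loop true (seq (prim (emit lpar)) (seq body (prim (emit (opSym o))))))
    (seq last (loop true (prim (emit rpar))))

  printTree : ∀ {r j} {ar : Vocab j} {v} → Tree r ar v → Cmd r v
  printTree (leaf s)          = prim (emit (tsym s))
  printTree (test β wf τ a b) = ite (evalP β τ []) (printTree a) (printTree b)

  print : ∀ {r j} {ar : Vocab j} {v k} → NF r ar v k → Cmd r v
  print (tree t)            = printTree t
  print (node ee ev ve vv) = chainC true (chainC false (print vv) (print ve)) (chainC false (print ev) (print ee))

  prefix : ∀ {A : Set} {n} → (Fin n → List A) → ℕ → List A
  prefix             f zero    = []
  prefix {n = zero}  f (suc i) = []
  prefix {n = suc n} f (suc i) = f zero ++ prefix (f ∘ suc) i

  prefix-suc : ∀ {A : Set} {n} (f : Fin n → List A) a → prefix f (suc (toℕ a)) ≡ prefix f (toℕ a) ++ f a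
  prefix-suc f zero    = List.++-identityʳ (f zero)
  prefix-suc f (suc a) = trans (cong (f zero ++_) (prefix-suc (f ∘ suc) a)) (sym (List.++-assoc (f zero) _ _))

  replicate-∷ʳ : ∀ {A : Set} n (x : A) → replicate n x ++ x ∷ [] ≡ x ∷ replicate n x
  replicate-∷ʳ zero    x = refl
  replicate-∷ʳ (suc n) x = cong (x ∷_) (replicate-∷ʳ n x)

  render-chain : ∀ {r} o n (f : Fin n → Term r) l → render (bigOp o n (ext f l)) ≡
    prefix (λ i → lpar ∷ render (f i) ++ opSym o ∷ []) n ++ render l ++ replicate n rpar
  render-chain o zero    f l = trans (cong render (single o)) (sym (List.++-identityʳ (render l)))
    where
    single : ∀ o → bigOp o zero (ext f l) ≡ l
    single true  = refl
    single false = refl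
  render-chain {r} o (suc n) f l = trans (unfold o) (cong (lpar ∷_) (trans
    (cong (λ z → render (f zero) ++ opSym o ∷ z ++ rpar ∷ []) (render-chain o n (f ∘ suc) l))
    (trans (cong (λ z → render (f zero) ++ opSym o ∷ z) (trans (List.++-assoc pre _ _) (cong (pre ++_)
              (trans (List.++-assoc (render l) _ _) (cong (render l ++_) (replicate-∷ʳ n rpar))))))
           (trans (sym (List.++-assoc (render (f zero)) (opSym o ∷ []) _)) (sym (List.++-assoc (render (f zero) ++ opSym o ∷ []) pre _))))))
    where
    pre : List (TSym r)
    pre = prefix (λ i → lpar ∷ render (f (suc i)) ++ opSym o ∷ []) n
    unfold : ∀ o → render (bigOp o (suc n) (ext f l)) ≡
      lpar ∷ render (f zero) ++ opSym o ∷ render (bigOp o n (ext (f ∘ suc) l)) ++ rpar ∷ []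
    unfold true  = refl
    unfold false = refl

  module Printing {r j : ℕ} {ar : Vocab j} (w : List (Fin 2)) (𝔄 : Struct ar) (n≤L : size 𝔄 ≤ length w)
      (reads : ∀ i t → isOne (nthᵐ w (position (size 𝔄) ar i t)) ≡ rels 𝔄 i t) where
    open Logic {r} w
    open Correct {r} w 𝔄 n≤L reads

    private
      n = size 𝔄

    record Emits (u : List (TSym r)) (s : St r) (b : Bool) (s' : St r) : Set where
      constructor emits
      field
        size-eq : N s' ≡ n
        out-eq  : out s' ≡ out s ++ u
    open Emits

    emits-trans : ∀ {u u' s b s₁ b' b'' s₂} → Emits u s b s₁ → Emits u' s₁ b' s₂ → Emits (u ++ u') s b'' s₂
    emits-trans {u} {s = s} (emits _ e) (emits hN e') = emits hN (trans e' (trans (cong (_++ _) e) (List.++-assoc (out s) u _)))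

    wp-chain : ∀ o {v} {body : Cmd r (suc v)} {last : Cmd r v} {η} (f : Fin n → Term r) (l : Term r) →
      (∀ i s → N s ≡ n → WP body (toℕ i ∷ η) s (Emits (render (f i)) s)) →
      (∀ s → N s ≡ n → WP last η s (Emits (render l) s)) →
      ∀ s → N s ≡ n → WP (chainC o body last) η s (Emits (render (bigOp o n (ext f l))) s)
    wp-chain o {body = body} {last} {η} f l hb hl s hN =
      wp-seq (Emits (prefix part n) s) (wp-mono (λ { true _ () ; false s' (emits b e) → emits b e })
        (wp-loop n≤L (λ i → Emits (prefix part i) s false) (λ _ → ⊥) size-eq opening (emits hN (sym (List.++-identityʳ (out s))))))
      (λ b s₁ h₁ → wp-seq (Emits (render l) s₁) (hl s₁ (size-eq h₁)) (λ b' s₂ h₂ →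
        wp-mono (λ { true _ () ; false s₃ h₃ → subst (λ u → Emits u s false s₃) (sym (render-chain o n f l))
            (emits-trans h₁ (emits-trans {b'' = false} h₂ h₃)) })
          (wp-loop n≤L {c = prim (emit rpar)} {η} (λ i → Emits (replicate i rpar) s₂ false) (λ _ → ⊥) size-eq
            (λ { i s' _ (emits a e) → wp (emits a (trans (cong (_++ rpar ∷ []) e)
               (trans (List.++-assoc (out s₂) _ _) (cong (out s₂ ++_) (replicate-∷ʳ i rpar))))) })
            (emits (size-eq h₂) (sym (List.++-identityʳ (out s₂)))))))
      where
      part : Fin n → List (TSym r)
      part i = lpar ∷ render (f i) ++ opSym o ∷ []
      opening : ∀ i s' → i < n → Emits (prefix part i) s false s' →
        WP (seq (prim (emit lpar)) (seq body (prim (emit (opSym o))))) (i ∷ η) s' (Branch (λ _ → ⊥) (Emits (prefix part (suc i)) s false))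
      opening i s' i<n h with fromℕ< i<n | Fin.toℕ-fromℕ< i<n
      ... | a | refl = wp-seq (λ b → Emits (lpar ∷ []) s' b) (wp (emits (size-eq h) refl)) (λ b s₁ h₁ →
        wp-seq (Emits (render (f a)) s₁) (hb a s₁ (size-eq h₁)) (λ b' s₂ h₂ →
          wp (subst (λ u → Emits u s false (record s₂ { out = out s₂ ++ opSym o ∷ [] })) (sym (prefix-suc part a))
            (emits-trans h (emits-trans {b'' = false} h₁ (emits-trans {b' = false} {b'' = false} h₂ (emits (size-eq h₂) refl)))))))

    wp-tree : ∀ {v} (t : Tree r ar v) η s → N s ≡ n → WP (printTree t) (toℕs η) s (Emits (render (gen (treeIdx 𝔄 t η))) s)
    wp-tree (leaf x) η s hN = wp (emits hN refl)
    wp-tree (test β wf τ a b) η s hN =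
      wp-ite (λ c s' → c ≡ evalB 𝔄 β (Vec.map (lookup η) τ) noRels × Keep 0 s s')
        (wp-formula β wf τ [] (Vec.map (lookup η) τ) noRels (toℕs η) s
          (trans (Vec.map-cong (λ i → Vec.lookup-map i toℕ η) τ) (Vec.map-∘ toℕ (lookup η) τ)) hN (holds (λ ()) (λ ())))
        (λ s' (e , q) → wp-mono (λ c s'' (emits hN' e') → emits hN' (trans e' (cong₂ _++_ (keepOut q)
            (cong (λ z → render (gen z)) (cong (λ z → if z then treeIdx 𝔄 a η else treeIdx 𝔄 b η) e)))))
          (wp-tree a η s' (trans (keepN q) hN)))
        (λ s' (e , q) → wp-mono (λ c s'' (emits hN' e') → emits hN' (trans e' (cong₂ _++_ (keepOut q)
            (cong (λ z → render (gen z)) (cong (λ z → if z then treeIdx 𝔄 a η else treeIdx 𝔄 b η) e)))))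
          (wp-tree b η s' (trans (keepN q) hN)))

    wp-print : ∀ {v k} (nf : NF r ar v k) η s → N s ≡ n → WP (print nf) (toℕs η) s (Emits (render (term 𝔄 nf η)) s)
    wp-print (tree t) η s hN = wp-tree t η s hN
    wp-print (node ee ev ve vv) η s hN = wp-chain true
      (λ x → bigOp false n (ext (λ y → term 𝔄 vv (y ∷ x ∷ η)) (term 𝔄 ve (x ∷ η))))
      (bigOp false n (ext (λ y → term 𝔄 ev (y ∷ η)) (term 𝔄 ee η)))
      (λ x s hN → wp-chain false (λ y → term 𝔄 vv (y ∷ x ∷ η)) (term 𝔄 ve (x ∷ η))
        (λ y s hN → wp-print vv (y ∷ x ∷ η) s hN) (λ s hN → wp-print ve (x ∷ η) s hN) s hN)
      (λ s hN → wp-chain false (λ y → term 𝔄 ev (y ∷ η)) (term 𝔄 ee η)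
        (λ y s hN → wp-print ev (y ∷ η) s hN) (λ s hN → wp-print ee η s hN) s hN) s hN

-- Normal forms of weighted formulas.

module FormulaToMachine where
  open FixedPoints
  open Machines
  open Programs
  open Encodings
  open Evaluation
  open PolynomialTime
  open Printing
  open import Data.Fin using (splitAt)
  open import Data.List using (foldr; map; tabulate; replicate)
  open import Relation.Nullary using (does)
  import Relation.Binary.PropositionalEquality as Eq

  sem-ite : ∀ {r v} w (c d e : Cmd r v) {η s b s'} → sem w c η s ≡ (b , s') →
    sem w (ite c d e) η s ≡ (if b then sem w d η s' else sem w e η s')
  sem-ite w c d e {η} eq = cong (λ res → if proj₁ res then sem w d η (proj₂ res) else sem w e η (proj₂ res)) eq

  sem-seq : ∀ {r v} w (c d : Cmd r v) {η s b s'} → sem w c η s ≡ (b , s') → sem w (seq c d) η s ≡ sem w d η s'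
  sem-seq w c d {b = true}  eq = sem-ite w c d d eq
  sem-seq w c d {b = false} eq = sem-ite w c d d eq

  -- Generator 0 denotes zero and generator 1 denotes one. At each level the value sits where both
  -- indices are extra; its cofactors are one, and every other summand contains a factor zero.
  pad : ∀ {r j} {ar : Vocab j} {v} → Tree (2 + r) ar v → ∀ k → NF (2 + r) ar v k
  pad t zero    = tree t
  pad t (suc k) = node (pad t k) (pad (leaf (suc zero)) k) (pad (leaf zero) k) (pad (leaf zero) k)

  isZero : ∀ {j} {ar : Vocab j} → Formula ar 1 []
  isZero = neg (ex (lt zero (suc zero)))

  -- Normal forms contain tests at their leaves only, so the choice is pushed down through all
  -- levels of two forms of equal depth.
  cond : ∀ {r j} {ar : Vocab j} {v k} → Fin v → NF r ar v k → NF r ar v k → NF r ar v k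
  cond x (tree a) (tree b) = tree (test isZero tt (x ∷ []) a b)
  cond x (node a b c d) (node a' b' c' d') =
    node (cond x a a') (cond (suc x) b b') (cond (suc x) c c') (cond (suc (suc x)) d d')

  isZero-zero : ∀ {j} {ar : Vocab j} (𝔄 : Struct ar) → evalB 𝔄 isZero (zero ∷ []) noRels ≡ true
  isZero-zero 𝔄 = none (allFin (size 𝔄))
    where
    none : ∀ (xs : List (Fin (size 𝔄))) → not (any (λ a → does (Data.Fin._<?_ a (zero {n = m 𝔄}))) xs) ≡ true
    none []       = Eq.refl
    none (x ∷ xs) = none xs

  isZero-suc : ∀ {j} {ar : Vocab j} (𝔄 : Struct ar) i → evalB 𝔄 isZero (suc i ∷ []) noRels ≡ false
  isZero-suc 𝔄 i = Eq.refl

  module Translate {c ℓ : Level} (S : Semiring c ℓ) {j : ℕ} (ar : Vocab j) where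
    open Semiring S using (Carrier; _≈_; 0#; 1#; setoid; refl; sym; trans; +-cong; *-cong; +-congˡ; +-congʳ; *-congˡ; *-congʳ;
      +-assoc; *-assoc; +-identityˡ; +-identityʳ; *-identityˡ; *-identityʳ; zeroˡ; zeroʳ; reflexive)
      renaming (_+_ to _+S_; _*_ to _*S_)
    open Weighted S
    open FP S

    consts : ∀ {v} → WFormula ar v → ℕ
    consts (bool β _) = 0
    consts (const s)  = 1
    consts (φ ⊕ ψ)    = consts φ + consts ψ
    consts (φ ⊗ ψ)    = consts φ + consts ψ
    consts (⨁ φ)      = consts φ
    consts (⨂ φ)      = consts φ

    constant : ∀ {v} (φ : WFormula ar v) → Fin (consts φ) → Carrier
    constant (const s) _ = s
    constant (φ ⊕ ψ)   i = Sum.[ constant φ , constant ψ ] (splitAt (consts φ) i)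
    constant (φ ⊗ ψ)   i = Sum.[ constant φ , constant ψ ] (splitAt (consts φ) i)
    constant (⨁ φ)     i = constant φ i
    constant (⨂ φ)     i = constant φ i

    depth : ∀ {v} → WFormula ar v → ℕ
    depth (bool β _) = 0
    depth (const s)  = 0
    depth (φ ⊕ ψ)    = suc (depth φ ⊔ depth ψ)
    depth (φ ⊗ ψ)    = suc (depth φ ⊔ depth ψ)
    depth (⨁ φ)      = suc (depth φ)
    depth (⨂ φ)      = suc (depth φ)

    -- Meaningful only for k ≥ depth φ.
    tr : ∀ {r u v} (φ : WFormula ar u) → Vec (Fin v) u → ∀ k → (Fin (consts φ) → Fin (2 + r)) → NF (2 + r) ar v k
    tr (bool β wf) τ k ix = pad (test β wf τ (leaf (suc zero)) (leaf zero)) k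
    tr (const s)   τ k ix = pad (leaf (ix zero)) k
    tr (φ ⊕ ψ) τ (suc k) ix = node (tr ψ τ k (ix ∘ (consts φ ↑ʳ_))) (pad (leaf (suc zero)) k)
      (cond zero (tr φ (Vec.map suc τ) k (ix ∘ (_↑ˡ consts ψ))) (pad (leaf zero) k)) (pad (leaf (suc zero)) k)
    tr (φ ⊗ ψ) τ (suc k) ix = node (tr ψ τ k (ix ∘ (consts φ ↑ʳ_)))
      (cond zero (tr φ (Vec.map suc τ) k (ix ∘ (_↑ˡ consts ψ))) (pad (leaf (suc zero)) k)) (pad (leaf zero) k) (pad (leaf zero) k)
    tr (⨁ φ) τ (suc k) ix = node (pad (leaf zero) k) (pad (leaf (suc zero)) k) (tr φ (zero ∷ Vec.map suc τ) k ix) (pad (leaf (suc zero)) k)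
    tr (⨂ φ) τ (suc k) ix = node (pad (leaf (suc zero)) k) (tr φ (zero ∷ Vec.map suc τ) k ix) (pad (leaf zero) k) (pad (leaf zero) k)
    tr φ τ zero ix = tree (leaf zero)

    -- Without opacity sums over a universe unfold, and their summands cannot be inferred.
    opaque
      foldF : (Carrier → Carrier → Carrier) → Carrier → ∀ {n} → (Fin n → Carrier) → Carrier
      foldF _∙_ e {zero}  f = e
      foldF _∙_ e {suc n} f = f zero ∙ foldF _∙_ e (f ∘ suc)

      foldF-zero : ∀ _∙_ e (f : Fin 0 → Carrier) → foldF _∙_ e f ≡ e
      foldF-zero _∙_ e f = Eq.refl

      foldF-suc : ∀ _∙_ e {n} (f : Fin (suc n) → Carrier) → foldF _∙_ e f ≡ f zero ∙ foldF _∙_ e (f ∘ suc)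
      foldF-suc _∙_ e f = Eq.refl

      foldr-foldF : ∀ _∙_ e {A : Set} {n} (f : A → Carrier) (h : Fin n → A) → foldr _∙_ e (map f (tabulate h)) ≡ foldF _∙_ e (f ∘ h)
      foldr-foldF _∙_ e {n = zero}  f h = Eq.refl
      foldr-foldF _∙_ e {n = suc n} f h = cong (f (h zero) ∙_) (foldr-foldF _∙_ e f (h ∘ suc))

      foldF-cong : ∀ _∙_ e → (∀ {a b c d} → a ≈ b → c ≈ d → (a ∙ c) ≈ (b ∙ d)) →
        ∀ {n} {f h : Fin n → Carrier} → (∀ i → f i ≈ h i) → foldF _∙_ e f ≈ foldF _∙_ e h
      foldF-cong _∙_ e cg {zero}  p = refl
      foldF-cong _∙_ e cg {suc n} p = cg (p zero) (foldF-cong _∙_ e cg (p ∘ suc))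

      foldF-unit : ∀ _∙_ e → (∀ {a b c d} → a ≈ b → c ≈ d → (a ∙ c) ≈ (b ∙ d)) → (e ∙ e) ≈ e →
        ∀ {n} {f : Fin n → Carrier} → (∀ i → f i ≈ e) → foldF _∙_ e f ≈ e
      foldF-unit _∙_ e cg u {zero}  p = refl
      foldF-unit _∙_ e cg u {suc n} p = trans (cg (p zero) (foldF-unit _∙_ e cg u (p ∘ suc))) u

    sumF prodF : ∀ {n} → (Fin n → Carrier) → Carrier
    sumF  = foldF _+S_ 0#
    prodF = foldF _*S_ 1#

    sumF-cong : ∀ {n} {f h : Fin n → Carrier} → (∀ i → f i ≈ h i) → sumF f ≈ sumF h
    sumF-cong = foldF-cong _+S_ 0# +-cong

    prodF-cong : ∀ {n} {f h : Fin n → Carrier} → (∀ i → f i ≈ h i) → prodF f ≈ prodF h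
    prodF-cong = foldF-cong _*S_ 1# *-cong

    sumF-0 : ∀ {n} {f : Fin n → Carrier} → (∀ i → f i ≈ 0#) → sumF f ≈ 0#
    sumF-0 = foldF-unit _+S_ 0# +-cong (+-identityˡ 0#)

    prodF-1 : ∀ {n} {f : Fin n → Carrier} → (∀ i → f i ≈ 1#) → prodF f ≈ 1#
    prodF-1 = foldF-unit _*S_ 1# *-cong (*-identityˡ 1#)

    module Value {r : ℕ} (g : Fin (2 + r) → Carrier) (g0 : g zero ≈ 0#) (g1 : g (suc zero) ≈ 1#) (𝔄 : Struct ar) where
      private
        n = size 𝔄

      -- The value of `term` with the extra index split off from each sum and each product.
      V : ∀ {v k} → NF (2 + r) ar v k → Vec (Fin n) v → Carrier
      V (tree t) η = g (treeIdx 𝔄 t η)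
      V (node ee ev ve vv) η = sumF (λ x → prodF (λ y → V vv (y ∷ x ∷ η)) *S V ve (x ∷ η)) +S (prodF (λ y → V ev (y ∷ η)) *S V ee η)

      value-sum : ∀ n (f : Fin n → Term (2 + r)) l → value g (bigSum n (ext f l)) ≈ sumF (λ i → value g (f i)) +S value g l
      value-sum zero    f l = sym (trans (+-congʳ (reflexive (foldF-zero _+S_ 0# _))) (+-identityˡ _))
      value-sum (suc n) f l = trans (+-congˡ (value-sum n (f ∘ suc) l))
        (trans (sym (+-assoc _ _ _)) (+-congʳ (reflexive (Eq.sym (foldF-suc _+S_ 0# (λ i → value g (f i)))))))

      value-prod : ∀ n (f : Fin n → Term (2 + r)) l → value g (bigProd n (ext f l)) ≈ prodF (λ i → value g (f i)) *S value g l
      value-prod zero    f l = sym (trans (*-congʳ (reflexive (foldF-zero _*S_ 1# _))) (*-identityˡ _))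
      value-prod (suc n) f l = trans (*-congˡ (value-prod n (f ∘ suc) l))
        (trans (sym (*-assoc _ _ _)) (*-congʳ (reflexive (Eq.sym (foldF-suc _*S_ 1# (λ i → value g (f i)))))))

      value-term : ∀ {v k} (nf : NF (2 + r) ar v k) η → value g (term 𝔄 nf η) ≈ V nf η
      value-term (tree t) η = refl
      value-term (node ee ev ve vv) η = trans
        (value-sum n (λ x → bigProd n (ext (λ y → term 𝔄 vv (y ∷ x ∷ η)) (term 𝔄 ve (x ∷ η)))) (bigProd n (ext (λ y → term 𝔄 ev (y ∷ η)) (term 𝔄 ee η))))
        (+-cong
          (sumF-cong (λ x → trans (value-prod n (λ y → term 𝔄 vv (y ∷ x ∷ η)) (term 𝔄 ve (x ∷ η)))
            (*-cong (prodF-cong (λ y → value-term vv (y ∷ x ∷ η))) (value-term ve (x ∷ η)))))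
          (trans (value-prod n (λ y → term 𝔄 ev (y ∷ η)) (term 𝔄 ee η))
            (*-cong (prodF-cong (λ y → value-term ev (y ∷ η))) (value-term ee η))))

      V-pad : ∀ {v} (t : Tree (2 + r) ar v) k η → V (pad t k) η ≈ g (treeIdx 𝔄 t η)
      V-pad t zero    η = refl
      V-pad t (suc k) η = trans (+-cong
          (sumF-0 (λ x → trans (*-congˡ (trans (V-pad (leaf zero) k (x ∷ η)) g0)) (zeroʳ _)))
          (trans (*-cong (prodF-1 (λ y → trans (V-pad (leaf (suc zero)) k (y ∷ η)) g1)) (V-pad t k η)) (*-identityˡ _)))
        (+-identityˡ _)

      V-0 : ∀ {v} k (η : Vec (Fin n) v) → V (pad (leaf zero) k) η ≈ 0#
      V-0 k η = trans (V-pad (leaf zero) k η) g0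

      V-1 : ∀ {v} k (η : Vec (Fin n) v) → V (pad (leaf (suc zero)) k) η ≈ 1#
      V-1 k η = trans (V-pad (leaf (suc zero)) k η) g1

      V-cond-true : ∀ {v k} x (a b : NF (2 + r) ar v k) η → evalB 𝔄 isZero (lookup η x ∷ []) noRels ≡ true → V (cond x a b) η ≈ V a η
      V-cond-true x (tree a) (tree b) η e = reflexive (cong (λ z → g (if z then treeIdx 𝔄 a η else treeIdx 𝔄 b η)) e)
      V-cond-true x (node a b c d) (node a' b' c' d') η e = +-cong
        (sumF-cong (λ i → *-cong (prodF-cong (λ y → V-cond-true (suc (suc x)) d d' (y ∷ i ∷ η) e)) (V-cond-true (suc x) c c' (i ∷ η) e)))
        (*-cong (prodF-cong (λ y → V-cond-true (suc x) b b' (y ∷ η) e)) (V-cond-true x a a' η e))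

      V-cond-false : ∀ {v k} x (a b : NF (2 + r) ar v k) η → evalB 𝔄 isZero (lookup η x ∷ []) noRels ≡ false → V (cond x a b) η ≈ V b η
      V-cond-false x (tree a) (tree b) η e = reflexive (cong (λ z → g (if z then treeIdx 𝔄 a η else treeIdx 𝔄 b η)) e)
      V-cond-false x (node a b c d) (node a' b' c' d') η e = +-cong
        (sumF-cong (λ i → *-cong (prodF-cong (λ y → V-cond-false (suc (suc x)) d d' (y ∷ i ∷ η) e)) (V-cond-false (suc x) c c' (i ∷ η) e)))
        (*-cong (prodF-cong (λ y → V-cond-false (suc x) b b' (y ∷ η) e)) (V-cond-false x a a' η e))

      -- A node whose sum index takes effect only at "end".
      V-prod : ∀ {v k} (ee : NF (2 + r) ar v k) ev η → V (node ee ev (pad (leaf zero) k) (pad (leaf zero) k)) η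
        ≈ prodF (λ y → V ev (y ∷ η)) *S V ee η
      V-prod {k = k} ee ev η = trans (+-congʳ (sumF-0 (λ x → trans (*-congˡ (V-0 k (x ∷ η))) (zeroʳ _)))) (+-identityˡ _)

      -- A node whose product index takes effect only at "end".
      V-sum : ∀ {v k} (ee : NF (2 + r) ar v k) ve η → V (node ee (pad (leaf (suc zero)) k) ve (pad (leaf (suc zero)) k)) η
        ≈ sumF (λ x → V ve (x ∷ η)) +S V ee η
      V-sum {k = k} ee ve η = +-cong
        (sumF-cong (λ x → trans (*-congʳ (prodF-1 (λ y → V-1 k (y ∷ x ∷ η)))) (*-identityˡ _)))
        (trans (*-congʳ (prodF-1 (λ y → V-1 k (y ∷ η)))) (*-identityˡ _))

      shift-env : ∀ {u v} (x : Fin n) (η : Vec (Fin n) v) (τ : Vec (Fin v) u) → Vec.map (lookup (x ∷ η)) (Vec.map suc τ) ≡ Vec.map (lookup η) τ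
      shift-env x η τ = lookup-shift (x ∷ []) η τ

      V-tr : ∀ {u v} (φ : WFormula ar u) (τ : Vec (Fin v) u) k ix → depth φ ≤ k → (∀ i → g (ix i) ≈ constant φ i) → ∀ η →
        V (tr φ τ k ix) η ≈ evalW 𝔄 φ (Vec.map (lookup η) τ)

      private
        at-zero : ∀ {u v} (φ : WFormula ar u) (τ : Vec (Fin v) u) k ix → depth φ ≤ k → (∀ i → g (ix i) ≈ constant φ i) → ∀ b η →
          V (cond zero (tr φ (Vec.map suc τ) k ix) b) (zero ∷ η) ≈ evalW 𝔄 φ (Vec.map (lookup η) τ)
        at-zero φ τ k ix d h b η = trans (V-cond-true zero (tr φ (Vec.map suc τ) k ix) b (zero ∷ η) (isZero-zero 𝔄))
          (trans (V-tr φ (Vec.map suc τ) k ix d h (zero ∷ η)) (reflexive (cong (evalW 𝔄 φ) (shift-env zero η τ))))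

      V-tr (bool β wf) τ k ix d h η = trans (V-pad _ k η) (choose (evalB 𝔄 β (Vec.map (lookup η) τ) noRels))
        where
        choose : ∀ b → g (if b then suc zero else zero) ≈ (if b then 1# else 0#)
        choose true  = g1
        choose false = g0
      V-tr (const s) τ k ix d h η = trans (V-pad (leaf (ix zero)) k η) (h zero)
      V-tr (φ ⊕ ψ) τ (suc k) ix (s≤s d) h η = trans (V-sum {k = k} (tr ψ τ k _) (cond zero φ' (pad (leaf zero) k)) η)
        (+-cong (trans (reflexive (foldF-suc _+S_ 0# (λ x → V (cond zero φ' (pad (leaf zero) k)) (x ∷ η)))) (trans (+-cong (at-zero φ τ k _ (ℕ.m⊔n≤o⇒m≤o _ _ d) hφ (pad (leaf zero) k) η)
                   (sumF-0 (λ i → trans (V-cond-false zero φ' (pad (leaf zero) k) (suc i ∷ η) (isZero-suc 𝔄 i)) (V-0 k (suc i ∷ η)))))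
                 (+-identityʳ _)))
          (V-tr ψ τ k _ (ℕ.m⊔n≤o⇒n≤o (depth φ) _ d) hψ η))
        where
        φ' = tr φ (Vec.map suc τ) k (ix ∘ (_↑ˡ consts ψ))
        hφ : ∀ i → g (ix (i ↑ˡ consts ψ)) ≈ constant φ i
        hφ i = trans (h (i ↑ˡ consts ψ)) (reflexive (cong Sum.[ constant φ , constant ψ ] (Fin.splitAt-↑ˡ (consts φ) i (consts ψ))))
        hψ : ∀ i → g (ix (consts φ ↑ʳ i)) ≈ constant ψ i
        hψ i = trans (h (consts φ ↑ʳ i)) (reflexive (cong Sum.[ constant φ , constant ψ ] (Fin.splitAt-↑ʳ (consts φ) (consts ψ) i)))
      V-tr (φ ⊗ ψ) τ (suc k) ix (s≤s d) h η = trans (V-prod {k = k} (tr ψ τ k _) (cond zero φ' (pad (leaf (suc zero)) k)) η)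
        (*-cong (trans (reflexive (foldF-suc _*S_ 1# (λ x → V (cond zero φ' (pad (leaf (suc zero)) k)) (x ∷ η)))) (trans (*-cong (at-zero φ τ k _ (ℕ.m⊔n≤o⇒m≤o _ _ d) hφ (pad (leaf (suc zero)) k) η)
                   (prodF-1 (λ i → trans (V-cond-false zero φ' (pad (leaf (suc zero)) k) (suc i ∷ η) (isZero-suc 𝔄 i)) (V-1 k (suc i ∷ η)))))
                 (*-identityʳ _)))
          (V-tr ψ τ k _ (ℕ.m⊔n≤o⇒n≤o (depth φ) _ d) hψ η))
        where
        φ' = tr φ (Vec.map suc τ) k (ix ∘ (_↑ˡ consts ψ))
        hφ : ∀ i → g (ix (i ↑ˡ consts ψ)) ≈ constant φ i
        hφ i = trans (h (i ↑ˡ consts ψ)) (reflexive (cong Sum.[ constant φ , constant ψ ] (Fin.splitAt-↑ˡ (consts φ) i (consts ψ))))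
        hψ : ∀ i → g (ix (consts φ ↑ʳ i)) ≈ constant ψ i
        hψ i = trans (h (consts φ ↑ʳ i)) (reflexive (cong Sum.[ constant φ , constant ψ ] (Fin.splitAt-↑ʳ (consts φ) (consts ψ) i)))
      V-tr (⨁ φ) τ (suc k) ix (s≤s d) h η = trans (V-sum {k = k} (pad (leaf zero) k) (tr φ _ k ix) η)
        (trans (+-cong (sumF-cong (λ x → trans (V-tr φ (zero ∷ Vec.map suc τ) k ix d h (x ∷ η))
                   (reflexive (cong (λ z → evalW 𝔄 φ (x ∷ z)) (shift-env x η τ))))) (V-0 k η))
          (trans (+-identityʳ _) (reflexive (Eq.sym (foldr-foldF _+S_ 0# (λ a → evalW 𝔄 φ (a ∷ Vec.map (lookup η) τ)) id)))))
      V-tr (⨂ φ) τ (suc k) ix (s≤s d) h η = trans (V-prod {k = k} (pad (leaf (suc zero)) k) (tr φ _ k ix) η)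
        (trans (*-cong (prodF-cong (λ x → trans (V-tr φ (zero ∷ Vec.map suc τ) k ix d h (x ∷ η))
                   (reflexive (cong (λ z → evalW 𝔄 φ (x ∷ z)) (shift-env x η τ))))) (V-1 k η))
          (trans (*-identityʳ _) (reflexive (Eq.sym (foldr-foldF _*S_ 1# (λ a → evalW 𝔄 φ (a ∷ Vec.map (lookup η) τ)) id)))))

    -- The structure read off the input agrees with the encoded one only pointwise.
    evalW-cong : ∀ m₀ r₁ r₂ → (∀ i t → r₁ i t ≡ r₂ i t) → ∀ {v} (φ : WFormula ar v) η →
      evalW (structure m₀ r₁) φ η ≡ evalW (structure m₀ r₂) φ η
    evalW-cong m₀ r₁ r₂ e (bool β _) η = cong (λ b → if b then 1# else 0#) (evalB-cong m₀ r₁ r₂ e β η noRels)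
    evalW-cong m₀ r₁ r₂ e (const s)  η = Eq.refl
    evalW-cong m₀ r₁ r₂ e (φ ⊕ ψ)    η = cong₂ _+S_ (evalW-cong m₀ r₁ r₂ e φ η) (evalW-cong m₀ r₁ r₂ e ψ η)
    evalW-cong m₀ r₁ r₂ e (φ ⊗ ψ)    η = cong₂ _*S_ (evalW-cong m₀ r₁ r₂ e φ η) (evalW-cong m₀ r₁ r₂ e ψ η)
    evalW-cong m₀ r₁ r₂ e (⨁ φ)      η = cong (foldr _+S_ 0#) (List.map-cong (λ a → evalW-cong m₀ r₁ r₂ e φ (a ∷ η)) (allFin (suc m₀)))
    evalW-cong m₀ r₁ r₂ e (⨂ φ)      η = cong (foldr _*S_ 1#) (List.map-cong (λ a → evalW-cong m₀ r₁ r₂ e φ (a ∷ η)) (allFin (suc m₀)))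

    module _ (ne : ∃ λ i → lookup ar i ≢ 0) (φ : WFormula ar 0) where
      private
        r = consts φ
        k = depth φ

        g : Fin (2 + r) → Carrier
        g zero          = 0#
        g (suc zero)    = 1#
        g (suc (suc i)) = constant φ i

        nf : NF (2 + r) ar 0 k
        nf = tr φ [] k (λ i → suc (suc i))

        program : Cmd (2 + r) 0
        -- The empty word encodes no structure and leaves no room for an element; a single zero is
        -- printed for it.
        program = ite (prim endA) (prim (emit (tsym zero))) (seq (computeN ar) (print nf))

        decoded : List (Fin 2) → ℕ → Struct ar
        decoded w m₀ = structure m₀ (λ i t → isOne (nthᵐ w (position (suc m₀) ar i t)))

        output : List (Fin 2) → List (TSym (2 + r))
        output w = out (proj₂ (sem w program [] initial-state))

        record Result (w : List (Fin 2)) : Set c where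
          field
            sh    : Vec (ℕ × ℕ) k
            s     : Idx sh → Fin (2 + r)
            out-≡ : output w ≡ render (nested sh s)
            good  : ∀ (𝔄 : Struct ar) → enc 𝔄 ≡ w → nested sh s ≡ term (decoded w (m 𝔄)) nf []

        nested-single : ∀ k → nested (Vec.replicate k (0 , 0)) (λ _ → zero) ≡ gen {2 + r} zero
        nested-single zero    = Eq.refl
        nested-single (suc k) = nested-single k

        result-nonempty : ∀ w → 1 ≤ length w → Result w
        result-nonempty w L≥1 = go _ Eq.refl (Logic.WP.un (wp-computeN {2 + r} w ar ne L≥1))
          where
          go : ∀ res → sem w (computeN {2 + r} ar) [] initial-state ≡ res →
            1 ≤ N (proj₂ res) × N (proj₂ res) ≤ length w × out (proj₂ res) ≡ [] ×
              (∀ n₀ → 1 ≤ n₀ → total ar n₀ ≡ length w → N (proj₂ res) ≡ n₀) → Result w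
          go (b , s₁@(st (suc m₀) _ _ _)) eq (_ , N≤L , o , unique) = record
            { sh = shape {2 + r} 𝔅 k ; s = leaves 𝔅 nf []
            ; out-≡ = Eq.trans both (cong render (term-nested 𝔅 nf []))
            ; good = λ 𝔄 e → Eq.trans (Eq.sym (term-nested 𝔅 nf []))
                (cong (λ m → term (decoded w m) nf []) (ℕ.suc-injective (unique (size 𝔄) (s≤s z≤n)
                  (Eq.trans (Eq.sym (length-encRels ar (rels 𝔄))) (cong length e))))) }
            where
            𝔅 = decoded w m₀
            printed : out (proj₂ (sem w (print nf) [] s₁)) ≡ render (term 𝔅 nf [])
            printed = Eq.trans (Printing.Emits.out-eq (Logic.WP.un (Printing.wp-print w 𝔅 N≤L (λ i t → Eq.refl) nf [] s₁ Eq.refl)))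
              (cong (_++ render (term 𝔅 nf [])) o)
            both : output w ≡ render (term 𝔅 nf [])
            both = Eq.trans (cong (out ∘ proj₂) (sem-ite w (prim endA) (prim (emit (tsym zero))) (seq (computeN ar) (print nf)) {[]} {initial-state}
                      (cong (_, initial-state) (nthᵐ-< w 0 L≥1))))
              (Eq.trans (cong (out ∘ proj₂) (sem-seq w (computeN ar) (print nf) eq)) printed)

        result : ∀ w → Result w
        result [] = record { sh = Vec.replicate k (0 , 0) ; s = λ _ → zero
          ; out-≡ = cong render (Eq.sym (nested-single k))
          ; good = λ 𝔄 e → ⊥-elim (ℕ.<⇒≱ (ℕ.≤-trans (s≤s z≤n) (total-≥ ar ne (size 𝔄)))
              (ℕ.≤-reflexive (Eq.trans (Eq.sym (length-encRels ar (rels 𝔄))) (cong length e)))) }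
        result w@(_ ∷ _) = result-nonempty w (s≤s z≤n)

      -- The series is by definition the value of what the machine prints. Membership in the class
      -- then concerns only shape and time, and φ matters only at encodings.
      P : List (Fin 2) → Carrier
      P w = value g (nested (Result.sh (result w)) (Result.s (result w)))

      P∈FP : InFP (Fin 2) P
      P∈FP = 2 + r , g , (zero , refl) , (suc zero , refl) , k , machine program , a , d , λ w →
          Result.sh (result w) , Result.s (result w) ,
          subst (ComputesWithin (machine program) w (a * length w ^ d + a)) (Result.out-≡ (result w))
            (proj₂ (proj₂ (polynomial-machine program)) w) , refl
        where
        a = proj₁ (polynomial-machine program)
        d = proj₁ (proj₂ (polynomial-machine program))

      P-enc : ∀ (𝔄 : Struct ar) → P (enc 𝔄) ≈ ⟦ φ ⟧ 𝔄
      P-enc 𝔄 = trans (reflexive (cong (value g) (Result.good (result (enc 𝔄)) 𝔄 Eq.refl)))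
        (trans (Value.value-term g refl refl 𝔅 nf [])
        (trans (Value.V-tr g refl refl 𝔅 φ [] k _ ℕ.≤-refl (λ _ → refl) [])
               (reflexive (evalW-cong (m 𝔄) _ (rels 𝔄) same φ []))))
        where
        𝔅 = decoded (enc 𝔄) (m 𝔄)
        same : ∀ i t → isOne (nthᵐ (enc {a = 0} 𝔄) (position (size 𝔄) ar i t)) ≡ rels 𝔄 i t
        same i t = Eq.trans (cong isOne (nth-encRels ar (rels 𝔄) i t)) (isOne-bit (rels 𝔄 i t))
          where
          isOne-bit : ∀ b → isOne (just (bit b)) ≡ b
          isOne-bit true  = Eq.refl
          isOne-bit false = Eq.refl

-- Definable predicates on numbers coded by tuples of elements.

module Numbers where
  open FixedPoints
  open import Data.Nat.DivMod using (_/_; m%n<n; [m+kn]%n≡m%n; m<n⇒m%n≡m; +-distrib-/-∣ʳ; m<n⇒m/n≡0; m*n/n≡m)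
  open import Data.Nat.Divisibility using (divides)
  open import Data.List.Membership.Propositional.Properties using (∈-allFin)
  open import Data.Vec using (concat; group)
  open import Data.Vec.Relation.Unary.All using (All; []; _∷_)
  open import Relation.Nullary using (Dec; does; proof; Reflects; ofʸ; ofⁿ)
  open import Relation.Nullary.Reflects using (¬-reflects; _⊎-reflects_)
  open import Relation.Binary.PropositionalEquality using (refl; sym; trans)
  import Level

  reflects-map : ∀ {P Q : Set} {b} → (P → Q) → (Q → P) → Reflects P b → Reflects Q b
  reflects-map f g (ofʸ p)  = ofʸ (f p)
  reflects-map f g (ofⁿ np) = ofⁿ (np ∘ g)

  reflects-true : ∀ {P : Set} {b} → Reflects P b → P → b ≡ true
  reflects-true (ofʸ _)  p = refl
  reflects-true (ofⁿ np) p = ⊥-elim (np p)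

  reflects-elim : ∀ {P : Set} {b} → Reflects P b → b ≡ true → P
  reflects-elim (ofʸ p) _ = p

  reflects-stable : ∀ {P : Set} {b} → Reflects P b → ¬ ¬ P → P
  reflects-stable (ofʸ p)  nn = p
  reflects-stable (ofⁿ np) nn = ⊥-elim (nn np)

  reflects-⇔ : ∀ {P : Set} {b} → (b ≡ true → P) → (P → b ≡ true) → Reflects P b
  reflects-⇔ {b = true}  f g = ofʸ (f refl)
  reflects-⇔ {b = false} f g = ofⁿ (λ p → absurd (g p))
    where absurd : false ≡ true → ⊥
          absurd ()

  concat-injective : ∀ {A : Set} {k l} (xss yss : Vec (Vec A k) l) → concat xss ≡ concat yss → xss ≡ yss
  concat-injective []         []         e = refl
  concat-injective (xs ∷ xss) (ys ∷ yss) e =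
    cong₂ _∷_ (Vec.++-injectiveˡ xs ys e) (concat-injective xss yss (Vec.++-injectiveʳ xs ys e))

  group-concat : ∀ {A : Set} l k (xss : Vec (Vec A k) l) → proj₁ (group l k (concat xss)) ≡ xss
  group-concat l k xss with group l k (concat xss)
  ... | yss , e = concat-injective yss xss (sym e)

  -- The first k digits of p. A total function is wanted here, because folds over all numbers below
  -- n ^ k evaluate formulas at these tuples.
  unnum : ∀ {m₀} k → ℕ → Vec (Fin (suc m₀)) k
  unnum        zero    p = []
  unnum {m₀} (suc k) p = fromℕ< (m%n<n p (suc m₀)) ∷ unnum k (p / suc m₀)

  numR-unnum : ∀ {m₀} k p → p < suc m₀ ^ k → numR (unnum {m₀} k p) ≡ p
  numR-unnum {m₀} k p h with numR-surjective k p h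
  ... | t , refl = cong numR (unnum-numR t)
    where
    unnum-numR : ∀ {k} (t : Vec (Fin (suc m₀)) k) → unnum k (numR t) ≡ t
    unnum-numR []      = refl
    unnum-numR (a ∷ t) = cong₂ _∷_
      (Fin.toℕ-injective (trans (Fin.toℕ-fromℕ< _) (trans ([m+kn]%n≡m%n (toℕ a) (numR t) n) (m<n⇒m%n≡m (Fin.toℕ<n a)))))
      (trans (cong (unnum _) quotient) (unnum-numR t))
      where
      n = suc m₀
      quotient : (toℕ a + numR t * n) / n ≡ numR t
      quotient = trans (+-distrib-/-∣ʳ (toℕ a) {n = numR t * n} (divides (numR t) refl))
        (cong₂ _+_ (m<n⇒m/n≡0 (Fin.toℕ<n a)) (m*n/n≡m (numR t) n))

  -- `open′ l` is the situation inside a fixed point: the first relation variable is the one being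
  -- defined, a relation between l numbers. In `closed` no relation variable may be used.
  data Mode : Set where
    closed : Mode
    open′  : ℕ → Mode

  -- A block of K first-order variables stands for a number below n ^ K.
  module Definable {j : ℕ} (ar : Vocab j) (K : ℕ) (Ok : Struct ar → Set) where

    bound : Struct ar → ℕ
    bound 𝔄 = size 𝔄 ^ K

    ctxK : Mode → ℕ → ℕ
    ctxK closed    k = k
    ctxK (open′ l) k = suc k

    ctx : ∀ μ {k} → Vec ℕ k → Vec ℕ (ctxK μ k)
    ctx closed    Δ = Δ
    ctx (open′ l) Δ = l * K ∷ Δ

    Sem : Mode → Set₁
    Sem closed    = Level.Lift _ ⊤
    Sem (open′ l) = Vec ℕ l → Set

    InRange : Struct ar → ∀ {u} → Vec ℕ u → Set
    InRange 𝔄 = All (_< bound 𝔄)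

    numbers : ∀ {n l} → Vec (Vec (Fin n) K) l → Vec ℕ l
    numbers = Vec.map numR

    digits : ∀ {m₀ l} → Vec ℕ l → Vec (Vec (Fin (suc m₀)) K) l
    digits = Vec.map (unnum K)

    -- Numbers out of range share their digits with numbers in range and are excluded explicitly.
    asRel : ∀ (𝔄 : Struct ar) {l} → (Vec (Fin (size 𝔄)) (l * K) → Bool) → Vec ℕ l → Set
    asRel 𝔄 R xs = InRange 𝔄 xs × R (concat (digits xs)) ≡ true

    interp : ∀ μ (𝔄 : Struct ar) {k} {Δ : Vec ℕ k} → RelEnv (size 𝔄) (ctx μ Δ) → Sem μ
    interp closed    𝔄 ρ = Level.lift tt
    interp (open′ l) 𝔄 ρ = asRel 𝔄 (ρ zero)

    vals : ∀ {n v u} → Vec (Fin n) v → Vec (Vec (Fin v) K) u → Vec ℕ u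
    vals η ts = Vec.map (λ xs → numR (Vec.map (lookup η) xs)) ts

    IsR : ∀ μ {k} → Fin (ctxK μ k) → Set
    IsR closed    i = ⊥
    IsR (open′ l) i = i ≡ zero

    -- The relation being defined occurs only positively. All other relation variables satisfy both
    -- `Pos` and `Neg`, that is, do not occur, so closed definitions can be negated and used under
    -- further fixed points.
    Good : ∀ μ {v k} {Δ : Vec ℕ k} → Formula ar v (ctx μ Δ) → Set
    Good μ φ = ∀ i → Pos i φ × (IsR μ i ⊎ Neg i φ)

    Pred : Mode → ℕ → Set₁
    Pred μ u = Struct ar → Sem μ → Vec ℕ u → Set

    -- The formula is given uniformly in all contexts, which makes it usable under quantifiers and
    -- fixed points. `Reflects` also decides Q, so that double negations can be removed.
    record Def (μ : Mode) (u : ℕ) (Q : Pred μ u) : Set₁ where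
      field
        form : ∀ {v k} {Δ : Vec ℕ k} → Vec (Vec (Fin v) K) u → Formula ar v (ctx μ Δ)
        wf   : ∀ {v k} {Δ : Vec ℕ k} ts → WF (form {v} {Δ = Δ} ts)
        good : ∀ {v k} {Δ : Vec ℕ k} ts → Good μ (form {v} {Δ = Δ} ts)
        sem  : ∀ (𝔄 : Struct ar) → Ok 𝔄 → ∀ {v k} {Δ : Vec ℕ k} ts (η : Vec (Fin (size 𝔄)) v) (ρ : RelEnv (size 𝔄) (ctx μ Δ)) →
               Reflects (Q 𝔄 (interp μ 𝔄 ρ) (vals η ts)) (evalB 𝔄 (form ts) η ρ)
    open Def public

    vals-range : ∀ (𝔄 : Struct ar) {v u} (η : Vec (Fin (size 𝔄)) v) (ts : Vec (Vec (Fin v) K) u) → InRange 𝔄 (vals η ts)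
    vals-range 𝔄 η []       = []
    vals-range 𝔄 η (t ∷ ts) = numR-bound (Vec.map (lookup η) t) ∷ vals-range 𝔄 η ts

    -- Exchanges the predicate that the connectives happen to produce for the intended one. The two
    -- have to agree only on numbers that tuples can express.
    conv-ok : ∀ {μ u} {Q Q' : Pred μ u} →
      (∀ (𝔄 : Struct ar) → Ok 𝔄 → ∀ R xs → InRange 𝔄 xs → (Q 𝔄 R xs → Q' 𝔄 R xs) × (Q' 𝔄 R xs → Q 𝔄 R xs)) →
      Def μ u Q → Def μ u Q'
    conv-ok h d = record
      { form = form d ; wf = wf d ; good = good d
      ; sem = λ 𝔄 ok ts η ρ → let (f , g) = h 𝔄 ok _ (vals η ts) (vals-range 𝔄 η ts) in reflects-map f g (sem d 𝔄 ok ts η ρ) }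

    conv : ∀ {μ u} {Q Q' : Pred μ u} → (∀ (𝔄 : Struct ar) R xs → InRange 𝔄 xs → (Q 𝔄 R xs → Q' 𝔄 R xs) × (Q' 𝔄 R xs → Q 𝔄 R xs)) →
      Def μ u Q → Def μ u Q'
    conv h = conv-ok (λ 𝔄 _ → h 𝔄)

    vals-sub : ∀ {n v u u'} (η : Vec (Fin n) v) (ts : Vec (Vec (Fin v) K) u) (σ : Vec (Fin u) u') →
      vals η (Vec.map (lookup ts) σ) ≡ Vec.map (lookup (vals η ts)) σ
    vals-sub η ts σ = trans (sym (Vec.map-∘ _ _ σ)) (Vec.map-cong (λ i → sym (Vec.lookup-map i _ ts)) σ)

    sub : ∀ {μ u u'} {Q : Pred μ u'} (σ : Vec (Fin u) u') → Def μ u' Q → Def μ u (λ 𝔄 R xs → Q 𝔄 R (Vec.map (lookup xs) σ))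
    sub {μ} {Q = Q} σ d = record
      { form = λ ts → form d (Vec.map (lookup ts) σ) ; wf = λ ts → wf d _ ; good = λ ts → good d _
      ; sem = λ 𝔄 ok ts η ρ → subst (λ xs → Reflects (Q 𝔄 (interp μ 𝔄 ρ) xs) (evalB 𝔄 (form d (Vec.map (lookup ts) σ)) η ρ))
          (vals-sub η ts σ) (sem d 𝔄 ok (Vec.map (lookup ts) σ) η ρ) }

    falseD : ∀ {μ u} → Def μ u (λ _ _ _ → ⊥)
    falseD = record { form = λ _ → ff ; wf = λ _ → tt ; good = λ _ _ → tt , inj₂ tt ; sem = λ _ _ _ _ _ → ofⁿ (λ ()) }

    private
      both : ∀ {A B C : Set} → A ⊎ B → A ⊎ C → A ⊎ (B × C)
      both (inj₁ a) _        = inj₁ a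
      both (inj₂ b) (inj₁ a) = inj₁ a
      both (inj₂ b) (inj₂ c) = inj₂ (b , c)

    infixr 5 _orD_
    infixr 6 _andD_

    _orD_ : ∀ {μ u} {P Q : Pred μ u} → Def μ u P → Def μ u Q → Def μ u (λ 𝔄 R xs → P 𝔄 R xs ⊎ Q 𝔄 R xs)
    c orD d = record
      { form = λ ts → or (form c ts) (form d ts) ; wf = λ ts → wf c ts , wf d ts
      ; good = λ ts i → let (p , q) = good c ts i
                            (p' , q') = good d ts i in (p , p') , both q q'
      ; sem = λ 𝔄 ok ts η ρ → sem c 𝔄 ok ts η ρ ⊎-reflects sem d 𝔄 ok ts η ρ }

    _andD_ : ∀ {μ u} {P Q : Pred μ u} → Def μ u P → Def μ u Q → Def μ u (λ 𝔄 R xs → P 𝔄 R xs × Q 𝔄 R xs)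
    c andD d = record
      { form = λ ts → neg (or (neg (form c ts)) (neg (form d ts))) ; wf = λ ts → wf c ts , wf d ts
      ; good = λ ts i → let (p , q) = good c ts i
                            (p' , q') = good d ts i in (p , p') , both q q'
      ; sem = λ 𝔄 ok ts η ρ → let C = sem c 𝔄 ok ts η ρ
                                  D = sem d 𝔄 ok ts η ρ in
          reflects-map (λ h → reflects-stable C (h ∘ inj₁) , reflects-stable D (h ∘ inj₂))
            (λ { (p , q) (inj₁ np) → np p ; (p , q) (inj₂ nq) → nq q })
            (¬-reflects (¬-reflects C ⊎-reflects ¬-reflects D)) }

    notD : ∀ {u} {P : Pred closed u} → Def closed u P → Def closed u (λ 𝔄 R xs → ¬ P 𝔄 R xs)
    notD c = record
      { form = λ ts → neg (form c ts) ; wf = λ ts → wf c ts ; good = λ ts i → swap (good c ts i)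
      ; sem = λ 𝔄 ok ts η ρ → ¬-reflects (sem c 𝔄 ok ts η ρ) }
      where
      swap : ∀ {A B : Set} → A × (⊥ ⊎ B) → B × (⊥ ⊎ A)
      swap (a , inj₂ b) = b , inj₂ a

    someD : ∀ {μ u} m {P : Fin m → Pred μ u} → (∀ i → Def μ u (P i)) → Def μ u (λ 𝔄 R xs → ∃ λ i → P i 𝔄 R xs)
    someD zero    d = conv (λ _ _ _ _ → (λ ()) , λ { (() , _) }) falseD
    someD (suc m) d = conv (λ _ _ _ _ → (λ { (inj₁ p) → zero , p ; (inj₂ (i , p)) → suc i , p })
                                      , (λ { (zero , p) → inj₁ p ; (suc i , p) → inj₂ (i , p) }))
      (d zero orD someD m (d ∘ suc))

    exs : ∀ k {v k'} {Δ : Vec ℕ k'} → Formula ar (k + v) Δ → Formula ar v Δ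
    exs zero    φ = φ
    exs (suc k) φ = exs k (ex φ)

    exs-wf : ∀ k {v k'} {Δ : Vec ℕ k'} (φ : Formula ar (k + v) Δ) → WF φ → WF (exs k φ)
    exs-wf zero    φ h = h
    exs-wf (suc k) φ h = exs-wf k (ex φ) h

    exs-good : ∀ k {μ v k'} {Δ : Vec ℕ k'} (φ : Formula ar (k + v) (ctx μ Δ)) → Good μ φ → Good μ (exs k φ)
    exs-good zero    φ h = h
    exs-good (suc k) φ h = exs-good k (ex φ) h

    exs-sem : ∀ (𝔄 : Struct ar) k {v k'} {Δ : Vec ℕ k'} (φ : Formula ar (k + v) Δ) η ρ →
      (evalB 𝔄 (exs k φ) η ρ ≡ true → ∃ λ (b : Vec (Fin (size 𝔄)) k) → evalB 𝔄 φ (b Vec.++ η) ρ ≡ true) ×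
      (∀ (b : Vec (Fin (size 𝔄)) k) → evalB 𝔄 φ (b Vec.++ η) ρ ≡ true → evalB 𝔄 (exs k φ) η ρ ≡ true)
    exs-sem 𝔄 zero    φ η ρ = (λ h → [] , h) , λ { [] h → h }
    exs-sem 𝔄 (suc k) φ η ρ = let (f , g) = exs-sem 𝔄 k (ex φ) η ρ in
      (λ h → let (b , e) = f h
                 (a , _ , e') = any-sound (allFin (size 𝔄)) e in a ∷ b , e') ,
      λ { (a ∷ b) h → g b (any-complete (∈-allFin a) h) }

    shifted : ∀ {n v u} (b : Vec (Fin n) K) (η : Vec (Fin n) v) (ts : Vec (Vec (Fin v) K) u) →
      vals (b Vec.++ η) (firstVars K ∷ Vec.map (Vec.map (K ↑ʳ_)) ts) ≡ numR b ∷ vals η ts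
    shifted b η ts = cong₂ _∷_ (cong numR (lookup-firstVars b η))
      (trans (sym (Vec.map-∘ _ _ ts)) (Vec.map-cong (λ t → cong numR (lookup-shift b η t)) ts))

    exD : ∀ {μ u} {P : Pred μ (suc u)} → Def μ (suc u) P → Def μ u (λ 𝔄 R xs → ∃ λ x → x < bound 𝔄 × P 𝔄 R (x ∷ xs))
    exD {μ} {P = P} d = record
      { form = λ ts → exs K (form d (inner ts)) ; wf = λ ts → exs-wf K _ (wf d (inner ts))
      ; good = λ ts → exs-good K {μ} _ (good d (inner ts))
      ; sem = semantics }
      where
      inner : ∀ {v u} → Vec (Vec (Fin v) K) u → Vec (Vec (Fin (K + v)) K) (suc u)
      inner ts = firstVars K ∷ Vec.map (Vec.map (K ↑ʳ_)) ts

      semantics : ∀ (𝔄 : Struct ar) → Ok 𝔄 → ∀ {v k} {Δ : Vec ℕ k} ts (η : Vec (Fin (size 𝔄)) v) (ρ : RelEnv (size 𝔄) (ctx μ Δ)) →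
        Reflects (∃ λ x → x < bound 𝔄 × P 𝔄 (interp μ 𝔄 ρ) (x ∷ vals η ts)) (evalB 𝔄 (exs K (form d {Δ = Δ} (inner ts))) η ρ)
      semantics 𝔄 ok {Δ = Δ} ts η ρ = reflects-⇔ to from
        where
        φ = form d {Δ = Δ} (inner ts)
        at : ∀ b → Reflects (P 𝔄 (interp μ 𝔄 ρ) (numR b ∷ vals η ts)) (evalB 𝔄 φ (b Vec.++ η) ρ)
        at b = subst (λ xs → Reflects (P 𝔄 (interp μ 𝔄 ρ) xs) (evalB 𝔄 φ (b Vec.++ η) ρ)) (shifted b η ts)
          (sem d 𝔄 ok {Δ = Δ} (inner ts) (b Vec.++ η) ρ)
        to : evalB 𝔄 (exs K φ) η ρ ≡ true → ∃ λ x → x < bound 𝔄 × P 𝔄 (interp μ 𝔄 ρ) (x ∷ vals η ts)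
        to h = let (b , e) = proj₁ (exs-sem 𝔄 K φ η ρ) h in numR b , numR-bound b , reflects-elim (at b) e
        from : (∃ λ x → x < bound 𝔄 × P 𝔄 (interp μ 𝔄 ρ) (x ∷ vals η ts)) → evalB 𝔄 (exs K φ) η ρ ≡ true
        from (x , h , p) = proj₂ (exs-sem 𝔄 K φ η ρ) (unnum K x) (reflects-true (at (unnum K x))
          (subst (λ y → P 𝔄 (interp μ 𝔄 ρ) (y ∷ vals η ts)) (sym (numR-unnum K x h)) p))

    weaken : ∀ {u} l {P : Pred closed u} → Def closed u P → Def (open′ l) u (λ 𝔄 _ xs → P 𝔄 (Level.lift tt) xs)
    weaken l d = record
      { form = form d ; wf = wf d ; good = λ ts i → let (p , q) = good d ts i in p , right-of q
      ; sem = λ 𝔄 ok ts η ρ → sem d 𝔄 ok ts η ρ }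
      where
      right-of : ∀ {A B : Set} → ⊥ ⊎ B → A ⊎ B
      right-of (inj₂ b) = inj₂ b

    private
      digits-numbers : ∀ {m₀ l} (bs : Vec (Vec (Fin (suc m₀)) K) l) → digits (numbers bs) ≡ bs
      digits-numbers []       = refl
      digits-numbers (b ∷ bs) = cong₂ _∷_ (numR-injective _ b (numR-unnum K (numR b) (numR-bound b))) (digits-numbers bs)

      numbers-digits : ∀ (𝔄 : Struct ar) {l} (xs : Vec ℕ l) → InRange 𝔄 xs → numbers (digits {m 𝔄} xs) ≡ xs
      numbers-digits 𝔄 []       []       = refl
      numbers-digits 𝔄 (x ∷ xs) (h ∷ hs) = cong₂ _∷_ (numR-unnum K x h) (numbers-digits 𝔄 xs hs)

      vals-numbers : ∀ {n v u} (η : Vec (Fin n) v) (ts : Vec (Vec (Fin v) K) u) →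
        vals η ts ≡ numbers (Vec.map (Vec.map (lookup η)) ts)
      vals-numbers η ts = Vec.map-∘ numR _ ts

      digits-vals : ∀ (𝔄 : Struct ar) {v u} (η : Vec (Fin (size 𝔄)) v) (ts : Vec (Vec (Fin v) K) u) →
        concat (digits (vals η ts)) ≡ Vec.map (lookup η) (concat ts)
      digits-vals 𝔄 η ts = trans (cong concat (trans (cong digits (vals-numbers η ts)) (digits-numbers _)))
        (sym (Vec.map-concat (lookup η) ts))

    relD : ∀ {l} → Def (open′ l) l (λ 𝔄 R xs → R xs)
    relD {l} = record
      { form = λ ts → rvar zero (concat ts) ; wf = λ _ → tt ; good = λ ts i → tt , isR i
      ; sem = λ 𝔄 ok ts η ρ → reflects-⇔
          (λ e → vals-range 𝔄 η ts , trans (cong (ρ zero) (digits-vals 𝔄 η ts)) e)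
          (λ (_ , e) → trans (cong (ρ zero) (sym (digits-vals 𝔄 η ts))) e) }
      where
      isR : ∀ {k} (i : Fin (suc k)) → i ≡ zero ⊎ (zero ≡ i → ⊥)
      isR zero    = inj₁ refl
      isR (suc i) = inj₂ (λ ())

    -- The two conditions characterise Q as least fixed point: P leads from subrelations of Q into
    -- Q, and every relation closed under P contains Q. Q has to be decidable because the semantics
    -- compares only Boolean relations, and Q must be one of them.
    lfpD : ∀ {l} {P : Pred (open′ l) l} {Q : Struct ar → Vec ℕ l → Set} → Def (open′ l) l P → (∀ (𝔄 : Struct ar) xs → Dec (Q 𝔄 xs)) →
      (∀ (𝔄 : Struct ar) → Ok 𝔄 → ∀ (R : Vec ℕ l → Set) → (∀ xs → R xs → Q 𝔄 xs) → ∀ xs → InRange 𝔄 xs → P 𝔄 R xs → Q 𝔄 xs) →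
      (∀ (𝔄 : Struct ar) → Ok 𝔄 → ∀ (R : Vec ℕ l → Set) → (∀ xs → InRange 𝔄 xs → P 𝔄 R xs → R xs) → ∀ xs → InRange 𝔄 xs → Q 𝔄 xs → R xs) →
      Def closed l (λ 𝔄 _ xs → Q 𝔄 xs)
    lfpD {l} {P} {Q} d dec sound complete = record
      { form = λ ts → lfp (l * K) (form d blocks) (concat ts)
      ; wf = λ ts → proj₁ (good d blocks zero) , wf d blocks
      ; good = λ ts i → let (p , q) = good d blocks (suc i) in p , other q
      ; sem = semantics }
      where
      blocks : ∀ {v} → Vec (Vec (Fin (l * K + v)) K) l
      blocks {v} = proj₁ (group l K (firstVars (l * K) {v}))

      other : ∀ {k} {i : Fin k} {A : Set} → suc i ≡ zero ⊎ A → ⊥ ⊎ A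
      other (inj₂ a) = inj₂ a

      vals-blocks : ∀ (𝔄 : Struct ar) {v} (bs : Vec (Vec (Fin (size 𝔄)) K) l) (η : Vec (Fin (size 𝔄)) v) → vals (concat bs Vec.++ η) blocks ≡ numbers bs
      vals-blocks 𝔄 bs η = trans (vals-numbers (concat bs Vec.++ η) blocks) (cong numbers
        (concat-injective _ bs (trans (sym (Vec.map-concat _ blocks))
          (trans (cong (Vec.map (lookup (concat bs Vec.++ η))) (sym (proj₂ (group l K (firstVars (l * K))))))
                 (lookup-firstVars (concat bs) η)))))

      unfold : ∀ (𝔄 : Struct ar) → Ok 𝔄 → ∀ {v k} {Δ : Vec ℕ k} (η : Vec (Fin (size 𝔄)) v) (ρ : RelEnv (size 𝔄) Δ) R xs → InRange 𝔄 xs →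
        Reflects (P 𝔄 (asRel 𝔄 R) xs) (operator 𝔄 (form d {Δ = Δ} blocks) η ρ R (concat (digits xs)))
      unfold 𝔄 ok {Δ = Δ} η ρ R xs h = subst (λ z → Reflects (P 𝔄 (asRel 𝔄 R) z) (operator 𝔄 (form d {Δ = Δ} blocks) η ρ R (concat (digits xs))))
        (trans (vals-blocks 𝔄 (digits xs) η) (numbers-digits 𝔄 xs h))
        (sem d 𝔄 ok {Δ = Δ} blocks (concat (digits xs) Vec.++ η) (extR R ρ))

      semantics : ∀ (𝔄 : Struct ar) → Ok 𝔄 → ∀ {v k} {Δ : Vec ℕ k} ts (η : Vec (Fin (size 𝔄)) v) (ρ : RelEnv (size 𝔄) Δ) →
        Reflects (Q 𝔄 (vals η ts)) (lfpᵇ (operator 𝔄 (form d {Δ = Δ} blocks) η ρ) (Vec.map (lookup η) (concat ts)))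
      semantics 𝔄 ok {Δ = Δ} ts η ρ = reflects-⇔ to from
        where
        F = operator 𝔄 (form d {Δ = Δ} blocks) η ρ
        xs = vals η ts
        back : numbers (proj₁ (group l K (concat (digits {m 𝔄} xs)))) ≡ xs
        back = trans (cong numbers (group-concat l K (digits xs))) (numbers-digits 𝔄 xs (vals-range 𝔄 η ts))

        Q? : Vec (Fin (size 𝔄)) (l * K) → Bool
        Q? b = does (dec 𝔄 (numbers (proj₁ (group l K b))))

        Q?-sound : ∀ b → Q? b ≡ true → Q 𝔄 (numbers (proj₁ (group l K b)))
        Q?-sound b e = reflects-elim (proof (dec 𝔄 (numbers (proj₁ (group l K b))))) e

        Q?-asRel : ∀ ys → asRel 𝔄 Q? ys → Q 𝔄 ys
        Q?-asRel ys (h , e) = subst (Q 𝔄) (trans (cong numbers (group-concat l K (digits ys))) (numbers-digits 𝔄 ys h)) (Q?-sound _ e)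

        range-numbers : ∀ {l} (bs : Vec (Vec (Fin (size 𝔄)) K) l) → InRange 𝔄 (numbers bs)
        range-numbers []       = []
        range-numbers (b ∷ bs) = numR-bound b ∷ range-numbers bs

        ungroup : ∀ b → concat (digits {m 𝔄} (numbers (proj₁ (group l K b)))) ≡ b
        ungroup b = trans (cong concat (digits-numbers (proj₁ (group l K b)))) (sym (proj₂ (group l K b)))

        to : lfpᵇ F (Vec.map (lookup η) (concat ts)) ≡ true → Q 𝔄 xs
        to e = subst (Q 𝔄) back' (Q?-sound _ (lfp-elim F (operator-ext 𝔄 (form d {Δ = Δ} blocks) η ρ) e Q? (λ b e' →
            let ys = numbers (proj₁ (group l K b))
                h  = range-numbers (proj₁ (group l K b)) in
            reflects-true (proof (dec 𝔄 ys)) (sound 𝔄 ok (asRel 𝔄 Q?) Q?-asRel ys h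
              (reflects-elim (unfold 𝔄 ok {Δ = Δ} η ρ Q? ys h) (trans (cong (F Q?) (ungroup b)) e'))))))
          where
          back' : numbers (proj₁ (group l K (Vec.map (lookup η) (concat ts)))) ≡ xs
          back' = trans (cong (λ z → numbers (proj₁ (group l K z))) (sym (digits-vals 𝔄 η ts))) back

        from : Q 𝔄 xs → lfpᵇ F (Vec.map (lookup η) (concat ts)) ≡ true
        from q = lfp-intro F (λ R c → subst (λ z → R z ≡ true) (digits-vals 𝔄 η ts)
          (proj₂ (complete 𝔄 ok (asRel 𝔄 R) (λ ys h p → h , c (concat (digits ys)) (reflects-true (unfold 𝔄 ok {Δ = Δ} η ρ R ys h) p))
            xs (vals-range 𝔄 η ts) q)))

-- Order, addition and the bits of the input.

module DefinableArithmetic where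
  open FixedPoints
  open Machines using (nthᵐ)
  open Encodings
  open Numbers
  open import Data.List.Membership.Propositional.Properties using (∈-allFin)
  open import Data.Vec.Relation.Unary.All using ([]; _∷_)
  open import Data.Vec.Relation.Unary.All.Properties using (lookup⁺)
  open import Relation.Nullary using (does; proof; Reflects; ofʸ; ofⁿ; yes; no)
  open import Relation.Nullary.Reflects using (¬-reflects; _⊎-reflects_)
  open import Relation.Binary.PropositionalEquality using (refl; sym; trans)
  open import Data.Fin.Patterns

  position-surjective : ∀ n {j} (ar : Vec ℕ j) p → p < total ar (suc n) →
    ∃ λ i → ∃ λ t → p ≡ position (suc n) ar i t
  position-surjective n (l ∷ ar) p h with p <? suc n ^ l
  ... | yes p< = let (t , e) = numR-surjective l p p< in zero , Vec.reverse t , trans (sym e) (cong numR (sym (Vec.reverse-involutive t)))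
  ... | no p≮ with ℕ.m≤n⇒∃[o]m+o≡n (ℕ.≮⇒≥ p≮)
  ...   | q , refl = let (i , t , e) = position-surjective n ar q (ℕ.+-cancelˡ-< (suc n ^ l) _ _ h) in suc i , t , cong (suc n ^ l +_) e

  offset : ℕ → ∀ {j} → Vec ℕ j → Fin j → ℕ
  offset n (l ∷ ar) zero    = 0
  offset n (l ∷ ar) (suc i) = n ^ l + offset n ar i

  position-offset : ∀ n {j} (ar : Vec ℕ j) i t → position n ar i t ≡ offset n ar i + numR (Vec.reverse t)
  position-offset n (l ∷ ar) zero    t = refl
  position-offset n (l ∷ ar) (suc i) t = trans (cong (n ^ l +_) (position-offset n ar i t)) (sym (ℕ.+-assoc (n ^ l) _ _))

  takeV : ∀ {A : Set} {l k} → l ≤ k → Vec A k → Vec A l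
  takeV z≤n     xs       = []
  takeV (s≤s h) (x ∷ xs) = x ∷ takeV h xs

  map-takeV : ∀ {A B : Set} (f : A → B) {l k} (h : l ≤ k) xs → Vec.map f (takeV h xs) ≡ takeV h (Vec.map f xs)
  map-takeV f z≤n     xs       = refl
  map-takeV f (s≤s h) (x ∷ xs) = cong (f x ∷_) (map-takeV f h xs)

  numR-< : ∀ {n l k} (a : Fin n) (s : Vec (Fin n) k) → numR (a ∷ s) < n ^ suc l → numR s < n ^ l
  numR-< {n} {l} a s h = ℕ.*-cancelʳ-< n (numR s) (n ^ l)
    (ℕ.≤-<-trans (ℕ.m≤n+m (numR s * n) (toℕ a)) (subst (numR (a ∷ s) <_) (ℕ.*-comm n (n ^ l)) h))

  <-numR : ∀ {n l k} (a : Fin n) (s : Vec (Fin n) k) → numR s < n ^ l → numR (a ∷ s) < n ^ suc l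
  <-numR {n} {l} a s h = ℕ.<-≤-trans (ℕ.+-monoˡ-< (numR s * n) (Fin.toℕ<n a))
    (ℕ.≤-trans (ℕ.*-monoˡ-≤ n h) (ℕ.≤-reflexive (ℕ.*-comm (n ^ l) n)))

  numR-takeV : ∀ {n l k} (h : l ≤ k) (s : Vec (Fin n) k) → numR s < n ^ l → numR (takeV h s) ≡ numR s
  numR-takeV z≤n     s       e = sym (ℕ.n<1⇒n≡0 e)
  numR-takeV {n} (s≤s {m = l} h) (a ∷ s) e = cong (λ x → toℕ a + x * n) (numR-takeV h s (numR-< {l = l} a s e))

  module Arithmetic {j : ℕ} (ar : Vocab j) (K : ℕ) (Ok : Struct ar → Set) where
    open Definable ar K Ok public

    private
      -- The order of the numbers: the tails hold the more significant digits and decide first.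
      lexLt : ∀ {v k k'} {Δ : Vec ℕ k} → Vec (Fin v) k' → Vec (Fin v) k' → Formula ar v Δ
      lexLt []       []       = ff
      lexLt (x ∷ xs) (y ∷ ys) = or (lexLt xs ys) (neg (or (lexLt ys xs) (neg (lt x y))))

      lexLt-wf : ∀ {v k k'} {Δ : Vec ℕ k} (xs ys : Vec (Fin v) k') → WF (lexLt {Δ = Δ} xs ys)
      lexLt-wf []       []       = tt
      lexLt-wf (x ∷ xs) (y ∷ ys) = lexLt-wf xs ys , lexLt-wf ys xs , tt

      lexLt-fresh : ∀ {v k k'} {Δ : Vec ℕ k} (xs ys : Vec (Fin v) k') i → Pos i (lexLt {Δ = Δ} xs ys) × Neg i (lexLt {Δ = Δ} xs ys)
      lexLt-fresh []       []       i = tt , tt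
      lexLt-fresh (x ∷ xs) (y ∷ ys) i = let (p , q) = lexLt-fresh xs ys i
                                            (p' , q') = lexLt-fresh ys xs i in (p , q' , tt) , (q , p' , tt)

      lexLt-sem : ∀ (𝔄 : Struct ar) {v k k'} (Δ : Vec ℕ k) (xs ys : Vec (Fin v) k') (η : Vec (Fin (size 𝔄)) v) (ρ : RelEnv (size 𝔄) Δ) →
        Reflects (numR (Vec.map (lookup η) xs) < numR (Vec.map (lookup η) ys)) (evalB 𝔄 (lexLt {Δ = Δ} xs ys) η ρ)
      lexLt-sem 𝔄 Δ []       []       η ρ = ofⁿ (λ ())
      lexLt-sem 𝔄 Δ (x ∷ xs) (y ∷ ys) η ρ = reflects-map to from
        (lexLt-sem 𝔄 Δ xs ys η ρ ⊎-reflects ¬-reflects (lexLt-sem 𝔄 Δ ys xs η ρ ⊎-reflects ¬-reflects (proof (a Fin.<? b))))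
        where
        n = size 𝔄
        a = lookup η x
        b = lookup η y
        s = numR (Vec.map (lookup η) xs)
        t = numR (Vec.map (lookup η) ys)
        to : s < t ⊎ ¬ (t < s ⊎ ¬ (toℕ a < toℕ b)) → toℕ a + s * n < toℕ b + t * n
        to (inj₁ s<t) = ℕ.<-≤-trans (ℕ.+-monoˡ-< (s * n) (Fin.toℕ<n a)) (ℕ.≤-trans (ℕ.*-monoˡ-≤ n s<t) (ℕ.m≤n+m _ (toℕ b)))
        to (inj₂ h) = ℕ.+-mono-<-≤ (ℕ.≰⇒> (λ b≤a → h (inj₂ (ℕ.≤⇒≯ b≤a)))) (ℕ.*-monoˡ-≤ n (ℕ.≮⇒≥ (h ∘ inj₁)))
        from : toℕ a + s * n < toℕ b + t * n → s < t ⊎ ¬ (t < s ⊎ ¬ (toℕ a < toℕ b))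
        from h with ℕ.<-cmp s t
        ... | tri< s<t _ _ = inj₁ s<t
        ... | tri≈ _ e _   = inj₂ Sum.[ ℕ.<-irrefl (sym e) , (λ na → na (ℕ.+-cancelʳ-< (t * n) (toℕ a) (toℕ b) (subst (λ z → toℕ a + z * n < _) e h))) ]
        ... | tri> _ _ t<s = ⊥-elim (ℕ.<-asym h
            (ℕ.<-≤-trans (ℕ.+-monoˡ-< (t * n) (Fin.toℕ<n b)) (ℕ.≤-trans (ℕ.*-monoˡ-≤ n t<s) (ℕ.m≤n+m _ (toℕ a)))))

      -- All digits from place l on are 0, which says that the number is below n ^ l. A digit is 0
      -- if no element is smaller.
      zeros : ∀ {v k k'} {Δ : Vec ℕ k} → ℕ → Vec (Fin v) k' → Formula ar v Δ
      zeros l       []       = neg ff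
      zeros zero    (x ∷ xs) = neg (or (ex (lt zero (suc x))) (neg (zeros zero xs)))
      zeros (suc l) (x ∷ xs) = zeros l xs

      zeros-wf : ∀ {v k k'} {Δ : Vec ℕ k} l (xs : Vec (Fin v) k') → WF (zeros {Δ = Δ} l xs)
      zeros-wf l       []       = tt
      zeros-wf zero    (x ∷ xs) = tt , zeros-wf zero xs
      zeros-wf (suc l) (x ∷ xs) = zeros-wf l xs

      zeros-fresh : ∀ {v k k'} {Δ : Vec ℕ k} l (xs : Vec (Fin v) k') i → Pos i (zeros {Δ = Δ} l xs) × Neg i (zeros {Δ = Δ} l xs)
      zeros-fresh l       []       i = tt , tt
      zeros-fresh zero    (x ∷ xs) i = let (p , q) = zeros-fresh zero xs i in (tt , p) , (tt , q)
      zeros-fresh (suc l) (x ∷ xs) i = zeros-fresh l xs i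

      zeros-sem : ∀ (𝔄 : Struct ar) {v k k'} (Δ : Vec ℕ k) l (xs : Vec (Fin v) k') (η : Vec (Fin (size 𝔄)) v) (ρ : RelEnv (size 𝔄) Δ) →
        Reflects (numR (Vec.map (lookup η) xs) < size 𝔄 ^ l) (evalB 𝔄 (zeros {Δ = Δ} l xs) η ρ)
      zeros-sem 𝔄 Δ l [] η ρ = ofʸ (ℕ.m^n>0 (size 𝔄) l)
      zeros-sem 𝔄 Δ (suc l) (x ∷ xs) η ρ = reflects-map (<-numR {l = l} (lookup η x) (Vec.map (lookup η) xs))
        (numR-< {l = l} (lookup η x) (Vec.map (lookup η) xs)) (zeros-sem 𝔄 Δ l xs η ρ)
      zeros-sem 𝔄 Δ zero (x ∷ xs) η ρ = reflects-map to from (¬-reflects (positive ⊎-reflects ¬-reflects (zeros-sem 𝔄 Δ zero xs η ρ)))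
        where
        n = size 𝔄
        a = lookup η x
        s = numR (Vec.map (lookup η) xs)
        positive : Reflects (0 < toℕ a) (evalB 𝔄 {Δ = Δ} (ex (lt zero (suc x))) η ρ)
        positive = reflects-⇔
          (λ h → let (b , _ , e) = any-sound (allFin n) h in ℕ.≤-<-trans z≤n (reflects-elim (proof (b Fin.<? a)) e))
          (λ h → any-complete {p = λ b → does (b Fin.<? a)} {xs = allFin n} (∈-allFin zero) (reflects-true (proof (zero {n = m 𝔄} Fin.<? a)) h))
        to : ¬ (0 < toℕ a ⊎ ¬ (s < 1)) → toℕ a + s * n < 1
        to h with toℕ a | s
        ... | suc _ | _     = ⊥-elim (h (inj₁ (s≤s z≤n)))
        ... | zero  | suc _ = ⊥-elim (h (inj₂ (λ { (s≤s ()) })))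
        ... | zero  | zero  = s≤s z≤n
        from : toℕ a + s * n < 1 → ¬ (0 < toℕ a ⊎ ¬ (s < 1))
        from h with toℕ a | s
        from (s≤s ()) | suc _ | _
        from (s≤s ()) | zero  | suc _
        ... | zero  | zero  = Sum.[ (λ ()) , (λ f → f (s≤s z≤n)) ]

    ltD : Def closed 2 (λ _ _ xs → lookup xs 0F < lookup xs 1F)
    ltD = record
      { form = λ { (xs ∷ ys ∷ []) → lexLt xs ys } ; wf = λ { (xs ∷ ys ∷ []) → lexLt-wf xs ys }
      ; good = λ { (xs ∷ ys ∷ []) i → let (p , q) = lexLt-fresh xs ys i in p , inj₂ q }
      ; sem = λ { 𝔄 _ {Δ = Δ} (xs ∷ ys ∷ []) η ρ → lexLt-sem 𝔄 Δ xs ys η ρ } }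

    belowD : ∀ l → Def closed 1 (λ 𝔄 _ xs → lookup xs 0F < size 𝔄 ^ l)
    belowD l = record
      { form = λ { (xs ∷ []) → zeros l xs } ; wf = λ { (xs ∷ []) → zeros-wf l xs }
      ; good = λ { (xs ∷ []) i → let (p , q) = zeros-fresh l xs i in p , inj₂ q }
      ; sem = λ { 𝔄 _ {Δ = Δ} (xs ∷ []) η ρ → zeros-sem 𝔄 Δ l xs η ρ } }

    private
      tupleOf : ∀ {l} → l ≤ K → ∀ {m₀} → ℕ → Vec (Fin (suc m₀)) l
      tupleOf h x = Vec.reverse (takeV h (unnum K x))

    atomD : ∀ i (h : lookup ar i ≤ K) → Def closed 1 (λ 𝔄 _ xs → rels 𝔄 i (tupleOf h (lookup xs 0F)) ≡ true)
    atomD i h = record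
      { form = λ { (xs ∷ []) → rel i (Vec.reverse (takeV h xs)) } ; wf = λ { (xs ∷ []) → tt }
      ; good = λ { (xs ∷ []) i → tt , inj₂ tt }
      ; sem = λ { 𝔄 _ (xs ∷ []) η ρ →
          let s = Vec.map (lookup η) xs
              e : Vec.map (lookup η) (Vec.reverse (takeV h xs)) ≡ tupleOf h (numR s)
              e = trans (Vec.map-reverse (lookup η) (takeV h xs)) (cong Vec.reverse (trans (map-takeV (lookup η) h xs)
                    (cong (takeV h) (sym (numR-injective _ s (numR-unnum K (numR s) (numR-bound s)))))))
          in reflects-⇔ (trans (cong (rels 𝔄 i) (sym e))) (trans (cong (rels 𝔄 i) e)) } }

    zeroD : Def closed 1 (λ _ _ xs → lookup xs 0F ≡ 0)
    zeroD = conv (λ 𝔄 _ xs h → (λ none → ℕ.n<1⇒n≡0 (ℕ.≰⇒> (λ pos → none (0 , ℕ.≤-<-trans z≤n (lookup⁺ h 0F) , pos)))) ,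
                               λ { e (y , _ , y<) → ℕ.<⇒≱ y< (ℕ.≤-trans (ℕ.≤-reflexive e) z≤n) })
      (notD (exD (sub (0F ∷ 1F ∷ []) ltD)))

    eqD : Def closed 2 (λ _ _ xs → lookup xs 0F ≡ lookup xs 1F)
    eqD = conv (λ _ _ xs _ → (λ (p , q) → ℕ.≤-antisym (ℕ.≮⇒≥ q) (ℕ.≮⇒≥ p)) , λ e → ℕ.<-irrefl e , ℕ.<-irrefl (sym e))
      (notD ltD andD notD (sub (1F ∷ 0F ∷ []) ltD))

    sucD : Def closed 2 (λ _ _ xs → lookup xs 1F ≡ suc (lookup xs 0F))
    sucD = conv (λ 𝔄 _ xs h →
          (λ (p , none) → ℕ.≤-antisym (ℕ.≮⇒≥ (λ q → none (suc (lookup xs 0F) , ℕ.<-trans q (lookup⁺ h 1F) , ℕ.≤-refl , q))) p) ,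
          λ e → ℕ.≤-reflexive (sym e) , λ { (z , _ , p , q) → ℕ.<⇒≱ q (ℕ.≤-trans (ℕ.≤-reflexive e) p) })
      (ltD andD notD (exD (sub (1F ∷ 0F ∷ []) ltD andD sub (0F ∷ 2F ∷ []) ltD)))

    lastD : Def closed 1 (λ 𝔄 _ xs → suc (lookup xs 0F) ≡ bound 𝔄)
    lastD = conv (λ 𝔄 _ xs h →
          (λ none → ℕ.≤-antisym (lookup⁺ h 0F) (ℕ.≮⇒≥ (λ q → none (suc (lookup xs 0F) , q , ℕ.≤-refl)))) ,
          λ { e (y , y<N , x<y) → ℕ.<⇒≱ y<N (ℕ.≤-trans (ℕ.≤-reflexive (sym e)) x<y) })
      (notD (exD (sub (1F ∷ 0F ∷ []) ltD)))

    constD : ∀ c → Def closed 1 (λ _ _ xs → lookup xs 0F ≡ c)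
    constD zero    = zeroD
    constD (suc c) = conv (λ 𝔄 _ xs h → (λ { (y , _ , e , e') → trans e' (cong suc e) }) ,
                              λ e → c , ℕ.<-trans (ℕ.≤-reflexive (sym e)) (lookup⁺ h 0F) , refl , e)
      (exD (sub (0F ∷ []) (constD c) andD sucD))

    plusD : Def closed 3 (λ _ _ xs → lookup xs 0F + lookup xs 1F ≡ lookup xs 2F)
    plusD = lfpD (weaken 3 (sub (1F ∷ []) zeroD andD sub (0F ∷ 2F ∷ []) eqD)
                  orD exD (exD (weaken 3 (sub (1F ∷ 3F ∷ []) sucD andD sub (0F ∷ 4F ∷ []) sucD) andD sub (2F ∷ 1F ∷ 0F ∷ []) relD)))
      (λ _ xs → _ ℕ.≟ _)
      (λ { 𝔄 _ R RQ (x ∷ y ∷ z ∷ []) _ (inj₁ (refl , e)) → trans (ℕ.+-identityʳ x) e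
         ; 𝔄 _ R RQ (x ∷ y ∷ z ∷ []) _ (inj₂ (y' , _ , z' , _ , (refl , refl) , q)) → trans (ℕ.+-suc x y') (cong suc (RQ _ q)) })
      (λ { 𝔄 _ R cl (x ∷ y ∷ z ∷ []) (hx ∷ hy ∷ hz ∷ []) e → grow 𝔄 R cl x y z hx hy hz e })
      where
      grow : ∀ (𝔄 : Struct ar) (R : Vec ℕ 3 → Set) → _ → ∀ x y z → x < bound 𝔄 → y < bound 𝔄 → z < bound 𝔄 → x + y ≡ z → R (x ∷ y ∷ z ∷ [])
      grow 𝔄 R cl x zero    z hx hy hz e = cl (x ∷ zero ∷ z ∷ []) (hx ∷ hy ∷ hz ∷ []) (inj₁ (refl , trans (sym (ℕ.+-identityʳ x)) e))
      grow 𝔄 R cl x (suc y) z hx hy hz refl = cl (x ∷ suc y ∷ z ∷ []) (hx ∷ hy ∷ hz ∷ [])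
        (inj₂ (y , hy' , x + y , hz' , (refl , ℕ.+-suc x y) , grow 𝔄 R cl x y (x + y) hx hy' hz' refl))
        where hy' = ℕ.<-trans ℕ.≤-refl hy
              hz' = ℕ.<-trans (ℕ.≤-reflexive (sym (ℕ.+-suc x y))) hz

    -- A power of n needs no multiplication: n ^ l is the least number that is not below n ^ l. If
    -- it is out of range, no number satisfies either side.
    powD : ∀ l → Def closed 1 (λ 𝔄 _ xs → lookup xs 0F ≡ size 𝔄 ^ l)
    powD l = conv (λ 𝔄 _ xs h → (λ (p , none) → ℕ.≤-antisym (ℕ.≮⇒≥ (λ q → none (_ , ℕ.<-trans q (lookup⁺ h 0F) , q , ℕ.<-irrefl refl))) (ℕ.≮⇒≥ p)) ,
                    λ e → (λ q → ℕ.<-irrefl e q) , λ { (y , _ , p , q) → q (ℕ.<-≤-trans p (ℕ.≤-reflexive e)) })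
      (notD (belowD l) andD notD (exD (ltD andD notD (sub (0F ∷ []) (belowD l)))))

    offsetD : ∀ {j'} (ar' : Vec ℕ j') i → Def closed 1 (λ 𝔄 _ xs → lookup xs 0F ≡ offset (size 𝔄) ar' i)
    offsetD (l ∷ ar') zero    = zeroD
    offsetD (l ∷ ar') (suc i) = conv (λ 𝔄 _ xs h →
        (λ { (p , _ , o , _ , e , e' , s) → trans (sym s) (trans (ℕ.+-comm o p) (cong₂ _+_ e' e)) }) ,
        λ e → size 𝔄 ^ l , ℕ.≤-<-trans (ℕ.≤-trans (ℕ.m≤m+n _ _) (ℕ.≤-reflexive (sym e))) (lookup⁺ h 0F) ,
              offset (size 𝔄) ar' i , ℕ.≤-<-trans (ℕ.≤-trans (ℕ.m≤n+m _ _) (ℕ.≤-reflexive (sym e))) (lookup⁺ h 0F) ,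
              refl , refl , trans (ℕ.+-comm (offset (size 𝔄) ar' i) _) (sym e))
      (exD (exD (sub (0F ∷ []) (offsetD ar' i) andD sub (1F ∷ []) (powD l) andD sub (0F ∷ 1F ∷ 2F ∷ []) plusD)))

    module Input (wide : ∀ i → lookup ar i ≤ K) where

      literalD : ∀ i b → Def closed 1 (λ 𝔄 _ xs → rels 𝔄 i (tupleOf (wide i) (lookup xs 0F)) ≡ b)
      literalD i true  = atomD i (wide i)
      literalD i false = conv (λ 𝔄 _ xs _ → negate _ , λ e e' → absurd (trans (sym e) e')) (notD (atomD i (wide i)))
        where
        absurd : false ≡ true → ⊥
        absurd ()
        negate : ∀ b → b ≢ true → b ≡ false
        negate false _ = refl
        negate true  h = ⊥-elim (h refl)

      entryD : ∀ i b → Def closed 1 (λ 𝔄 _ xs → ∃ λ t → lookup xs 0F ≡ numR (Vec.reverse t) × rels 𝔄 i t ≡ b)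
      entryD i b = conv (λ { 𝔄 _ (x ∷ []) (h ∷ []) →
          (λ (p , e) → tupleOf (wide i) x , trans (sym (trans (numR-takeV (wide i) (unnum K x) (subst (_< size 𝔄 ^ lookup ar i) (sym (numR-unnum K x h)) p))
                                               (numR-unnum K x h))) (cong numR (sym (Vec.reverse-involutive (takeV (wide i) (unnum K x))))) , e) ,
          λ { (t , refl , e) → numR-bound (Vec.reverse t) , trans (cong (rels 𝔄 i) (round 𝔄 t h)) e } })
        (belowD (lookup ar i) andD literalD i b)
        where
        round : ∀ (𝔄 : Struct ar) (t : Vec (Fin (size 𝔄)) (lookup ar i)) → numR (Vec.reverse t) < bound 𝔄 → tupleOf (wide i) (numR (Vec.reverse t)) ≡ t
        round 𝔄 t h = trans (cong Vec.reverse (numR-injective (takeV (wide i) (unnum K (numR (Vec.reverse t)))) (Vec.reverse t)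
          (trans (numR-takeV (wide i) (unnum K (numR (Vec.reverse t)))
            (subst (_< size 𝔄 ^ lookup ar i) (sym (numR-unnum K _ h)) (numR-bound (Vec.reverse t)))) (numR-unnum K _ h))))
          (Vec.reverse-involutive t)

      -- A position of the input is the offset of some relation plus the number of a reversed tuple;
      -- a finite disjunction finds the relation.
      inputD : ∀ {a} b → Def closed 1 (λ 𝔄 _ xs → nthᵐ (enc {a = a} 𝔄) (lookup xs 0F) ≡ just (bit b))
      inputD {a} b = conv (λ { 𝔄 _ (x ∷ []) (h ∷ []) → to 𝔄 x , from 𝔄 x h })
        (someD j (λ i → exD (exD (sub (0F ∷ []) (offsetD ar i) andD sub (1F ∷ []) (entryD i b) andD sub (0F ∷ 1F ∷ 2F ∷ []) plusD))))
        where
        nth-position : ∀ (𝔄 : Struct ar) i t → nthᵐ (enc {a = a} 𝔄) (position (size 𝔄) ar i t) ≡ just (bit (rels 𝔄 i t))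
        nth-position 𝔄 i t = nth-encRels ar (rels 𝔄) i t
        to : ∀ (𝔄 : Struct ar) x → (∃ λ i → ∃ λ y → y < bound 𝔄 × ∃ λ o → o < bound 𝔄 × o ≡ offset (size 𝔄) ar i ×
            (∃ λ t → y ≡ numR (Vec.reverse t) × rels 𝔄 i t ≡ b) × o + y ≡ x) → nthᵐ (enc {a = a} 𝔄) x ≡ just (bit b)
        to 𝔄 x (i , y , _ , o , _ , refl , (t , refl , refl) , refl) =
          trans (cong (nthᵐ (enc 𝔄)) (sym (position-offset (size 𝔄) ar i t))) (nth-position 𝔄 i t)
        from : ∀ (𝔄 : Struct ar) x → x < bound 𝔄 → nthᵐ (enc {a = a} 𝔄) x ≡ just (bit b) →
            ∃ λ i → ∃ λ y → y < bound 𝔄 × ∃ λ o → o < bound 𝔄 × o ≡ offset (size 𝔄) ar i ×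
            (∃ λ t → y ≡ numR (Vec.reverse t) × rels 𝔄 i t ≡ b) × o + y ≡ x
        from 𝔄 x h e with position-surjective (m 𝔄) ar x (subst (x <_) (length-encRels {a = a} ar (rels 𝔄)) (nth-just (enc 𝔄) x e))
        ... | i , t , refl = i , numR (Vec.reverse t) , ℕ.≤-<-trans (ℕ.≤-trans (ℕ.m≤n+m _ _) (ℕ.≤-reflexive (sym s))) h ,
              offset (size 𝔄) ar i , ℕ.≤-<-trans (ℕ.≤-trans (ℕ.m≤m+n _ _) (ℕ.≤-reflexive (sym s))) h , refl ,
              (t , refl , bit-injective _ b (trans (sym (nth-position 𝔄 i t)) e)) , sym s
          where
          s = position-offset (size 𝔄) ar i t
          bit-injective : ∀ b b' → _≡_ {A = Data.Maybe.Maybe (Fin (suc (suc a)))} (just (bit b)) (just (bit b')) → b ≡ b'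
          bit-injective true  true  e = refl
          bit-injective false false e = refl
          bit-injective true  false ()
          bit-injective false true  ()

-- Computations as definable relations between time, position and content.

module Histories where
  open Machines using (nthᵐ; ≡ᵇ-sound; ≡ᵇ-refl)
  open Programs using (nthᵐ-length)
  open Encodings
  open Numbers
  open DefinableArithmetic
  open import Data.Vec.Relation.Unary.All using ([]; _∷_)
  open import Relation.Nullary using (Dec; yes; no)
  open import Relation.Nullary.Decidable using (_⊎-dec_; _×-dec_)
  open import Relation.Binary.PropositionalEquality using (refl; sym; trans)
  open import Data.Fin.Patterns

  module Machine {I O : Set} (M : TM I O) where
    open TM M
    open Config

    act : Config M → Maybe (Fin nQ × Fin nΓ × Move) → Config M
    act c            nothing             = c
    act (cfg q p t) (just (q' , s , d)) = cfg q' (move M d p) (write M t p s)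

    current : Config M → Maybe (Fin nQ × Fin nΓ × Move)
    current c = δ (state c) (tape c (head c))

    private
      step-act : ∀ c → (step M c ≡ nothing × act c (current c) ≡ c) ⊎ step M c ≡ just (act c (current c))
      step-act (cfg q p t) with δ q (t p)
      ... | nothing           = inj₁ (refl , refl)
      ... | just (q' , s , d) = inj₂ refl

    -- `run` peels off the first step, while the induction over time needs the last one. `act`
    -- leaves a halted configuration unchanged, so it also covers idle time.
    run-suc : ∀ n c → run M (suc n) c ≡ act (run M n c) (current (run M n c))
    run-suc n c with step M c in eq | step-act c
    run-suc zero    c | nothing | inj₁ (_ , e) = sym e
    run-suc (suc n) c | nothing | inj₁ (_ , e) rewrite eq = sym e
    run-suc zero    c | just c' | inj₂ refl = refl
    run-suc (suc n) c | just c' | inj₂ refl rewrite eq = run-suc n c'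

    move-≤ : ∀ d p → move M d p ≤ suc p
    move-≤ left  zero    = z≤n
    move-≤ left  (suc p) = ℕ.m≤n⇒m≤1+n (ℕ.n≤1+n p)
    move-≤ right p       = ℕ.≤-refl
    move-≤ stay  p       = ℕ.n≤1+n p

    head-≤ : ∀ w n → head (run M n (initCfg M w)) ≤ n
    head-≤ w zero    = z≤n
    head-≤ w (suc n) = ℕ.≤-trans (ℕ.≤-reflexive (cong head (run-suc n (initCfg M w)))) (after (run M n (initCfg M w)) (head-≤ w n))
      where
      after : ∀ c → head c ≤ n → head (act c (current c)) ≤ suc n
      after c h with current c
      ... | nothing          = ℕ.m≤n⇒m≤1+n h
      ... | just (q' , s , d) = ℕ.≤-trans (move-≤ d (head c)) (s≤s h)

    write-at : ∀ t p s → write M t p s p ≡ s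
    write-at t p s rewrite ≡ᵇ-refl p = refl

    write-off : ∀ t p s i → i ≢ p → write M t p s i ≡ t i
    write-off t p s i ne with i ≡ᵇ p in eq
    ... | true  = ⊥-elim (ne (≡ᵇ-sound i p eq))
    ... | false = refl

    -- z codes the symbol in cell p, or the state if the head is at p.
    Shows : Config M → ℕ → ℕ → Set
    Shows c p z = z ≡ toℕ (tape c p) ⊎ (z ≡ nΓ + toℕ (state c) × p ≡ head c)

    shows? : ∀ c p z → Dec (Shows c p z)
    shows? c p z = (z ℕ.≟ toℕ (tape c p)) ⊎-dec ((z ℕ.≟ nΓ + toℕ (state c)) ×-dec (p ℕ.≟ head c))

    -- Symbols are coded by numbers below nΓ and states by numbers from nΓ on, so a code tells which
    -- of the two it reports.
    state-code : ∀ {c h} q → Shows c h (nΓ + toℕ q) → q ≡ state c × h ≡ head c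
    state-code {c} {h} q (inj₁ e) = ⊥-elim (ℕ.<⇒≱ (Fin.toℕ<n (tape c h)) (ℕ.≤-trans (ℕ.m≤m+n nΓ (toℕ q)) (ℕ.≤-reflexive e)))
    state-code q (inj₂ (e , e')) = Fin.toℕ-injective (ℕ.+-cancelˡ-≡ nΓ _ _ e) , e'

    symbol-code : ∀ {c p z} → z < nΓ → Shows c p z → z ≡ toℕ (tape c p)
    symbol-code h (inj₁ e)        = e
    symbol-code h (inj₂ (e , _)) = ⊥-elim (ℕ.<⇒≱ h (ℕ.≤-trans (ℕ.m≤m+n nΓ _) (ℕ.≤-reflexive (sym e))))

    -- One step in terms of facts about the old time, which occur only positively as required under
    -- a least fixed point: negation is applied to positions alone. The condition `z < nΓ` keeps the
    -- old state from being carried over.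
    After : Maybe (Fin nQ × Fin nΓ × Move) → Set → ℕ → ℕ → ℕ → Set
    After nothing             same h p z = same
    After (just (q' , s , d)) same h p z =
      (z ≡ toℕ s × p ≡ h) ⊎ (z ≡ nΓ + toℕ q' × p ≡ move M d h) ⊎ (¬ (p ≡ h) × z < nΓ × same)

    after-sound : ∀ c x p z → After x (Shows c p z) (head c) p z → Shows (act c x) p z
    after-sound c nothing             p z h = h
    after-sound c (just (q' , s , d)) p z (inj₁ (refl , refl)) = inj₁ (cong toℕ (sym (write-at (tape c) (head c) s)))
    after-sound c (just (q' , s , d)) p z (inj₂ (inj₁ h)) = inj₂ h
    after-sound c (just (q' , s , d)) p z (inj₂ (inj₂ (ne , lt' , h))) =
      inj₁ (trans (symbol-code {c} lt' h) (cong toℕ (sym (write-off (tape c) (head c) s p ne))))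

    after-complete : ∀ c x p z → Shows (act c x) p z → After x (Shows c p z) (head c) p z
    after-complete c nothing             p z h = h
    after-complete c (just (q' , s , d)) p z (inj₂ h) = inj₂ (inj₁ h)
    after-complete c (just (q' , s , d)) p z (inj₁ e) with p ℕ.≟ head c
    ... | yes refl = inj₁ (trans e (cong toℕ (write-at (tape c) (head c) s)) , refl)
    ... | no ne    = inj₂ (inj₂ (ne , subst (_< nΓ) (sym e') (Fin.toℕ<n (tape c p)) , inj₁ e'))
      where e' = trans e (cong toℕ (write-off (tape c) (head c) s p ne))

    after-map : ∀ x {A B : Set} {h p z} → (A → B) → After x A h p z → After x B h p z
    after-map nothing             f y = f y
    after-map (just (q' , s , d)) f (inj₁ y)                    = inj₁ y
    after-map (just (q' , s , d)) f (inj₂ (inj₁ y))             = inj₂ (inj₁ y)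
    after-map (just (q' , s , d)) f (inj₂ (inj₂ (ne , l , y))) = inj₂ (inj₂ (ne , l , f y))

    private
      nth-nthᵐ : ∀ w i → nth M w i ≡ nthᵐ w i
      nth-nthᵐ []      i       = refl
      nth-nthᵐ (x ∷ w) zero    = refl
      nth-nthᵐ (x ∷ w) (suc i) = nth-nthᵐ w i

    initial-tape : ∀ w i → tape (initCfg M w) i ≡ Data.Maybe.maybe′ inp blank (nthᵐ w i)
    initial-tape w i rewrite sym (nth-nthᵐ w i) with nth M w i
    ... | just a  = refl
    ... | nothing = refl

  module Simulation {j : ℕ} (ar : Vocab j) (K : ℕ) (Ok : Struct ar → Set) (wide : ∀ i → lookup ar i ≤ K)
      {a : ℕ} {O : Set} (M : TM (Fin (suc (suc a))) O)
      (big : ∀ (𝔄 : Struct ar) → Ok 𝔄 → TM.nΓ M + TM.nQ M ≤ size 𝔄 ^ K) where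
    open Arithmetic ar K Ok public
    open Input wide
    open TM M
    open Machine M
    open Config

    conf : Struct ar → ℕ → Config M
    conf 𝔄 t = run M t (initCfg M (enc 𝔄))

    private
      relCode : ∀ {u} c (t p : Fin u) → Def (open′ 3) u (λ 𝔄 R xs → ∃ λ y → y < bound 𝔄 × y ≡ c × R (lookup xs t ∷ lookup xs p ∷ y ∷ []))
      relCode c t p = exD (weaken 3 (sub (0F ∷ []) (constD c)) andD sub (suc t ∷ suc p ∷ 0F ∷ []) relD)

      moveD : ∀ d → Def closed 2 (λ _ _ xs → lookup xs 1F ≡ move M d (lookup xs 0F))
      moveD right = sucD
      moveD stay  = sub (1F ∷ 0F ∷ []) eqD
      moveD left  = conv (λ { 𝔄 _ (x ∷ y ∷ []) _ →
          (λ { (inj₁ refl) → refl ; (inj₂ (refl , refl)) → refl }) , back x y })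
        (sub (1F ∷ 0F ∷ []) sucD orD (sub (0F ∷ []) zeroD andD sub (1F ∷ []) zeroD))
        where
        back : ∀ x y → y ≡ move M left x → x ≡ suc y ⊎ (x ≡ 0 × y ≡ 0)
        back zero    y e    = inj₂ (refl , e)
        back (suc x) y refl = inj₁ refl

      belowConstD : ∀ c → Def closed 1 (λ _ _ xs → lookup xs 0F < c)
      belowConstD c = conv (λ _ _ xs _ → (λ { (i , e) → subst (_< c) (sym e) (Fin.toℕ<n i) }) ,
                                      λ h → Data.Fin.fromℕ< h , sym (Fin.toℕ-fromℕ< h))
        (someD c (λ i → constD (toℕ i)))

      -- Variables: head position, old time, new time, position, code.
      afterD : ∀ x → Def (open′ 3) 5 (λ 𝔄 R xs →
        After x (R (lookup xs 1F ∷ lookup xs 3F ∷ lookup xs 4F ∷ [])) (lookup xs 0F) (lookup xs 3F) (lookup xs 4F))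
      afterD nothing             = sub (1F ∷ 3F ∷ 4F ∷ []) relD
      afterD (just (q' , s , d)) =
        weaken 3 (sub (4F ∷ []) (constD (toℕ s)) andD sub (3F ∷ 0F ∷ []) eqD)
        orD weaken 3 (sub (4F ∷ []) (constD (nΓ + toℕ q')) andD sub (0F ∷ 3F ∷ []) (moveD d))
        orD (weaken 3 (notD (sub (3F ∷ 0F ∷ []) eqD)) andD weaken 3 (sub (4F ∷ []) (belowConstD nΓ)) andD sub (1F ∷ 3F ∷ 4F ∷ []) relD)

      -- The letters of an encoding are the two bits even if the alphabet is larger, so blank cells
      -- are those where neither bit is found.
      initD : Def closed 2 (λ 𝔄 _ xs → Shows (initCfg M (enc 𝔄)) (lookup xs 0F) (lookup xs 1F))
      initD = conv (λ { 𝔄 _ (p ∷ z ∷ []) _ → to 𝔄 p z , from 𝔄 p z })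
        (given true orD given false
         orD (notD (sub (0F ∷ []) (inputD {a} true)) andD notD (sub (0F ∷ []) (inputD {a} false)) andD sub (1F ∷ []) (constD (toℕ blank)))
         orD (sub (1F ∷ []) (constD (nΓ + toℕ start)) andD sub (0F ∷ []) zeroD))
        where
        given : ∀ b → Def closed 2 (λ 𝔄 _ xs → nthᵐ (enc {a = a} 𝔄) (lookup xs 0F) ≡ just (bit b) × lookup xs 1F ≡ toℕ (inp (bit b)))
        given b = sub (0F ∷ []) (inputD b) andD sub (1F ∷ []) (constD (toℕ (inp (bit b))))
        read : ∀ (𝔄 : Struct ar) p {x} → nthᵐ (enc {a = a} 𝔄) p ≡ x → tape (initCfg M (enc 𝔄)) p ≡ Data.Maybe.maybe′ inp blank x
        read 𝔄 p e = trans (initial-tape (enc 𝔄) p) (cong (Data.Maybe.maybe′ inp blank) e)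
        letters : ∀ (𝔄 : Struct ar) p → nthᵐ (enc {a = a} 𝔄) p ≡ nothing ⊎ ∃ λ b → nthᵐ (enc {a = a} 𝔄) p ≡ just (bit b)
        letters 𝔄 p with p ℕ.<? total ar (size 𝔄)
        ... | no ge = inj₁ (nthᵐ-length (enc 𝔄) p (subst (_≤ p) (sym (length-encRels ar (rels 𝔄))) (ℕ.≮⇒≥ ge)))
        ... | yes p< with position-surjective (m 𝔄) ar p p<
        ...   | i , t , refl = inj₂ (rels 𝔄 i t , nth-encRels ar (rels 𝔄) i t)
        to : ∀ (𝔄 : Struct ar) p z → _ → Shows (initCfg M (enc 𝔄)) p z
        to 𝔄 p z (inj₁ (e , e'))               = inj₁ (trans e' (cong toℕ (sym (read 𝔄 p e))))
        to 𝔄 p z (inj₂ (inj₁ (e , e')))        = inj₁ (trans e' (cong toℕ (sym (read 𝔄 p e))))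
        to 𝔄 p z (inj₂ (inj₂ (inj₂ h)))        = inj₂ h
        to 𝔄 p z (inj₂ (inj₂ (inj₁ (n₁ , n₂ , e)))) with letters 𝔄 p
        ... | inj₁ e'           = inj₁ (trans e (cong toℕ (sym (read 𝔄 p e'))))
        ... | inj₂ (true , e')  = ⊥-elim (n₁ e')
        ... | inj₂ (false , e') = ⊥-elim (n₂ e')
        from : ∀ (𝔄 : Struct ar) p z → Shows (initCfg M (enc 𝔄)) p z → _
        from 𝔄 p z (inj₂ h) = inj₂ (inj₂ (inj₂ h))
        from 𝔄 p z (inj₁ e) with letters 𝔄 p
        ... | inj₁ e'           = inj₂ (inj₂ (inj₁ ((λ x → absurd (trans (sym e') x)) , (λ x → absurd (trans (sym e') x)) , trans e (cong toℕ (read 𝔄 p e')))))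
          where
          absurd : ∀ {A : Set} {x : A} → nothing ≡ just x → ⊥
          absurd ()
        ... | inj₂ (true , e')  = inj₁ (e' , trans e (cong toℕ (read 𝔄 p e')))
        ... | inj₂ (false , e') = inj₂ (inj₁ (e' , trans e (cong toℕ (read 𝔄 p e'))))

    historyD : Def closed 3 (λ 𝔄 _ xs → Shows (conf 𝔄 (lookup xs 0F)) (lookup xs 1F) (lookup xs 2F))
    historyD = lfpD
      (weaken 3 (sub (0F ∷ []) zeroD andD sub (1F ∷ 2F ∷ []) initD)
       orD exD (exD (weaken 3 (sub (1F ∷ 2F ∷ []) sucD) andD someD nQ (λ q → someD nΓ (λ γ →
          relCode (nΓ + toℕ q) 1F 0F andD relCode (toℕ γ) 1F 0F andD afterD (δ q γ))))))
      (λ 𝔄 xs → shows? (conf 𝔄 (lookup xs 0F)) (lookup xs 1F) (lookup xs 2F))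
      (λ { 𝔄 ok R RQ (t ∷ p ∷ z ∷ []) _ (inj₁ (refl , h)) → h
         ; 𝔄 ok R RQ (t ∷ p ∷ z ∷ []) _ (inj₂ (t' , _ , h , _ , refl , q , γ , (_ , _ , refl , r₁) , (_ , _ , refl , r₂) , f)) →
             sound 𝔄 t' h p z q γ (RQ _ r₁) (RQ _ r₂) (after-map (δ q γ) (RQ _) f) })
      (λ { 𝔄 ok R cl (t ∷ p ∷ z ∷ []) (ht ∷ hp ∷ hz ∷ []) s → complete 𝔄 ok R cl t p z ht hp hz s })
      where
      sound : ∀ (𝔄 : Struct ar) t h p z q γ → Shows (conf 𝔄 t) h (nΓ + toℕ q) → Shows (conf 𝔄 t) h (toℕ γ) →
        After (δ q γ) (Shows (conf 𝔄 t) p z) h p z → Shows (conf 𝔄 (suc t)) p z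
      sound 𝔄 t h p z q γ r₁ r₂ f with state-code {conf 𝔄 t} q r₁
      ... | refl , refl with Fin.toℕ-injective (symbol-code {conf 𝔄 t} (Fin.toℕ<n γ) r₂)
      ...   | refl = subst (λ c → Shows c p z) (sym (run-suc t _)) (after-sound (conf 𝔄 t) _ p z f)
      complete : ∀ (𝔄 : Struct ar) → Ok 𝔄 → ∀ (R : Vec ℕ 3 → Set) → _ → ∀ t p z → t < bound 𝔄 → p < bound 𝔄 → z < bound 𝔄 →
        Shows (conf 𝔄 t) p z → R (t ∷ p ∷ z ∷ [])
      complete 𝔄 ok R cl zero    p z ht hp hz s = cl (zero ∷ p ∷ z ∷ []) (ht ∷ hp ∷ hz ∷ []) (inj₁ (refl , s))
      complete 𝔄 ok R cl (suc t) p z ht hp hz s = cl (suc t ∷ p ∷ z ∷ []) (ht ∷ hp ∷ hz ∷ [])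
        (inj₂ (t , ht' , head c , hh , refl , state c , tape c (head c) ,
          (_ , hq , refl , complete 𝔄 ok R cl t (head c) _ ht' hh hq (inj₂ (refl , refl))) ,
          (_ , hγ , refl , complete 𝔄 ok R cl t (head c) _ ht' hh hγ (inj₁ refl)) ,
          after-map (current c) (complete 𝔄 ok R cl t p z ht' hp hz)
            (after-complete c (current c) p z (subst (λ c → Shows c p z) (run-suc t _) s))))
        where
        c = conf 𝔄 t
        ht' = ℕ.<-trans ℕ.≤-refl ht
        -- The head moves by at most one cell per step, so its position at an expressible time is
        -- expressible too.
        hh = ℕ.≤-<-trans (head-≤ (enc 𝔄) t) ht'
        hq = ℕ.<-≤-trans (ℕ.+-monoʳ-< nΓ (Fin.toℕ<n (state c))) (big 𝔄 ok)
        hγ = ℕ.<-≤-trans (Fin.toℕ<n (tape c (head c))) (ℕ.≤-trans (ℕ.m≤m+n nΓ nQ) (big 𝔄 ok))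

    -- The tape at the last time that a block of variables can express.
    final : Struct ar → ℕ → Fin nΓ
    final 𝔄 = tape (conf 𝔄 (Data.Nat.pred (bound 𝔄)))

    finalD : ∀ (f : Fin nΓ → Bool) → Def closed 1 (λ 𝔄 _ xs → f (final 𝔄 (lookup xs 0F)) ≡ true)
    finalD f = conv-ok (λ { 𝔄 ok _ (p ∷ []) (hp ∷ []) → to 𝔄 p , from 𝔄 ok p })
      (someD nΓ (λ γ → only γ (exD (exD (sub (1F ∷ []) lastD andD sub (0F ∷ []) (constD (toℕ γ)) andD sub (1F ∷ 2F ∷ 0F ∷ []) historyD)))))
      where
      only : ∀ γ {P} → Def closed 1 P → Def closed 1 (λ 𝔄 R xs → f γ ≡ true × P 𝔄 R xs)
      only γ d with f γ
      ... | true  = conv (λ _ _ _ _ → (refl ,_) , proj₂) d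
      ... | false = conv (λ _ _ _ _ → (λ ()) , λ { (() , _) }) falseD
      to : ∀ (𝔄 : Struct ar) p → _ → f (final 𝔄 p) ≡ true
      to 𝔄 p (γ , e , t , _ , _ , _ , l , refl , s) =
        trans (cong f (sym (Fin.toℕ-injective (trans (symbol-code {conf 𝔄 t} (Fin.toℕ<n γ) s) (cong (λ n → toℕ (tape (conf 𝔄 (Data.Nat.pred n)) p)) l))))) e
      from : ∀ (𝔄 : Struct ar) → Ok 𝔄 → ∀ p → f (final 𝔄 p) ≡ true → _
      from 𝔄 ok p e = final 𝔄 p , e , Data.Nat.pred (bound 𝔄) , ℕ.≤-reflexive l , toℕ (final 𝔄 p) , ℕ.<-≤-trans (Fin.toℕ<n (final 𝔄 p)) (ℕ.≤-trans (ℕ.m≤m+n nΓ nQ) (big 𝔄 ok)) , l , refl , inj₁ refl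
        where l : suc (Data.Nat.pred (bound 𝔄)) ≡ bound 𝔄
              l = ℕ.suc-pred (bound 𝔄) {{ℕ.m^n≢0 (size 𝔄) K}}

-- Positions of subterms in a printed term and their definability.

module Subterms where
  open Machines using (nthᵐ)
  open Encodings
  open Numbers
  open DefinableArithmetic
  open import Data.Maybe.Properties using (just-injective)
  open import Data.Vec.Relation.Unary.All using ([]; _∷_)
  open import Relation.Nullary using (Dec; yes; no)
  open import Relation.Binary.PropositionalEquality using (refl; sym; trans)
  open import Data.Fin.Patterns
  import Data.List.Membership.DecPropositional

  len : ∀ {r} → Term r → ℕ
  len t = length (render t)

  branch : ∀ {r} → Bool → Term r → Term r → Term r
  branch true  a b = a [+] b
  branch false a b = a [·] b

  operator-symbol : ∀ {r} → Bool → TSym r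
  operator-symbol true  = plus
  operator-symbol false = dot

  data View {r} : Term r → Set where
    gen  : ∀ i → View (gen i)
    node : ∀ o a b → View (branch o a b)

  view : ∀ {r} (t : Term r) → View t
  view (gen i)   = gen i
  view (a [+] b) = node true a b
  view (a [·] b) = node false a b

  branch-injective : ∀ {r} {o o'} {a b a' b' : Term r} → branch o a b ≡ branch o' a' b' → o ≡ o' × a ≡ a' × b ≡ b'
  branch-injective {o = true}  {true}  refl = refl , refl , refl
  branch-injective {o = false} {false} refl = refl , refl , refl
  branch-injective {o = true}  {false} ()
  branch-injective {o = false} {true}  ()

  render-branch : ∀ {r} o (a b : Term r) → render (branch o a b) ≡ lpar ∷ render a ++ operator-symbol o ∷ render b ++ rpar ∷ []
  render-branch true  a b = refl
  render-branch false a b = refl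

  len-branch : ∀ {r} o (a b : Term r) → len (branch o a b) ≡ 3 + (len a + len b)
  len-branch o a b = trans (cong length (render-branch o a b)) (cong suc
    (trans (List.length-++ (render a)) (trans (ℕ.+-suc (len a) _) (cong suc
      (trans (cong (len a +_) (trans (List.length-++ (render b)) (ℕ.+-comm (len b) 1))) (ℕ.+-suc (len a) (len b)))))))

  -- f on the first k places, one empty place for the operator symbol, then g.
  skipTo : ∀ {A : Set} → ℕ → (ℕ → Maybe A) → (ℕ → Maybe A) → ℕ → Maybe A
  skipTo zero    f g zero    = nothing
  skipTo zero    f g (suc p) = g p
  skipTo (suc k) f g zero    = f zero
  skipTo (suc k) f g (suc p) = skipTo k (f ∘ suc) g p

  skipTo-< : ∀ {A : Set} k (f g : ℕ → Maybe A) p → p < k → skipTo k f g p ≡ f p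
  skipTo-< (suc k) f g zero    h       = refl
  skipTo-< (suc k) f g (suc p) (s≤s h) = skipTo-< k (f ∘ suc) g p h

  skipTo-+ : ∀ {A : Set} k (f g : ℕ → Maybe A) p → skipTo k f g (k + suc p) ≡ g p
  skipTo-+ zero    f g p = refl
  skipTo-+ (suc k) f g p = skipTo-+ k (f ∘ suc) g p

  skipTo-inv : ∀ {A : Set} k (f g : ℕ → Maybe A) p {x} → skipTo k f g p ≡ just x →
    (p < k × f p ≡ just x) ⊎ (∃ λ q → p ≡ k + suc q × g q ≡ just x)
  skipTo-inv zero    f g (suc p) e = inj₂ (p , refl , e)
  skipTo-inv (suc k) f g zero    e = inj₁ (s≤s z≤n , e)
  skipTo-inv (suc k) f g (suc p) e with skipTo-inv k (f ∘ suc) g p e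
  ... | inj₁ (h , e')        = inj₁ (s≤s h , e')
  ... | inj₂ (q , refl , e') = inj₂ (q , refl , e')

  -- The subterm whose rendering starts at the given position.
  at : ∀ {r} → Term r → ℕ → Maybe (Term r)
  at t         zero    = just t
  at (gen i)   (suc p) = nothing
  at (a [+] b) (suc p) = skipTo (len a) (at a) (at b) p
  at (a [·] b) (suc p) = skipTo (len a) (at a) (at b) p

  at-branch : ∀ {r} o (a b : Term r) p → at (branch o a b) (suc p) ≡ skipTo (len a) (at a) (at b) p
  at-branch true  a b p = refl
  at-branch false a b p = refl

  len-pos : ∀ {r} (t : Term r) → 0 < len t
  len-pos (gen i)   = s≤s z≤n
  len-pos (a [+] b) = s≤s z≤n
  len-pos (a [·] b) = s≤s z≤n

  at-left : ∀ {r} o (a b : Term r) → at (branch o a b) 1 ≡ just a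
  at-left o a b = trans (at-branch o a b 0) (skipTo-< (len a) (at a) (at b) 0 (len-pos a))

  at-right : ∀ {r} o (a b : Term r) → at (branch o a b) (suc (len a + 1)) ≡ just b
  at-right o a b = trans (at-branch o a b _) (skipTo-+ (len a) (at a) (at b) 0)

  nth-branch-left : ∀ {r} o (a b : Term r) p {x} → nthᵐ (render a) p ≡ just x → nthᵐ (render (branch o a b)) (suc p) ≡ just x
  nth-branch-left o a b p e = trans (cong (λ z → nthᵐ z (suc p)) (render-branch o a b)) (nth-++-just (render a) _ p e)

  nth-branch-right : ∀ {r} o (a b : Term r) p {x} → nthᵐ (render b) p ≡ just x →
    nthᵐ (render (branch o a b)) (suc (len a + suc p)) ≡ just x
  nth-branch-right o a b p e = trans (cong (λ z → nthᵐ z (suc (len a + suc p))) (render-branch o a b))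
    (trans (nth-++ʳ (render a) _ (suc p)) (nth-++-just (render b) _ p e))

  nth-operator : ∀ {r} o (a b : Term r) → nthᵐ (render (branch o a b)) (suc (len a)) ≡ just (operator-symbol o)
  nth-operator o a b = trans (cong (λ z → nthᵐ z (suc (len a))) (render-branch o a b))
    (trans (cong (nthᵐ (render a ++ operator-symbol o ∷ render b ++ rpar ∷ [])) (sym (ℕ.+-identityʳ (len a))))
      (nth-++ʳ (render a) (operator-symbol o ∷ render b ++ rpar ∷ []) 0))

  term-ind : ∀ {r} (P : Term r → Set) → (∀ i → P (gen i)) → (∀ o a b → P a → P b → P (branch o a b)) → ∀ t → P t
  term-ind P g n (gen i)   = g i
  term-ind P g n (a [+] b) = n true a b (term-ind P g n a) (term-ind P g n b)
  term-ind P g n (a [·] b) = n false a b (term-ind P g n a) (term-ind P g n b)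

  at-bound : ∀ {r} (t : Term r) p {u} → at t p ≡ just u → p + len u ≤ len t
  at-bound {r} = term-ind (λ t → ∀ p {u} → at t p ≡ just u → p + len u ≤ len t)
    (λ { i zero refl → ℕ.≤-refl }) induct
    where
    induct : ∀ o a b → (∀ p {u} → at a p ≡ just u → p + len u ≤ len a) → (∀ p {u} → at b p ≡ just u → p + len u ≤ len b) →
      ∀ p {u} → at (branch o a b) p ≡ just u → p + len u ≤ len (branch {r} o a b)
    induct o a b A B zero    refl = ℕ.≤-refl
    induct o a b A B (suc p) {u} e with skipTo-inv (len a) (at a) (at b) p (trans (sym (at-branch o a b p)) e)
    ... | inj₁ (_ , e')        = subst (suc (p + len u) ≤_) (sym (len-branch o a b))
            (s≤s (ℕ.≤-trans (A p e') (ℕ.≤-trans (ℕ.m≤m+n (len a) (len b)) (ℕ.m≤n+m _ 2))))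
    ... | inj₂ (q , refl , e') = subst (suc (len a + suc q + len u) ≤_) (sym (len-branch o a b)) (s≤s
            (ℕ.≤-trans (ℕ.≤-reflexive (ℕ.+-assoc (len a) (suc q) (len u)))
            (ℕ.≤-trans (ℕ.+-monoʳ-≤ (len a) (s≤s (B q e')))
              (ℕ.≤-trans (ℕ.≤-reflexive (ℕ.+-suc (len a) (len b))) (ℕ.n≤1+n _)))))

  at-inside : ∀ {r} (t : Term r) p {u} → at t p ≡ just u → p < len t
  at-inside t p {u} e = ℕ.<-≤-trans (ℕ.m<m+n p (len-pos u)) (at-bound t p e)

  at-zero : ∀ {r} (t : Term r) → at t 0 ≡ just t
  at-zero (gen i)   = refl
  at-zero (a [+] b) = refl
  at-zero (a [·] b) = refl

  at-trans : ∀ {r} (t : Term r) p {u} i {v} → at t p ≡ just u → at u i ≡ just v → at t (p + i) ≡ just v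
  at-trans {r} = term-ind (λ t → ∀ p {u} i {v} → at t p ≡ just u → at u i ≡ just v → at t (p + i) ≡ just v)
    (λ { x zero i refl e → e }) induct
    where
    induct : ∀ o a b → (∀ p {u} i {v} → at a p ≡ just u → at u i ≡ just v → at a (p + i) ≡ just v) →
      (∀ p {u} i {v} → at b p ≡ just u → at u i ≡ just v → at b (p + i) ≡ just v) →
      ∀ p {u} i {v} → at (branch {r} o a b) p ≡ just u → at u i ≡ just v → at (branch o a b) (p + i) ≡ just v
    induct o a b A B zero    i h e with trans (sym (at-zero (branch o a b))) h
    ... | refl = e
    induct o a b A B (suc p) i h e with skipTo-inv (len a) (at a) (at b) p (trans (sym (at-branch o a b p)) h)
    ... | inj₁ (_ , h') = trans (at-branch o a b _) (trans (skipTo-< (len a) (at a) (at b) (p + i) (at-inside a (p + i) (A p i h' e))) (A p i h' e))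
    ... | inj₂ (q , refl , h') = trans (at-branch o a b _) (trans
            (cong (skipTo (len a) (at a) (at b)) (ℕ.+-assoc (len a) (suc q) i))
            (trans (skipTo-+ (len a) (at a) (at b) (q + i)) (B q i h' e)))

  nth-trans : ∀ {r} (t : Term r) p {u} i {x} → at t p ≡ just u → nthᵐ (render u) i ≡ just x → nthᵐ (render t) (p + i) ≡ just x
  nth-trans {r} = term-ind (λ t → ∀ p {u} i {x} → at t p ≡ just u → nthᵐ (render u) i ≡ just x → nthᵐ (render t) (p + i) ≡ just x)
    (λ { y zero i refl e → e }) induct
    where
    induct : ∀ o a b → (∀ p {u} i {x} → at a p ≡ just u → nthᵐ (render u) i ≡ just x → nthᵐ (render a) (p + i) ≡ just x) →
      (∀ p {u} i {x} → at b p ≡ just u → nthᵐ (render u) i ≡ just x → nthᵐ (render b) (p + i) ≡ just x) →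
      ∀ p {u} i {x} → at (branch {r} o a b) p ≡ just u → nthᵐ (render u) i ≡ just x → nthᵐ (render (branch o a b)) (p + i) ≡ just x
    induct o a b A B zero    i h e with trans (sym (at-zero (branch o a b))) h
    ... | refl = e
    induct o a b A B (suc p) i h e with skipTo-inv (len a) (at a) (at b) p (trans (sym (at-branch o a b p)) h)
    ... | inj₁ (_ , h')        = nth-branch-left o a b (p + i) (A p i h' e)
    ... | inj₂ (q , refl , h') = trans (cong (nthᵐ (render (branch o a b)) ∘ suc) (ℕ.+-assoc (len a) (suc q) i))
            (nth-branch-right o a b (q + i) (B q i h' e))

  opens : ∀ {r} → TSym r → Bool
  opens (tsym _) = true
  opens lpar     = true
  opens _        = false

  -- Besides its operands and its opening parenthesis a node prints only an operator and a closing
  -- parenthesis, and neither of these opens a term.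
  subterm-at : ∀ {r} (t : Term r) p {x} → nthᵐ (render t) p ≡ just x → opens x ≡ true →
    ∃ λ u → at t p ≡ just u × nthᵐ (render u) 0 ≡ just x
  subterm-at {r} = term-ind Claim (λ { i zero e h → gen i , refl , e }) induct
    where
    Claim : Term r → Set
    Claim t = ∀ p {x} → nthᵐ (render t) p ≡ just x → opens x ≡ true → ∃ λ u → at t p ≡ just u × nthᵐ (render u) 0 ≡ just x
    closes : ∀ o → opens (operator-symbol {r} o) ≡ true → ⊥
    closes true  ()
    closes false ()
    induct : ∀ o a b → Claim a → Claim b → Claim (branch o a b)
    induct o a b A B zero    e h = branch o a b , at-zero (branch o a b) , e
    induct o a b A B (suc p) {x} e h = cases (ℕ.<-cmp p (len a))
      where
      tail = operator-symbol o ∷ render b ++ rpar ∷ []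
      e₁ : nthᵐ (render a ++ tail) p ≡ just x
      e₁ = trans (sym (cong (λ z → nthᵐ z (suc p)) (render-branch o a b))) e
      in-right : ∀ q → p ≡ len a + suc q → ∃ λ u → at (branch o a b) (suc p) ≡ just u × nthᵐ (render u) 0 ≡ just x
      in-right q refl = split (ℕ.<-cmp q (len b))
        where
        e₂ : nthᵐ (render b ++ rpar ∷ []) q ≡ just x
        e₂ = trans (sym (nth-++ʳ (render a) tail (suc q))) e₁
        split : _ → ∃ λ u → at (branch o a b) (suc (len a + suc q)) ≡ just u × nthᵐ (render u) 0 ≡ just x
        split (tri< q< _ _) = let (u , e' , f) = B q (trans (sym (nth-++ˡ (render b) _ q<)) e₂) h
          in u , trans (at-branch o a b (len a + suc q)) (trans (skipTo-+ (len a) (at a) (at b) q) e') , f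
        split (tri≈ _ refl _) = ⊥-elim (absurd (trans (cong opens (just-injective
            (trans (sym (trans (cong (nthᵐ (render b ++ rpar ∷ [])) (sym (ℕ.+-identityʳ (len b)))) (nth-++ʳ (render b) (rpar ∷ []) 0))) e₂))) h))
          where absurd : false ≡ true → ⊥
                absurd ()
        split (tri> _ _ q>) with ℕ.m≤n⇒∃[o]m+o≡n q>
        ... | q' , refl with trans (sym (trans (cong (nthᵐ (render b ++ rpar ∷ [])) (sym (ℕ.+-suc (len b) q'))) (nth-++ʳ (render b) (rpar ∷ []) (suc q')))) e₂
        ...   | ()
      cases : _ → ∃ λ u → at (branch o a b) (suc p) ≡ just u × nthᵐ (render u) 0 ≡ just x
      cases (tri< p< _ _) = let (u , e' , f) = A p (trans (sym (nth-++ˡ (render a) _ p<)) e₁) h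
        in u , trans (at-branch o a b p) (trans (skipTo-< (len a) (at a) (at b) p p<) e') , f
      cases (tri≈ _ refl _) = ⊥-elim (closes o (trans (cong opens (just-injective (trans (sym (nth-operator o a b)) e))) h))
      cases (tri> _ _ p>) with ℕ.m≤n⇒∃[o]m+o≡n p>
      ... | q , e' = in-right q (trans (sym e') (sym (ℕ.+-suc (len a) q)))

  -- Only the right spine is followed: a left operand is one item even if its root is the same
  -- operator. A term with another root is its own only item. The offset of the right operand counts
  -- the opening parenthesis, the left operand and the operator.
  items : ∀ {r} → Bool → Term r → ℕ → List ℕ
  items true  (a [+] b) p = suc p ∷ items true b (p + suc (len a + 1))
  items true  _         p = p ∷ []
  items false (a [·] b) p = suc p ∷ items false b (p + suc (len a + 1))
  items false _         p = p ∷ []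

  items-branch : ∀ {r} o (a b : Term r) p → items o (branch o a b) p ≡ suc p ∷ items o b (p + suc (len a + 1))
  items-branch true  a b p = refl
  items-branch false a b p = refl

  items-other : ∀ {r} o (t : Term r) p → (∀ a b → t ≢ branch o a b) → items o t p ≡ p ∷ []
  items-other true  (gen i)   p h = refl
  items-other true  (a [+] b) p h = ⊥-elim (h a b refl)
  items-other true  (a [·] b) p h = refl
  items-other false (gen i)   p h = refl
  items-other false (a [+] b) p h = refl
  items-other false (a [·] b) p h = ⊥-elim (h a b refl)

  -- Strictly increasing lists within bounds; increasing order is what allows a noncommutative
  -- product over all positions to be restricted to the items.
  data Ascending : ℕ → ℕ → List ℕ → Set where
    []  : ∀ {lo hi} → Ascending lo hi []
    _∷_ : ∀ {lo hi p ps} → lo ≤ p × p < hi → Ascending (suc p) hi ps → Ascending lo hi (p ∷ ps)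

  ascending-from : ∀ {lo lo' hi ps} → lo ≤ lo' → Ascending lo' hi ps → Ascending lo hi ps
  ascending-from h []            = []
  ascending-from h ((a , b) ∷ c) = (ℕ.≤-trans h a , b) ∷ c

  ascending-to : ∀ {lo hi hi' ps} → hi ≤ hi' → Ascending lo hi ps → Ascending lo hi' ps
  ascending-to h []            = []
  ascending-to h ((a , b) ∷ c) = (a , ℕ.<-≤-trans b h) ∷ ascending-to h c

  ascending-∈ : ∀ {lo hi ps q} → Ascending lo hi ps → q ∈ ps → lo ≤ q × q < hi
  ascending-∈ (h ∷ _) (here refl) = h
  ascending-∈ ((a , _) ∷ c) (there m) = let (x , y) = ascending-∈ c m in ℕ.≤-trans (ℕ.≤-trans a (ℕ.n≤1+n _)) x , y

  right-end : ∀ {r} o (a b : Term r) p → suc (p + suc (len a + 1) + len b) ≡ p + len (branch o a b)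
  right-end o a b p = trans (cong suc (ℕ.+-assoc p _ (len b))) (trans (sym (ℕ.+-suc p _)) (cong (p +_)
    (trans (cong (λ z → suc (suc (z + len b))) (ℕ.+-comm (len a) 1)) (sym (len-branch o a b)))))

  items-ascending : ∀ {r} o (t : Term r) p → Ascending p (p + len t) (items o t p)
  items-ascending {r} o = term-ind (λ t → ∀ p → Ascending p (p + len t) (items o t p)) (λ i p → single o i p) induct
    where
    only : ∀ (t : Term r) p → Ascending p (p + len t) (p ∷ [])
    only t p = (ℕ.≤-refl , ℕ.m<m+n p (len-pos t)) ∷ []
    single : ∀ o i p → Ascending p (p + len (gen {r} i)) (items o (gen i) p)
    single true  i p = only (gen i) p
    single false i p = only (gen i) p
    induct : ∀ o' a b → (∀ p → Ascending p (p + len a) (items o a p)) → (∀ p → Ascending p (p + len b) (items o b p)) →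
      ∀ p → Ascending p (p + len (branch o' a b)) (items o (branch o' a b) p)
    induct o' a b A B p with o Data.Bool.≟ o'
    ... | no ne    = subst (Ascending p _) (sym (items-other o (branch o' a b) p (λ a' b' eq → ne (sym (proj₁ (branch-injective eq))))))
                       (only (branch o' a b) p)
    ... | yes refl = subst (Ascending p _) (sym (items-branch o a b p))
                       ((ℕ.n≤1+n p , subst (suc p <_) (right-end o a b p) (s≤s (ℕ.<-≤-trans (ℕ.m<m+n p (s≤s z≤n)) (ℕ.m≤m+n _ (len b))))) ∷
                        ascending-to (ℕ.≤-trans (ℕ.n≤1+n _) (ℕ.≤-reflexive (right-end o a b p)))
                          (ascending-from (ℕ.≤-trans (ℕ.≤-reflexive (ℕ.+-comm 2 p)) (ℕ.+-monoʳ-≤ p (s≤s (ℕ.m≤n+m 1 (len a))))) (B (p + suc (len a + 1)))))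

  isAtom isLpar : ∀ {r} → TSym r → Bool
  isAtom (tsym _) = true
  isAtom _        = false
  isLpar lpar = true
  isLpar _    = false

  isOperator : ∀ {r} → Bool → TSym r → Bool
  isOperator true  plus = true
  isOperator false dot  = true
  isOperator _     _    = false

  At : ∀ {r} → (TSym r → Bool) → Term r → ℕ → Set
  At f t p = ∃ λ x → nthᵐ (render t) p ≡ just x × f x ≡ true

  module Parsing {j : ℕ} (ar : Vocab j) (K : ℕ) (Ok : Struct ar → Set) where
    open Arithmetic ar K Ok

    module _ {r : ℕ} (t₀ : Struct ar → Term r) (fits : ∀ (𝔄 : Struct ar) → Ok 𝔄 → len (t₀ 𝔄) < bound 𝔄)
        (atD : ∀ f → Def closed 1 (λ 𝔄 _ xs → At f (t₀ 𝔄) (lookup xs 0F))) where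

      private
        just-unique : ∀ {A : Set} {x : Maybe A} {a b} → x ≡ just a → x ≡ just b → a ≡ b
        just-unique e e' = just-injective (trans (sym e) e')

      atom-at : ∀ (t : Term r) p → At isAtom t p → ∃ λ i → at t p ≡ just (gen i)
      atom-at t p (tsym i , e , refl) with subterm-at t p e refl
      ... | u , e' , f with view u
      ...   | gen i' = i' , e'
      ...   | node o a b with just-injective (trans (sym f) (cong (λ z → nthᵐ z 0) (render-branch o a b)))
      ...     | ()

      node-at : ∀ (t : Term r) p → At isLpar t p → ∃ λ o → ∃ λ a → ∃ λ b → at t p ≡ just (branch o a b)
      node-at t p (lpar , e , refl) with subterm-at t p e refl
      ... | u , e' , f with view u
      ...   | node o a b = o , a , b , e'
      node-at t p (lpar , e , refl) | u , e' , () | gen i'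

      at-node : ∀ (t : Term r) p o a b → at t p ≡ just (branch o a b) → At isLpar t p
      at-node t p o a b e = lpar , trans (cong (nthᵐ (render t)) (sym (ℕ.+-identityʳ p)))
        (nth-trans t p 0 e (cong (λ z → nthᵐ z 0) (render-branch o a b))) , refl

      at-atom : ∀ (t : Term r) p i → at t p ≡ just (gen i) → At isAtom t p
      at-atom t p i e = tsym i , trans (cong (nthᵐ (render t)) (sym (ℕ.+-identityʳ p))) (nth-trans t p 0 e refl) , refl

      left-at : ∀ (t : Term r) p o a b → at t p ≡ just (branch o a b) → at t (suc p) ≡ just a
      left-at t p o a b e = trans (cong (at t) (ℕ.+-comm 1 p)) (at-trans t p 1 e (at-left o a b))

      right-at : ∀ (t : Term r) p o a b → at t p ≡ just (branch o a b) → at t (p + suc (len a + 1)) ≡ just b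
      right-at t p o a b e = at-trans t p _ e (at-right o a b)

      operator-at : ∀ (t : Term r) p o a b → at t p ≡ just (branch o a b) → nthᵐ (render t) (suc p + len a) ≡ just (operator-symbol o)
      operator-at t p o a b e = trans (cong (nthᵐ (render t)) (sym (ℕ.+-suc p (len a)))) (nth-trans t p _ e (nth-operator o a b))

      private
        right-pos : ∀ p (a : Term r) → suc (suc p + len a) ≡ p + suc (len a + 1)
        right-pos p a = sym (trans (ℕ.+-suc p _) (cong suc (trans (cong (p +_) (ℕ.+-comm (len a) 1)) (ℕ.+-suc p (len a)))))

      Spans : Struct ar → ℕ → ℕ → Set
      Spans 𝔄 p q = ∃ λ u → at (t₀ 𝔄) p ≡ just u × q ≡ p + len u

      private
        spans? : ∀ 𝔄 p q → Dec (Spans 𝔄 p q)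
        spans? 𝔄 p q with at (t₀ 𝔄) p
        ... | nothing = no (λ { (_ , () , _) })
        ... | just u with q ℕ.≟ p + len u
        ...   | yes e = yes (u , refl , e)
        ...   | no ne = no (λ { (_ , refl , e) → ne e })

      -- The grammar of terms as an inductive definition. The operator and the closing parenthesis
      -- need no check, because the output is known to be a term and at most one subterm starts at a
      -- position.
      spansD : Def closed 2 (λ 𝔄 _ xs → Spans 𝔄 (lookup xs 0F) (lookup xs 1F))
      spansD = lfpD
        (weaken 2 (sub (0F ∷ []) (atD isAtom) andD sucD)
         orD (weaken 2 (sub (0F ∷ []) (atD isLpar)) andD exD (exD (exD (exD
           (weaken 2 (sub (4F ∷ 3F ∷ []) sucD) andD sub (3F ∷ 2F ∷ []) relD andD weaken 2 (sub (2F ∷ 1F ∷ []) sucD)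
            andD sub (1F ∷ 0F ∷ []) relD andD weaken 2 (sub (0F ∷ 5F ∷ []) sucD)))))))
        (λ 𝔄 xs → spans? 𝔄 (lookup xs 0F) (lookup xs 1F))
        (λ { 𝔄 ok R RQ (p ∷ q ∷ []) _ (inj₁ (a , refl)) → let (i , e) = atom-at (t₀ 𝔄) p a in gen i , e , ℕ.+-comm 1 p
           ; 𝔄 ok R RQ (p ∷ q ∷ []) _ (inj₂ (l , p₁ , _ , q₁ , _ , p₂ , _ , q₂ , _ , refl , r₁ , refl , r₂ , refl)) →
               sound 𝔄 p l (RQ _ r₁) (RQ _ r₂) })
        (λ { 𝔄 ok R cl (p ∷ q ∷ []) (hp ∷ hq ∷ []) (u , e , refl) → complete 𝔄 ok R cl p u e })
        where
        sound : ∀ 𝔄 p {q₁ q₂} → At isLpar (t₀ 𝔄) p → Spans 𝔄 (suc p) q₁ → Spans 𝔄 (suc q₁) q₂ → Spans 𝔄 p (suc q₂)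
        sound 𝔄 p l (a' , e₁ , refl) (b' , e₂ , refl) with node-at (t₀ 𝔄) p l
        ... | o , a , b , e with just-unique e₁ (left-at (t₀ 𝔄) p o a b e)
        ...   | refl with just-unique e₂ (trans (cong (at (t₀ 𝔄)) (right-pos p a)) (right-at (t₀ 𝔄) p o a b e))
        ...     | refl = branch o a b , e , trans (cong (λ z → suc (z + len b)) (right-pos p a)) (right-end o a b p)
        complete : ∀ 𝔄 → Ok 𝔄 → ∀ (R : Vec ℕ 2 → Set) → _ → ∀ p u → at (t₀ 𝔄) p ≡ just u → R (p ∷ p + len u ∷ [])
        complete 𝔄 ok R cl p u = term-ind (λ u → ∀ p → at (t₀ 𝔄) p ≡ just u → R (p ∷ p + len u ∷ []))
          (λ i p e → cl _ (ℕ.<-trans (at-inside (t₀ 𝔄) p e) (fits 𝔄 ok) ∷ ℕ.≤-<-trans (at-bound (t₀ 𝔄) p e) (fits 𝔄 ok) ∷ [])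
            (inj₁ (at-atom (t₀ 𝔄) p i e , ℕ.+-comm p 1))) induct u p
          where
          induct : ∀ o a b → (∀ p → at (t₀ 𝔄) p ≡ just a → R (p ∷ p + len a ∷ [])) → (∀ p → at (t₀ 𝔄) p ≡ just b → R (p ∷ p + len b ∷ [])) →
            ∀ p → at (t₀ 𝔄) p ≡ just (branch o a b) → R (p ∷ p + len (branch o a b) ∷ [])
          induct o a b A B p e = cl _ (ℕ.≤-<-trans (ℕ.m≤m+n p _) h ∷ h ∷ [])
            (inj₂ (at-node (t₀ 𝔄) p o a b e , suc p , prior (ℕ.m≤n⇒m≤1+n (ℕ.m≤m+n (suc p) (len a))) , suc p + len a , prior (ℕ.n≤1+n _) ,
              p + suc (len a + 1) , under (ℕ.m≤m+n _ (len b)) , p + suc (len a + 1) + len b , under ℕ.≤-refl ,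
              refl , A (suc p) (left-at (t₀ 𝔄) p o a b e) , sym (right-pos p a) ,
              B (p + suc (len a + 1)) (right-at (t₀ 𝔄) p o a b e) , sym (right-end o a b p)))
            where
            h : p + len (branch o a b) < bound 𝔄
            h = ℕ.≤-<-trans (at-bound (t₀ 𝔄) p e) (fits 𝔄 ok)
            under : ∀ {z} → z ≤ p + suc (len a + 1) + len b → z < bound 𝔄
            under h' = ℕ.<-trans (s≤s h') (ℕ.≤-<-trans (ℕ.≤-reflexive (right-end o a b p)) h)
            prior : ∀ {z} → z ≤ suc (suc p + len a) → z < bound 𝔄
            prior h' = under (ℕ.≤-trans h' (ℕ.≤-trans (ℕ.≤-reflexive (right-pos p a)) (ℕ.m≤m+n _ (len b))))

      IsOp : Bool → Struct ar → ℕ → Set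
      IsOp o 𝔄 p = ∃ λ a → ∃ λ b → at (t₀ 𝔄) p ≡ just (branch o a b)

      -- The operator of a node stands where its left operand ends.
      operatorD : ∀ o → Def closed 1 (λ 𝔄 _ xs → IsOp o 𝔄 (lookup xs 0F))
      operatorD o = conv-ok (λ { 𝔄 ok _ (p ∷ []) _ → to 𝔄 p , from 𝔄 ok p })
        (atD isLpar andD exD (exD (sub (2F ∷ 1F ∷ []) sucD andD sub (1F ∷ 0F ∷ []) spansD andD sub (0F ∷ []) (atD (isOperator o)))))
        where
        same-operator : ∀ o o' → isOperator o (operator-symbol {r} o') ≡ true → o ≡ o'
        same-operator true  true  h = refl
        same-operator false false h = refl
        same-operator true  false ()
        same-operator false true  ()
        operator-refl : ∀ o → isOperator o (operator-symbol {r} o) ≡ true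
        operator-refl true  = refl
        operator-refl false = refl
        to : ∀ (𝔄 : Struct ar) p → _ → IsOp o 𝔄 p
        to 𝔄 p (l , _ , _ , _ , _ , refl , (a' , e₁ , refl) , (x , e₂ , h)) with node-at (t₀ 𝔄) p l
        ... | o' , a , b , e with just-unique e₁ (left-at (t₀ 𝔄) p o' a b e)
        ...   | refl with just-unique e₂ (operator-at (t₀ 𝔄) p o' a b e)
        ...     | refl with same-operator o o' h
        ...       | refl = a , b , e
        from : ∀ (𝔄 : Struct ar) → Ok 𝔄 → ∀ p → IsOp o 𝔄 p → _
        from 𝔄 ok p (a , b , e) = at-node (t₀ 𝔄) p o a b e , suc p , ℕ.≤-<-trans (ℕ.m≤m+n (suc p) (len a)) h , suc p + len a , h , refl ,
            (a , left-at (t₀ 𝔄) p o a b e , refl) , (operator-symbol o , operator-at (t₀ 𝔄) p o a b e , operator-refl o)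
          where
          h : suc p + len a < bound 𝔄
          h = ℕ.≤-<-trans (at-bound (t₀ 𝔄) (suc p) (left-at (t₀ 𝔄) p o a b e)) (fits 𝔄 ok)

      startD : Def closed 1 (λ 𝔄 _ xs → ∃ λ u → at (t₀ 𝔄) (lookup xs 0F) ≡ just u)
      startD = conv (λ { 𝔄 _ (p ∷ []) _ →
          (λ (x , e , h) → let (u , e' , _) = subterm-at (t₀ 𝔄) p e h in u , e') , λ (u , e) → from 𝔄 p u e }) (atD opens)
        where
        from : ∀ (𝔄 : Struct ar) p u → at (t₀ 𝔄) p ≡ just u → At opens (t₀ 𝔄) p
        from 𝔄 p u e with view u
        ... | gen i      = let (x , e' , _) = at-atom (t₀ 𝔄) p i e in tsym i , trans (cong (nthᵐ (render (t₀ 𝔄))) (sym (ℕ.+-identityʳ p))) (nth-trans (t₀ 𝔄) p 0 e refl) , refl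
        ... | node o a b = lpar , trans (cong (nthᵐ (render (t₀ 𝔄))) (sym (ℕ.+-identityʳ p)))
                             (nth-trans (t₀ 𝔄) p 0 e (cong (λ z → nthᵐ z 0) (render-branch o a b))) , refl

      HasItem : Bool → Struct ar → ℕ → ℕ → Set
      HasItem o 𝔄 p q = ∃ λ u → at (t₀ 𝔄) p ≡ just u × q ∈ items o u p

      private
        hasItem? : ∀ o 𝔄 p q → Dec (HasItem o 𝔄 p q)
        hasItem? o 𝔄 p q with at (t₀ 𝔄) p
        ... | nothing = no (λ { (_ , () , _) })
        ... | just u with Data.List.Membership.DecPropositional._∈?_ ℕ._≟_ q (items o u p)
        ...   | yes h = yes (u , refl , h)
        ...   | no nh = no (λ { (_ , refl , h) → nh h })

      -- Walks down the right spine. `operatorD` is a completed fixed point, so its negation may be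
      -- used inside this one to recognise the last item.
      itemsD : ∀ o → Def closed 2 (λ 𝔄 _ xs → HasItem o 𝔄 (lookup xs 0F) (lookup xs 1F))
      itemsD o = lfpD
        (weaken 2 (sub (0F ∷ []) startD andD notD (sub (0F ∷ []) (operatorD o)) andD eqD)
         orD weaken 2 (sub (0F ∷ []) (operatorD o) andD sucD)
         orD (weaken 2 (sub (0F ∷ []) (operatorD o)) andD exD (exD (exD (
           weaken 2 (sub (3F ∷ 2F ∷ []) sucD andD sub (2F ∷ 1F ∷ []) spansD andD sub (1F ∷ 0F ∷ []) sucD) andD sub (0F ∷ 4F ∷ []) relD)))))
        (λ 𝔄 xs → hasItem? o 𝔄 (lookup xs 0F) (lookup xs 1F))
        (λ { 𝔄 ok R RQ (p ∷ q ∷ []) _ (inj₁ ((u , e) , no-op , refl)) → u , e ,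
               subst (p ∈_) (sym (items-other o u p (λ a b eq → no-op (a , b , trans e (cong just eq))))) (here refl)
           ; 𝔄 ok R RQ (p ∷ q ∷ []) _ (inj₂ (inj₁ ((a , b , e) , refl))) → branch o a b , e ,
               subst (suc p ∈_) (sym (items-branch o a b p)) (here refl)
           ; 𝔄 ok R RQ (p ∷ q ∷ []) _ (inj₂ (inj₂ ((a , b , e) , _ , _ , _ , _ , _ , _ , (refl , (a' , e₁ , refl) , refl) , r₁))) →
               sound 𝔄 p q a b e a' e₁ (RQ _ r₁) })
        (λ { 𝔄 ok R cl (p ∷ q ∷ []) _ (u , e , h) → complete 𝔄 ok R cl u p q e h })
        where
        sound : ∀ 𝔄 p q a b → at (t₀ 𝔄) p ≡ just (branch o a b) → ∀ a' → at (t₀ 𝔄) (suc p) ≡ just a' →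
          HasItem o 𝔄 (suc (suc p + len a')) q → HasItem o 𝔄 p q
        sound 𝔄 p q a b e a' e₁ (b' , e₂ , h) with just-unique e₁ (left-at (t₀ 𝔄) p o a b e)
        ... | refl with just-unique e₂ (trans (cong (at (t₀ 𝔄)) (right-pos p a)) (right-at (t₀ 𝔄) p o a b e))
        ...   | refl = branch o a b , e , subst (q ∈_) (sym (items-branch o a b p))
                  (there (subst (λ z → q ∈ items o b z) (right-pos p a) h))
        complete : ∀ 𝔄 → Ok 𝔄 → ∀ (R : Vec ℕ 2 → Set) → _ → ∀ u p q → at (t₀ 𝔄) p ≡ just u → q ∈ items o u p → R (p ∷ q ∷ [])
        complete 𝔄 ok R cl = term-ind (λ u → ∀ p q → at (t₀ 𝔄) p ≡ just u → q ∈ items o u p → R (p ∷ q ∷ []))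
          (λ i p q e h → other (gen i) p q e (λ a b eq → absurd o eq) h) induct
          where
          absurd : ∀ o {i} {a b : Term r} → gen i ≡ branch o a b → ⊥
          absurd true  ()
          absurd false ()
          inRange : ∀ {p u} → at (t₀ 𝔄) p ≡ just u → p < bound 𝔄
          inRange e = ℕ.<-trans (at-inside (t₀ 𝔄) _ e) (fits 𝔄 ok)
          other : ∀ u p q → at (t₀ 𝔄) p ≡ just u → (∀ a b → u ≢ branch o a b) → q ∈ items o u p → R (p ∷ q ∷ [])
          other u p q e ne h with subst (q ∈_) (items-other o u p ne) h
          ... | here refl = cl _ (inRange e ∷ inRange e ∷ []) (inj₁ ((u , e) , (λ (a , b , e') → ne a b (just-unique e e')) , refl))
          own : ∀ a b p q → (∀ p q → at (t₀ 𝔄) p ≡ just b → q ∈ items o b p → R (p ∷ q ∷ [])) →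
            at (t₀ 𝔄) p ≡ just (branch o a b) → q ∈ items o (branch o a b) p → q < bound 𝔄 → R (p ∷ q ∷ [])
          own a b p q B e h hq with subst (q ∈_) (items-branch o a b p) h
          ... | here refl = cl _ (inRange e ∷ hq ∷ []) (inj₂ (inj₁ ((a , b , e) , refl)))
          ... | there h'  = cl _ (inRange e ∷ hq ∷ [])
              (inj₂ (inj₂ ((a , b , e) , suc p , inRange (left-at (t₀ 𝔄) p o a b e) , suc p + len a , ℕ.<-trans ℕ.≤-refl below-right ,
                suc (suc p + len a) , below-right , (refl , (a , left-at (t₀ 𝔄) p o a b e , refl) , refl) ,
                B _ q at-r (subst (λ z → q ∈ items o b z) (sym (right-pos p a)) h'))))
            where
            at-r : at (t₀ 𝔄) (suc (suc p + len a)) ≡ just b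
            at-r = trans (cong (at (t₀ 𝔄)) (right-pos p a)) (right-at (t₀ 𝔄) p o a b e)
            below-right : suc (suc p + len a) < bound 𝔄
            below-right = inRange at-r
          induct : ∀ o' a b → (∀ p q → at (t₀ 𝔄) p ≡ just a → q ∈ items o a p → R (p ∷ q ∷ [])) →
            (∀ p q → at (t₀ 𝔄) p ≡ just b → q ∈ items o b p → R (p ∷ q ∷ [])) →
            ∀ p q → at (t₀ 𝔄) p ≡ just (branch o' a b) → q ∈ items o (branch o' a b) p → R (p ∷ q ∷ [])
          induct o' a b A B p q e h with o Data.Bool.≟ o'
          -- An item lies inside the subterm that it belongs to, and the whole output is below the
          -- bound.
          ... | yes refl = own a b p q B e h (ℕ.<-trans (ℕ.<-≤-trans (proj₂ (ascending-∈ (items-ascending o (branch o a b) p) h)) (at-bound (t₀ 𝔄) p e)) (fits 𝔄 ok))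
          ... | no ne    = other (branch o' a b) p q e (λ a' b' eq → ne (sym (proj₁ (branch-injective eq)))) h

-- Evaluation of a printed term by weighted quantifiers.

module TermValues where
  open FixedPoints
  open Machines using (nthᵐ)
  open Numbers
  open DefinableArithmetic
  open Subterms
  open import Data.List using (foldr; map; tabulate)
  open import Data.Maybe.Properties using (just-injective)
  open import Relation.Nullary using (does; yes; no; ofʸ; ofⁿ)
  open import Algebra.Structures using (IsMonoid)
  import Level
  open import Data.Fin.Patterns
  import Relation.Binary.PropositionalEquality as Eq

  module Range {c ℓ : Level} (Mon : Monoid c ℓ) where
    open Monoid Mon

    rng : ℕ → (ℕ → Carrier) → Carrier
    rng zero    F = ε
    rng (suc m) F = F 0 ∙ rng m (F ∘ suc)

    rng-cong : ∀ m {F G : ℕ → Carrier} → (∀ i → i < m → F i ≈ G i) → rng m F ≈ rng m G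
    rng-cong zero    h = refl
    rng-cong (suc m) h = ∙-cong (h 0 (s≤s z≤n)) (rng-cong m (λ i i<m → h (suc i) (s≤s i<m)))

    rng-+ : ∀ m k F → rng (m + k) F ≈ rng m F ∙ rng k (λ i → F (m + i))
    rng-+ zero    k F = sym (identityˡ _)
    rng-+ (suc m) k F = trans (∙-congˡ (rng-+ m k (F ∘ suc))) (sym (assoc _ _ _))

    -- No commutativity is involved, since a + p * n runs through the range in the order of the two
    -- nested folds.
    rng-* : ∀ m n F → rng (m * n) F ≈ rng m (λ p → rng n (λ a → F (a + p * n)))
    rng-* zero    n F = refl
    rng-* (suc m) n F = trans (rng-+ n (m * n) F) (∙-cong (rng-cong n (λ i _ → reflexive (cong F (Eq.sym (ℕ.+-identityʳ i)))))
      (trans (rng-* m n (λ i → F (n + i))) (rng-cong m (λ p _ → rng-cong n (λ a _ → reflexive (cong F (swap a (p * n))))))))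
      where
      swap : ∀ a x → n + (a + x) ≡ a + (n + x)
      swap a x = Eq.trans (Eq.sym (ℕ.+-assoc n a x)) (Eq.trans (cong (_+ x) (ℕ.+-comm n a)) (ℕ.+-assoc a n x))

    foldr-rng : ∀ {A : Set} {n} (f : A → Carrier) (h : Fin n → A) F → (∀ i → f (h i) ≈ F (toℕ i)) →
      foldr _∙_ ε (map f (tabulate h)) ≈ rng n F
    foldr-rng {n = zero}  f h F e = refl
    foldr-rng {n = suc n} f h F e = ∙-cong (e zero) (foldr-rng f (h ∘ suc) (F ∘ suc) (e ∘ suc))

    listFold : (ℕ → Carrier) → List ℕ → Carrier
    listFold F []       = ε
    listFold F (p ∷ ps) = F p ∙ listFold F ps

    -- A fold over all positions, with the unit off the list, meets the listed positions in the
    -- order of the list because the list ascends.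
    rng-pick : ∀ m lo {hi ps} (F G : ℕ → Carrier) → lo + m ≡ hi → Ascending lo hi ps → (∀ q → q ∈ ps → G q ≈ F q) →
      (∀ q → lo ≤ q → q < hi → q ∉ ps → G q ≈ ε) → rng m (λ i → G (lo + i)) ≈ listFold F ps
    rng-pick zero    lo F G e []            hin hout = refl
    rng-pick zero    lo F G e ((a , b) ∷ _) hin hout = ⊥-elim (ℕ.<⇒≱ b (ℕ.≤-trans (ℕ.≤-reflexive (Eq.trans (Eq.sym e) (ℕ.+-identityʳ lo))) a))
    rng-pick (suc m) lo {hi} {ps} F G e asc hin hout = trans (∙-cong (reflexive (cong G (ℕ.+-identityʳ lo)))
        (rng-cong m (λ i _ → reflexive (cong G (ℕ.+-suc lo i))))) (go asc hin hout)
      where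
      e' : suc lo + m ≡ hi
      e' = Eq.trans (Eq.sym (ℕ.+-suc lo m)) e
      lo<hi : lo < hi
      lo<hi = ℕ.<-≤-trans (s≤s (ℕ.m≤m+n lo m)) (ℕ.≤-reflexive e')
      go : ∀ {ps} → Ascending lo hi ps → (∀ q → q ∈ ps → G q ≈ F q) → (∀ q → lo ≤ q → q < hi → q ∉ ps → G q ≈ ε) →
        G lo ∙ rng m (λ i → G (suc lo + i)) ≈ listFold F ps
      go [] hin hout = trans (∙-cong (hout lo ℕ.≤-refl lo<hi (λ ())) (rng-pick m (suc lo) F G e' [] hin
        (λ q a → hout q (ℕ.≤-trans (ℕ.n≤1+n lo) a)))) (identityˡ _)
      go (_∷_ {p = p} {ps} (a , b) c) hin hout with ℕ.m≤n⇒m<n∨m≡n a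
      ... | inj₂ Eq.refl = ∙-cong (hin lo (here Eq.refl)) (rng-pick m (suc lo) F G e' c (λ q h → hin q (there h))
            (λ q h₁ h₂ n → hout q (ℕ.≤-trans (ℕ.n≤1+n lo) h₁) h₂ (λ { (here Eq.refl) → ℕ.<-irrefl Eq.refl h₁ ; (there h) → n h })))
      ... | inj₁ lo<p = trans (∙-cong
              (hout lo ℕ.≤-refl lo<hi (λ h → ℕ.<⇒≱ (proj₁ (ascending-∈ {lo = suc lo} ((lo<p , b) ∷ c) h)) ℕ.≤-refl))
              (rng-pick m (suc lo) F G e' ((lo<p , b) ∷ c) hin (λ q h → hout q (ℕ.≤-trans (ℕ.n≤1+n lo) h))))
            (identityˡ _)

  -- Terms read greedily as k nested sums (true) of products (false), whatever
  -- the shape by which they arose.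
  data In {r} : Bool → ℕ → Term r → Set where
    atom  : ∀ {i} → In true 0 (gen i)
    fromP : ∀ {k t} → In false (suc k) t → In true (suc k) t
    plus  : ∀ {k a b} → In false (suc k) a → In true (suc k) b → In true (suc k) (a [+] b)
    fromS : ∀ {k t} → In true k t → In false (suc k) t
    dot   : ∀ {k a b} → In true k a → In false (suc k) b → In false (suc k) (a [·] b)

  plus-inv : ∀ {r k} {a b : Term r} → In true (suc k) (a [+] b) → In false (suc k) a × In true (suc k) b
  plus-inv (plus x y) = x , y
  plus-inv {k = suc k} (fromP (fromS s)) = let (x , y) = plus-inv s in fromS (fromP x) , fromP (fromS y)

  dot-inv : ∀ {r k} {a b : Term r} → In false (suc k) (a [·] b) → In true k a × In false (suc k) b
  dot-inv (dot x y) = x , y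
  dot-inv {k = suc k} (fromS (fromP p)) = let (x , y) = dot-inv p in fromP (fromS x) , fromS (fromP y)

  nested-In : ∀ {r k} (sh : Vec (ℕ × ℕ) k) (s : Idx sh → Fin r) → In true k (nested sh s)
  nested-In []               s = atom
  nested-In {r} {suc k} ((m₁ , m₂) ∷ sh) s = sums m₁ _ (λ i → prods m₂ _ (λ j → nested-In sh (λ ix → s (i , j , ix))))
    where
    sums : ∀ m (f : Fin (suc m) → Term r) → (∀ i → In false (suc k) (f i)) → In true (suc k) (bigSum m f)
    sums zero    f h = fromP (h zero)
    sums (suc m) f h = plus (h zero) (sums m (f ∘ suc) (h ∘ suc))
    prods : ∀ m (f : Fin (suc m) → Term r) → (∀ i → In true k (f i)) → In false (suc k) (bigProd m f)
    prods zero    f h = fromS (h zero)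
    prods (suc m) f h = dot (h zero) (prods m (f ∘ suc) (h ∘ suc))

  module Evaluate {c ℓ : Level} (S : Semiring c ℓ) {j : ℕ} (ar : Vocab j) (K : ℕ) (Ok : Struct ar → Set)
      {r} (g : Fin r → Semiring.Carrier S) (t₀ : Struct ar → Term r)
      (fits : ∀ (𝔄 : Struct ar) → Ok 𝔄 → len (t₀ 𝔄) < size 𝔄 ^ K)
      (atD : ∀ f → Definable.Def ar K Ok closed 1 (λ 𝔄 _ xs → At f (t₀ 𝔄) (lookup xs 0F))) where
    open Semiring S using (Carrier; _≈_; 0#; 1#; setoid; refl; sym; trans; +-cong; *-cong; +-congˡ; +-congʳ; *-congˡ; *-congʳ;
      +-assoc; *-assoc; +-identityˡ; +-identityʳ; *-identityˡ; *-identityʳ; zeroˡ; zeroʳ; reflexive; +-monoid; *-monoid)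
      renaming (_+_ to _+S_; _*_ to _*S_)
    open Weighted S
    open FP S
    open Arithmetic ar K Ok
    open Parsing ar K Ok

    monoid : Bool → Monoid c ℓ
    monoid o = record { Carrier = Carrier ; _≈_ = _≈_ ; _∙_ = op o ; ε = unit o ; isMonoid = isMonoid o }
      where
      op : Bool → Carrier → Carrier → Carrier
      op true  = _+S_
      op false = _*S_
      unit : Bool → Carrier
      unit true  = 0#
      unit false = 1#
      isMonoid : ∀ o → IsMonoid _≈_ (op o) (unit o)
      isMonoid true  = Monoid.isMonoid +-monoid
      isMonoid false = Monoid.isMonoid *-monoid

    module Fold (o : Bool) = Range (monoid o)

    quant : Bool → ∀ {v} → WFormula ar (suc v) → WFormula ar v
    quant true  = ⨁
    quant false = ⨂

    quants : Bool → ∀ k {v} → WFormula ar (k + v) → WFormula ar v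
    quants o zero    φ = φ
    quants o (suc k) φ = quants o k (quant o φ)

    evalW-quant : ∀ o (𝔄 : Struct ar) {v} (φ : WFormula ar (suc v)) η F → (∀ a → evalW 𝔄 φ (a ∷ η) ≈ F (toℕ a)) →
      evalW 𝔄 (quant o φ) η ≈ Fold.rng o (size 𝔄) F
    evalW-quant true  𝔄 φ η F e = Fold.foldr-rng true (λ a → evalW 𝔄 φ (a ∷ η)) id F e
    evalW-quant false 𝔄 φ η F e = Fold.foldr-rng false (λ a → evalW 𝔄 φ (a ∷ η)) id F e

    unnum-∷ : ∀ {m₀} k (a : Fin (suc m₀)) p → p < suc m₀ ^ k → unnum {m₀} (suc k) (toℕ a + p * suc m₀) ≡ a ∷ unnum k p
    unnum-∷ {m₀} k a p h = numR-injective (unnum (suc k) (toℕ a + p * suc m₀)) (a ∷ unnum k p)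
      (Eq.trans (numR-unnum (suc k) _ bounded) digit)
      where
      digit : toℕ a + p * suc m₀ ≡ numR (a ∷ unnum {m₀} k p)
      digit = cong (λ z → toℕ a + z * suc m₀) (Eq.sym (numR-unnum k p h))
      bounded : toℕ a + p * suc m₀ < suc m₀ ^ suc k
      bounded = subst (_< suc m₀ ^ suc k) (Eq.sym digit) (numR-bound (a ∷ unnum {m₀} k p))

    -- The innermost quantifier runs through the least significant digit, so the numbers are met in
    -- increasing order, as a product requires.
    evalW-quants : ∀ o k (𝔄 : Struct ar) {v} (φ : WFormula ar (k + v)) η →
      evalW 𝔄 (quants o k φ) η ≈ Fold.rng o (size 𝔄 ^ k) (λ p → evalW 𝔄 φ (unnum k p Vec.++ η))
    evalW-quants o zero    𝔄 φ η = sym (Monoid.identityʳ (monoid o) _)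
    evalW-quants o (suc k) 𝔄 φ η = trans (evalW-quants o k 𝔄 (quant o φ) η)
      (trans (Fold.rng-cong o (n ^ k) (λ p h → evalW-quant o 𝔄 φ (unnum k p Vec.++ η)
                (λ a → evalW 𝔄 φ (unnum (suc k) (a + p * n) Vec.++ η))
                (λ a → reflexive (cong (λ z → evalW 𝔄 φ (z Vec.++ η)) (Eq.sym (unnum-∷ k a p h))))))
      (trans (sym (Fold.rng-* o (n ^ k) n (λ x → evalW 𝔄 φ (unnum (suc k) x Vec.++ η))))
        (reflexive (cong (λ z → Fold.rng o z (λ x → evalW 𝔄 φ (unnum (suc k) x Vec.++ η))) (ℕ.*-comm (n ^ k) n)))))
      where n = size 𝔄

    flag : ∀ {u v} {Q : Pred closed u} → Def closed u Q → Vec (Vec (Fin v) K) u → WFormula ar v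
    flag d ts = bool (form d ts) (wf d ts)

    flag-yes : ∀ {u v} {Q : Pred closed u} (d : Def closed u Q) (𝔄 : Struct ar) → Ok 𝔄 → ∀ (ts : Vec (Vec (Fin v) K) u) η →
      Q 𝔄 (Level.lift tt) (vals η ts) → evalW 𝔄 (flag d ts) η ≈ 1#
    flag-yes d 𝔄 ok ts η q with evalB 𝔄 (form d {Δ = []} ts) η noRels | sem d 𝔄 ok {Δ = []} ts η noRels
    ... | true  | _      = refl
    ... | false | ofⁿ nq = ⊥-elim (nq q)

    flag-no : ∀ {u v} {Q : Pred closed u} (d : Def closed u Q) (𝔄 : Struct ar) → Ok 𝔄 → ∀ (ts : Vec (Vec (Fin v) K) u) η →
      ¬ Q 𝔄 (Level.lift tt) (vals η ts) → evalW 𝔄 (flag d ts) η ≈ 0#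
    flag-no d 𝔄 ok ts η nq with evalB 𝔄 (form d {Δ = []} ts) η noRels | sem d 𝔄 ok {Δ = []} ts η noRels
    ... | false | _     = refl
    ... | true  | ofʸ q = ⊥-elim (nq q)

    choice : ∀ m {v} → (Fin m → WFormula ar v) → WFormula ar v
    choice zero    φ = const 0#
    choice (suc m) φ = φ zero ⊕ choice m (φ ∘ suc)

    choice-value : ∀ m {v} (φ : Fin m → WFormula ar v) (𝔄 : Struct ar) η i → (∀ i' → i' ≢ i → evalW 𝔄 (φ i') η ≈ 0#) →
      evalW 𝔄 (choice m φ) η ≈ evalW 𝔄 (φ i) η
    choice-value (suc m) φ 𝔄 η zero h = trans (+-congˡ (none m (φ ∘ suc) (λ i → h (suc i) (λ ())))) (+-identityʳ _)
      where
      none : ∀ m (φ : Fin m → WFormula ar _) → (∀ i → evalW 𝔄 (φ i) η ≈ 0#) → evalW 𝔄 (choice m φ) η ≈ 0#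
      none zero    φ h = refl
      none (suc m) φ h = trans (+-cong (h zero) (none m (φ ∘ suc) (h ∘ suc))) (+-identityʳ _)
    choice-value (suc m) φ 𝔄 η (suc i) h = trans (+-congʳ (h zero (λ ())))
      (trans (+-identityˡ _) (choice-value m (φ ∘ suc) 𝔄 η i (λ i' ne → h (suc i') (λ e → ne (Fin.suc-injective e)))))

    isSym : Fin r → TSym r → Bool
    isSym i (tsym i') = does (i Fin.≟ i')
    isSym i _         = false

    private
      pair : ∀ {v} → Vec (Fin v) K → Vec (Vec (Fin (K + v)) K) 2
      pair p = Vec.map (K ↑ʳ_) p ∷ firstVars K ∷ []

      hasItemD : ∀ o → Def closed 2 (λ 𝔄 _ xs → HasItem t₀ fits atD o 𝔄 (lookup xs 0F) (lookup xs 1F))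
      hasItemD = itemsD t₀ fits atD

    -- Positions that are no items must contribute 1 to a product, hence the second summand; in
    -- `summands` they contribute 0.
    factors : ∀ {v} → WFormula ar (K + v) → Vec (Fin v) K → WFormula ar v
    factors φ q = quants false K ((flag (hasItemD false) (pair q) ⊗ φ) ⊕ flag (notD (hasItemD false)) (pair q))

    summands : ∀ {v} → WFormula ar (K + v) → Vec (Fin v) K → WFormula ar v
    summands φ p = quants true K (flag (hasItemD true) (pair p) ⊗ φ)

    -- Each level binds a block for the start of a summand and a block for the start of a factor in
    -- it; `firstVars K` is the block bound last.
    termFormula : ℕ → ∀ {v} → Vec (Fin v) K → WFormula ar v
    termFormula zero    p = choice r (λ i → flag (atD (isSym i)) (p ∷ []) ⊗ const (g i))
    termFormula (suc k) p = summands (factors (termFormula k (firstVars K)) (firstVars K)) p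

    module _ (𝔄 : Struct ar) (ok : Ok 𝔄) where
      private
        N  = bound 𝔄
        t  = t₀ 𝔄

        just-unique : ∀ {A : Set} {x : Data.Maybe.Maybe A} {a b} → x ≡ just a → x ≡ just b → a ≡ b
        just-unique e e' = just-injective (Eq.trans (Eq.sym e) e')

        position-of : ∀ {v} → Vec (Fin (size 𝔄)) v → Vec (Fin v) K → ℕ
        position-of η p = numR (Vec.map (lookup η) p)

        vals-pair : ∀ {v} (b : Vec (Fin (size 𝔄)) K) (η : Vec (Fin (size 𝔄)) v) p →
          vals (b Vec.++ η) (pair p) ≡ position-of η p ∷ numR b ∷ []
        vals-pair b η p = cong₂ (λ x y → numR x ∷ numR y ∷ []) (lookup-shift b η p) (lookup-firstVars b η)

        position-first : ∀ {v} q → q < N → (η : Vec (Fin (size 𝔄)) v) → position-of (unnum K q Vec.++ η) (firstVars K) ≡ q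
        position-first q h η = Eq.trans (cong numR (lookup-firstVars (unnum K q) η)) (numR-unnum K q h)

        pair-values : ∀ {v} q → q < N → (η : Vec (Fin (size 𝔄)) v) → ∀ p → vals (unnum K q Vec.++ η) (pair p) ≡ position-of η p ∷ q ∷ []
        pair-values q h η p = Eq.trans (vals-pair (unnum K q) η p) (cong (λ z → position-of η p ∷ z ∷ []) (numR-unnum K q h))

        items-range : ∀ o {p u} → at t p ≡ just u → Ascending 0 N (items o u p)
        items-range o {p} {u} e = ascending-from z≤n
          (ascending-to (ℕ.≤-trans (at-bound t p e) (ℕ.<⇒≤ (fits 𝔄 ok))) (items-ascending o u p))

      summands-value : ∀ {v} (φ : WFormula ar (K + v)) p η {u} → at t (position-of η p) ≡ just u →
        evalW 𝔄 (summands φ p) η ≈ Range.listFold (monoid true) (λ q → evalW 𝔄 φ (unnum K q Vec.++ η)) (items true u (position-of η p))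
      summands-value φ p η {u} e = trans (evalW-quants true K 𝔄 (flag (hasItemD true) (pair p) ⊗ φ) η)
        (Fold.rng-pick true N 0 (λ q → evalW 𝔄 φ (unnum K q Vec.++ η))
          (λ q → evalW 𝔄 (flag (hasItemD true) (pair p) ⊗ φ) (unnum K q Vec.++ η)) Eq.refl (items-range true e)
          (λ q m → trans (*-congʳ (flag-yes (hasItemD true) 𝔄 ok (pair p) (unnum K q Vec.++ η)
              (subst (λ xs → HasItem t₀ fits atD true 𝔄 (lookup xs 0F) (lookup xs 1F))
                (Eq.sym (pair-values q (proj₂ (ascending-∈ (items-range true e) m)) η p)) (u , e , m)))) (*-identityˡ _))
          (λ q _ h n → trans (*-congʳ (flag-no (hasItemD true) 𝔄 ok (pair p) (unnum K q Vec.++ η)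
              (λ x → let (u' , e' , m) = subst (λ xs → HasItem t₀ fits atD true 𝔄 (lookup xs 0F) (lookup xs 1F)) (pair-values q h η p) x
                     in n (subst (λ u → q ∈ items true u (position-of η p)) (just-unique e' e) m)))) (zeroˡ _)))

      factors-value : ∀ {v} (φ : WFormula ar (K + v)) p η {u} → at t (position-of η p) ≡ just u →
        evalW 𝔄 (factors φ p) η ≈ Range.listFold (monoid false) (λ q → evalW 𝔄 φ (unnum K q Vec.++ η)) (items false u (position-of η p))
      factors-value φ p η {u} e = trans (evalW-quants false K 𝔄 body η)
        (Fold.rng-pick false N 0 (λ q → evalW 𝔄 φ (unnum K q Vec.++ η)) (λ q → evalW 𝔄 body (unnum K q Vec.++ η)) Eq.refl (items-range false e)
          (λ q m → let h = yes-item q m in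
            trans (+-cong (trans (*-congʳ (flag-yes (hasItemD false) 𝔄 ok (pair p) (unnum K q Vec.++ η) h)) (*-identityˡ _))
                          (flag-no (notD (hasItemD false)) 𝔄 ok (pair p) (unnum K q Vec.++ η) (λ nh → nh h))) (+-identityʳ _))
          (λ q _ h n → let nh = no-item q h n in
            trans (+-cong (trans (*-congʳ (flag-no (hasItemD false) 𝔄 ok (pair p) (unnum K q Vec.++ η) nh)) (zeroˡ _))
                          (flag-yes (notD (hasItemD false)) 𝔄 ok (pair p) (unnum K q Vec.++ η) nh)) (+-identityˡ _)))
        where
        body = (flag (hasItemD false) (pair p) ⊗ φ) ⊕ flag (notD (hasItemD false)) (pair p)
        Has : Vec ℕ 2 → Set
        Has xs = HasItem t₀ fits atD false 𝔄 (lookup xs 0F) (lookup xs 1F)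
        yes-item : ∀ q → q ∈ items false u (position-of η p) → Has (vals (unnum K q Vec.++ η) (pair p))
        yes-item q m = subst Has (Eq.sym (pair-values q (proj₂ (ascending-∈ (items-range false e) m)) η p)) (u , e , m)
        no-item : ∀ q → q < N → q ∉ items false u (position-of η p) → ¬ Has (vals (unnum K q Vec.++ η) (pair p))
        no-item q h n x = let (u' , e' , m) = subst Has (pair-values q h η p) x
                          in n (subst (λ u → q ∈ items false u (position-of η p)) (just-unique e' e) m)

      -- `items` follows the right spine, and `plus-inv` carries membership in the class down the
      -- same spine, so every item is a product of the required level.
      sum-items : ∀ {k} u p → at t p ≡ just u → In true (suc k) u → (F : ℕ → Carrier) →
        (∀ q u' → at t q ≡ just u' → In false (suc k) u' → F q ≈ value g u') →
        Range.listFold (monoid true) F (items true u p) ≈ value g u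
      sum-items (gen i)   p e (fromP h) F f = trans (+-identityʳ _) (f p (gen i) e h)
      sum-items (a [·] b) p e (fromP h) F f = trans (+-identityʳ _) (f p (a [·] b) e h)
      sum-items (a [+] b) p e h F f = let (x , y) = plus-inv h in
        +-cong (f (suc p) a (left-at t₀ fits atD t p true a b e) x)
               (sum-items b _ (right-at t₀ fits atD t p true a b e) y F f)

      prod-items : ∀ {k} u p → at t p ≡ just u → In false (suc k) u → (F : ℕ → Carrier) →
        (∀ q u' → at t q ≡ just u' → In true k u' → F q ≈ value g u') →
        Range.listFold (monoid false) F (items false u p) ≈ value g u
      prod-items (gen i)   p e (fromS h) F f = trans (*-identityʳ _) (f p (gen i) e h)
      prod-items (a [+] b) p e (fromS h) F f = trans (*-identityʳ _) (f p (a [+] b) e h)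
      prod-items (a [·] b) p e h F f = let (x , y) = dot-inv h in
        *-cong (f (suc p) a (left-at t₀ fits atD t p false a b e) x)
               (prod-items b _ (right-at t₀ fits atD t p false a b e) y F f)

      private
        inRange : ∀ {p u} → at t p ≡ just u → p < N
        inRange {p} e = ℕ.<-trans (at-inside t p e) (fits 𝔄 ok)

      termFormula-value : ∀ k {v} (p : Vec (Fin v) K) η u → at t (position-of η p) ≡ just u → In true k u →
        evalW 𝔄 (termFormula k p) η ≈ value g u
      termFormula-value zero p η (gen i) e atom = trans
        (choice-value r _ 𝔄 η i (λ i' ne → trans (*-congʳ (flag-no (atD (isSym i')) 𝔄 ok (p ∷ []) η (other i' ne))) (zeroˡ _)))
        (trans (*-congʳ (flag-yes (atD (isSym i)) 𝔄 ok (p ∷ []) η (tsym i , symbol , self))) (*-identityˡ _))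
        where
        symbol : nthᵐ (render t) (position-of η p) ≡ just (tsym i)
        symbol = Eq.trans (cong (nthᵐ (render t)) (Eq.sym (ℕ.+-identityʳ _))) (nth-trans t (position-of η p) 0 e Eq.refl)
        self : does (i Fin.≟ i) ≡ true
        self with i Fin.≟ i
        ... | yes _ = Eq.refl
        ... | no ne = ⊥-elim (ne Eq.refl)
        other : ∀ i' → i' ≢ i → ¬ At (isSym i') t (position-of η p)
        other i' ne (x , e' , h) with just-unique e' symbol
        ... | Eq.refl with i' Fin.≟ i
        other i' ne (x , e' , h)  | Eq.refl | yes eq = ne eq
        other i' ne (x , e' , ()) | Eq.refl | no _
      termFormula-value (suc k) p η u e h = trans (summands-value _ p η e) (sum-items u (position-of η p) e h _ (λ q u' e' h' →
        let η' = unnum K q Vec.++ η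
            at-q = Eq.trans (cong (at t) (position-first q (inRange e') η)) e' in
        trans (factors-value (termFormula k (firstVars K)) (firstVars K) η' at-q)
          (prod-items u' _ at-q h' _ (λ q' u'' e'' h'' →
            termFormula-value k (firstVars K) (unnum K q' Vec.++ η') u''
              (Eq.trans (cong (at t) (position-first q' (inRange e'') η')) e'') h''))))

    -- No constant denotes position 0; it is bound by a sum in which all other positions contribute
    -- 0.
    wholeFormula : ℕ → WFormula ar 0
    wholeFormula k = quants true K (flag zeroD (firstVars K ∷ []) ⊗ termFormula k (firstVars K))

    wholeFormula-value : ∀ k (𝔄 : Struct ar) → Ok 𝔄 → In true k (t₀ 𝔄) → ⟦ wholeFormula k ⟧ 𝔄 ≈ value g (t₀ 𝔄)
    wholeFormula-value k 𝔄 ok h = trans (evalW-quants true K 𝔄 _ [])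
      (trans (Fold.rng-pick true N 0 (λ q → evalW 𝔄 (termFormula k (firstVars K)) (unnum K q Vec.++ [])) _ Eq.refl
          ((z≤n , N>0) ∷ [])
          (λ { q (here Eq.refl) → trans (*-congʳ (flag-yes zeroD 𝔄 ok (firstVars K ∷ []) (unnum K 0 Vec.++ []) (first 0 N>0))) (*-identityˡ _) })
          (λ q _ q< n → trans (*-congʳ (flag-no zeroD 𝔄 ok (firstVars K ∷ []) (unnum K q Vec.++ []) (λ z → n (here (Eq.trans (Eq.sym (first q q<)) z))))) (zeroˡ _)))
        (trans (+-identityʳ _) (termFormula-value 𝔄 ok k (firstVars K) (unnum K 0 Vec.++ []) (t₀ 𝔄)
          (Eq.trans (cong (at (t₀ 𝔄)) (first 0 N>0)) (at-zero (t₀ 𝔄))) h)))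
      where
      N = bound 𝔄
      N>0 : 0 < N
      N>0 = ℕ.m^n>0 (size 𝔄) K
      first : ∀ q → q < N → numR (Vec.map (lookup (unnum {m 𝔄} K q Vec.++ [])) (firstVars K)) ≡ q
      first q h = Eq.trans (cong numR (lookup-firstVars (unnum K q) [])) (numR-unnum K q h)

-- Choice of the block length, and universes with a single element.

module MachineToFormula where
  open FixedPoints
  open Machines using (nthᵐ)
  open Programs using (nthᵐ-length)
  open Encodings
  open Numbers
  open DefinableArithmetic
  open Histories
  open Subterms
  open TermValues
  open import Data.List.Membership.Propositional.Properties using (∈-allFin)
  open import Data.Maybe using (maybe′)
  import Data.Bool.Properties as Bool
  open import Data.Fin.Patterns
  import Relation.Binary.PropositionalEquality as Eq

  module _ {n : ℕ} (n≥2 : 2 ≤ n) where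

    private
      n≥1 : 1 ≤ n
      n≥1 = ℕ.≤-trans (s≤s z≤n) n≥2

    1≤n^ : ∀ e → 1 ≤ n ^ e
    1≤n^ zero    = ℕ.≤-refl
    1≤n^ (suc e) = ℕ.*-mono-≤ n≥1 (1≤n^ e)

    ^-weaken : ∀ e f → n ^ e ≤ n ^ (e + f)
    ^-weaken e f = ℕ.≤-trans (ℕ.≤-trans (ℕ.≤-reflexive (Eq.sym (ℕ.*-identityʳ (n ^ e)))) (ℕ.*-monoʳ-≤ (n ^ e) (1≤n^ f)))
      (ℕ.≤-reflexive (Eq.sym (ℕ.^-distribˡ-+-* n e f)))

    ^-weakenʳ : ∀ e f → n ^ f ≤ n ^ (e + f)
    ^-weakenʳ e f = ℕ.≤-trans (^-weaken f e) (ℕ.≤-reflexive (cong (n ^_) (ℕ.+-comm f e)))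

    double-≤ : ∀ e → n ^ e + n ^ e ≤ n ^ suc e
    double-≤ e = ℕ.≤-trans (ℕ.≤-reflexive (cong (n ^ e +_) (Eq.sym (ℕ.+-identityʳ (n ^ e))))) (ℕ.*-monoˡ-≤ (n ^ e) n≥2)

    -- Allows constant factors and constant bounds to be absorbed into the exponent; for n = 1 this
    -- fails.
    self-< : ∀ c → c < n ^ c
    self-< zero    = s≤s z≤n
    self-< (suc c) = ℕ.≤-trans (ℕ.+-mono-≤ (1≤n^ c) (self-< c)) (double-≤ c)

  -- An exponent that bounds the length of the encoding. The 1 for each relation pays for one
  -- addition, as two copies of n ^ x are at most n ^ (x + 1).
  arities : ∀ {j} → Vec ℕ j → ℕ
  arities []       = 0
  arities (l ∷ ar) = suc (l + arities ar)

  arity-≤ : ∀ {j} (ar : Vec ℕ j) i → lookup ar i ≤ arities ar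
  arity-≤ (l ∷ ar) zero    = ℕ.≤-trans (ℕ.m≤m+n l (arities ar)) (ℕ.n≤1+n _)
  arity-≤ (l ∷ ar) (suc i) = ℕ.≤-trans (arity-≤ ar i) (ℕ.≤-trans (ℕ.m≤n+m _ l) (ℕ.n≤1+n _))

  module _ {n : ℕ} (n≥2 : 2 ≤ n) where

    total-≤ : ∀ {j} (ar : Vec ℕ j) → total ar n ≤ n ^ arities ar
    total-≤ []       = z≤n
    total-≤ (l ∷ ar) = ℕ.≤-trans (ℕ.+-mono-≤ (^-weaken n≥2 l (arities ar)) (ℕ.≤-trans (total-≤ ar) (^-weakenʳ n≥2 l (arities ar))))
      (double-≤ n≥2 (l + arities ar))

    -- Each of the three terms is at most X, a fourth X makes the inequality strict, and four copies
    -- of X are at most n ^ 2 times X; hence the 2 in the exponent.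
    running-time-< : ∀ a d e {L} → L ≤ n ^ e → a * L ^ d + a + L < n ^ (2 + (a + e * d + e))
    running-time-< a d e {L} h = begin-strict
      a * L ^ d + a + L     ≤⟨ ℕ.+-mono-≤ (ℕ.+-mono-≤ part₁ part₂) part₃ ⟩
      X + X + X             <⟨ ℕ.m<m+n (X + X + X) (1≤n^ n≥2 M) ⟩
      X + X + X + X         ≡⟨ ℕ.+-assoc (X + X) X X ⟩
      X + X + (X + X)       ≤⟨ ℕ.+-mono-≤ (double-≤ n≥2 M) (double-≤ n≥2 M) ⟩
      n ^ suc M + n ^ suc M ≤⟨ double-≤ n≥2 (suc M) ⟩
      n ^ (2 + M)           ∎
      where
      open ℕ.≤-Reasoning
      M = a + e * d + e
      X = n ^ M
      part₁ : a * L ^ d ≤ X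
      part₁ = ℕ.≤-trans (ℕ.*-mono-≤ (ℕ.<⇒≤ (self-< n≥2 a)) (ℕ.≤-trans (ℕ.^-monoˡ-≤ d h) (ℕ.≤-reflexive (ℕ.^-*-assoc n e d))))
        (ℕ.≤-trans (ℕ.≤-reflexive (Eq.sym (ℕ.^-distribˡ-+-* n a (e * d)))) (^-weaken n≥2 (a + e * d) e))
      part₂ : a ≤ X
      part₂ = ℕ.≤-trans (ℕ.<⇒≤ (self-< n≥2 a)) (ℕ.≤-trans (^-weaken n≥2 a (e * d)) (^-weaken n≥2 (a + e * d) e))
      part₃ : L ≤ X
      part₃ = ℕ.≤-trans h (^-weakenʳ n≥2 (a + e * d) e)

  module _ {I O : Set} (M : TM I O) where
    open TM M
    open Machine M
    open Config

    -- The cell after the output is included, as it must carry no output symbol. Beyond it the tape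
    -- is arbitrary.
    tapeOut-nth : ∀ tp k u → TapeOut M tp k u → ∀ i → i ≤ length u → out (tp (k + i)) ≡ nthᵐ u i
    tapeOut-nth tp k []      h       zero    _       = Eq.trans (cong (out ∘ tp) (ℕ.+-identityʳ k)) h
    tapeOut-nth tp k (o ∷ u) (h , _) zero    _       = Eq.trans (cong (out ∘ tp) (ℕ.+-identityʳ k)) h
    tapeOut-nth tp k (o ∷ u) (_ , h) (suc i) (s≤s l) = Eq.trans (cong (out ∘ tp) (ℕ.+-suc k i)) (tapeOut-nth tp (suc k) u h i l)

    untouched : ∀ w t i → t ≤ i → tape (run M t (initCfg M w)) i ≡ tape (initCfg M w) i
    untouched w zero    i h = Eq.refl
    untouched w (suc t) i h = Eq.trans (cong (λ c → tape c i) (run-suc t (initCfg M w)))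
      (Eq.trans (unwritten (run M t (initCfg M w)) (head-≤ w t)) (untouched w t i (ℕ.≤-trans (ℕ.n≤1+n t) h)))
      where
      unwritten : ∀ c → head c ≤ t → tape (act c (current c)) i ≡ tape c i
      unwritten c hc with current c
      ... | nothing           = Eq.refl
      ... | just (q' , s , d) = write-off (tape c) (head c) s i (λ e → ℕ.<⇒≱ h (ℕ.≤-trans (ℕ.≤-reflexive e) hc))

    stable : ∀ T c → Halted M (run M T c) → ∀ k → run M (k + T) c ≡ run M T c
    stable T c h zero    = Eq.refl
    stable T c h (suc k) = Eq.trans (run-suc (k + T) c) (Eq.trans (cong (λ c → act c (current c)) (stable T c h k))
      (cong (act (run M T c)) h))

  module Capture {c ℓ : Level} (S : Semiring c ℓ) {j : ℕ} (ar : Vocab j) {a r k : ℕ} (g : Fin r → Semiring.Carrier S)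
      (M : TM (Fin (suc (suc a))) (TSym r)) (a' d : ℕ)
      (sh : List (Fin (suc (suc a))) → Vec (ℕ × ℕ) k) (s : ∀ w → Idx (sh w) → Fin r)
      (computes : ∀ w → ComputesWithin M w (a' * length w ^ d + a') (render (nested (sh w) (s w)))) where
    open TM M
    open Config

    private
      Ok : Struct ar → Set
      Ok 𝔄 = 1 ≤ m 𝔄

      e = arities ar
      E = 2 + (a' + e * d + e)
      -- E makes room for the running time together with the input, the other part for the codes of
      -- symbols and states.
      K = E + (nΓ + nQ)

      wide : ∀ i → lookup ar i ≤ K
      wide i = ℕ.≤-trans (arity-≤ ar i) (ℕ.≤-trans (ℕ.m≤n+m e (2 + (a' + e * d))) (ℕ.m≤m+n E (nΓ + nQ)))

      big : ∀ (𝔄 : Struct ar) → Ok 𝔄 → nΓ + nQ ≤ size 𝔄 ^ K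
      big 𝔄 ok = ℕ.≤-trans (ℕ.<⇒≤ (self-< (s≤s ok) (nΓ + nQ))) (^-weakenʳ (s≤s ok) E (nΓ + nQ))

      t₀ : Struct ar → Term r
      t₀ 𝔄 = nested (sh (enc 𝔄)) (s (enc 𝔄))

      T : Struct ar → ℕ
      T 𝔄 = a' * length (enc {a = a} 𝔄) ^ d + a'

      open Simulation ar K Ok wide M big

      enough : ∀ (𝔄 : Struct ar) → Ok 𝔄 → T 𝔄 + length (enc {a = a} 𝔄) < bound 𝔄
      enough 𝔄 ok = ℕ.<-≤-trans (running-time-< (s≤s ok) a' d e
          (ℕ.≤-trans (ℕ.≤-reflexive (length-encRels ar (rels 𝔄)))
            (total-≤ (s≤s ok) ar)))
        (^-weaken (s≤s ok) E (nΓ + nQ))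

      halting-tape : ∀ (𝔄 : Struct ar) → Ok 𝔄 → ∀ i → final 𝔄 i ≡ tape (conf 𝔄 (T 𝔄)) i
      halting-tape 𝔄 ok i with ℕ.m≤n⇒∃[o]m+o≡n (ℕ.≤-trans (ℕ.m≤m+n (T 𝔄) _) (ℕ.≤-pred (ℕ.≤-trans (enough 𝔄 ok)
                                (ℕ.≤-reflexive (Eq.sym (ℕ.suc-pred (bound 𝔄) {{ℕ.m^n≢0 (size 𝔄) K}}))))))
      ... | x , eq = cong (λ c → tape c i) (Eq.trans (cong (conf 𝔄) (Eq.trans (Eq.sym eq) (ℕ.+-comm (T 𝔄) x)))
                       (stable M (T 𝔄) (initCfg M (enc 𝔄)) (proj₁ (computes (enc 𝔄))) x))

      output : ∀ (𝔄 : Struct ar) i → i ≤ len (t₀ 𝔄) → out (tape (conf 𝔄 (T 𝔄)) i) ≡ nthᵐ (render (t₀ 𝔄)) i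
      output 𝔄 = tapeOut-nth M (tape (conf 𝔄 (T 𝔄))) 0 (render (t₀ 𝔄)) (proj₂ (computes (enc 𝔄)))

      final-output : ∀ (𝔄 : Struct ar) → Ok 𝔄 → ∀ i → i ≤ len (t₀ 𝔄) → out (final 𝔄 i) ≡ nthᵐ (render (t₀ 𝔄)) i
      final-output 𝔄 ok i h = Eq.trans (cong out (halting-tape 𝔄 ok i)) (output 𝔄 i h)

      absurd : ∀ {A : Set} {x : A} → nothing ≡ just x → ⊥
      absurd ()

      -- Cells that are neither input nor visited are blank, so the output,
      -- which ends at some cell, cannot extend over one of them.
      fits : ∀ (𝔄 : Struct ar) → Ok 𝔄 → len (t₀ 𝔄) < bound 𝔄
      fits 𝔄 ok = ℕ.≰⇒> (λ N≤ →
        let X   = T 𝔄 + length (enc {a = a} 𝔄)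
            X<  = ℕ.<-≤-trans (enough 𝔄 ok) N≤
            (x , e) = nth-< (render (t₀ 𝔄)) X X<
        in absurd (Eq.trans (Eq.sym (nthᵐ-length (render (t₀ 𝔄)) _ ℕ.≤-refl))
             (Eq.trans (Eq.sym (output 𝔄 (len (t₀ 𝔄)) ℕ.≤-refl))
             (Eq.trans (cong out (Eq.trans (blank-at (len (t₀ 𝔄)) (ℕ.<⇒≤ X<)) (Eq.sym (blank-at X ℕ.≤-refl))))
             (Eq.trans (output 𝔄 X (ℕ.<⇒≤ X<)) e)))))
        where
        blank-at : ∀ i → T 𝔄 + length (enc {a = a} 𝔄) ≤ i → tape (conf 𝔄 (T 𝔄)) i ≡ blank
        blank-at i h = Eq.trans (untouched M (enc 𝔄) (T 𝔄) i (ℕ.≤-trans (ℕ.m≤m+n (T 𝔄) _) h))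
          (Eq.trans (Machine.initial-tape M (enc 𝔄) i)
            (cong (maybe′ inp blank) (nthᵐ-length (enc 𝔄) i (ℕ.≤-trans (ℕ.m≤n+m _ (T 𝔄)) h))))

      holdsOf : (TSym r → Bool) → Maybe (TSym r) → Bool
      holdsOf f (just x) = f x
      holdsOf f nothing  = false

      -- Symbols behind the first cell without output symbol are left over from the computation and
      -- do not belong to the term; the negated conjunct excludes them.
      atD : ∀ f → Def closed 1 (λ 𝔄 _ xs → At f (t₀ 𝔄) (lookup xs 0F))
      atD f = conv-ok (λ { 𝔄 ok _ (p ∷ []) _ → to 𝔄 ok p , from 𝔄 ok p })
        (finalD (holdsOf f ∘ out) andD notD (exD (ltD andD sub (0F ∷ []) (finalD (is-nothing ∘ out)))))
        where
        to : ∀ (𝔄 : Struct ar) → Ok 𝔄 → ∀ p → holdsOf f (out (final 𝔄 p)) ≡ true ×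
          ¬ (∃ λ y → y < bound 𝔄 × y < p × is-nothing (out (final 𝔄 y)) ≡ true) → At f (t₀ 𝔄) p
        to 𝔄 ok p (h , none) with ℕ.<-cmp p (len (t₀ 𝔄))
        ... | tri< p< _ _ = let (x , e) = nth-< (render (t₀ 𝔄)) p p<
                            in x , e , subst (λ z → holdsOf f z ≡ true) (Eq.trans (final-output 𝔄 ok p (ℕ.<⇒≤ p<)) e) h
        ... | tri≈ _ Eq.refl _ = ⊥-elim (impossible (subst (λ z → holdsOf f z ≡ true)
              (Eq.trans (final-output 𝔄 ok (len (t₀ 𝔄)) ℕ.≤-refl) (nthᵐ-length (render (t₀ 𝔄)) _ ℕ.≤-refl)) h))
          where impossible : false ≡ true → ⊥
                impossible ()
        ... | tri> _ _ p> = ⊥-elim (none (len (t₀ 𝔄) , fits 𝔄 ok , p> ,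
              cong is-nothing (Eq.trans (final-output 𝔄 ok (len (t₀ 𝔄)) ℕ.≤-refl) (nthᵐ-length (render (t₀ 𝔄)) _ ℕ.≤-refl))))
        from : ∀ (𝔄 : Struct ar) → Ok 𝔄 → ∀ p → At f (t₀ 𝔄) p → holdsOf f (out (final 𝔄 p)) ≡ true ×
          ¬ (∃ λ y → y < bound 𝔄 × y < p × is-nothing (out (final 𝔄 y)) ≡ true)
        from 𝔄 ok p (x , e , h) = Eq.trans (cong (holdsOf f) (Eq.trans (final-output 𝔄 ok p (ℕ.<⇒≤ p<)) e)) h ,
          λ (y , _ , y<p , n) → let (z , e') = nth-< (render (t₀ 𝔄)) y (ℕ.<-trans y<p p<) in
            impossible (Eq.trans (Eq.sym (cong is-nothing (Eq.trans (final-output 𝔄 ok y (ℕ.<⇒≤ (ℕ.<-trans y<p p<))) e'))) n)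
          where
          p< = nth-just (render (t₀ 𝔄)) p e
          impossible : false ≡ true → ⊥
          impossible ()

      open Evaluate S ar K Ok g t₀ fits atD

    formula : Weighted.WFormula S ar 0
    formula = wholeFormula k

    formula-value : ∀ (𝔄 : Struct ar) → 1 ≤ m 𝔄 →
      Semiring._≈_ S (Weighted.⟦_⟧ S formula 𝔄) (FP.value S g (nested (sh (enc 𝔄)) (s (enc 𝔄))))
    formula-value 𝔄 ok = wholeFormula-value k 𝔄 ok (nested-In (sh (enc 𝔄)) (s (enc 𝔄)))

  module Small {c ℓ : Level} (S : Semiring c ℓ) {j : ℕ} (ar : Vocab j) (a : ℕ)
      (P : List (Fin (suc (suc a))) → Semiring.Carrier S) where
    open Semiring S using (Carrier; _≈_; 0#; 1#; refl; sym; trans; +-cong; *-congʳ; +-identityˡ; +-identityʳ; *-identityˡ; zeroˡ; reflexive)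
      renaming (_+_ to _+S_; _*_ to _*S_)
    open Weighted S

    bySwitch : (β : Formula ar 0 []) → WF β → WFormula ar 0 → WFormula ar 0 → WFormula ar 0
    bySwitch β wf φ ψ = (bool β wf ⊗ φ) ⊕ (bool (neg β) wf ⊗ ψ)

    bySwitch-value : ∀ (𝔄 : Struct ar) β wf φ ψ →
      ⟦ bySwitch β wf φ ψ ⟧ 𝔄 ≈ (if evalB 𝔄 β [] noRels then ⟦ φ ⟧ 𝔄 else ⟦ ψ ⟧ 𝔄)
    bySwitch-value 𝔄 β wf φ ψ with evalB 𝔄 β [] noRels
    ... | true  = trans (+-cong (*-identityˡ _) (zeroˡ _)) (+-identityʳ _)
    ... | false = trans (+-cong (zeroˡ _) (*-identityˡ _)) (+-identityˡ _)

    -- Over a one-element universe a structure is given by one bit for each relation.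
    byBits : ∀ k → (Fin k → Σ (Formula ar 0 []) WF) → (Vec Bool k → Carrier) → WFormula ar 0
    byBits zero    β f = const (f [])
    byBits (suc k) β f = bySwitch (proj₁ (β zero)) (proj₂ (β zero))
      (byBits k (β ∘ suc) (f ∘ (true ∷_))) (byBits k (β ∘ suc) (f ∘ (false ∷_)))

    byBits-value : ∀ k β f (𝔄 : Struct ar) → ⟦ byBits k β f ⟧ 𝔄 ≈ f (Vec.tabulate (λ i → evalB 𝔄 (proj₁ (β i)) [] noRels))
    byBits-value zero    β f 𝔄 = refl
    byBits-value (suc k) β f 𝔄 = trans (bySwitch-value 𝔄 (proj₁ (β zero)) (proj₂ (β zero))
        (byBits k (β ∘ suc) (f ∘ (true ∷_))) (byBits k (β ∘ suc) (f ∘ (false ∷_)))) choose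
      where
      choose : (if evalB 𝔄 (proj₁ (β zero)) [] noRels then ⟦ byBits k (β ∘ suc) (f ∘ (true ∷_)) ⟧ 𝔄 else ⟦ byBits k (β ∘ suc) (f ∘ (false ∷_)) ⟧ 𝔄)
        ≈ f (evalB 𝔄 (proj₁ (β zero)) [] noRels ∷ Vec.tabulate (λ i → evalB 𝔄 (proj₁ (β (suc i))) [] noRels))
      choose with evalB 𝔄 (proj₁ (β zero)) [] noRels
      ... | true  = byBits-value k (β ∘ suc) (f ∘ (true ∷_)) 𝔄
      ... | false = byBits-value k (β ∘ suc) (f ∘ (false ∷_)) 𝔄

    private
      -- A sentence has no free variable for the only element, so a quantifier supplies it.
      relBit : Fin j → Σ (Formula ar 0 []) WF
      relBit i = ex (rel i (Vec.replicate _ zero)) , tt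

      word : Vec Bool j → List (Fin (suc (suc a)))
      word v = encRels {n = 1} ar (λ i _ → lookup v i)

      encRels-cong : ∀ {j'} (ar' : Vec ℕ j') {n} {R R' : (i : Fin j') → Vec (Fin n) (lookup ar' i) → Bool} →
        (∀ i t → R i t ≡ R' i t) → encRels {a = a} ar' R ≡ encRels ar' R'
      encRels-cong []        e = Eq.refl
      encRels-cong (l ∷ ar') e = cong₂ _++_ (List.map-cong (λ t → cong bit (e zero t)) _) (encRels-cong ar' (e ∘ suc))

    small : WFormula ar 0
    small = byBits j relBit (P ∘ word)

    small-value : ∀ (𝔄 : Struct ar) → m 𝔄 ≡ 0 → ⟦ small ⟧ 𝔄 ≈ P (enc 𝔄)
    small-value 𝔄@(record { m = zero ; rels = R }) Eq.refl = trans (byBits-value j relBit (P ∘ word) 𝔄)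
      (reflexive (cong P (encRels-cong ar (λ i t → Eq.trans (Vec.lookup∘tabulate _ i)
        (Eq.trans (Bool.∨-identityʳ _) (cong (R i) (unique _ t)))))))
      where
      unique : ∀ {l} (u t : Vec (Fin 1) l) → u ≡ t
      unique []         []         = Eq.refl
      unique (zero ∷ u) (zero ∷ t) = cong (zero ∷_) (unique u t)

  atLeastTwo : ∀ {j} {ar : Vocab j} → Formula ar 0 []
  atLeastTwo = ex (ex (lt zero (suc zero)))

  atLeastTwo-sem : ∀ {j} {ar : Vocab j} (𝔄 : Struct ar) → (m 𝔄 ≡ 0 × evalB 𝔄 atLeastTwo [] noRels ≡ false) ⊎ (1 ≤ m 𝔄 × evalB 𝔄 atLeastTwo [] noRels ≡ true)
  atLeastTwo-sem (record { m = zero }) = inj₁ (Eq.refl , Eq.refl)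
  atLeastTwo-sem {ar = ar} 𝔄@(record { m = suc m' }) = inj₂ (s≤s z≤n ,
    any-complete {p = λ x → evalB 𝔄 {Δ = []} (ex (lt zero (suc zero))) (x ∷ []) noRels} (∈-allFin (suc zero))
      (any-complete {p = λ y → evalB 𝔄 {Δ = []} (lt zero (suc zero)) (y ∷ suc zero ∷ []) noRels} (∈-allFin zero) Eq.refl))

open FormulaToMachine
open MachineToFormula

theorem16 : ∀ {c ℓ : Level} (S : Semiring c ℓ) {j : ℕ} (ar : Vocab j) →
    (∃ λ (i : Fin j) → lookup ar i ≢ 0) →
    ((φ : Weighted.WFormula S ar 0) →
    Σ ℕ λ a → Σ (List (Fin (suc (suc a))) → Semiring.Carrier S) λ P →
    FP.InFP S (Fin (suc (suc a))) P ×
    (∀ (𝔄 : Struct ar) → Semiring._≈_ S (P (enc 𝔄)) (Weighted.⟦_⟧ S φ 𝔄)))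
    ×
    ((a : ℕ) (P : List (Fin (suc (suc a))) → Semiring.Carrier S) →
    FP.InFP S (Fin (suc (suc a))) P →
    Σ (Weighted.WFormula S ar 0) λ φ →
    ∀ (𝔄 : Struct ar) → Semiring._≈_ S (P (enc 𝔄)) (Weighted.⟦_⟧ S φ 𝔄))
theorem16 S {j} ar ne = (λ φ → 0 , Translate.P S ar ne φ , Translate.P∈FP S ar ne φ , Translate.P-enc S ar ne φ) , converse
  where
  open Semiring S using (_≈_; sym; trans; reflexive)
  converse : (a : ℕ) (P : List (Fin (suc (suc a))) → Semiring.Carrier S) → FP.InFP S (Fin (suc (suc a))) P →
    Σ (Weighted.WFormula S ar 0) λ φ → ∀ (𝔄 : Struct ar) → P (enc 𝔄) ≈ Weighted.⟦_⟧ S φ 𝔄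
  converse a P (r , g , _ , _ , k , M , a' , d , H) = bySwitch atLeastTwo tt formula small , correct
    where
    open Capture S ar g M a' d (λ w → proj₁ (H w)) (λ w → proj₁ (proj₂ (H w))) (λ w → proj₁ (proj₂ (proj₂ (H w))))
    open Small S ar a P
    correct : ∀ (𝔄 : Struct ar) → P (enc 𝔄) ≈ Weighted.⟦_⟧ S (bySwitch atLeastTwo tt formula small) 𝔄
    correct 𝔄 = sym (trans (bySwitch-value 𝔄 atLeastTwo tt formula small) (decide (atLeastTwo-sem 𝔄)))
      where
      decide : (m 𝔄 ≡ 0 × evalB 𝔄 atLeastTwo [] noRels ≡ false) ⊎ (1 ≤ m 𝔄 × evalB 𝔄 atLeastTwo [] noRels ≡ true) →
        (if evalB 𝔄 atLeastTwo [] noRels then Weighted.⟦_⟧ S formula 𝔄 else Weighted.⟦_⟧ S small 𝔄) ≈ P (enc 𝔄)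
      decide (inj₁ (e , b)) = trans (reflexive (cong (λ x → if x then Weighted.⟦_⟧ S formula 𝔄 else Weighted.⟦_⟧ S small 𝔄) b)) (small-value 𝔄 e)
      decide (inj₂ (h , b)) = trans (reflexive (cong (λ x → if x then Weighted.⟦_⟧ S formula 𝔄 else Weighted.⟦_⟧ S small 𝔄) b))
        (trans (formula-value 𝔄 h) (proj₂ (proj₂ (proj₂ (H (enc 𝔄))))))
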